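{- Let $\delta>0$ be any constant. For any $\varepsilon>0$, any $L$, and any set $S$ of $n$ input points from a universe $[U]$, there is a data structure using $$n\lg(L/\varepsilon)+O\!\left(n\lg^{\delta}(L/\varepsilon)\right)$$ bits of space that answers (approximate) range emptiness queries on $S$ for all ranges of length at most $L$ in constant time, with a false positive rate of at most $\varepsilon$.
   Context: $[U]=\{0,\dots,U-1\}$; $\lg$ is the base-2 logarithm and $\lg^\delta x=(\lg x)^\delta$; $n$, $L$, $U$ are positive integers; $[a;b]$ denotes the integer interval $\{a,\dots,b\}$, whose length is $b-a+1$. The constant hidden in $O(\cdot)$ and the constant query time may depend on $\delta$ but not on $n,U,L,\varepsilon,S$. Approximate range emptiness: a set $S\subseteq[U]$ of $n$ points is preprocessed by a randomized construction algorithm into a memory representation; a query is an interval $I=[a;b]$ and the answer is "empty" or "non-empty". If $S\cap I\neq\emptyset$ the answer must be "non-empty" with probability $1$. The false positive rate is at most $\varepsilon$ if for every query interval $I$ (of the allowed lengths) with $S\cap I=\emptyset$, the answer is "empty" with probability at least $1-\varepsilon$, over the randomness used in the construction. Model of computation: the standard unit-cost word RAM with words of $\Theta(\lg U)$ bits; time is the number of word operations.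
   Formalization: The space bound does not charge a constant number of words independent of S (numerical parameters and the drawn hash function), since otherwise at least lg lg U bits are needed; and lg(L/ε) is read as max(1, lg(L/ε)), since the literal bound fails when L/ε is near or below 1. -}

module Defs where

open import Algebra.Definitions.RawSemiring using () renaming (_^_ to pow)
open import Data.Bool using (Bool; true; false; if_then_else_; _∧_; _∨_; _xor_)
open import Data.Fin as Fin using (Fin; toℕ)
open import Data.Fin.Subset using (Subset; _∈_; ∣_∣)
open import Data.Integer using (+_)
open import Data.List using (List; []; _∷_)
open import Data.Maybe using (Maybe; just; nothing; Is-just)
open import Data.Nat as ℕ using (ℕ; zero; suc; NonZero; ⌊_/2⌋)
open import Data.Nat.Logarithm using (⌈log₂_⌉)
open import Data.Product using (∃-syntax; _×_)
open import Data.Rational as ℚ using (ℚ; 0ℚ; 1ℚ; _/_)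
open import Data.Sum using (_⊎_)
open import Data.Vec using (Vec; []; _∷_; tabulate; zipWith)
open import Relation.Binary.PropositionalEquality using (_≡_)
open import Relation.Nullary using (¬_)

-- Dedekind reals: `lower q` means q < x and `upper q` means x < q.
record ℝ : Set₁ where
  field
    lower upper   : ℚ → Set
    lower-inhab   : ∃[ q ] lower q
    upper-inhab   : ∃[ q ] upper q
    lower-closed  : ∀ {p q} → p ℚ.< q → lower q → lower p
    upper-closed  : ∀ {p q} → p ℚ.< q → upper p → upper q
    lower-rounded : ∀ {p} → lower p → ∃[ q ] (p ℚ.< q × lower q)
    upper-rounded : ∀ {q} → upper q → ∃[ p ] (p ℚ.< q × upper p)
    disjoint      : ∀ {q} → ¬ (lower q × upper q)
    located       : ∀ {p q} → p ℚ.< q → lower p ⊎ upper q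

open ℝ public

Positive : ℝ → Set
Positive x = lower x 0ℚ

fromℕℚ : ℕ → ℚ
fromℕℚ n = + n / 1

infixr 8 _^ℚ_
_^ℚ_ : ℚ → ℕ → ℚ
_^ℚ_ = pow ℚ.+-*-rawSemiring

-- The expressions bounding the space occur only on the right of ≤, so they
-- are given by their rational upper bounds. `X q` is implied by x < q and
-- implies x ≤ q; whether the infimum itself belongs to X does not matter.
UpperReal : Set₁
UpperReal = ℚ → Set

infix  4 _≤ᵁ_
infixl 6 _+ᵁ_
infixl 7 _*ᵁ_
infixl 7 _÷_
infixr 8 _^ᵁ_

_≤ᵁ_ : ℕ → UpperReal → Set
m ≤ᵁ X = ∀ q → X q → fromℕℚ m ℚ.≤ q

_+ᵁ_ : UpperReal → UpperReal → UpperReal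
(X +ᵁ Y) q = ∃[ a ] ∃[ b ] (X a × Y b × a ℚ.+ b ℚ.≤ q)

_*ᵁ_ : ℕ → UpperReal → UpperReal
(k *ᵁ X) q = ∃[ a ] (X a × fromℕℚ k ℚ.* a ℚ.≤ q)

-- L / ε, for ε > 0: the numbers at least L / e for some rational 0 < e < ε.
_÷_ : ℕ → ℝ → UpperReal
(L ÷ ε) q = ∃[ e ] (0ℚ ℚ.< e × lower ε e × fromℕℚ L ℚ.≤ q ℚ.* e)

-- max(1, lg x), for x > 0. This equals lg x for x ≥ 2; for x near 1 or below,
-- a bound of order lg x would be less than one bit or even negative.
-- q ^ d ≤ 2 ^ a says lg q ≤ a / d, and exponents a ≥ 0 suffice since only
-- bounds y > 1 are kept.
lg⁺ : UpperReal → UpperReal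
lg⁺ X y = 1ℚ ℚ.< y ×
  (∃[ q ] ∃[ a ] ∃[ d ] (X q × (q ^ℚ suc d) ℚ.≤ fromℕℚ (2 ℕ.^ a) × (+ a / suc d) ℚ.≤ y))

-- x ^ δ, for x ≥ 1 and δ > 0. As y ≥ 1, y ^ δ is the infimum of y ^ (p / r)
-- over the rationals p / r > δ, and y ^ (p / r) ≤ z iff y ^ p ≤ z ^ r.
_^ᵁ_ : UpperReal → ℝ → UpperReal
(X ^ᵁ δ) z = 0ℚ ℚ.≤ z ×
  (∃[ y ] ∃[ p ] ∃[ r ] (X y × upper δ (+ p / suc r) × (y ^ℚ p) ℚ.≤ (z ^ℚ suc r)))

-- Probability of an event under the uniform distribution on N outcomes.
Pr : ∀ {N} .{{_ : NonZero N}} → (Fin N → Bool) → ℚ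
Pr {N} E = + ∣ tabulate E ∣ / N

-- 1 - ε ≤ p
AtLeast1- : ℝ → ℚ → Set
AtLeast1- ε p = ∀ e → upper ε e → (1ℚ ℚ.- e) ℚ.≤ p

-- Least significant bit first.
Word : ℕ → Set
Word w = Vec Bool w

value : ∀ {w} → Word w → ℕ
value []       = 0
value (b ∷ bs) = (if b then 1 else 0) ℕ.+ 2 ℕ.* value bs

-- Reduction modulo 2 ^ w.
word : ∀ w → ℕ → Word w
word zero    n = []
word (suc w) n = (n ℕ.% 2 ℕ.≡ᵇ 1) ∷ word w ⌊ n /2⌋

-- Arithmetic is modulo 2 ^ w; division by zero yields zero.
data Op : Set where
  add sub mul div rem and or xor shl shr lt eq : Op

divide remainder : ℕ → ℕ → ℕ
divide m zero      = 0
divide m (suc n)   = m ℕ./ suc n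
remainder m zero   = 0
remainder m (suc n) = m ℕ.% suc n

apply : ∀ {w} → Op → Word w → Word w → Word w
apply {w} add x y = word w (value x ℕ.+ value y)
apply {w} sub x y = word w ((value x ℕ.+ 2 ℕ.^ w) ℕ.∸ value y)
apply {w} mul x y = word w (value x ℕ.* value y)
apply {w} div x y = word w (divide (value x) (value y))
apply {w} rem x y = word w (remainder (value x) (value y))
apply     and x y = zipWith _∧_ x y
apply     or  x y = zipWith _∨_ x y
apply     xor x y = zipWith _xor_ x y
apply {w} shl x y = word w (value x ℕ.* 2 ℕ.^ value y)
apply {w} shr x y = word w (divide (value x) (2 ℕ.^ value y))
apply {w} lt  x y = word w (if value x ℕ.<ᵇ value y then 1 else 0)
apply {w} eq  x y = word w (if value x ℕ.≡ᵇ value y then 1 else 0)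

data Answer : Set where
  empty nonEmpty : Answer

Reg : Set
Reg = ℕ

data Instr : Set where
  const  : Reg → ℕ → Instr              -- r := k
  op     : Op → Reg → Reg → Reg → Instr -- r := s ∙ t
  load   : Reg → Reg → Instr            -- r := M[s]
  store  : Reg → Reg → Instr            -- M[r] := s
  jz     : Reg → ℕ → Instr              -- if r = 0 then goto k
  return : Answer → Instr

Program : Set
Program = List Instr

fetch : Program → ℕ → Maybe Instr
fetch []       _       = nothing
fetch (i ∷ _)  zero    = just i
fetch (_ ∷ is) (suc k) = fetch is k

_[_↦_] : {A : Set} → (ℕ → A) → ℕ → A → (ℕ → A)
(f [ k ↦ v ]) j = if j ℕ.≡ᵇ k then v else f j

-- `run P t pc R M`: the answer of P, if it returns within t instructions.
run : ∀ {w} → Program → ℕ → ℕ → (Reg → Word w) → (ℕ → Word w) → Maybe Answer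
run P zero    pc R M = nothing
run {w} P (suc t) pc R M with fetch P pc
... | nothing           = nothing
... | just (const r k)  = run P t (suc pc) (R [ r ↦ word w k ]) M
... | just (op f r s u) = run P t (suc pc) (R [ r ↦ apply f (R s) (R u) ]) M
... | just (load r s)   = run P t (suc pc) (R [ r ↦ M (value (R s)) ]) M
... | just (store r s)  = run P t (suc pc) R (M [ value (R r) ↦ R s ])
... | just (jz r k)     = run P t (if value (R r) ℕ.≡ᵇ 0 then k else suc pc) R M
... | just (return a)   = just a

nth : {A : Set} {m : ℕ} → A → Vec A m → ℕ → A
nth d []       _       = d
nth d (x ∷ _)  zero    = x
nth d (_ ∷ xs) (suc k) = nth d xs k

-- An m-bit string occupies the words at addresses 0, 1, …, padded with zeros.
memory : ∀ {m} w → Vec Bool m → ℕ → Word w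
memory w bs i = tabulate λ j → nth false bs (i ℕ.* w ℕ.+ toℕ j)

-- Everything that must not depend on n, U, L, ε and S.
record Algorithm : Set where
  field
    program      : Program
    wordFactor   : ℕ
    wordFactor≢0 : NonZero wordFactor
    paramWords   : ℕ
    time         : ℕ

  -- Θ(lg U), with 1 + ⌈lg U⌉ in place of lg U so that U = 1 is meaningful.
  wordSize : ℕ → ℕ
  wordSize U = wordFactor ℕ.* suc ⌈log₂ U ⌉

-- S ∩ [a;b] ≠ ∅
Hits : ∀ {U} → Subset U → Fin U → Fin U → Set
Hits S a b = ∃[ x ] (x ∈ S × a Fin.≤ x × x Fin.≤ b)

record Query (U L : ℕ) : Set where
  field
    a b   : Fin U
    a≤b   : a Fin.≤ b
    short : suc (toℕ b ℕ.∸ toℕ a) ℕ.≤ L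

isEmpty : Maybe Answer → Bool
isEmpty (just empty) = true
isEmpty _            = false

isNonEmpty : Maybe Answer → Bool
isNonEmpty (just nonEmpty) = true
isNonEmpty _               = false

-- Registers initially hold a, b, the parameter words, and then zeros.
execute : ∀ (A : Algorithm) {U m} (let open Algorithm A) → Fin U → Fin U →
  Vec (Word (wordSize U)) paramWords → Vec Bool m → Maybe Answer
execute A {U} a b ps bs =
  run program time 0
    (nth (word w 0) (word w (toℕ a) ∷ word w (toℕ b) ∷ ps))
    (memory w bs)
  where
  open Algorithm A
  w : ℕ
  w = wordSize U

-- The construction draws one of `outcomes` equally likely seeds and maps S to
-- a string of `bits` bits. Beside that string a query sees `paramWords` words
-- fixed before S is known: the numerical parameters and the hash functions
-- drawn. These are not charged; were the drawn hash function charged, any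
-- scheme would need lg lg U bits, already for n = L = 1 and ε = 1/2, since the
-- sets accepted by the possible strings must then separate any two points.
record RangeEmptiness (A : Algorithm) (n U L : ℕ) (ε : ℝ) : Set where
  open Algorithm A
  field
    outcomes       : ℕ
    {{outcomes≢0}} : NonZero outcomes
    bits           : ℕ
    params         : Fin outcomes → Vec (Word (wordSize U)) paramWords
    build          : (S : Subset U) → ∣ S ∣ ≡ n → Fin outcomes → Vec Bool bits

  answer : (S : Subset U) → ∣ S ∣ ≡ n → Query U L → Fin outcomes → Maybe Answer
  answer S ∣S∣≡n I ω =
    execute A (Query.a I) (Query.b I) (params ω) (build S ∣S∣≡n ω)

  field
    constantTime : ∀ S ∣S∣≡n I ω → Is-just (answer S ∣S∣≡n I ω)
    noFalseNegative : ∀ S ∣S∣≡n I → Hits S (Query.a I) (Query.b I) →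
      Pr (λ ω → isNonEmpty (answer S ∣S∣≡n I ω)) ≡ 1ℚ
    falsePositiveRate : ∀ S ∣S∣≡n I → ¬ Hits S (Query.a I) (Query.b I) →
      AtLeast1- ε (Pr (λ ω → isEmpty (answer S ∣S∣≡n I ω)))

module Submission where

-- The points are grouped into blocks of 2 ^ λ ≥ L consecutive ones (all of them
-- if L > U), and the blocks are hashed to 2 ^ μ = O(n / ε) slots, by multiplying
-- with a random number. A query meets two blocks at most, so it turns into two
-- emptiness queries inside a slot, which are answered exactly; it errs only if a
-- block of S collides with one of those two. There are n points at most in this
-- universe of size O(n L / ε), and lg (L / ε) + O(1) bits of a point distinguish
-- it from those close by.
--
-- The universe is cut into about n / lg (L / ε) buckets of 2 ^ ℓ numbers, and
-- the keys of a bucket are stored in order. An interval of length about 2 ^ t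
-- meets at most three nodes of level t in the binary tree over the bucket, and if
-- it contains a key at all, then it contains the least or the greatest key of one
-- of them. A key extreme up to level T is filed under a few of its ancestors:
-- with ρ = ℓ ^ (1 / S), under ρ multiples of each power ρ ^ j below T, so that
-- one of S + 1 roundings of t hits one of them. The tables for this are perfect
-- hash tables that do not store their keys, and a rank in a bucket takes only
-- O(lg ℓ) bits there, as it is relative to an ancestor with few keys. A wrong
-- entry does no harm, because a key found is compared with the query. The
-- choice S = 2 s with 1 / s < δ makes the overhead O(lg ^ δ (L / ε)) per point.
--
-- If lg (L / ε) is below lg lg n, the pointers to buckets would be too long.
-- Then blocks of about (lg n) / 4 numbers are coded in lg (L / ε) + O(1) bits
-- per point, and decoded by a table.
--
-- The query program has no loops: it evaluates a single arithmetic expression.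

module Rationals where
  open import Defs using (fromℕℚ; _^ℚ_)
  open import Data.Nat as ℕ using (ℕ; zero; suc)
  import Data.Nat.Properties as ℕ
  open import Data.Integer as ℤ using (ℤ; +_)
  import Data.Integer.Properties as ℤ
  open import Data.Rational
  open import Data.Rational.Properties
  open import Data.Rational.Unnormalised as ℚᵘ using (mkℚᵘ; *≡*; *≤*; *<*)
  import Data.Rational.Unnormalised.Properties as ℚᵘ
  open import Algebra.Bundles using (module CommutativeRing)
  open import Algebra.Properties.CommutativeSemiring.Exp (CommutativeRing.commutativeSemiring +-*-commutativeRing) using (^-assocʳ; ^-distrib-*)
  open import Data.Empty using (⊥-elim)
  open import Relation.Binary.PropositionalEquality
  open import Relation.Nullary using (yes; no)

  frac : ∀ a d → toℚᵘ (+ a / suc d) ℚᵘ.≃ mkℚᵘ (+ a) d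
  frac a d = toℚᵘ-fromℚᵘ (mkℚᵘ (+ a) d)

  ι : ∀ m → toℚᵘ (fromℕℚ m) ℚᵘ.≃ mkℚᵘ (+ m) 0
  ι m = frac m 0

  ι-+ : ∀ m n → fromℕℚ (m ℕ.+ n) ≡ fromℕℚ m + fromℕℚ n
  ι-+ m n = toℚᵘ-injective (ℚᵘ.≃-trans (ι (m ℕ.+ n)) (ℚᵘ.≃-sym (ℚᵘ.≃-trans (toℚᵘ-homo-+ (fromℕℚ m) (fromℕℚ n)) (ℚᵘ.≃-trans (ℚᵘ.+-cong (ι m) (ι n))
    (*≡* (cong (ℤ._* + 1) (cong₂ ℤ._+_ (ℤ.*-identityʳ (+ m)) (ℤ.*-identityʳ (+ n)))))))))

  ι-* : ∀ m n → fromℕℚ (m ℕ.* n) ≡ fromℕℚ m * fromℕℚ n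
  ι-* m n = toℚᵘ-injective (ℚᵘ.≃-trans (ι (m ℕ.* n)) (ℚᵘ.≃-sym (ℚᵘ.≃-trans (toℚᵘ-homo-* (fromℕℚ m) (fromℕℚ n)) (ℚᵘ.≃-trans (ℚᵘ.*-cong (ι m) (ι n))
    (*≡* (cong (ℤ._* + 1) (sym (ℤ.pos-* m n))))))))

  frac-* : ∀ a d → (+ a / suc d) * fromℕℚ (suc d) ≡ fromℕℚ a
  frac-* a d = toℚᵘ-injective (ℚᵘ.≃-trans (toℚᵘ-homo-* (+ a / suc d) (fromℕℚ (suc d))) (ℚᵘ.≃-trans (ℚᵘ.*-cong (frac a d) (ι (suc d)))
    (ℚᵘ.≃-trans (*≡* (trans (ℤ.*-identityʳ _) (cong (+ a ℤ.*_) (cong (λ x → + suc x) (sym (ℕ.*-identityʳ d)))))) (ℚᵘ.≃-sym (ι a)))))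

  ι-≤ : ∀ {m n} → m ℕ.≤ n → fromℕℚ m ≤ fromℕℚ n
  ι-≤ {m} {n} h = toℚᵘ-cancel-≤ (ℚᵘ.≤-respˡ-≃ (ℚᵘ.≃-sym (ι m)) (ℚᵘ.≤-respʳ-≃ (ℚᵘ.≃-sym (ι n)) (*≤* (ℤ.*-monoʳ-≤-nonNeg (+ 1) (ℤ.+≤+ h)))))

  ι-≤⁻ : ∀ {m n} → fromℕℚ m ≤ fromℕℚ n → m ℕ.≤ n
  ι-≤⁻ {m} {n} h = ℕ.≮⇒≥ λ lt → <-irrefl refl (<-≤-trans (strict lt) h)
    where
    strict : ∀ {m n} → m ℕ.< n → fromℕℚ m < fromℕℚ n
    strict {m} {n} lt = toℚᵘ-cancel-< (ℚᵘ.<-respˡ-≃ (ℚᵘ.≃-sym (ι m)) (ℚᵘ.<-respʳ-≃ (ℚᵘ.≃-sym (ι n)) (*<* (ℤ.*-monoʳ-<-pos (+ 1) (ℤ.+<+ lt)))))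

  ι-nonNeg : ∀ m → 0ℚ ≤ fromℕℚ m
  ι-nonNeg m = ι-≤ {0} {m} ℕ.z≤n

  ι-pos : ∀ m → 0ℚ < fromℕℚ (suc m)
  ι-pos m = ≤∧≢⇒<′ (ι-nonNeg (suc m)) λ e → ℕ.n≮0 (ι-≤⁻ {suc m} {0} (≤-reflexive (sym e)))
    where
    ≤∧≢⇒<′ : ∀ {p q} → p ≤ q → p ≢ q → p < q
    ≤∧≢⇒<′ {p} {q} le ne with p <? q
    ... | yes lt = lt
    ... | no nlt = ⊥-elim (ne (≤-antisym le (≮⇒≥ nlt)))

  module _ {p q r s : ℚ} where

    *-mono : 0ℚ ≤ p → 0ℚ ≤ r → p ≤ q → r ≤ s → p * r ≤ q * s
    *-mono 0≤p 0≤r p≤q r≤s = ≤-trans (*-monoʳ-≤-nonNeg r {{nonNegative 0≤r}} p≤q) (*-monoˡ-≤-nonNeg q {{nonNegative (≤-trans 0≤p p≤q)}} r≤s)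

  *-nonneg : ∀ {p q} → 0ℚ ≤ p → 0ℚ ≤ q → 0ℚ ≤ p * q
  *-nonneg {p} {q} 0≤p 0≤q = ≤-trans (≤-reflexive (sym (*-zeroʳ p))) (*-monoˡ-≤-nonNeg p {{nonNegative 0≤p}} 0≤q)

  ^-nonneg : ∀ {p} n → 0ℚ ≤ p → 0ℚ ≤ p ^ℚ n
  ^-nonneg zero h = ι-nonNeg 1
  ^-nonneg (suc n) h = *-nonneg h (^-nonneg n h)

  ^-mono-≤ : ∀ {p q} n → 0ℚ ≤ p → p ≤ q → p ^ℚ n ≤ q ^ℚ n
  ^-mono-≤ zero h le = ≤-refl
  ^-mono-≤ (suc n) h le = *-mono h (^-nonneg n h) le (^-mono-≤ n h le)

  ^-pos : ∀ {p} n → 0ℚ < p → 0ℚ < p ^ℚ n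
  ^-pos zero h = ι-pos 0
  ^-pos {p} (suc n) h = ≤-<-trans (≤-reflexive (sym (*-zeroʳ p))) (*-monoʳ-<-pos p {{positive h}} (^-pos n h))

  ^-cancel-≤ : ∀ {p q} n → 0ℚ ≤ q → p ^ℚ suc n ≤ q ^ℚ suc n → p ≤ q
  ^-cancel-≤ {p} {q} n 0≤q h with p ≤? q
  ... | yes le = le
  ... | no nle = ⊥-elim (<-irrefl refl (<-≤-trans (strict (≰⇒> nle)) h))
    where
    strict : q < p → q ^ℚ suc n < p ^ℚ suc n
    strict lt = ≤-<-trans (*-monoˡ-≤-nonNeg q {{nonNegative 0≤q}} (^-mono-≤ n 0≤q (<⇒≤ lt))) (*-monoˡ-<-pos (p ^ℚ n) {{positive (^-pos n (≤-<-trans 0≤q lt))}} lt)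

  ^-≥1 : ∀ {p} n → 1ℚ ≤ p → 1ℚ ≤ p ^ℚ n
  ^-≥1 zero h = ≤-refl
  ^-≥1 {p} (suc n) h = ≤-trans (≤-reflexive (sym (*-identityʳ 1ℚ))) (*-mono (ι-nonNeg 1) (ι-nonNeg 1) h (^-≥1 n h))

  ^-mono-exponent : ∀ {p m n} → 1ℚ ≤ p → m ℕ.≤ n → p ^ℚ m ≤ p ^ℚ n
  ^-mono-exponent {p} {n = n} h ℕ.z≤n = ^-≥1 n h
  ^-mono-exponent {p} h (ℕ.s≤s le) = *-monoˡ-≤-nonNeg p {{nonNegative (≤-trans (ι-nonNeg 1) h)}} (^-mono-exponent h le)

  ι-^ : ∀ m k → fromℕℚ (m ℕ.^ k) ≡ fromℕℚ m ^ℚ k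
  ι-^ m zero = refl
  ι-^ m (suc k) = trans (ι-* m (m ℕ.^ k)) (cong (fromℕℚ m *_) (ι-^ m k))

  ^-^ : ∀ p m n → (p ^ℚ m) ^ℚ n ≡ p ^ℚ (m ℕ.* n)
  ^-^ p m n = ^-assocʳ p m n

  *-^ : ∀ p q n → (p * q) ^ℚ n ≡ p ^ℚ n * q ^ℚ n
  *-^ p q n = ^-distrib-* p q n

module RealBounds where
  open import Defs
  open Rationals
  open import Data.Fin using (Fin)
  open import Data.Fin.Subset using (∣_∣)
  open import Data.Nat as ℕ using (ℕ; zero; suc; NonZero)
  import Data.Nat.Properties as ℕ
  open import Data.Integer as ℤ using (ℤ; +_; +[1+_])
  open import Data.Rational hiding (Positive; NonZero; ∣_∣; _÷_)
  open import Data.Rational.Properties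
  open import Data.Rational.Unnormalised as ℚᵘ using (*≤*; *<*)
  import Data.Rational.Unnormalised.Properties as ℚᵘ
  import Data.Integer.Properties as ℤ
  open import Data.Product using (_×_; _,_; ∃-syntax; proj₁; proj₂)
  open import Data.Sum using (inj₁; inj₂)
  open import Data.Empty using (⊥-elim)
  open import Data.Vec using (tabulate)
  open import Data.Bool using (Bool)
  open import Relation.Binary.PropositionalEquality
  open import Relation.Nullary using (yes; no)

  lower-≤ : ∀ (x : ℝ) {p q} → p ≤ q → lower x q → lower x p
  lower-≤ x {p} {q} p≤q h = let r , q<r , l = lower-rounded x h in lower-closed x (≤-<-trans p≤q q<r) l

  lower-<-upper : ∀ (x : ℝ) {p q} → lower x p → upper x q → p < q
  lower-<-upper x {p} {q} l u with p <? q
  ... | yes p<q = p<q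
  ... | no nlt = ⊥-elim (disjoint x (lower-≤ x (≮⇒≥ nlt) l , u))

  2·½ : fromℕℚ 2 * ½ ≡ 1ℚ
  2·½ = refl

  ½^-* : ∀ k → ½ ^ℚ k * fromℕℚ (2 ℕ.^ k) ≡ 1ℚ
  ½^-* k = trans (cong (½ ^ℚ k *_) (ι-^ 2 k)) (trans (sym (*-^ ½ (fromℕℚ 2) k)) (one k))
    where
    one : ∀ k → 1ℚ ^ℚ k ≡ 1ℚ
    one zero = refl
    one (suc k) = trans (*-identityˡ (1ℚ ^ℚ k)) (one k)

  ½>0 : ∀ k → 0ℚ < ½ ^ℚ k
  ½>0 k = ^-pos k (positive⁻¹ ½)

  ½^-< : ∀ k → ½ ^ℚ suc k < ½ ^ℚ k
  ½^-< k = <-≤-trans (*-monoˡ-<-pos (½ ^ℚ k) {{positive (½>0 k)}} {½} {1ℚ} (toℚᵘ-cancel-< (*<* (ℤ.+<+ (ℕ.s≤s (ℕ.s≤s ℕ.z≤n)))))) (≤-reflexive (*-identityˡ (½ ^ℚ k)))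

  unit-below : ∀ {p} → 0ℚ < p → ∃[ d ] (+ 1 / suc d ≤ p)
  unit-below {mkℚ +[1+ n ] d c} h = d , toℚᵘ-cancel-≤ (ℚᵘ.≤-respˡ-≃ (ℚᵘ.≃-sym (frac 1 d)) (*≤* (ℤ.*-monoʳ-≤-nonNeg (+ suc d) {+ 1} {+ suc n} (ℤ.+≤+ (ℕ.s≤s ℕ.z≤n)))))
  unit-below {mkℚ (+ 0) d c} (*<* (ℤ.+<+ ()))
  unit-below {mkℚ ℤ.-[1+ n ] d c} (*<* ())

  ½^≤unit : ∀ d → ½ ^ℚ d ≤ + 1 / suc d
  ½^≤unit d = *-cancelʳ-≤-pos (fromℕℚ (suc d)) {{positive (ι-pos d)}} (≤-trans (*-monoˡ-≤-nonNeg (½ ^ℚ d) {{nonNegative (<⇒≤ (½>0 d))}} (ι-≤ {suc d} {2 ℕ.^ d} (small d)))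
    (≤-reflexive (trans (½^-* d) (sym (frac-* 1 d)))))
    where
    small : ∀ d → suc d ℕ.≤ 2 ℕ.^ d
    small zero = ℕ.≤-refl
    small (suc d) = ℕ.≤-trans (ℕ.+-mono-≤ (ℕ.≤-trans (ℕ.s≤s ℕ.z≤n) (small d)) (small d)) (ℕ.≤-reflexive (cong (2 ℕ.^ d ℕ.+_) (sym (ℕ.+-identityʳ (2 ℕ.^ d)))))

  exponent : ∀ (ε : ℝ) → Positive ε → upper ε (fromℕℚ 2) → ∃[ E ] (lower ε (½ ^ℚ suc E) × upper ε (fromℕℚ 2 * ½ ^ℚ E))
  exponent ε ε>0 below2 = search (suc (proj₁ bound)) 0 enough (subst (upper ε) (sym (*-identityʳ (fromℕℚ 2))) below2)
    where
    positive-part = lower-rounded ε ε>0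
    bound = unit-below (proj₁ (proj₂ positive-part))
    d = proj₁ bound
    tiny : lower ε (½ ^ℚ d)
    tiny = lower-≤ ε (≤-trans (½^≤unit d) (proj₂ bound)) (proj₂ (proj₂ positive-part))
    enough : lower ε (½ ^ℚ (suc d ℕ.+ 0))
    enough = subst (λ k → lower ε (½ ^ℚ k)) (sym (ℕ.+-identityʳ (suc d))) (lower-≤ ε (<⇒≤ (½^-< d)) tiny)
    halve : ∀ j → ½ ^ℚ j ≡ fromℕℚ 2 * ½ ^ℚ suc j
    halve j = trans (sym (*-identityˡ (½ ^ℚ j))) (trans (cong (_* ½ ^ℚ j) (sym 2·½)) (*-assoc (fromℕℚ 2) ½ (½ ^ℚ j)))
    search : ∀ fuel j → lower ε (½ ^ℚ (fuel ℕ.+ j)) → upper ε (fromℕℚ 2 * ½ ^ℚ j) → ∃[ E ] (lower ε (½ ^ℚ suc E) × upper ε (fromℕℚ 2 * ½ ^ℚ E))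
    search zero j l u = j , lower-≤ ε (<⇒≤ (½^-< j)) l , u
    search (suc f) j l u with located ε (½^-< j)
    ... | inj₁ low = j , low , u
    ... | inj₂ high = search f (suc j) (subst (λ k → lower ε (½ ^ℚ k)) (sym (ℕ.+-suc f j)) l) (subst (upper ε) (halve j) high)

  Pr-certain : ∀ {N} .{{_ : NonZero N}} (E : Fin N → Bool) → ∣ tabulate E ∣ ≡ N → Pr E ≡ 1ℚ
  Pr-certain {suc N} E h = *-cancelʳ′ (trans (frac-* ∣ tabulate E ∣ N) (trans (cong fromℕℚ h) (sym (*-identityˡ (fromℕℚ (suc N))))))
    where
    *-cancelʳ′ : ∀ {p q} → p * fromℕℚ (suc N) ≡ q * fromℕℚ (suc N) → p ≡ q
    *-cancelʳ′ e = ≤-antisym (*-cancelʳ-≤-pos (fromℕℚ (suc N)) {{positive (ι-pos N)}} (≤-reflexive e)) (*-cancelʳ-≤-pos (fromℕℚ (suc N)) {{positive (ι-pos N)}} (≤-reflexive (sym e)))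

  Pr-nonneg : ∀ {N} .{{_ : NonZero N}} (E : Fin N → Bool) → 0ℚ ≤ Pr E
  Pr-nonneg {suc N} E = *-cancelʳ-≤-pos (fromℕℚ (suc N)) {{positive (ι-pos N)}} (≤-trans (≤-reflexive (*-zeroˡ (fromℕℚ (suc N)))) (≤-trans (ι-nonNeg ∣ tabulate E ∣) (≤-reflexive (sym (frac-* ∣ tabulate E ∣ N)))))

  1-≤ : ∀ {e p} → 1ℚ ≤ p + e → 1ℚ - e ≤ p
  1-≤ {e} {p} h = ≤-trans (+-monoˡ-≤ (- e) h) (≤-reflexive (trans (+-assoc p e (- e)) (trans (cong (_+_ p) (+-inverseʳ e)) (+-identityʳ p))))

  Pr-likely : ∀ {N} .{{_ : NonZero N}} (E : Fin N → Bool) k failures → N ℕ.≤ ∣ tabulate E ∣ ℕ.+ failures → failures ℕ.* 2 ℕ.^ k ℕ.≤ N →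
    ∀ {e} → ½ ^ℚ k < e → 1ℚ - e ≤ Pr E
  Pr-likely {suc N} E k failures all few {e} ½^k<e = 1-≤ (≤-trans bound (+-monoʳ-≤ (Pr E) (<⇒≤ ½^k<e)))
    where
    c D : ℕ
    c = ∣ tabulate E ∣
    D = 2 ℕ.^ k
    M = suc N ℕ.* D
    count : suc N ℕ.* D ℕ.≤ c ℕ.* D ℕ.+ suc N
    count = ℕ.≤-trans (ℕ.*-monoˡ-≤ D all) (ℕ.≤-trans (ℕ.≤-reflexive (ℕ.*-distribʳ-+ D c failures)) (ℕ.+-monoʳ-≤ (c ℕ.* D) few))
    open ≡-Reasoning
    expand : (Pr E + ½ ^ℚ k) * fromℕℚ (suc N ℕ.* D) ≡ fromℕℚ (c ℕ.* D ℕ.+ suc N)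
    expand = begin
      (Pr E + ½ ^ℚ k) * fromℕℚ (suc N ℕ.* D) ≡⟨ *-distribʳ-+ (fromℕℚ (suc N ℕ.* D)) (Pr E) (½ ^ℚ k) ⟩
      Pr E * fromℕℚ (suc N ℕ.* D) + ½ ^ℚ k * fromℕℚ (suc N ℕ.* D) ≡⟨ cong₂ _+_ first second ⟩
      fromℕℚ (c ℕ.* D) + fromℕℚ (suc N) ≡⟨ ι-+ (c ℕ.* D) (suc N) ⟨
      fromℕℚ (c ℕ.* D ℕ.+ suc N) ∎
      where
      first : Pr E * fromℕℚ (suc N ℕ.* D) ≡ fromℕℚ (c ℕ.* D)
      first = trans (cong (Pr E *_) (ι-* (suc N) D)) (trans (sym (*-assoc (Pr E) (fromℕℚ (suc N)) (fromℕℚ D))) (trans (cong (_* fromℕℚ D) (frac-* c N)) (sym (ι-* c D))))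
      second : ½ ^ℚ k * fromℕℚ (suc N ℕ.* D) ≡ fromℕℚ (suc N)
      second = trans (cong (½ ^ℚ k *_) (trans (cong fromℕℚ (ℕ.*-comm (suc N) D)) (ι-* D (suc N)))) (trans (sym (*-assoc (½ ^ℚ k) (fromℕℚ D) (fromℕℚ (suc N)))) (trans (cong (_* fromℕℚ (suc N)) (½^-* k)) (*-identityˡ _)))
    M>0 : 0ℚ < fromℕℚ (suc N ℕ.* D)
    M>0 = ≤-<-trans ≤-refl (<-≤-trans (ι-pos 0) (ι-≤ {1} (ℕ.*-mono-≤ {1} {suc N} (ℕ.s≤s ℕ.z≤n) (ℕ.m^n>0 2 k))))
    bound : 1ℚ ≤ Pr E + ½ ^ℚ k
    bound = *-cancelʳ-≤-pos (fromℕℚ (suc N ℕ.* D)) {{positive M>0}} (≤-trans (≤-reflexive (*-identityˡ _)) (≤-trans (ι-≤ count) (≤-reflexive (sym expand))))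

  lg-bound : ∀ (ε : ℝ) {L E λ′ y} → 0 ℕ.< L → upper ε (fromℕℚ 2 * ½ ^ℚ E) → 2 ℕ.^ λ′ ℕ.≤ 4 ℕ.* L → lg⁺ (L ÷ ε) y → fromℕℚ (λ′ ℕ.+ E) ≤ fromℕℚ 3 + y
  lg-bound ε {L} {E} {λ′} {y} L>0 high wide (1<y , q , a , d , (e , 0<e , low , L≤qe) , q^d≤ , a/d≤y) =
    *-cancelʳ-≤-pos (fromℕℚ (suc d)) {{positive (ι-pos d)}} (begin
      fromℕℚ (λ′ ℕ.+ E) * fromℕℚ (suc d) ≡⟨ ι-* (λ′ ℕ.+ E) (suc d) ⟨
      fromℕℚ ((λ′ ℕ.+ E) ℕ.* suc d) ≤⟨ ι-≤ exponents ⟩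
      fromℕℚ (3 ℕ.* suc d ℕ.+ a) ≡⟨ trans (ι-+ (3 ℕ.* suc d) a) (cong₂ _+_ (ι-* 3 (suc d)) (sym (frac-* a d))) ⟩
      fromℕℚ 3 * fromℕℚ (suc d) + (+ a / suc d) * fromℕℚ (suc d) ≡⟨ *-distribʳ-+ (fromℕℚ (suc d)) (fromℕℚ 3) (+ a / suc d) ⟨
      (fromℕℚ 3 + (+ a / suc d)) * fromℕℚ (suc d) ≤⟨ *-monoʳ-≤-nonNeg (fromℕℚ (suc d)) {{nonNegative (ι-nonNeg (suc d))}} (+-monoʳ-≤ (fromℕℚ 3) a/d≤y) ⟩
      (fromℕℚ 3 + y) * fromℕℚ (suc d) ∎)
    where
    open ≤-Reasoning
    q≥0 : 0ℚ ≤ q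
    q≥0 = *-cancelʳ-≤-pos e {{positive 0<e}} (≤-trans (≤-reflexive (*-zeroˡ e)) (≤-trans (ι-nonNeg L) L≤qe))
    base : fromℕℚ (2 ℕ.^ (λ′ ℕ.+ E)) ≤ fromℕℚ 8 * q
    base = begin
      fromℕℚ (2 ℕ.^ (λ′ ℕ.+ E)) ≡⟨ trans (cong fromℕℚ (ℕ.^-distribˡ-+-* 2 λ′ E)) (ι-* (2 ℕ.^ λ′) (2 ℕ.^ E)) ⟩
      fromℕℚ (2 ℕ.^ λ′) * T ≤⟨ *-monoʳ-≤-nonNeg T {{nonNegative T≥0}} (≤-trans (ι-≤ wide) (≤-reflexive (ι-* 4 L))) ⟩
      fromℕℚ 4 * fromℕℚ L * T ≤⟨ *-monoʳ-≤-nonNeg T {{nonNegative T≥0}} (*-monoˡ-≤-nonNeg (fromℕℚ 4) {{nonNegative (ι-nonNeg 4)}} (≤-trans L≤qe (*-monoˡ-≤-nonNeg q {{nonNegative q≥0}} (<⇒≤ (lower-<-upper ε low high))))) ⟩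
      fromℕℚ 4 * (q * (fromℕℚ 2 * ½ ^ℚ E)) * T ≡⟨ trans (*-assoc (fromℕℚ 4) (q * (fromℕℚ 2 * ½ ^ℚ E)) T) (cong (fromℕℚ 4 *_) (trans (*-assoc q (fromℕℚ 2 * ½ ^ℚ E) T) (cong (q *_) (trans (*-assoc (fromℕℚ 2) (½ ^ℚ E) T) (trans (cong (fromℕℚ 2 *_) (½^-* E)) (*-identityʳ (fromℕℚ 2))))))) ⟩
      fromℕℚ 4 * (q * fromℕℚ 2) ≡⟨ trans (cong (fromℕℚ 4 *_) (*-comm q (fromℕℚ 2))) (trans (sym (*-assoc (fromℕℚ 4) (fromℕℚ 2) q)) (cong (_* q) (sym (ι-* 4 2)))) ⟩
      fromℕℚ 8 * q ∎
      where
      T = fromℕℚ (2 ℕ.^ E)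
      T≥0 = ι-nonNeg (2 ℕ.^ E)
    powers : 2 ℕ.^ ((λ′ ℕ.+ E) ℕ.* suc d) ℕ.≤ 2 ℕ.^ (3 ℕ.* suc d ℕ.+ a)
    powers = ι-≤⁻ (begin
      fromℕℚ (2 ℕ.^ ((λ′ ℕ.+ E) ℕ.* suc d)) ≡⟨ trans (cong fromℕℚ (sym (ℕ.^-*-assoc 2 (λ′ ℕ.+ E) (suc d)))) (ι-^ (2 ℕ.^ (λ′ ℕ.+ E)) (suc d)) ⟩
      fromℕℚ (2 ℕ.^ (λ′ ℕ.+ E)) ^ℚ suc d ≤⟨ ^-mono-≤ (suc d) (ι-nonNeg (2 ℕ.^ (λ′ ℕ.+ E))) base ⟩
      (fromℕℚ 8 * q) ^ℚ suc d ≡⟨ trans (*-^ (fromℕℚ 8) q (suc d)) (cong (_* q ^ℚ suc d) (sym (ι-^ 8 (suc d)))) ⟩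
      fromℕℚ (8 ℕ.^ suc d) * q ^ℚ suc d ≤⟨ *-monoˡ-≤-nonNeg (fromℕℚ (8 ℕ.^ suc d)) {{nonNegative (ι-nonNeg (8 ℕ.^ suc d))}} q^d≤ ⟩
      fromℕℚ (8 ℕ.^ suc d) * fromℕℚ (2 ℕ.^ a) ≡⟨ trans (sym (ι-* (8 ℕ.^ suc d) (2 ℕ.^ a))) (cong fromℕℚ (trans (cong (ℕ._* 2 ℕ.^ a) (ℕ.^-*-assoc 2 3 (suc d))) (sym (ℕ.^-distribˡ-+-* 2 (3 ℕ.* suc d) a)))) ⟩
      fromℕℚ (2 ℕ.^ (3 ℕ.* suc d ℕ.+ a)) ∎)
    exponents : (λ′ ℕ.+ E) ℕ.* suc d ℕ.≤ 3 ℕ.* suc d ℕ.+ a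
    exponents = ℕ.≮⇒≥ λ lt′ → ℕ.<-irrefl refl (ℕ.<-≤-trans (ℕ.^-monoʳ-< 2 (ℕ.s≤s (ℕ.s≤s ℕ.z≤n)) lt′) powers)

  root-bound : ∀ (δ : ℝ) {s X z} → lower δ (+ 1 / suc s) → (X ^ᵁ δ) z → ∃[ y ] (X y × (1ℚ ≤ y → y ≤ z ^ℚ suc s))
  root-bound δ {s} {X} {z} low (0≤z , y , p , r , Xy , high , y^p≤) = y , Xy , λ 1≤y → ^-cancel-≤ r (^-nonneg (suc s) 0≤z) (begin
      y ^ℚ suc r ≤⟨ ^-mono-exponent 1≤y exponents ⟩
      y ^ℚ (p ℕ.* suc s) ≡⟨ ^-^ y p (suc s) ⟨
      (y ^ℚ p) ^ℚ suc s ≤⟨ ^-mono-≤ (suc s) (^-nonneg p (≤-trans (ι-nonNeg 1) 1≤y)) y^p≤ ⟩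
      (z ^ℚ suc r) ^ℚ suc s ≡⟨ trans (^-^ z (suc r) (suc s)) (trans (cong (z ^ℚ_) (ℕ.*-comm (suc r) (suc s))) (sym (^-^ z (suc s) (suc r)))) ⟩
      (z ^ℚ suc s) ^ℚ suc r ∎)
    where
    open ≤-Reasoning
    exponents : suc r ℕ.≤ p ℕ.* suc s
    exponents = ι-≤⁻ (begin
      fromℕℚ (suc r) ≡⟨ trans (sym (*-identityˡ _)) (cong (_* fromℕℚ (suc r)) (sym (frac-* 1 s))) ⟩
      (+ 1 / suc s) * fromℕℚ (suc s) * fromℕℚ (suc r) ≡⟨ *-assoc (+ 1 / suc s) (fromℕℚ (suc s)) (fromℕℚ (suc r)) ⟩
      (+ 1 / suc s) * (fromℕℚ (suc s) * fromℕℚ (suc r)) ≤⟨ *-monoʳ-≤-nonNeg (fromℕℚ (suc s) * fromℕℚ (suc r)) {{nonNegative (*-nonneg (ι-nonNeg (suc s)) (ι-nonNeg (suc r)))}} (<⇒≤ (lower-<-upper δ low high)) ⟩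
      (+ p / suc r) * (fromℕℚ (suc s) * fromℕℚ (suc r)) ≡⟨ trans (cong ((+ p / suc r) *_) (*-comm (fromℕℚ (suc s)) (fromℕℚ (suc r)))) (trans (sym (*-assoc (+ p / suc r) _ _)) (trans (cong (_* fromℕℚ (suc s)) (frac-* p r)) (sym (ι-* p (suc s))))) ⟩
      fromℕℚ (p ℕ.* suc s) ∎)

module SpaceBound where
  open import Defs
  open Rationals
  open RealBounds
  open import Data.Nat as ℕ using (ℕ; zero; suc)
  import Data.Nat.Properties as ℕ
  import Data.Integer as ℤ
  open import Data.Rational hiding (Positive; NonZero; ∣_∣; _÷_)
  open import Data.Rational.Properties
  open import Data.Product using (_,_; proj₁; proj₂)
  open import Relation.Binary.PropositionalEquality

  abstract
    spaceFactor : ℕ → ℕ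
    spaceFactor o = 8 ℕ.+ 700 ℕ.* (80 ℕ.* o)

    spaceFactor≡ : ∀ o → spaceFactor o ≡ 8 ℕ.+ 700 ℕ.* (80 ℕ.* o)
    spaceFactor≡ o = refl

  square-root : ∀ {s root ℓ k y z} → 0ℚ ≤ z → 1ℚ ≤ y → root ℕ.^ (2 ℕ.* suc s) ℕ.≤ 8 ℕ.* suc ℓ → ℓ ℕ.≤ k ℕ.+ 5 → fromℕℚ k ≤ fromℕℚ 3 + y → y ≤ z ^ℚ suc s →
    fromℕℚ (root ℕ.* root) ≤ fromℕℚ 80 * z
  square-root {s} {root} {ℓ} {k} {y} {z} 0≤z 1≤y root≤ ℓ≤ k≤ y≤ = ^-cancel-≤ s (*-nonneg (ι-nonNeg 80) 0≤z) (begin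
      fromℕℚ (root ℕ.* root) ^ℚ suc s ≡⟨ ι-^ (root ℕ.* root) (suc s) ⟨
      fromℕℚ ((root ℕ.* root) ℕ.^ suc s) ≤⟨ ι-≤ (ℕ.≤-trans (ℕ.≤-reflexive squares) (ℕ.≤-trans root≤ (ℕ.*-monoʳ-≤ 8 (ℕ.s≤s ℓ≤)))) ⟩
      fromℕℚ (8 ℕ.* (suc k ℕ.+ 5)) ≡⟨ trans (ι-* 8 (suc k ℕ.+ 5)) (cong (fromℕℚ 8 *_) (trans (cong fromℕℚ (sym (ℕ.+-suc k 5))) (ι-+ k 6))) ⟩
      fromℕℚ 8 * (fromℕℚ k + fromℕℚ 6) ≤⟨ *-monoˡ-≤-nonNeg (fromℕℚ 8) {{nonNegative (ι-nonNeg 8)}} ten ⟩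
      fromℕℚ 8 * (fromℕℚ 10 * y) ≡⟨ trans (sym (*-assoc (fromℕℚ 8) (fromℕℚ 10) y)) (cong (_* y) (sym (ι-* 8 10))) ⟩
      fromℕℚ 80 * y ≤⟨ *-mono (ι-nonNeg 80) (≤-trans (ι-nonNeg 1) 1≤y) (≤-trans (≤-reflexive (sym (*-identityʳ (fromℕℚ 80)))) (^-mono-exponent {fromℕℚ 80} (ι-≤ {1} {80} (ℕ.s≤s ℕ.z≤n)) (ℕ.s≤s (ℕ.z≤n {s})))) y≤ ⟩
      fromℕℚ 80 ^ℚ suc s * z ^ℚ suc s ≡⟨ *-^ (fromℕℚ 80) z (suc s) ⟨
      (fromℕℚ 80 * z) ^ℚ suc s ∎)
    where
    open ≤-Reasoning
    squares : (root ℕ.* root) ℕ.^ suc s ≡ root ℕ.^ (2 ℕ.* suc s)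
    squares = trans (cong (ℕ._^ suc s) (cong (root ℕ.*_) (sym (ℕ.*-identityʳ root)))) (ℕ.^-*-assoc root 2 (suc s))
    ten : fromℕℚ k + fromℕℚ 6 ≤ fromℕℚ 10 * y
    ten = begin
      fromℕℚ k + fromℕℚ 6 ≤⟨ +-monoˡ-≤ (fromℕℚ 6) k≤ ⟩
      fromℕℚ 3 + y + fromℕℚ 6 ≡⟨ trans (cong (_+ fromℕℚ 6) (+-comm (fromℕℚ 3) y)) (trans (+-assoc y (fromℕℚ 3) (fromℕℚ 6)) (cong (y +_) (sym (ι-+ 3 6)))) ⟩
      y + fromℕℚ 9 ≤⟨ +-mono-≤ (≤-reflexive (sym (*-identityˡ y))) (≤-trans (≤-reflexive (sym (*-identityʳ (fromℕℚ 9)))) (*-monoˡ-≤-nonNeg (fromℕℚ 9) {{nonNegative (ι-nonNeg 9)}} 1≤y)) ⟩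
      1ℚ * y + fromℕℚ 9 * y ≡⟨ trans (sym (*-distribʳ-+ y 1ℚ (fromℕℚ 9))) (cong (_* y) (sym (ι-+ 1 9))) ⟩
      fromℕℚ 10 * y ∎

  combine : ∀ c o n space ℓ₁ k x {y z q a b} → 1ℚ ≤ z → space ℕ.≤ n ℕ.* ℓ₁ ℕ.+ n ℕ.* (c ℕ.* (o ℕ.* x)) → ℓ₁ ℕ.≤ k ℕ.+ 5 → fromℕℚ k ≤ fromℕℚ 3 + y → fromℕℚ x ≤ fromℕℚ 80 * z →
    fromℕℚ n * y ≤ a → fromℕℚ ((8 ℕ.+ c ℕ.* (80 ℕ.* o)) ℕ.* n) * z ≤ b → a + b ≤ q → fromℕℚ space ≤ q
  combine c o n space ℓ₁ k x {y} {z} {q} {a} {b} 1≤z space≤ ℓ₁≤ k≤ x≤ a≥ b≥ q≥ = begin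
      fromℕℚ space ≤⟨ ι-≤ space≤ ⟩
      fromℕℚ (n ℕ.* ℓ₁ ℕ.+ n ℕ.* (c ℕ.* (o ℕ.* x))) ≡⟨ trans (cong fromℕℚ (sym (ℕ.*-distribˡ-+ n ℓ₁ _))) (trans (ι-* n _) (cong (fromℕℚ n *_) (trans (ι-+ ℓ₁ _) (cong (fromℕℚ ℓ₁ +_) (trans (ι-* c _) (cong (fromℕℚ c *_) (ι-* o x))))))) ⟩
      fromℕℚ n * (fromℕℚ ℓ₁ + fromℕℚ c * (fromℕℚ o * fromℕℚ x)) ≤⟨ *-monoˡ-≤-nonNeg (fromℕℚ n) {{nonNegative (ι-nonNeg n)}} (+-mono-≤ near (*-monoˡ-≤-nonNeg (fromℕℚ c) {{nonNegative (ι-nonNeg c)}} (*-monoˡ-≤-nonNeg (fromℕℚ o) {{nonNegative (ι-nonNeg o)}} x≤))) ⟩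
      fromℕℚ n * (y + fromℕℚ 8 * z + fromℕℚ c * (fromℕℚ o * (fromℕℚ 80 * z))) ≡⟨ cong (fromℕℚ n *_) (trans (+-assoc y _ _) (cong (y +_) gather)) ⟩
      fromℕℚ n * (y + fromℕℚ C * z) ≡⟨ trans (*-distribˡ-+ (fromℕℚ n) y _) (cong (fromℕℚ n * y +_) (trans (sym (*-assoc (fromℕℚ n) (fromℕℚ C) z)) (cong (_* z) (trans (*-comm (fromℕℚ n) (fromℕℚ C)) (sym (ι-* C n)))))) ⟩
      fromℕℚ n * y + fromℕℚ (C ℕ.* n) * z ≤⟨ +-mono-≤ a≥ b≥ ⟩
      a + b ≤⟨ q≥ ⟩
      q ∎
    where
    open ≤-Reasoning
    C : ℕ
    C = 8 ℕ.+ c ℕ.* (80 ℕ.* o)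
    near : fromℕℚ ℓ₁ ≤ y + fromℕℚ 8 * z
    near = begin
      fromℕℚ ℓ₁ ≤⟨ ι-≤ ℓ₁≤ ⟩
      fromℕℚ (k ℕ.+ 5) ≡⟨ ι-+ k 5 ⟩
      fromℕℚ k + fromℕℚ 5 ≤⟨ +-monoˡ-≤ (fromℕℚ 5) k≤ ⟩
      fromℕℚ 3 + y + fromℕℚ 5 ≡⟨ trans (cong (_+ fromℕℚ 5) (+-comm (fromℕℚ 3) y)) (trans (+-assoc y (fromℕℚ 3) (fromℕℚ 5)) (cong (y +_) (sym (ι-+ 3 5)))) ⟩
      y + fromℕℚ 8 ≤⟨ +-monoʳ-≤ y (≤-trans (≤-reflexive (sym (*-identityʳ (fromℕℚ 8)))) (*-monoˡ-≤-nonNeg (fromℕℚ 8) {{nonNegative (ι-nonNeg 8)}} 1≤z)) ⟩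
      y + fromℕℚ 8 * z ∎
    gather : fromℕℚ 8 * z + fromℕℚ c * (fromℕℚ o * (fromℕℚ 80 * z)) ≡ fromℕℚ C * z
    gather = trans (cong (fromℕℚ 8 * z +_) (trans (cong (fromℕℚ c *_) (trans (sym (*-assoc (fromℕℚ o) (fromℕℚ 80) z)) (cong (_* z) (trans (*-comm (fromℕℚ o) (fromℕℚ 80)) (sym (ι-* 80 o))))))
        (trans (sym (*-assoc (fromℕℚ c) (fromℕℚ (80 ℕ.* o)) z)) (cong (_* z) (sym (ι-* c (80 ℕ.* o)))))))
      (trans (sym (*-distribʳ-+ z (fromℕℚ 8) (fromℕℚ (c ℕ.* (80 ℕ.* o))))) (cong (_* z) (sym (ι-+ 8 (c ℕ.* (80 ℕ.* o))))))

  space-bound : ∀ (δ ε : ℝ) {s o n L λ′ E ℓ₁ root space} → lower δ (ℤ.+ 1 / suc s) → 0 ℕ.< L → upper ε (fromℕℚ 2 * ½ ^ℚ E) → 2 ℕ.^ λ′ ℕ.≤ 4 ℕ.* L →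
    ℓ₁ ℕ.≤ λ′ ℕ.+ E ℕ.+ 5 → root ℕ.^ (2 ℕ.* suc s) ℕ.≤ 8 ℕ.* suc ℓ₁ → space ℕ.≤ n ℕ.* ℓ₁ ℕ.+ n ℕ.* (700 ℕ.* (o ℕ.* (root ℕ.* root))) →
    space ≤ᵁ n *ᵁ lg⁺ (L ÷ ε) +ᵁ (spaceFactor o ℕ.* n) *ᵁ lg⁺ (L ÷ ε) ^ᵁ δ
  space-bound δ ε {s} {o} {n} {L} {λ′} {E} {ℓ₁} {root} {space} low L>0 high wide ℓ₁≤ root≤ space≤ q (a , b , (y , lgy , ny≤a) , (z , zδ , Cnz≤b) , a+b≤q) =
    combine 700 o n space ℓ₁ (λ′ ℕ.+ E) (root ℕ.* root) 1≤z space≤ ℓ₁≤ (lg-bound ε {L} {E} {λ′} L>0 high wide lgy) (square-root {s} {root} 0≤z 1≤y₂ root≤ ℓ₁≤ (lg-bound ε {L} {E} {λ′} L>0 high wide lgy₂) y₂≤) ny≤a (subst (λ C → fromℕℚ (C ℕ.* n) * z ≤ b) (spaceFactor≡ o) Cnz≤b) a+b≤q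
    where
    0≤z : 0ℚ ≤ z
    0≤z = proj₁ zδ
    power = root-bound δ {s} {lg⁺ (L ÷ ε)} {z} low zδ
    y₂ = proj₁ power
    lgy₂ : lg⁺ (L ÷ ε) y₂
    lgy₂ = proj₁ (proj₂ power)
    1≤y₂ : 1ℚ ≤ y₂
    1≤y₂ = <⇒≤ (proj₁ lgy₂)
    y₂≤ : y₂ ≤ z ^ℚ suc s
    y₂≤ = proj₂ (proj₂ power) 1≤y₂
    1≤z : 1ℚ ≤ z
    1≤z = ^-cancel-≤ s 0≤z (≤-trans (≤-trans (≤-reflexive (one (suc s))) 1≤y₂) y₂≤)
      where
      one : ∀ k → 1ℚ ^ℚ k ≡ 1ℚ
      one zero = refl
      one (suc k) = trans (*-identityˡ (1ℚ ^ℚ k)) (one k)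

  zero-space : ∀ {X Y : UpperReal} → (∀ q → X q → 0ℚ ≤ q) → (∀ q → Y q → 0ℚ ≤ q) → ∀ n m → 0 ≤ᵁ n *ᵁ X +ᵁ m *ᵁ Y
  zero-space X≥0 Y≥0 n m q (a , b , (y , Xy , ny≤a) , (z , Yz , mz≤b) , a+b≤q) = ≤-trans (≤-trans (≤-reflexive (sym (+-identityʳ 0ℚ)))
    (+-mono-≤ (≤-trans (*-nonneg (ι-nonNeg n) (X≥0 y Xy)) ny≤a) (≤-trans (*-nonneg (ι-nonNeg m) (Y≥0 z Yz)) mz≤b))) a+b≤q

open import Defs
open import Data.Bool using (Bool; true; false; if_then_else_; not; _∧_; _∨_; T)
open import Data.Empty using (⊥; ⊥-elim)
open import Data.Fin as Fin using (Fin; toℕ; fromℕ<; #_)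
open import Data.List using (List; []; _∷_; _++_; length)
open import Data.List.Properties using (length-++; ++-assoc)
open import Data.Maybe using (Maybe; just; nothing; Is-just)
open import Data.Nat hiding (_/_; _%_)
open import Data.Nat.Properties
open import Data.Product using (_×_; _,_; proj₁; proj₂; Σ-syntax; ∃-syntax)
open import Data.Sum using (_⊎_; inj₁; inj₂; [_,_]′)
open import Data.Unit using (⊤; tt)
open import Data.Vec as Vec using (Vec; []; _∷_; tabulate; zipWith)
open import Function using (_∘_)
open import Relation.Binary.Definitions using (tri<; tri≈; tri>)
open import Relation.Binary.PropositionalEquality
open import Relation.Nullary using (¬_; yes; no; Dec)
open import Relation.Nullary.Decidable using (True; toWitness; fromWitness)

module PolynomialInequalities where
  infixl 6 _:+_
  infixl 7 _:*_

  data Poly : Set where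
    var con : ℕ → Poly
    _:+_ _:*_ : Poly → Poly → Poly

  at : List ℕ → ℕ → ℕ
  at [] _ = 0
  at (x ∷ _) zero = x
  at (_ ∷ xs) (suc i) = at xs i

  ⟦_⟧ : Poly → List ℕ → ℕ
  ⟦ var i ⟧ ρ = at ρ i
  ⟦ con c ⟧ ρ = c
  ⟦ p :+ q ⟧ ρ = ⟦ p ⟧ ρ + ⟦ q ⟧ ρ
  ⟦ p :* q ⟧ ρ = ⟦ p ⟧ ρ * ⟦ q ⟧ ρ

  Mono NF : Set
  Mono = List ℕ
  NF = List (Mono × ℕ)

  ⟦_⟧ᵐ : Mono → List ℕ → ℕ
  ⟦ [] ⟧ᵐ ρ = 1
  ⟦ i ∷ m ⟧ᵐ ρ = at ρ i * ⟦ m ⟧ᵐ ρ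

  ⟦_⟧ⁿ : NF → List ℕ → ℕ
  ⟦ [] ⟧ⁿ ρ = 0
  ⟦ (m , c) ∷ p ⟧ⁿ ρ = c * ⟦ m ⟧ᵐ ρ + ⟦ p ⟧ⁿ ρ

  insertᵐ : ℕ → Mono → Mono
  insertᵐ i [] = i ∷ []
  insertᵐ i (j ∷ m) = if i ≤ᵇ j then i ∷ j ∷ m else j ∷ insertᵐ i m

  _*ᵐ_ : Mono → Mono → Mono
  [] *ᵐ n = n
  (i ∷ m) *ᵐ n = insertᵐ i (m *ᵐ n)

  eqᵐ : Mono → Mono → Bool
  eqᵐ [] [] = true
  eqᵐ (i ∷ m) (j ∷ n) = (i ≡ᵇ j) ∧ eqᵐ m n
  eqᵐ _ _ = false

  addTerm : Mono → ℕ → NF → NF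
  addTerm m c [] = (m , c) ∷ []
  addTerm m c ((n , d) ∷ p) = if eqᵐ m n then (n , c + d) ∷ p else (n , d) ∷ addTerm m c p

  _+ⁿ_ : NF → NF → NF
  [] +ⁿ q = q
  ((m , c) ∷ p) +ⁿ q = addTerm m c (p +ⁿ q)

  scale : Mono → ℕ → NF → NF
  scale m c [] = []
  scale m c ((n , d) ∷ p) = addTerm (m *ᵐ n) (c * d) (scale m c p)

  _*ⁿ_ : NF → NF → NF
  [] *ⁿ q = []
  ((m , c) ∷ p) *ⁿ q = scale m c q +ⁿ (p *ⁿ q)

  norm : Poly → NF
  norm (var i) = (i ∷ [] , 1) ∷ []
  norm (con c) = ([] , c) ∷ []
  norm (p :+ q) = norm p +ⁿ norm q
  norm (p :* q) = norm p *ⁿ norm q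

  take : Mono → ℕ → NF → Maybe NF
  take m zero q = just q
  take m (suc c) [] = nothing
  take m (suc c) ((n , d) ∷ q) with eqᵐ m n | suc c ≤ᵇ d
  ... | true | true = just ((n , d ∸ suc c) ∷ q)
  ... | true | false = nothing
  ... | false | _ with take m (suc c) q
  ... | just q′ = just ((n , d) ∷ q′)
  ... | nothing = nothing

  leⁿ : NF → NF → Bool
  leⁿ [] q = true
  leⁿ ((m , c) ∷ p) q with take m c q
  ... | just q′ = leⁿ p q′
  ... | nothing = false

  swap* : ∀ a b c → a * (b * c) ≡ b * (a * c)
  swap* a b c = trans (sym (*-assoc a b c)) (trans (cong (_* c) (*-comm a b)) (*-assoc b a c))

  swap+ : ∀ a b c → a + (b + c) ≡ b + (a + c)
  swap+ a b c = trans (sym (+-assoc a b c)) (trans (cong (_+ c) (+-comm a b)) (+-assoc b a c))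

  insertᵐ-sound : ∀ ρ i m → ⟦ insertᵐ i m ⟧ᵐ ρ ≡ at ρ i * ⟦ m ⟧ᵐ ρ
  insertᵐ-sound ρ i [] = refl
  insertᵐ-sound ρ i (j ∷ m) with i ≤ᵇ j
  ... | true = refl
  ... | false = trans (cong (at ρ j *_) (insertᵐ-sound ρ i m)) (swap* (at ρ j) (at ρ i) _)

  *ᵐ-sound : ∀ ρ m n → ⟦ m *ᵐ n ⟧ᵐ ρ ≡ ⟦ m ⟧ᵐ ρ * ⟦ n ⟧ᵐ ρ
  *ᵐ-sound ρ [] n = sym (+-identityʳ _)
  *ᵐ-sound ρ (i ∷ m) n = trans (insertᵐ-sound ρ i (m *ᵐ n))
    (trans (cong (at ρ i *_) (*ᵐ-sound ρ m n)) (sym (*-assoc (at ρ i) _ _)))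

  eqᵐ-sound : ∀ m n → eqᵐ m n ≡ true → m ≡ n
  eqᵐ-sound [] [] e = refl
  eqᵐ-sound (i ∷ m) (j ∷ n) e with i ≡ᵇ j in ij
  ... | true = cong₂ _∷_ (≡ᵇ⇒≡ i j (subst T (sym ij) tt)) (eqᵐ-sound m n e)

  addTerm-sound : ∀ ρ m c p → ⟦ addTerm m c p ⟧ⁿ ρ ≡ c * ⟦ m ⟧ᵐ ρ + ⟦ p ⟧ⁿ ρ
  addTerm-sound ρ m c [] = refl
  addTerm-sound ρ m c ((n , d) ∷ p) with eqᵐ m n in e
  ... | true rewrite eqᵐ-sound m n e =
    trans (cong (_+ ⟦ p ⟧ⁿ ρ) (*-distribʳ-+ (⟦ n ⟧ᵐ ρ) c d)) (+-assoc (c * ⟦ n ⟧ᵐ ρ) _ _)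
  ... | false = trans (cong (d * ⟦ n ⟧ᵐ ρ +_) (addTerm-sound ρ m c p)) (swap+ (d * ⟦ n ⟧ᵐ ρ) (c * ⟦ m ⟧ᵐ ρ) (⟦ p ⟧ⁿ ρ))

  +ⁿ-sound : ∀ ρ p q → ⟦ p +ⁿ q ⟧ⁿ ρ ≡ ⟦ p ⟧ⁿ ρ + ⟦ q ⟧ⁿ ρ
  +ⁿ-sound ρ [] q = refl
  +ⁿ-sound ρ ((m , c) ∷ p) q = trans (addTerm-sound ρ m c (p +ⁿ q))
    (trans (cong (c * ⟦ m ⟧ᵐ ρ +_) (+ⁿ-sound ρ p q)) (sym (+-assoc (c * ⟦ m ⟧ᵐ ρ) _ _)))

  scale-sound : ∀ ρ m c p → ⟦ scale m c p ⟧ⁿ ρ ≡ c * ⟦ m ⟧ᵐ ρ * ⟦ p ⟧ⁿ ρ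
  scale-sound ρ m c [] = sym (*-zeroʳ (c * ⟦ m ⟧ᵐ ρ))
  scale-sound ρ m c ((n , d) ∷ p) = begin
    ⟦ addTerm (m *ᵐ n) (c * d) (scale m c p) ⟧ⁿ ρ ≡⟨ addTerm-sound ρ (m *ᵐ n) (c * d) (scale m c p) ⟩
    c * d * ⟦ m *ᵐ n ⟧ᵐ ρ + ⟦ scale m c p ⟧ⁿ ρ ≡⟨ cong₂ _+_ (cong (c * d *_) (*ᵐ-sound ρ m n)) (scale-sound ρ m c p) ⟩
    c * d * (M * N) + c * M * ⟦ p ⟧ⁿ ρ ≡⟨ cong (_+ c * M * ⟦ p ⟧ⁿ ρ) ([m*n]*[o*p]≡[m*o]*[n*p] c d M N) ⟩
    c * M * (d * N) + c * M * ⟦ p ⟧ⁿ ρ ≡⟨ *-distribˡ-+ (c * M) (d * N) _ ⟨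
    c * M * (d * N + ⟦ p ⟧ⁿ ρ) ∎
    where
    open ≡-Reasoning
    M = ⟦ m ⟧ᵐ ρ
    N = ⟦ n ⟧ᵐ ρ

  *ⁿ-sound : ∀ ρ p q → ⟦ p *ⁿ q ⟧ⁿ ρ ≡ ⟦ p ⟧ⁿ ρ * ⟦ q ⟧ⁿ ρ
  *ⁿ-sound ρ [] q = refl
  *ⁿ-sound ρ ((m , c) ∷ p) q = trans (+ⁿ-sound ρ (scale m c q) (p *ⁿ q))
    (trans (cong₂ _+_ (scale-sound ρ m c q) (*ⁿ-sound ρ p q)) (sym (*-distribʳ-+ (⟦ q ⟧ⁿ ρ) (c * ⟦ m ⟧ᵐ ρ) _)))

  norm-sound : ∀ ρ p → ⟦ norm p ⟧ⁿ ρ ≡ ⟦ p ⟧ ρ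
  norm-sound ρ (var i) = trans (+-identityʳ _) (trans (+-identityʳ _) (*-identityʳ _))
  norm-sound ρ (con c) = trans (+-identityʳ _) (*-identityʳ c)
  norm-sound ρ (p :+ q) = trans (+ⁿ-sound ρ (norm p) (norm q)) (cong₂ _+_ (norm-sound ρ p) (norm-sound ρ q))
  norm-sound ρ (p :* q) = trans (*ⁿ-sound ρ (norm p) (norm q)) (cong₂ _*_ (norm-sound ρ p) (norm-sound ρ q))

  take-sound : ∀ ρ m c q {q′} → take m c q ≡ just q′ → ⟦ q ⟧ⁿ ρ ≡ c * ⟦ m ⟧ᵐ ρ + ⟦ q′ ⟧ⁿ ρ
  take-sound ρ m zero q refl = refl
  take-sound ρ m (suc c) ((n , d) ∷ q) e with eqᵐ m n in mn | suc c ≤ᵇ d in cd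
  take-sound ρ m (suc c) ((n , d) ∷ q) refl | true | true rewrite eqᵐ-sound m n mn =
    trans (cong (_+ ⟦ q ⟧ⁿ ρ) (trans (cong (_* ⟦ n ⟧ᵐ ρ) (sym (m+[n∸m]≡n (≤ᵇ⇒≤ (suc c) d (subst T (sym cd) tt)))))
      (*-distribʳ-+ (⟦ n ⟧ᵐ ρ) (suc c) (d ∸ suc c)))) (+-assoc (suc c * ⟦ n ⟧ᵐ ρ) _ _)
  take-sound ρ m (suc c) ((n , d) ∷ q) e | false | _ with take m (suc c) q in eq
  take-sound ρ m (suc c) ((n , d) ∷ q) refl | false | _ | just q′ =
    trans (cong (d * ⟦ n ⟧ᵐ ρ +_) (take-sound ρ m (suc c) q eq)) (swap+ (d * ⟦ n ⟧ᵐ ρ) (suc c * ⟦ m ⟧ᵐ ρ) (⟦ q′ ⟧ⁿ ρ))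

  leⁿ-sound : ∀ ρ p q → leⁿ p q ≡ true → ⟦ p ⟧ⁿ ρ ≤ ⟦ q ⟧ⁿ ρ
  leⁿ-sound ρ [] q e = z≤n
  leⁿ-sound ρ ((m , c) ∷ p) q e with take m c q in eq
  ... | just q′ rewrite take-sound ρ m c q eq = +-monoʳ-≤ (c * ⟦ m ⟧ᵐ ρ) (leⁿ-sound ρ p q′ e)

  infix 4 _:≤_
  record Goal : Set where
    constructor _:≤_
    field lhs rhs : Poly
  open Goal

  Holds : List ℕ → Goal → Set
  Holds ρ (l :≤ r) = ⟦ l ⟧ ρ ≤ ⟦ r ⟧ ρ

  record Hyp (ρ : List ℕ) : Set where
    constructor hyp
    field
      weight : Poly
      goal : Goal
      proof : Holds ρ goal

  addHyps : ∀ {ρ} → List (Hyp ρ) → Goal → Goal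
  addHyps [] g = g
  addHyps (hyp w (l :≤ r) _ ∷ hs) g = lhs g′ :+ w :* r :≤ rhs g′ :+ w :* l
    where g′ = addHyps hs g

  addHyps-sound : ∀ {ρ} (hs : List (Hyp ρ)) g → Holds ρ (addHyps hs g) → Holds ρ g
  addHyps-sound [] g h = h
  addHyps-sound {ρ} (hyp w (l :≤ r) p ∷ hs) g h = addHyps-sound hs g
    (+-cancelʳ-≤ (⟦ w ⟧ ρ * ⟦ r ⟧ ρ) _ _ (≤-trans h (+-monoʳ-≤ _ (*-monoʳ-≤ (⟦ w ⟧ ρ) p))))

  valid : Goal → Bool
  valid (l :≤ r) = leⁿ (norm l) (norm r)

  -- The goal plus a combination of hypotheses must hold coefficientwise.
  lin : ∀ ρ g (hs : List (Hyp ρ)) → valid (addHyps hs g) ≡ true → Holds ρ g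
  lin ρ g hs e = addHyps-sound hs g (subst₂ _≤_ (norm-sound ρ l) (norm-sound ρ r) (leⁿ-sound ρ (norm l) (norm r) e))
    where
    l = lhs (addHyps hs g)
    r = rhs (addHyps hs g)

  ring : ∀ ρ l r → valid (l :≤ r) ≡ true → valid (r :≤ l) ≡ true → ⟦ l ⟧ ρ ≡ ⟦ r ⟧ ρ
  ring ρ l r e e′ = ≤-antisym (lin ρ (l :≤ r) [] e) (lin ρ (r :≤ l) [] e′)

  X0 X1 X2 X3 X4 X5 X6 X7 X8 X9 : Poly
  X0 = var 0
  X1 = var 1
  X2 = var 2
  X3 = var 3
  X4 = var 4
  X5 = var 5
  X6 = var 6
  X7 = var 7
  X8 = var 8
  X9 = var 9

open PolynomialInequalities using (con; _:+_; _:*_; _:≤_; hyp; lin; ring; X0; X1; X2; X3; X4; X5; X6; X7; X8; X9)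

import Data.Nat as N
import Data.Nat.DivMod as DM
open import Relation.Unary using (Decidable)

infixl 7 _//_ _%%_
_//_ _%%_ : ℕ → ℕ → ℕ
_//_ = divide
_%%_ = remainder

div-mod : ∀ m {n} → 0 < n → m ≡ m %% n + m // n * n
div-mod m {suc n} _ = DM.m≡m%n+[m/n]*n m (suc n)

%%-< : ∀ m {n} → 0 < n → m %% n < n
%%-< m {suc n} _ = DM.m%n<n m (suc n)

//-* : ∀ r q {n} → r < n → (r + q * n) // n ≡ q
//-* r q {suc n} r<n = trans (DM.+-distrib-/ r (q * suc n) sum<)
  (cong₂ _+_ (DM.m<n⇒m/n≡0 r<n) (DM.m*n/n≡m q (suc n)))
  where
  sum< : r N.% suc n + (q * suc n) N.% suc n < suc n
  sum< = subst (_< suc n) (sym (trans (cong₂ _+_ (DM.m<n⇒m%n≡m r<n) (DM.m*n%n≡0 q (suc n))) (+-identityʳ r))) r<n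

%%-* : ∀ r q {n} → r < n → (r + q * n) %% n ≡ r
%%-* r q {suc n} r<n = trans (DM.[m+kn]%n≡m%n r q (suc n)) (DM.m<n⇒m%n≡m r<n)

//-small : ∀ {m n} → m < n → m // n ≡ 0
//-small {m} {n} m<n = trans (cong (_// n) (sym (+-identityʳ m))) (//-* m 0 m<n)

%%-small : ∀ {m n} → m < n → m %% n ≡ m
%%-small {m} {n} m<n = trans (cong (_%% n) (sym (+-identityʳ m))) (%%-* m 0 m<n)

//-*-≤ : ∀ m n → m // n * n ≤ m
//-*-≤ m zero = z≤n
//-*-≤ m (suc n) = DM.m/n*n≤m m (suc n)

<-//-suc : ∀ m {n} → 0 < n → m < suc (m // n) * n
<-//-suc m {n} n>0 = begin-strict
  m ≡⟨ div-mod m n>0 ⟩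
  m %% n + m // n * n <⟨ +-monoˡ-< (m // n * n) (%%-< m n>0) ⟩
  suc (m // n) * n ∎
  where open ≤-Reasoning

*-≤⇒≤-// : ∀ {q m n} → 0 < n → q * n ≤ m → q ≤ m // n
*-≤⇒≤-// {q} {m} {n} n>0 h with q ≤? m // n
... | yes le = le
... | no nle = ⊥-elim (<-irrefl refl (<-≤-trans (<-//-suc m n>0) (≤-trans (*-monoˡ-≤ n (≰⇒> nle)) h)))

<-*⇒//-< : ∀ {q m n} → m < q * n → m // n < q
<-*⇒//-< {q} {m} {n} h = *-cancelʳ-< n (m // n) q (≤-<-trans (//-*-≤ m n) h)

//-mono : ∀ {m m′} n → m ≤ m′ → m // n ≤ m′ // n
//-mono zero h = z≤n
//-mono (suc n) h = DM./-monoˡ-≤ (suc n) h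

//-≤ : ∀ m n → m // n ≤ m
//-≤ m zero = z≤n
//-≤ m (suc n) = DM.m/n≤m m (suc n)

%%-≤ : ∀ m n → m %% n ≤ m
%%-≤ m zero = z≤n
%%-≤ m (suc n) = DM.m%n≤m m (suc n)

//-unique : ∀ {m n q} → q * n ≤ m → m < suc q * n → m // n ≡ q
//-unique {m} {n} {q} lo hi = ≤-antisym (s≤s⁻¹ (<-*⇒//-< hi)) (*-≤⇒≤-// n>0 lo)
  where
  n>0 : 0 < n
  n>0 = n≢0⇒n>0 λ { refl → n≮0 (subst (m <_) (*-zeroʳ q) hi) }

//-// : ∀ m {a b} → 0 < a → 0 < b → m // (a * b) ≡ m // a // b
//-// m {suc a} {suc b} _ _ = sym (DM.m/n/o≡m/[n*o] m (suc a) (suc b))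

pow>0 : ∀ n → 0 < 2 ^ n
pow>0 n = m^n>0 2 n

pow-+ : ∀ m n → 2 ^ (m + n) ≡ 2 ^ m * 2 ^ n
pow-+ = ^-distribˡ-+-* 2

pow-mono : ∀ {m n} → m ≤ n → 2 ^ m ≤ 2 ^ n
pow-mono = ^-monoʳ-≤ 2

pow-mono-< : ∀ {m n} → m < n → 2 ^ m < 2 ^ n
pow-mono-< = ^-monoʳ-< 2 (s≤s (s≤s z≤n))

pow-cancel-< : ∀ {m n} → 2 ^ m < 2 ^ n → m < n
pow-cancel-< {m} {n} h with m <? n
... | yes m<n = m<n
... | no nlt = ⊥-elim (<-irrefl refl (<-≤-trans h (pow-mono (≮⇒≥ nlt))))

n<2^n : ∀ n → n < 2 ^ n
n<2^n zero = z<s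
n<2^n (suc n) = ≤-trans (+-mono-≤ (pow>0 n) (n<2^n n)) (≤-reflexive (cong (2 ^ n +_) (sym (+-identityʳ (2 ^ n)))))

least : ∀ {P : ℕ → Set} → Decidable P → ℕ → ℕ
least P? zero = 0
least P? (suc n) with P? 0
... | yes _ = 0
... | no _ = suc (least (P? ∘ suc) n)

least-≤ : ∀ {P : ℕ → Set} (P? : Decidable P) n → least P? n ≤ n
least-≤ P? zero = z≤n
least-≤ P? (suc n) with P? 0
... | yes _ = z≤n
... | no _ = s≤s (least-≤ (P? ∘ suc) n)

least-holds : ∀ {P : ℕ → Set} (P? : Decidable P) n → P n → P (least P? n)
least-holds P? zero p = p
least-holds P? (suc n) p with P? 0
... | yes q = q
... | no _ = least-holds (P? ∘ suc) n p

least-min : ∀ {P : ℕ → Set} (P? : Decidable P) n {i} → P i → least P? n ≤ i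
least-min P? zero p = z≤n
least-min P? (suc n) {i} p with P? 0
... | yes q = z≤n
least-min P? (suc n) {zero} p | no nq = ⊥-elim (nq p)
least-min P? (suc n) {suc i} p | no nq = s≤s (least-min (P? ∘ suc) n p)

abstract
  bits : ℕ → ℕ
  bits n = least (λ b → n <? 2 ^ b) n

  <-bits : ∀ n → n < 2 ^ bits n
  <-bits n = least-holds (λ b → n <? 2 ^ b) n (n<2^n n)

  bits-≤ : ∀ {n k} → n < 2 ^ k → bits n ≤ k
  bits-≤ {n} = least-min (λ b → n <? 2 ^ b) n

  bits≤ : ∀ n → bits n ≤ n
  bits≤ n = least-≤ (λ b → n <? 2 ^ b) n

  bits-mono : ∀ {m n} → m ≤ n → bits m ≤ bits n
  bits-mono {m} {n} h = bits-≤ (≤-<-trans h (<-bits n))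

  2^bits-≤ : ∀ n → 2 ^ bits n ≤ 1 + 2 * n
  2^bits-≤ n with bits n in e≡
  ... | zero = s≤s z≤n
  ... | suc b = ≤-trans (*-monoʳ-≤ 2 (≮⇒≥ λ n<2^b → <-irrefl refl (≤-trans (≤-reflexive (sym e≡)) (bits-≤ {n} n<2^b)))) (n≤1+n _)

bits-tail : ∀ n h → bits n ≤ h + n // 2 ^ h
bits-tail n h = bits-≤ (begin-strict
  n <⟨ <-//-suc n (pow>0 h) ⟩
  suc (n // 2 ^ h) * 2 ^ h ≤⟨ *-monoˡ-≤ (2 ^ h) (n<2^n (n // 2 ^ h)) ⟩
  2 ^ (n // 2 ^ h) * 2 ^ h ≡⟨ *-comm (2 ^ (n // 2 ^ h)) (2 ^ h) ⟩
  2 ^ h * 2 ^ (n // 2 ^ h) ≡⟨ pow-+ h (n // 2 ^ h) ⟨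
  2 ^ (h + n // 2 ^ h) ∎)
  where open ≤-Reasoning

bits-* : ∀ m n → bits (m * n) ≤ bits m + bits n
bits-* m n = bits-≤ (subst (m * n <_) (sym (pow-+ (bits m) (bits n))) (*-mono-< (<-bits m) (<-bits n)))

import Data.Fin.Properties as Fin

value-< : ∀ {w} (x : Word w) → value x < 2 ^ w
value-< [] = z<s
value-< {suc w} (true ∷ x) = lin (value x ∷ 2 ^ w ∷ []) (con 2 :+ con 2 :* X0 :≤ con 2 :* X1) (hyp (con 2) (con 1 :+ X0 :≤ X1) (value-< x) ∷ []) refl
value-< {suc w} (false ∷ x) = lin (value x ∷ 2 ^ w ∷ []) (con 1 :+ con 2 :* X0 :≤ con 2 :* X1) (hyp (con 2) (con 1 :+ X0 :≤ X1) (value-< x) ∷ []) refl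

half : ∀ n → ⌊ n /2⌋ ≡ n // 2
half n = trans (cong ⌊_/2⌋ n≡) (lem (n N.% 2) (n N./ 2) (DM.m%n<n n 2))
  where
  n≡ : n ≡ n N.% 2 + 2 * (n N./ 2)
  n≡ = trans (DM.m≡m%n+[m/n]*n n 2) (cong (n N.% 2 +_) (*-comm (n N./ 2) 2))
  ⌊2q/2⌋ : ∀ q → ⌊ 2 * q /2⌋ ≡ q
  ⌊2q/2⌋ zero = refl
  ⌊2q/2⌋ (suc q) = cong ⌊_/2⌋ (*-suc 2 q) ∙ cong suc (⌊2q/2⌋ q)
    where _∙_ = trans
  ⌊1+2q/2⌋ : ∀ q → ⌊ 1 + 2 * q /2⌋ ≡ q
  ⌊1+2q/2⌋ zero = refl
  ⌊1+2q/2⌋ (suc q) = cong (⌊_/2⌋ ∘ suc) (*-suc 2 q) ∙ cong suc (⌊1+2q/2⌋ q)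
    where _∙_ = trans
  lem : ∀ r q → r < 2 → ⌊ r + 2 * q /2⌋ ≡ q
  lem 0 q _ = ⌊2q/2⌋ q
  lem 1 q _ = ⌊1+2q/2⌋ q
  lem (suc (suc r)) q (s≤s (s≤s ()))

odd-bit : ∀ n → (if n N.% 2 ≡ᵇ 1 then 1 else 0) ≡ n %% 2
odd-bit n with n N.% 2 | DM.m%n<n n 2
... | 0 | _ = refl
... | 1 | _ = refl
... | suc (suc _) | s≤s (s≤s ())

value-word : ∀ w n → value (word w n) ≡ n %% 2 ^ w
value-word zero n = sym (n<1⇒n≡0 (%%-< n z<s))
value-word (suc w) n = begin
  (if n N.% 2 ≡ᵇ 1 then 1 else 0) + 2 * value (word w ⌊ n /2⌋)
    ≡⟨ cong₂ (λ x y → x + 2 * y) (odd-bit n) (trans (value-word w ⌊ n /2⌋) (cong (_%% 2 ^ w) (half n))) ⟩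
  n %% 2 + 2 * r
    ≡⟨ %%-* (n %% 2 + 2 * r) q r′< ⟨
  (n %% 2 + 2 * r + q * 2 ^ suc w) %% 2 ^ suc w
    ≡⟨ cong (_%% 2 ^ suc w) n≡ ⟨
  n %% 2 ^ suc w ∎
  where
  open ≡-Reasoning
  r = n // 2 %% 2 ^ w
  q = n // 2 // 2 ^ w
  r′< : n %% 2 + 2 * r < 2 * 2 ^ w
  r′< = lin (n %% 2 ∷ r ∷ 2 ^ w ∷ []) (con 1 :+ (X0 :+ con 2 :* X1) :≤ con 2 :* X2)
    (hyp (con 1) (con 1 :+ X0 :≤ con 2) (%%-< n z<s) ∷ hyp (con 2) (con 1 :+ X1 :≤ X2) (%%-< (n // 2) (pow>0 w)) ∷ []) refl
  n≡ : n ≡ n %% 2 + 2 * r + q * (2 * 2 ^ w)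
  n≡ = trans (div-mod n {2} z<s) (trans (cong (λ m → n %% 2 + m * 2) (div-mod (n // 2) (pow>0 w)))
    (ring (n %% 2 ∷ r ∷ q ∷ 2 ^ w ∷ []) (X0 :+ (X1 :+ X2 :* X3) :* con 2) (X0 :+ con 2 :* X1 :+ X2 :* (con 2 :* X3)) refl refl))

data Expr (k : ℕ) : Set where
  par : Fin k → Expr k
  lit : ℕ → Expr k
  ap : Op → Expr k → Expr k → Expr k
  ld : Expr k → Expr k

eval : ∀ {k w} → (Fin k → Word w) → (ℕ → Word w) → Expr k → Word w
eval R M (par i) = R i
eval {w = w} R M (lit n) = word w n
eval R M (ap f x y) = apply f (eval R M x) (eval R M y)
eval R M (ld x) = M (value (eval R M x))

compile : ∀ {k} → Expr k → Reg → Program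
compile (par i) r = op and r (toℕ i) (toℕ i) ∷ []
compile (lit n) r = const r n ∷ []
compile (ap f x y) r = compile x r ++ compile y (suc r) ++ op f r r (suc r) ∷ []
compile (ld x) r = compile x r ++ load r r ∷ []

At-pc : Program → ℕ → Program → Set
At-pc P pc [] = ⊤
At-pc P pc (i ∷ is) = fetch P pc ≡ just i × At-pc P (suc pc) is

At-pc-++ˡ : ∀ P pc c d → At-pc P pc (c ++ d) → At-pc P pc c
At-pc-++ˡ P pc [] d h = tt
At-pc-++ˡ P pc (i ∷ c) d (h , hs) = h , At-pc-++ˡ P (suc pc) c d hs

At-pc-++ʳ : ∀ P pc c d → At-pc P pc (c ++ d) → At-pc P (length c + pc) d
At-pc-++ʳ P pc [] d h = h
At-pc-++ʳ P pc (i ∷ c) d (h , hs) = subst (λ p → At-pc P p d) (+-suc (length c) pc) (At-pc-++ʳ P (suc pc) c d hs)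

At-pc-self : ∀ c d → At-pc (c ++ d) (length c) d
At-pc-self c d = subst (λ p → At-pc (c ++ d) p d) (+-identityʳ (length c)) (At-pc-++ʳ (c ++ d) 0 c d (self (c ++ d)))
  where
  shift : ∀ i P pc d → At-pc P pc d → At-pc (i ∷ P) (suc pc) d
  shift i P pc [] h = tt
  shift i P pc (j ∷ d) (h , hs) = h , shift i P (suc pc) d hs
  self : ∀ P → At-pc P 0 P
  self [] = tt
  self (i ∷ P) = refl , shift i P 0 P (self P)

≡ᵇ-refl : ∀ n → (n ≡ᵇ n) ≡ true
≡ᵇ-refl zero = refl
≡ᵇ-refl (suc n) = ≡ᵇ-refl n

≡ᵇ-< : ∀ {m n} → m < n → (m ≡ᵇ n) ≡ false
≡ᵇ-< {zero} {suc n} h = refl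
≡ᵇ-< {suc m} {suc n} h = ≡ᵇ-< (s<s⁻¹ h)

set-same : ∀ {A : Set} (f : ℕ → A) k v → (f [ k ↦ v ]) k ≡ v
set-same f k v rewrite ≡ᵇ-refl k = refl

set-below : ∀ {A : Set} (f : ℕ → A) k v {j} → j < k → (f [ k ↦ v ]) j ≡ f j
set-below f k v j<k rewrite ≡ᵇ-< j<k = refl

and-idem : ∀ {w} (x : Word w) → zipWith _∧_ x x ≡ x
and-idem [] = refl
and-idem (true ∷ x) = cong (true ∷_) (and-idem x)
and-idem (false ∷ x) = cong (false ∷_) (and-idem x)

module _ {k w : ℕ} (P : Program) (M : ℕ → Word w) where

  Agrees : (Fin k → Word w) → (ℕ → Word w) → Set
  Agrees ρ R = ∀ i → R (toℕ i) ≡ ρ i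

  compile-run : ∀ ρ (e : Expr k) r pc R → k ≤ r → Agrees ρ R → At-pc P pc (compile e r) →
    Σ[ R′ ∈ (ℕ → Word w) ] (R′ r ≡ eval ρ M e) × (∀ {j} → j < r → R′ j ≡ R j) ×
      (∀ t → run P (length (compile e r) + t) pc R M ≡ run P t (length (compile e r) + pc) R′ M)
  compile-run ρ (par i) r pc R k≤r ag (h , _) =
    R [ r ↦ zipWith _∧_ (R (toℕ i)) (R (toℕ i)) ] ,
    trans (set-same R r _) (trans (and-idem _) (ag i)) ,
    (λ j<r → set-below R r _ j<r) , step
    where
    step : ∀ t → run P (1 + t) pc R M ≡ run P t (suc pc) (R [ r ↦ zipWith _∧_ (R (toℕ i)) (R (toℕ i)) ]) M
    step t rewrite h = refl
  compile-run ρ (lit n) r pc R k≤r ag (h , _) =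
    R [ r ↦ word w n ] , set-same R r _ , (λ j<r → set-below R r _ j<r) , step
    where
    step : ∀ t → run P (1 + t) pc R M ≡ run P t (suc pc) (R [ r ↦ word w n ]) M
    step t rewrite h = refl
  compile-run ρ (ap f x y) r pc R k≤r ag h
    with compile-run ρ x r pc R k≤r ag (At-pc-++ˡ P pc (compile x r) _ h)
  ... | R₁ , v₁ , keep₁ , run₁
    with compile-run ρ y (suc r) (length (compile x r) + pc) R₁ (m≤n⇒m≤1+n k≤r)
           (λ i → trans (keep₁ (<-≤-trans (Fin.toℕ<n i) k≤r)) (ag i))
           (At-pc-++ˡ P _ (compile y (suc r)) _ (At-pc-++ʳ P pc (compile x r) _ h))
  ... | R₂ , v₂ , keep₂ , run₂ =
    R₂ [ r ↦ apply f (R₂ r) (R₂ (suc r)) ] ,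
    trans (set-same R₂ r _) (cong₂ (apply f) (trans (keep₂ (n<1+n r)) v₁) v₂) ,
    (λ j<r → trans (set-below R₂ r _ j<r) (trans (keep₂ (m<n⇒m<1+n j<r)) (keep₁ j<r))) , steps
    where
    open ≡-Reasoning
    cx = compile x r
    cy = compile y (suc r)
    lenEq : ∀ t → length (cx ++ cy ++ op f r r (suc r) ∷ []) + t ≡ length cx + (length cy + (1 + t))
    lenEq t rewrite length-++ cx {cy ++ op f r r (suc r) ∷ []} | length-++ cy {op f r r (suc r) ∷ []} =
      ring (length cx ∷ length cy ∷ t ∷ []) (X0 :+ (X1 :+ con 1) :+ X2) (X0 :+ (X1 :+ (con 1 :+ X2))) refl refl
    pcEq : suc (length cy + (length cx + pc)) ≡ length (cx ++ cy ++ op f r r (suc r) ∷ []) + pc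
    pcEq = trans (ring (length cx ∷ length cy ∷ pc ∷ []) (con 1 :+ (X1 :+ (X0 :+ X2))) (X0 :+ (X1 :+ (con 1 :+ X2))) refl refl) (sym (lenEq pc))
    last : ∀ t → run P (1 + t) (length cy + (length cx + pc)) R₂ M ≡
      run P t (suc (length cy + (length cx + pc))) (R₂ [ r ↦ apply f (R₂ r) (R₂ (suc r)) ]) M
    last t rewrite proj₁ (At-pc-++ʳ P _ cy _ (At-pc-++ʳ P pc cx _ h)) = refl
    steps : ∀ t → run P (length (cx ++ cy ++ op f r r (suc r) ∷ []) + t) pc R M ≡ _
    steps t = begin
      run P (length (cx ++ cy ++ op f r r (suc r) ∷ []) + t) pc R M ≡⟨ cong (λ s → run P s pc R M) (lenEq t) ⟩
      run P (length cx + (length cy + (1 + t))) pc R M ≡⟨ run₁ _ ⟩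
      run P (length cy + (1 + t)) (length cx + pc) R₁ M ≡⟨ run₂ _ ⟩
      run P (1 + t) (length cy + (length cx + pc)) R₂ M ≡⟨ last t ⟩
      run P t (suc (length cy + (length cx + pc))) _ M ≡⟨ cong (λ p → run P t p (R₂ [ r ↦ apply f (R₂ r) (R₂ (suc r)) ]) M) pcEq ⟩
      run P t (length (cx ++ cy ++ op f r r (suc r) ∷ []) + pc) _ M ∎
  compile-run ρ (ld x) r pc R k≤r ag h
    with compile-run ρ x r pc R k≤r ag (At-pc-++ˡ P pc (compile x r) _ h)
  ... | R₁ , v₁ , keep₁ , run₁ =
    R₁ [ r ↦ M (value (R₁ r)) ] , trans (set-same R₁ r _) (cong (M ∘ value) v₁) ,
    (λ j<r → trans (set-below R₁ r _ j<r) (keep₁ j<r)) , steps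
    where
    cx = compile x r
    lenEq : ∀ t → length (cx ++ load r r ∷ []) + t ≡ length cx + (1 + t)
    lenEq t rewrite length-++ cx {load r r ∷ []} =
      ring (length cx ∷ t ∷ []) (X0 :+ con 1 :+ X1) (X0 :+ (con 1 :+ X1)) refl refl
    last : ∀ t → run P (1 + t) (length cx + pc) R₁ M ≡ run P t (suc (length cx + pc)) (R₁ [ r ↦ M (value (R₁ r)) ]) M
    last t rewrite proj₁ (At-pc-++ʳ P pc cx _ h) = refl
    steps : ∀ t → run P (length (cx ++ load r r ∷ []) + t) pc R M ≡ _
    steps t = trans (cong (λ s → run P s pc R M) (lenEq t)) (trans (run₁ _) (trans (last t)
      (cong (λ p → run P t p (R₁ [ r ↦ M (value (R₁ r)) ]) M) (trans (sym (+-suc (length cx) pc)) (sym (lenEq pc))))))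

deciding : ∀ {k} → Expr k → Program
deciding {k} e = compile e k ++ jz k (2 + length (compile e k)) ∷ return nonEmpty ∷ return empty ∷ []

deciding-run : ∀ {k w} (e : Expr k) (R M : ℕ → Word w) →
  run (deciding e) (length (compile e k) + 2) 0 R M ≡
    just (if value (eval (R ∘ toℕ) M e) ≡ᵇ 0 then empty else nonEmpty)
deciding-run {k} {w} e R M with compile-run {k} (deciding e) M (R ∘ toℕ) e k 0 R ≤-refl (λ _ → refl)
    (At-pc-++ˡ (deciding e) 0 (compile e k) _ (At-pc-self [] (deciding e)))
... | R′ , v , _ , runs = trans (runs 2) (trans (cong (λ p → run (deciding e) 2 p R′ M) (+-identityʳ _)) finish)
  where
  c = compile e k
  tail : At-pc (deciding e) (length c) (jz k (2 + length c) ∷ return nonEmpty ∷ return empty ∷ [])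
  tail = At-pc-self c _
  finish : run (deciding e) 2 (length c) R′ M ≡ just (if value (eval (R ∘ toℕ) M e) ≡ᵇ 0 then empty else nonEmpty)
  finish rewrite proj₁ tail | v with value (eval (R ∘ toℕ) M e) ≡ᵇ 0
  ... | true rewrite proj₁ (proj₂ (proj₂ tail)) = refl
  ... | false rewrite proj₁ (proj₂ tail) = refl

b2n : Bool → ℕ
b2n true = 1
b2n false = 0

b2n-if : ∀ b → (if b then 1 else 0) ≡ b2n b
b2n-if true = refl
b2n-if false = refl

b2n-≤ : ∀ b → b2n b ≤ 1
b2n-≤ true = ≤-refl
b2n-≤ false = z≤n

read : (ℕ → Bool) → ℕ → ℕ → ℕ
read β p zero = 0
read β p (suc l) = b2n (β p) + 2 * read β (suc p) l

read-< : ∀ β p l → read β p l < 2 ^ l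
read-< β p zero = z<s
read-< β p (suc l) = lin (b2n (β p) ∷ read β (suc p) l ∷ 2 ^ l ∷ []) (con 1 :+ (X0 :+ con 2 :* X1) :≤ con 2 :* X2)
  (hyp (con 1) (X0 :≤ con 1) (b2n-≤ (β p)) ∷ hyp (con 2) (con 1 :+ X1 :≤ X2) (read-< β (suc p) l) ∷ []) refl

read-+ : ∀ β p a b → read β p (a + b) ≡ read β p a + read β (p + a) b * 2 ^ a
read-+ β p zero b = sym (trans (*-identityʳ _) (cong (λ q → read β q b) (+-identityʳ p)))
read-+ β p (suc a) b = trans (cong (λ x → b2n (β p) + 2 * x)
  (trans (read-+ β (suc p) a b) (cong (λ q → read β (suc p) a + read β q b * 2 ^ a) (sym (+-suc p a)))))
  (ring (b2n (β p) ∷ read β (suc p) a ∷ read β (p + suc a) b ∷ 2 ^ a ∷ [])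
    (X0 :+ con 2 :* (X1 :+ X2 :* X3)) (X0 :+ con 2 :* X1 :+ X2 :* (con 2 :* X3)) refl refl)

read-// : ∀ β p a b → read β p (a + b) // 2 ^ a ≡ read β (p + a) b
read-// β p a b = trans (cong (_// 2 ^ a) (read-+ β p a b)) (//-* (read β p a) (read β (p + a) b) (read-< β p a))

read-%% : ∀ β p a b → read β p (a + b) %% 2 ^ a ≡ read β p a
read-%% β p a b = trans (cong (_%% 2 ^ a) (read-+ β p a b)) (%%-* (read β p a) (read β (p + a) b) (read-< β p a))

mem : (ℕ → Bool) → (w : ℕ) → ℕ → Word w
mem β w i = tabulate λ j → β (i * w + toℕ j)

value-tabulate : ∀ β p l (f : Fin l → Bool) → (∀ j → f j ≡ β (p + toℕ j)) → value (tabulate f) ≡ read β p l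
value-tabulate β p zero f h = refl
value-tabulate β p (suc l) f h = cong₂ (λ x y → x + 2 * y)
  (trans (b2n-if (f Fin.zero)) (cong b2n (trans (h Fin.zero) (cong β (+-identityʳ p)))))
  (value-tabulate β (suc p) l (f ∘ Fin.suc) (λ j → trans (h (Fin.suc j)) (cong β (+-suc p (toℕ j)))))

value-mem : ∀ β w i → value (mem β w i) ≡ read β (i * w) w
value-mem β w i = value-tabulate β (i * w) w _ (λ _ → refl)

*-%% : ∀ y z n → (y * (z %% n)) %% n ≡ (y * z) %% n
*-%% y z zero = refl
*-%% y z n@(suc _) = sym (begin
  (y * z) %% n ≡⟨ cong (λ m → (y * m) %% n) (div-mod z {n} z<s) ⟩
  (y * (r + q * n)) %% n ≡⟨ cong (_%% n) (*-distribˡ-+ y r (q * n)) ⟩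
  (y * r + y * (q * n)) %% n ≡⟨ cong₂ (λ a b → (a + b) %% n) (div-mod (y * r) {n} z<s) (sym (*-assoc y q n)) ⟩
  (r′ + q′ * n + y * q * n) %% n ≡⟨ cong (_%% n) (trans (+-assoc r′ (q′ * n) (y * q * n)) (cong (r′ +_) (sym (*-distribʳ-+ n q′ (y * q))))) ⟩
  (r′ + (q′ + y * q) * n) %% n ≡⟨ %%-* r′ (q′ + y * q) (%%-< (y * r) {n} z<s) ⟩
  r′ ∎)
  where
  open ≡-Reasoning
  r = z %% n
  q = z // n
  r′ = (y * r) %% n
  q′ = (y * r) // n

-- A machine word holds F fields of u bits each; u bounds the length of every
-- number that the query handles, so that no intermediate result overflows.
F : ℕ
F = 64

add′ sub′ mul′ div′ rem′ lt′ and′ : ∀ {k} → Expr k → Expr k → Expr k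
add′ = ap add
sub′ = ap sub
mul′ = ap mul
div′ = ap div
rem′ = ap rem
lt′ = ap lt
and′ = ap and

pow′ : ∀ {k} → Expr k → Expr k
pow′ x = ap shl (lit 1) x

opaque
  rd : ∀ {k} → Expr k → Expr k → Expr k → Expr k
  rd W p l = rem′ (add′ (div′ (ld (div′ p W)) (pow′ (rem′ p W)))
                        (mul′ (ld (add′ (div′ p W) (lit 1))) (pow′ (sub′ W (rem′ p W))))) (pow′ l)

module Semantics {k : ℕ} (u : ℕ) (u>0 : 0 < u) (R : Fin k → Word (F * u)) (β : ℕ → Bool) where

  w : ℕ
  w = F * u

  opaque
    ⟪_⟫ : Expr k → ℕ
    ⟪ e ⟫ = value (eval R (mem β w) e)

  infix 4 _⇓_∶_
  record _⇓_∶_ (e : Expr k) (v i : ℕ) : Set where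
    constructor _⟨_⟩
    field
      val : ⟪ e ⟫ ≡ v
      bnd : v < 2 ^ (i * u)
  open _⇓_∶_ public

  private variable
    e e₁ e₂ : Expr k
    x y i j : ℕ

  fits : {_ : True (i ≤? F)} → x < 2 ^ (i * u) → x < 2 ^ w
  fits {i} {x} {p} h = <-≤-trans h (pow-mono (*-monoˡ-≤ u (toWitness p)))

  rebound : e ⇓ x ∶ i → x < 2 ^ (j * u) → e ⇓ x ∶ j
  rebound (h ⟨ _ ⟩) b = h ⟨ b ⟩

  raise : e ⇓ x ∶ i → {_ : True (i ≤? j)} → e ⇓ x ∶ j
  raise (h ⟨ b ⟩) {p} = h ⟨ <-≤-trans b (pow-mono (*-monoˡ-≤ u (toWitness p))) ⟩

  cast : x ≡ y → e ⇓ x ∶ i → e ⇓ y ∶ i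
  cast refl h = h

  word-small : ∀ {x i} {_ : True (i ≤? F)} → x < 2 ^ (i * u) → value (word w x) ≡ x
  word-small {x} {i} {p} h = trans (value-word w x) (%%-small (fits {i} {_} {p} h))

  opaque
    unfolding ⟪_⟫

    ⇓num : ∀ {c} → c < 2 ^ (1 * u) → lit c ⇓ c ∶ 1
    ⇓num {c} h = word-small {_} {1} h ⟨ h ⟩

    ⇓lit : ∀ c {_ : True (c ≤? F)} → lit c ⇓ c ∶ c
    ⇓lit c {p} = word-small {c} {c} {p} b ⟨ b ⟩
      where
      b : c < 2 ^ (c * u)
      b = <-≤-trans (n<2^n c) (pow-mono (≤-trans (≤-reflexive (sym (*-identityʳ c))) (*-monoʳ-≤ c u>0)))

    ⇓add : e₁ ⇓ x ∶ i → e₂ ⇓ y ∶ j → {_ : True (suc (i ⊔ j) ≤? F)} → add′ e₁ e₂ ⇓ x + y ∶ suc (i ⊔ j)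
    ⇓add {x = x} {i = i} {y = y} {j = j} (refl ⟨ bx ⟩) (refl ⟨ by ⟩) {p} = word-small {_} {suc (i ⊔ j)} {p} b ⟨ b ⟩
      where
      b : x + y < 2 ^ (suc (i ⊔ j) * u)
      b = begin-strict
        x + y <⟨ +-mono-<-≤ (<-≤-trans bx (pow-mono (*-monoˡ-≤ u (m≤m⊔n i j)))) (<⇒≤ (<-≤-trans by (pow-mono (*-monoˡ-≤ u (m≤n⊔m i j))))) ⟩
        2 ^ ((i ⊔ j) * u) + 2 ^ ((i ⊔ j) * u) ≡⟨ cong (2 ^ ((i ⊔ j) * u) +_) (+-identityʳ _) ⟨
        2 ^ 1 * 2 ^ ((i ⊔ j) * u) ≤⟨ *-monoˡ-≤ (2 ^ ((i ⊔ j) * u)) (pow-mono u>0) ⟩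
        2 ^ u * 2 ^ ((i ⊔ j) * u) ≡⟨ pow-+ u ((i ⊔ j) * u) ⟨
        2 ^ (suc (i ⊔ j) * u) ∎
        where open ≤-Reasoning

    ⇓mul : e₁ ⇓ x ∶ i → e₂ ⇓ y ∶ j → {_ : True (i + j ≤? F)} → mul′ e₁ e₂ ⇓ x * y ∶ i + j
    ⇓mul {x = x} {i = i} {y = y} {j = j} (refl ⟨ bx ⟩) (refl ⟨ by ⟩) {p} = word-small {_} {i + j} {p} b ⟨ b ⟩
      where
      b : x * y < 2 ^ ((i + j) * u)
      b = <-≤-trans (*-mono-< bx by) (≤-reflexive (trans (sym (pow-+ (i * u) (j * u))) (cong (2 ^_) (sym (*-distribʳ-+ u i j)))))

    ⇓sub : y ≤ x → e₁ ⇓ x ∶ i → e₂ ⇓ y ∶ j → {_ : True (i ≤? F)} → sub′ e₁ e₂ ⇓ x ∸ y ∶ i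
    ⇓sub {y = y} {x = x} {i = i} y≤x (refl ⟨ bx ⟩) (refl ⟨ by ⟩) {p} = trans (value-word w _) (trans (cong (_%% 2 ^ w) shift) (%%-* (x ∸ y) 1 (fits {i} {_} {p} b))) ⟨ b ⟩
      where
      b : x ∸ y < 2 ^ (i * u)
      b = ≤-<-trans (m∸n≤m x y) bx
      shift : x + 2 ^ w ∸ y ≡ x ∸ y + 1 * 2 ^ w
      shift = trans (+-∸-comm (2 ^ w) y≤x) (cong (x ∸ y +_) (sym (+-identityʳ (2 ^ w))))

    ⇓div : e₁ ⇓ x ∶ i → e₂ ⇓ y ∶ j → {_ : True (i ≤? F)} → div′ e₁ e₂ ⇓ x // y ∶ i
    ⇓div {x = x} {i = i} {y = y} (refl ⟨ bx ⟩) (refl ⟨ by ⟩) {p} = word-small {_} {i} {p} b ⟨ b ⟩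
      where
      b : x // y < 2 ^ (i * u)
      b = ≤-<-trans (//-≤ x y) bx

    ⇓rem : e₁ ⇓ x ∶ i → e₂ ⇓ y ∶ j → {_ : True (i ≤? F)} → rem′ e₁ e₂ ⇓ x %% y ∶ i
    ⇓rem {x = x} {i = i} {y = y} (refl ⟨ bx ⟩) (refl ⟨ by ⟩) {p} = word-small {_} {i} {p} b ⟨ b ⟩
      where
      b : x %% y < 2 ^ (i * u)
      b = ≤-<-trans (%%-≤ x y) bx

    2^<2^suc : ∀ {v} j → v ≤ j * u → 2 ^ v < 2 ^ (suc j * u)
    2^<2^suc j h = ≤-<-trans (pow-mono h) (pow-mono-< (m<n+m (j * u) u>0))

    1<2^u : 1 < 2 ^ (1 * u)
    1<2^u = 2^<2^suc 0 z≤n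

    ⇓pow : e ⇓ x ∶ i → ∀ j → x ≤ j * u → {_ : True (suc j ≤? F)} → pow′ e ⇓ 2 ^ x ∶ suc j
    ⇓pow {x = x} (refl ⟨ _ ⟩) j h {p} =
      trans (cong (λ a → value (word w (a * 2 ^ x))) (val (⇓lit 1)))
        (trans (cong (value ∘ word w) (+-identityʳ (2 ^ x))) (word-small {_} {suc j} {p} (2^<2^suc j h))) ⟨ 2^<2^suc j h ⟩

    ⇓lt : e₁ ⇓ x ∶ i → e₂ ⇓ y ∶ j → lt′ e₁ e₂ ⇓ b2n (x <ᵇ y) ∶ 1
    ⇓lt {x = x} {y = y} (refl ⟨ _ ⟩) (refl ⟨ _ ⟩) =
      trans (cong (value ∘ word w) (b2n-if (x <ᵇ y))) (word-small {_} {1} b) ⟨ b ⟩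
      where
      b : b2n (x <ᵇ y) < 2 ^ (1 * u)
      b = ≤-<-trans (b2n-≤ (x <ᵇ y)) 1<2^u

    ⟪⟫-< : ∀ e → ⟪ e ⟫ < 2 ^ w
    ⟪⟫-< e = value-< (eval R (mem β w) e)

  module _ {W : Expr k} (⇓W : W ⇓ w ∶ 7) where

    opaque
      unfolding ⟪_⟫ rd

      ⇓rd : ∀ {p l} j → e₁ ⇓ p ∶ i → e₂ ⇓ l ∶ y → l ≤ j * u → {_ : True (suc i ≤? F)} {_ : True (suc j ≤? F)} →
        rd W e₁ e₂ ⇓ read β p l ∶ j
      ⇓rd {e₁ = e₁} {i = i} {e₂ = e₂} {p = p} {l} j ⇓p ⇓l l≤ {si} {sj} =
        trans (value-word w _) (trans (cong₂ (λ a b → (a %% b) %% 2 ^ w) window (val (⇓pow ⇓l j l≤ {sj})))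
          (trans (cong (_%% 2 ^ w) windowed) (%%-small (<-≤-trans (read-< β p l) (pow-mono l≤w))))) ⟨ <-≤-trans (read-< β p l) (pow-mono l≤) ⟩
        where
        open ≤-Reasoning
        w>0 : 0 < w
        w>0 = *-mono-< {0} {F} z<s u>0
        l≤w : l ≤ w
        l≤w = ≤-trans l≤ (*-monoˡ-≤ u (≤-trans (n≤1+n j) (toWitness sj)))
        o≤w : (p %% w) ≤ w
        o≤w = <⇒≤ (%%-< p w>0)
        i≤F : True (i ≤? F)
        i≤F = fromWitness {a? = i ≤? F} (≤-trans (n≤1+n i) (toWitness si))
        ⇓q : div′ e₁ W ⇓ p // w ∶ i
        ⇓q = ⇓div ⇓p ⇓W {i≤F}
        ⇓o : rem′ e₁ W ⇓ p %% w ∶ i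
        ⇓o = ⇓rem ⇓p ⇓W {i≤F}
        p≡ : (p // w) * w + (p %% w) ≡ p
        p≡ = trans (+-comm ((p // w) * w) (p %% w)) (sym (div-mod p w>0))
        X≡ : ⟪ ld (div′ e₁ W) ⟫ ≡ read β ((p // w) * w) w
        X≡ = trans (cong (λ a → value (mem β w a)) (val ⇓q)) (value-mem β w (p // w))
        Y≡ : ⟪ ld (add′ (div′ e₁ W) (lit 1)) ⟫ ≡ read β ((p // w) * w + w) w
        Y≡ = trans (cong (λ a → value (mem β w a)) (trans (value-word w _) (trans (cong₂ (λ a b → (a + b) %% 2 ^ w) (val ⇓q) (val (⇓lit 1))) (%%-small q+1<))))
               (trans (value-mem β w ((p // w) + 1)) (cong (λ a → read β a w) (trans (*-distribʳ-+ w (p // w) 1) (cong ((p // w) * w +_) (*-identityˡ w)))))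
          where
          q+1< : (p // w) + 1 < 2 ^ w
          q+1< = begin-strict
            (p // w) + 1 ≤⟨ +-monoˡ-≤ 1 (//-≤ p w) ⟩
            p + 1 ≤⟨ ≤-trans (≤-reflexive (+-comm p 1)) (bnd ⇓p) ⟩
            2 ^ (i * u) <⟨ 2^<2^suc i ≤-refl ⟩
            2 ^ (suc i * u) ≤⟨ pow-mono (*-monoˡ-≤ u (toWitness si)) ⟩
            2 ^ w ∎
        low≡ : ⟪ div′ (ld (div′ e₁ W)) (pow′ (rem′ e₁ W)) ⟫ ≡ read β p (w ∸ (p %% w))
        low≡ = trans (value-word w _) (trans (cong₂ (λ a b → (a // b) %% 2 ^ w) X≡ pow≡) (trans (cong (_%% 2 ^ w) shifted) (%%-small (<-≤-trans (read-< β p (w ∸ (p %% w))) (pow-mono (m∸n≤m w (p %% w)))))))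
          where
          pow≡ : ⟪ pow′ (rem′ e₁ W) ⟫ ≡ 2 ^ (p %% w)
          pow≡ = trans (cong₂ (λ a b → value (word w (a * 2 ^ b))) (val (⇓lit 1)) (val ⇓o))
            (trans (cong (value ∘ word w) (+-identityʳ (2 ^ (p %% w)))) (trans (value-word w _) (%%-small (pow-mono-< (%%-< p w>0)))))
          shifted : read β ((p // w) * w) w // 2 ^ (p %% w) ≡ read β p (w ∸ (p %% w))
          shifted = trans (cong (λ a → read β ((p // w) * w) a // 2 ^ (p %% w)) (sym (m+[n∸m]≡n o≤w)))
            (trans (read-// β ((p // w) * w) (p %% w) (w ∸ (p %% w))) (cong (λ a → read β a (w ∸ (p %% w))) p≡))
        -- For (p %% w) = 0 the shift distance is w, and 2 ^ w is 0 in a word.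
        high≡ : ⟪ mul′ (ld (add′ (div′ e₁ W) (lit 1))) (pow′ (sub′ W (rem′ e₁ W))) ⟫ ≡ read β ((p // w) * w + w) (p %% w) * 2 ^ (w ∸ (p %% w))
        high≡ = trans (value-word w _) (trans (cong₂ (λ a b → (a * b) %% 2 ^ w) Y≡ pow≡) (trans (*-%% (read β ((p // w) * w + w) w) (2 ^ (w ∸ (p %% w))) (2 ^ w)) (trans (cong (_%% 2 ^ w) split) (%%-* _ (read β ((p // w) * w + w + (p %% w)) (w ∸ (p %% w))) small))))
          where
          pow≡ : ⟪ pow′ (sub′ W (rem′ e₁ W)) ⟫ ≡ 2 ^ (w ∸ (p %% w)) %% 2 ^ w
          pow≡ = trans (cong₂ (λ a b → value (word w (a * 2 ^ b))) (val (⇓lit 1)) (val (⇓sub o≤w ⇓W ⇓o)))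
            (trans (cong (value ∘ word w) (+-identityʳ (2 ^ (w ∸ (p %% w))))) (value-word w _))
          small : read β ((p // w) * w + w) (p %% w) * 2 ^ (w ∸ (p %% w)) < 2 ^ w
          small = begin-strict
            read β ((p // w) * w + w) (p %% w) * 2 ^ (w ∸ (p %% w)) <⟨ *-monoˡ-< (2 ^ (w ∸ (p %% w))) {{m^n≢0 2 (w ∸ (p %% w))}} (read-< β ((p // w) * w + w) (p %% w)) ⟩
            2 ^ (p %% w) * 2 ^ (w ∸ (p %% w)) ≡⟨ pow-+ (p %% w) (w ∸ (p %% w)) ⟨
            2 ^ ((p %% w) + (w ∸ (p %% w))) ≡⟨ cong (2 ^_) (m+[n∸m]≡n o≤w) ⟩
            2 ^ w ∎
          split : (read β ((p // w) * w + w) w) * 2 ^ (w ∸ (p %% w)) ≡ read β ((p // w) * w + w) (p %% w) * 2 ^ (w ∸ (p %% w)) + read β ((p // w) * w + w + (p %% w)) (w ∸ (p %% w)) * 2 ^ w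
          split = trans (cong (_* 2 ^ (w ∸ (p %% w))) (trans (cong (read β ((p // w) * w + w)) (sym (m+[n∸m]≡n o≤w))) (read-+ β ((p // w) * w + w) (p %% w) (w ∸ (p %% w)))))
            (trans (ring (read β ((p // w) * w + w) (p %% w) ∷ read β ((p // w) * w + w + (p %% w)) (w ∸ (p %% w)) ∷ 2 ^ (p %% w) ∷ 2 ^ (w ∸ (p %% w)) ∷ [])
              ((X0 :+ X1 :* X2) :* X3) (X0 :* X3 :+ X1 :* (X2 :* X3)) refl refl)
              (cong (λ a → read β ((p // w) * w + w) (p %% w) * 2 ^ (w ∸ (p %% w)) + read β ((p // w) * w + w + (p %% w)) (w ∸ (p %% w)) * a)
                (trans (sym (pow-+ (p %% w) (w ∸ (p %% w)))) (cong (2 ^_) (m+[n∸m]≡n o≤w)))))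
        joined : read β p (w ∸ (p %% w)) + read β ((p // w) * w + w) (p %% w) * 2 ^ (w ∸ (p %% w)) ≡ read β p w
        joined = sym (trans (cong (read β p) (sym (m∸n+n≡m o≤w))) (trans (read-+ β p (w ∸ (p %% w)) (p %% w))
          (cong (λ a → read β p (w ∸ (p %% w)) + read β a (p %% w) * 2 ^ (w ∸ (p %% w))) pos)))
          where
          pos : p + (w ∸ (p %% w)) ≡ (p // w) * w + w
          pos = trans (cong (_+ (w ∸ (p %% w))) (sym p≡)) (trans (+-assoc ((p // w) * w) (p %% w) (w ∸ (p %% w))) (cong ((p // w) * w +_) (m+[n∸m]≡n o≤w)))
        window : ⟪ add′ (div′ (ld (div′ e₁ W)) (pow′ (rem′ e₁ W))) (mul′ (ld (add′ (div′ e₁ W) (lit 1))) (pow′ (sub′ W (rem′ e₁ W)))) ⟫ ≡ read β p w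
        window = trans (value-word w _) (trans (cong₂ (λ a b → (a + b) %% 2 ^ w) low≡ high≡)
          (trans (cong (_%% 2 ^ w) joined) (%%-small (read-< β p w))))
        windowed : read β p w %% 2 ^ l ≡ read β p l
        windowed = trans (cong (λ a → read β p a %% 2 ^ l) (sym (m+[n∸m]≡n l≤w))) (read-%% β p l (w ∸ l))

module Layout where
  Bits : Set
  Bits = List Bool

  Σ< : ℕ → (ℕ → ℕ) → ℕ
  Σ< zero f = 0
  Σ< (suc n) f = Σ< n f + f n

  Σ<-cong : ∀ n {f g : ℕ → ℕ} → (∀ i → i < n → f i ≡ g i) → Σ< n f ≡ Σ< n g
  Σ<-cong zero h = refl
  Σ<-cong (suc n) h = cong₂ _+_ (Σ<-cong n (λ i i<n → h i (m<n⇒m<1+n i<n))) (h n (n<1+n n))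

  Σ<-mono : ∀ n {f g : ℕ → ℕ} → (∀ i → i < n → f i ≤ g i) → Σ< n f ≤ Σ< n g
  Σ<-mono zero h = z≤n
  Σ<-mono (suc n) h = +-mono-≤ (Σ<-mono n (λ i i<n → h i (m<n⇒m<1+n i<n))) (h n (n<1+n n))

  Σ<-const : ∀ n c → Σ< n (λ _ → c) ≡ n * c
  Σ<-const zero c = refl
  Σ<-const (suc n) c = trans (cong (_+ c) (Σ<-const n c)) (+-comm (n * c) c)

  Σ<-+ : ∀ n f g → Σ< n (λ i → f i + g i) ≡ Σ< n f + Σ< n g
  Σ<-+ zero f g = refl
  Σ<-+ (suc n) f g = trans (cong (_+ (f n + g n)) (Σ<-+ n f g))
    (ring (Σ< n f ∷ Σ< n g ∷ f n ∷ g n ∷ []) (X0 :+ X1 :+ (X2 :+ X3)) (X0 :+ X2 :+ (X1 :+ X3)) refl refl)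

  Σ<-*ˡ : ∀ n c f → Σ< n (λ i → c * f i) ≡ c * Σ< n f
  Σ<-*ˡ zero c f = sym (*-zeroʳ c)
  Σ<-*ˡ (suc n) c f = trans (cong (_+ c * f n) (Σ<-*ˡ n c f)) (sym (*-distribˡ-+ c (Σ< n f) (f n)))

  Σ<-*ʳ : ∀ n c f → Σ< n (λ i → f i * c) ≡ Σ< n f * c
  Σ<-*ʳ n c f = trans (Σ<-cong n (λ i _ → *-comm (f i) c)) (trans (Σ<-*ˡ n c f) (*-comm c (Σ< n f)))

  Σ<-split : ∀ m n f → Σ< (m + n) f ≡ Σ< m f + Σ< n (λ i → f (m + i))
  Σ<-split m zero f = trans (cong (λ k → Σ< k f) (+-identityʳ m)) (sym (+-identityʳ _))
  Σ<-split m (suc n) f = trans (cong (λ k → Σ< k f) (+-suc m n))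
    (trans (cong (_+ f (m + n)) (Σ<-split m n f)) (+-assoc (Σ< m f) _ _))

  Σ<-blocks : ∀ m n f → Σ< (m * n) f ≡ Σ< m (λ i → Σ< n (λ j → f (i * n + j)))
  Σ<-blocks zero n f = refl
  Σ<-blocks (suc m) n f = trans (cong (λ k → Σ< k f) (+-comm n (m * n)))
    (trans (Σ<-split (m * n) n f) (cong (_+ Σ< n (λ j → f (m * n + j))) (Σ<-blocks m n f)))

  Σ<-term : ∀ {n i} f → i < n → f i ≤ Σ< n f
  Σ<-term {suc n} {i} f i<n with i ≟ n
  ... | yes refl = m≤n+m (f n) (Σ< n f)
  ... | no i≢n = ≤-trans (Σ<-term f (≤∧≢⇒< (s≤s⁻¹ i<n) i≢n)) (m≤m+n _ (f n))

  Σ<-prefix : ∀ {m n} f → m ≤ n → Σ< m f ≤ Σ< n f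
  Σ<-prefix {m} {n} f m≤n = subst (λ k → Σ< m f ≤ Σ< k f) (m+[n∸m]≡n m≤n)
    (subst (Σ< m f ≤_) (sym (Σ<-split m (n ∸ m) f)) (m≤m+n _ _))

  enc : ℕ → ℕ → Bits
  enc zero v = []
  enc (suc l) v = (v %% 2 ≡ᵇ 1) ∷ enc l (v // 2)

  length-enc : ∀ l v → length (enc l v) ≡ l
  length-enc zero v = refl
  length-enc (suc l) v = cong suc (length-enc l (v // 2))

  cat : ℕ → (ℕ → Bits) → Bits
  cat zero b = []
  cat (suc n) b = cat n b ++ b n

  length-cat : ∀ n b → length (cat n b) ≡ Σ< n (length ∘ b)
  length-cat zero b = refl
  length-cat (suc n) b = trans (length-++ (cat n b)) (cong (_+ length (b n)) (length-cat n b))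

  length-cat-const : ∀ n b {l} → (∀ i → length (b i) ≡ l) → length (cat n b) ≡ n * l
  length-cat-const n b {l} h = trans (length-cat n b) (trans (Σ<-cong n (λ i _ → h i)) (Σ<-const n l))

  At : (ℕ → Bool) → ℕ → ℕ → Bits → Set
  At β Z p [] = p ≤ Z
  At β Z p (x ∷ xs) = β p ≡ x × At β Z (suc p) xs

  module _ {β : ℕ → Bool} {Z : ℕ} where

    At-end : ∀ {p} xs → At β Z p xs → p + length xs ≤ Z
    At-end {p} [] h = subst (_≤ Z) (sym (+-identityʳ p)) h
    At-end {p} (x ∷ xs) (_ , h) = subst (_≤ Z) (sym (+-suc p (length xs))) (At-end xs h)

    At-start : ∀ {p} xs → At β Z p xs → p ≤ Z
    At-start {p} xs h = ≤-trans (m≤m+n p (length xs)) (At-end xs h)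

    At-++ʳ : ∀ {p} xs {ys} → At β Z p (xs ++ ys) → At β Z (p + length xs) ys
    At-++ʳ {p} [] {ys} h = subst (λ q → At β Z q ys) (sym (+-identityʳ p)) h
    At-++ʳ {p} (x ∷ xs) {ys} (_ , h) = subst (λ q → At β Z q ys) (sym (+-suc p (length xs))) (At-++ʳ xs h)

    At-++ˡ : ∀ {p} xs {ys} → At β Z p (xs ++ ys) → At β Z p xs
    At-++ˡ [] {ys} h = At-start ys h
    At-++ˡ (x ∷ xs) (h , hs) = h , At-++ˡ xs hs

    At-cat : ∀ {p} n b {i} → i < n → At β Z p (cat n b) → At β Z (p + Σ< i (length ∘ b)) (b i)
    At-cat {p} (suc n) b {i} i<n h with i ≟ n
    ... | yes refl = subst (λ l → At β Z (p + l) (b i)) (length-cat n b) (At-++ʳ (cat n b) h)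
    ... | no i≢n = At-cat n b (≤∧≢⇒< (s≤s⁻¹ i<n) i≢n) (At-++ˡ (cat n b) h)

    At-cat-const : ∀ {p} n b {i l} → i < n → (∀ j → length (b j) ≡ l) → At β Z p (cat n b) → At β Z (p + i * l) (b i)
    At-cat-const {p} n b {i} {l} i<n eql h = subst (λ q → At β Z (p + q) (b i))
      (trans (Σ<-cong i (λ j _ → eql j)) (Σ<-const i l)) (At-cat n b i<n h)

    At-enc-mod : ∀ {p} l v → At β Z p (enc l v) → read β p l ≡ v %% 2 ^ l
    At-enc-mod zero v h = sym (n<1⇒n≡0 (%%-< v z<s))
    At-enc-mod {p} (suc l) v (h , hs) = begin
      b2n (β p) + 2 * read β (suc p) l ≡⟨ cong₂ (λ x y → x + 2 * y) (trans (cong b2n h) bit≡) (At-enc-mod l (v // 2) hs) ⟩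
      v %% 2 + 2 * r ≡⟨ %%-* (v %% 2 + 2 * r) q r< ⟨
      (v %% 2 + 2 * r + q * (2 * 2 ^ l)) %% 2 ^ suc l ≡⟨ cong (_%% 2 ^ suc l) v≡ ⟨
      v %% 2 ^ suc l ∎
      where
      open ≡-Reasoning
      r = v // 2 %% 2 ^ l
      q = v // 2 // 2 ^ l
      bit≡ : b2n (v %% 2 ≡ᵇ 1) ≡ v %% 2
      bit≡ with v %% 2 | %%-< v {2} z<s
      ... | 0 | _ = refl
      ... | 1 | _ = refl
      ... | suc (suc _) | s≤s (s≤s ())
      r< : v %% 2 + 2 * r < 2 * 2 ^ l
      r< = lin (v %% 2 ∷ r ∷ 2 ^ l ∷ []) (con 1 :+ (X0 :+ con 2 :* X1) :≤ con 2 :* X2)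
        (hyp (con 1) (con 1 :+ X0 :≤ con 2) (%%-< v z<s) ∷ hyp (con 2) (con 1 :+ X1 :≤ X2) (%%-< (v // 2) (pow>0 l)) ∷ []) refl
      v≡ : v ≡ v %% 2 + 2 * r + q * (2 * 2 ^ l)
      v≡ = trans (div-mod v {2} z<s) (trans (cong (λ m → v %% 2 + m * 2) (div-mod (v // 2) (pow>0 l)))
        (ring (v %% 2 ∷ r ∷ q ∷ 2 ^ l ∷ []) (X0 :+ (X1 :+ X2 :* X3) :* con 2) (X0 :+ con 2 :* X1 :+ X2 :* (con 2 :* X3)) refl refl))

    At-enc : ∀ {p l v} → v < 2 ^ l → At β Z p (enc l v) → read β p l ≡ v
    At-enc {p} {l} {v} v< h = trans (At-enc-mod l v h) (%%-small v<)

  -- A table of pointers, relative to its own start, followed by n strings. Its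
  -- first f bits hold the width of the pointers.
  module Parr (f n : ℕ) (b : ℕ → Bits) where

    total width : ℕ
    total = f + n + Σ< n (length ∘ b)
    width = 3 * bits total

    offset : ℕ → ℕ
    offset i = f + n * width + Σ< i (length ∘ b)

    parr : Bits
    parr = enc f width ++ cat n (enc width ∘ offset) ++ cat n b

    length-parr : length parr ≡ f + (n * width + Σ< n (length ∘ b))
    length-parr = trans (length-++ (enc f width)) (cong₂ _+_ (length-enc f width)
      (trans (length-++ (cat n (enc width ∘ offset))) (cong₂ _+_ (length-cat-const n _ (λ i → length-enc width (offset i))) (length-cat n b))))

    offset-< : ∀ {i} → i < n → offset i < 2 ^ width
    offset-< {i} i<n = begin-strict
      offset i ≤⟨ +-monoʳ-≤ (f + n * width) (Σ<-prefix (length ∘ b) (<⇒≤ i<n)) ⟩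
      f + n * width + S ≤⟨ lin (f ∷ n ∷ width ∷ S ∷ []) (X0 :+ X1 :* X2 :+ X3 :≤ (X0 :+ X1 :+ X3) :* (con 1 :+ X2)) [] refl ⟩
      total * (1 + width) <⟨ *-monoˡ-< (1 + width) (<-bits total) ⟩
      2 ^ c * (1 + 3 * c) ≤⟨ *-monoʳ-≤ (2 ^ c) (1+3n≤4^n c) ⟩
      2 ^ c * (2 ^ c * 2 ^ c) ≡⟨ cong (2 ^ c *_) (pow-+ c c) ⟨
      2 ^ c * 2 ^ (c + c) ≡⟨ pow-+ c (c + c) ⟨
      2 ^ (c + (c + c)) ≡⟨ cong (λ k → 2 ^ (c + (c + k))) (+-identityʳ c) ⟨
      2 ^ width ∎
      where
      open ≤-Reasoning
      S = Σ< n (length ∘ b)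
      c = bits total
      1+3n≤4^n : ∀ m → 1 + 3 * m ≤ 2 ^ m * 2 ^ m
      1+3n≤4^n zero = ≤-refl
      1+3n≤4^n (suc m) = lin (m ∷ 2 ^ m ∷ []) (con 1 :+ con 3 :* (con 1 :+ X0) :≤ con 2 :* X1 :* (con 2 :* X1))
        (hyp (con 1) (con 1 :+ con 3 :* X0 :≤ X1 :* X1) (1+3n≤4^n m) ∷ hyp (con 3) (con 1 :≤ X1 :* X1) (*-mono-≤ (pow>0 m) (pow>0 m)) ∷ []) refl

    module _ {β Z p} (here : At β Z p parr) (width< : width < 2 ^ f) where

      read-width : read β p f ≡ width
      read-width = At-enc width< (At-++ˡ (enc f width) here)

      private
        rest : At β Z (p + f) (cat n (enc width ∘ offset) ++ cat n b)
        rest = subst (λ l → At β Z (p + l) (cat n (enc width ∘ offset) ++ cat n b)) (length-enc f width) (At-++ʳ (enc f width) here)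

      read-offset : ∀ {i} → i < n → read β (p + f + i * width) width ≡ offset i
      read-offset {i} i<n = At-enc (offset-< i<n) (At-cat-const n _ i<n (λ j → length-enc width (offset j)) (At-++ˡ (cat n (enc width ∘ offset)) rest))

      At-blob : ∀ {i} → i < n → At β Z (p + offset i) (b i)
      At-blob {i} i<n = subst (λ q → At β Z q (b i)) pos (At-cat n b i<n (At-++ʳ (cat n (enc width ∘ offset)) rest))
        where
        pos : p + f + length (cat n (enc width ∘ offset)) + Σ< i (length ∘ b) ≡ p + offset i
        pos = trans (cong (λ l → p + f + l + Σ< i (length ∘ b)) (length-cat-const n _ (λ j → length-enc width (offset j))))
          (ring (p ∷ f ∷ n * width ∷ Σ< i (length ∘ b) ∷ []) (X0 :+ X1 :+ X2 :+ X3) (X0 :+ (X1 :+ X2 :+ X3)) refl refl)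

  -- 2 ^ m strings in groups of 2 ^ g, so that pointers inside a group are short.
  module Store (m g f : ℕ) (b : ℕ → Bits) where

    module Group (γ : ℕ) = Parr f (2 ^ (m ⊓ g)) (λ j → b (γ * 2 ^ g + j))
    module Top = Parr f (2 ^ (m ∸ g)) (λ γ → Group.parr γ)

    layout : Bits
    layout = Top.parr

    record Narrow : Set where
      constructor narrow
      field
        top-width : Top.width < 2 ^ f
        group-width : ∀ {γ} → γ < 2 ^ (m ∸ g) → Group.width γ < 2 ^ f

    group-< : ∀ {i} → i < 2 ^ m → i // 2 ^ g < 2 ^ (m ∸ g)
    group-< {i} i< = <-*⇒//-< (<-≤-trans i< (≤-trans (pow-mono (m≤n+m∸n m g)) (≤-reflexive (trans (pow-+ g (m ∸ g)) (*-comm (2 ^ g) _)))))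

    member-< : ∀ {i} → i < 2 ^ m → i %% 2 ^ g < 2 ^ (m ⊓ g)
    member-< {i} i< with ≤-total m g
    ... | inj₁ m≤g = subst (λ e → i %% 2 ^ g < 2 ^ e) (sym (m≤n⇒m⊓n≡m m≤g)) (≤-<-trans (%%-≤ i (2 ^ g)) i<)
    ... | inj₂ g≤m = subst (λ e → i %% 2 ^ g < 2 ^ e) (sym (m≥n⇒m⊓n≡n g≤m)) (%%-< i (pow>0 g))

    index≡ : ∀ i → i // 2 ^ g * 2 ^ g + i %% 2 ^ g ≡ i
    index≡ i = trans (+-comm (i // 2 ^ g * 2 ^ g) _) (sym (div-mod i (pow>0 g)))

  opaque
    parrE : ∀ {k} → Expr k → Expr k → Expr k → Expr k → Expr k
    parrE W f p i = add′ p (rd W (add′ (add′ p f) (mul′ i (rd W p f))) (rd W p f))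

    storeE : ∀ {k} → Expr k → Expr k → Expr k → Expr k → Expr k → Expr k
    storeE W f g p i = parrE W f (parrE W f p (div′ i (pow′ g))) (rem′ i (pow′ g))

  module Lookup {k : ℕ} (u : ℕ) (u>0 : 0 < u) (R : Fin k → Word (F * u)) (β : ℕ → Bool)
    (Z : ℕ) (Z< : Z < 2 ^ (1 * u)) {W : Expr k} (⇓W : Semantics._⇓_∶_ u u>0 R β W (F * u) 7) where

    open Semantics u u>0 R β public

    private variable
      e e₁ e₂ e₃ : Expr k

    At-∶ : ∀ {p i} xs → At β Z p xs → e ⇓ p ∶ i → e ⇓ p ∶ 1
    At-∶ xs h ⇓p = rebound ⇓p (≤-<-trans (At-start xs h) Z<)

    at-pos : ∀ {p i} xs → p ≡ i → At β Z p xs → At β Z i xs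
    at-pos xs refl h = h

    opaque
      unfolding parrE storeE

      ⇓parr : ∀ {f n b p i} → e₁ ⇓ f ∶ 1 → f ≤ 1 * u → Parr.width f n b < 2 ^ f → Parr.width f n b ≤ 1 * u →
        e₂ ⇓ p ∶ 1 → At β Z p (Parr.parr f n b) → e₃ ⇓ i ∶ 1 → i < n →
        Σ[ q ∈ ℕ ] (parrE W e₁ e₂ e₃ ⇓ q ∶ 1) × At β Z q (b i)
      ⇓parr {e₁ = e₁} {e₂ = e₂} {f = f} {n} {b} {p} {i} ⇓f f≤ width< width≤ ⇓p here ⇓i i<n =
        p + offset i , At-∶ (b i) there (⇓add ⇓p (cast (read-offset here width< i<n) (⇓rd ⇓W 1 (⇓add (⇓add ⇓p ⇓f) (⇓mul ⇓i ⇓width)) ⇓width width≤))) , there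
        where
        open Parr f n b
        there : At β Z (p + offset i) (b i)
        there = At-blob here width< i<n
        ⇓width : rd W e₂ e₁ ⇓ width ∶ 1
        ⇓width = cast (read-width here width<) (⇓rd ⇓W 1 ⇓p ⇓f f≤)

      ⇓store : ∀ {m g f b p i} {e₄ : Expr k} → e₁ ⇓ f ∶ 1 → f ≤ 1 * u → e₄ ⇓ g ∶ 1 → g ≤ 1 * u →
        Store.Narrow m g f b → 2 ^ f ≤ 1 * u → e₂ ⇓ p ∶ 1 → At β Z p (Store.layout m g f b) → e₃ ⇓ i ∶ 1 → i < 2 ^ m →
        Σ[ q ∈ ℕ ] (storeE W e₁ e₄ e₂ e₃ ⇓ q ∶ 1) × At β Z q (b i)
      ⇓store {e₁ = e₁} {e₂ = e₂} {e₃ = e₃} {m = m} {g} {f} {b} {p} {i} {e₄} ⇓f f≤ ⇓g g≤ (Store.narrow top< group<) 2^f≤ ⇓p here ⇓i i< =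
        proj₁ second , proj₁ (proj₂ second) , subst (λ j → At β Z (proj₁ second) (b j)) (Store.index≡ m g f b i) (proj₂ (proj₂ second))
        where
        γ< : i // 2 ^ g < 2 ^ (m ∸ g)
        γ< = Store.group-< m g f b i<
        first : Σ[ q ∈ ℕ ] (parrE W e₁ e₂ (div′ e₃ (pow′ e₄)) ⇓ q ∶ 1) × At β Z q (Parr.parr f (2 ^ (m ⊓ g)) (λ j → b (i // 2 ^ g * 2 ^ g + j)))
        first = ⇓parr {n = 2 ^ (m ∸ g)} {b = λ γ → Parr.parr f (2 ^ (m ⊓ g)) (λ j → b (γ * 2 ^ g + j))}
          ⇓f f≤ top< (≤-trans (<⇒≤ top<) 2^f≤) ⇓p here (⇓div ⇓i (⇓pow ⇓g 1 g≤)) γ<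
        second : Σ[ q ∈ ℕ ] (storeE W e₁ e₄ e₂ e₃ ⇓ q ∶ 1) × At β Z q (b (i // 2 ^ g * 2 ^ g + i %% 2 ^ g))
        second = ⇓parr {n = 2 ^ (m ⊓ g)} {b = λ j → b (i // 2 ^ g * 2 ^ g + j)}
          ⇓f f≤ (group< γ<) (≤-trans (<⇒≤ (group< γ<)) 2^f≤) (proj₁ (proj₂ first)) (proj₂ (proj₂ first)) (⇓rem ⇓i (⇓pow ⇓g 1 g≤)) (Store.member-< m g f b i<)

open Layout

module StoreLength (m g f : ℕ) (b : ℕ → Bits) where
  open Layout.Store m g f b

  S M G n : ℕ
  S = Σ< (2 ^ m) (length ∘ b)
  M = 2 ^ m
  G = 2 ^ (m ∸ g)
  n = 2 ^ (m ⊓ g)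

  Gn≡M : G * n ≡ M
  Gn≡M = trans (sym (pow-+ (m ∸ g) (m ⊓ g))) (cong (2 ^_) (trans (+-comm (m ∸ g) (m ⊓ g)) (m⊓n+n∸m≡n′ m g)))
    where
    m⊓n+n∸m≡n′ : ∀ m g → m ⊓ g + (m ∸ g) ≡ m
    m⊓n+n∸m≡n′ m g = trans (cong (_+ (m ∸ g)) (⊓-comm m g)) (m⊓n+n∸m≡n g m)

  G≤M : G ≤ M
  G≤M = pow-mono (m∸n≤m m g)

  members : ℕ → ℕ
  members γ = Σ< n (λ j → length (b (γ * 2 ^ g + j)))

  Σ-members : Σ< G members ≡ S
  Σ-members with ≤-total m g
  ... | inj₂ g≤m = trans (Σ<-cong G (λ γ _ → cong (λ e → Σ< (2 ^ e) (λ j → length (b (γ * 2 ^ g + j)))) (m≥n⇒m⊓n≡n g≤m)))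
          (trans (sym (Σ<-blocks G (2 ^ g) (length ∘ b))) (cong (λ k → Σ< k (length ∘ b))
            (trans (sym (pow-+ (m ∸ g) g)) (cong (2 ^_) (m∸n+n≡m g≤m)))))
  ... | inj₁ m≤g = trans (cong (λ k → Σ< (2 ^ k) members) (m≤n⇒m∸n≡0 m≤g)) (cong (λ e → Σ< (2 ^ e) (length ∘ b)) (m≤n⇒m⊓n≡m m≤g))

  members-≤ : ∀ {γ} → γ < G → members γ ≤ S
  members-≤ γ<G = ≤-trans (Σ<-term members γ<G) (≤-reflexive Σ-members)

  groups : ℕ
  groups = Σ< G (λ γ → length (Group.parr γ))

  group-length : ∀ y γ → 2 ^ y * length (Group.parr γ) ≤
    (2 ^ y * (f + 3 * (n * (g + y))) + 3 * (f + n)) + (2 ^ y + 3) * members γ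
  group-length y γ = begin
    2 ^ y * length (Group.parr γ) ≡⟨ cong (2 ^ y *_) (Group.length-parr γ) ⟩
    2 ^ y * (f + (n * (3 * bits x) + members γ))
      ≤⟨ lin (2 ^ y ∷ f ∷ n ∷ bits x ∷ members γ ∷ x ∷ g + y ∷ [])
           (X0 :* (X1 :+ (X2 :* (con 3 :* X3) :+ X4)) :≤ X0 :* (X1 :+ con 3 :* (X2 :* X6)) :+ con 3 :* X5 :+ X0 :* X4)
           (hyp (con 3) (X0 :* (X2 :* X3) :≤ X0 :* (X2 :* X6) :+ X5) weighted ∷ []) refl ⟩
    2 ^ y * (f + 3 * (n * (g + y))) + 3 * x + 2 ^ y * members γ
      ≡⟨ ring (2 ^ y * (f + 3 * (n * (g + y))) ∷ f ∷ n ∷ members γ ∷ 2 ^ y ∷ [])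
           (X0 :+ con 3 :* (X1 :+ X2 :+ X3) :+ X4 :* X3) (X0 :+ con 3 :* (X1 :+ X2) :+ (X4 :+ con 3) :* X3) refl refl ⟩
    (2 ^ y * (f + 3 * (n * (g + y))) + 3 * (f + n)) + (2 ^ y + 3) * members γ ∎
    where
    open ≤-Reasoning
    x = f + n + members γ
    weighted : 2 ^ y * (n * bits x) ≤ 2 ^ y * (n * (g + y)) + x
    weighted = begin
      2 ^ y * (n * bits x) ≤⟨ *-monoʳ-≤ (2 ^ y) (*-monoʳ-≤ n (bits-tail x (g + y))) ⟩
      2 ^ y * (n * (g + y + x // 2 ^ (g + y))) ≡⟨ ring (2 ^ y ∷ n ∷ g + y ∷ x // 2 ^ (g + y) ∷ []) (X0 :* (X1 :* (X2 :+ X3))) (X0 :* (X1 :* X2) :+ X0 :* (X1 :* X3)) refl refl ⟩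
      2 ^ y * (n * (g + y)) + 2 ^ y * (n * (x // 2 ^ (g + y)))
        ≤⟨ +-monoʳ-≤ _ (*-monoʳ-≤ (2 ^ y) (*-monoˡ-≤ _ (pow-mono (m⊓n≤n m g)))) ⟩
      2 ^ y * (n * (g + y)) + 2 ^ y * (2 ^ g * (x // 2 ^ (g + y)))
        ≡⟨ cong (2 ^ y * (n * (g + y)) +_) (trans (ring (2 ^ y ∷ 2 ^ g ∷ x // 2 ^ (g + y) ∷ []) (X0 :* (X1 :* X2)) (X2 :* (X1 :* X0)) refl refl)
             (cong (x // 2 ^ (g + y) *_) (sym (pow-+ g y)))) ⟩
      2 ^ y * (n * (g + y)) + x // 2 ^ (g + y) * 2 ^ (g + y) ≤⟨ +-monoʳ-≤ _ (//-*-≤ x (2 ^ (g + y))) ⟩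
      2 ^ y * (n * (g + y)) + x ∎

  groups-≤ : ∀ y → 2 ^ y * groups ≤ 2 ^ y * (M * f + 3 * (M * (g + y))) + 3 * (M * f + M) + (2 ^ y + 3) * S
  groups-≤ y = begin
    2 ^ y * groups ≡⟨ Σ<-*ˡ G (2 ^ y) _ ⟨
    Σ< G (λ γ → 2 ^ y * length (Group.parr γ)) ≤⟨ Σ<-mono G (λ γ _ → group-length y γ) ⟩
    Σ< G (λ γ → c + (2 ^ y + 3) * members γ) ≡⟨ Σ<-+ G (λ _ → c) (λ γ → (2 ^ y + 3) * members γ) ⟩
    Σ< G (λ _ → c) + Σ< G (λ γ → (2 ^ y + 3) * members γ) ≡⟨ cong₂ _+_ (Σ<-const G c) (trans (Σ<-*ˡ G (2 ^ y + 3) members) (cong ((2 ^ y + 3) *_) Σ-members)) ⟩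
    G * c + (2 ^ y + 3) * S ≤⟨ +-monoˡ-≤ _ bound ⟩
    2 ^ y * (M * f + 3 * (M * (g + y))) + 3 * (M * f + M) + (2 ^ y + 3) * S ∎
    where
    open ≤-Reasoning
    c = 2 ^ y * (f + 3 * (n * (g + y))) + 3 * (f + n)
    bound : G * c ≤ 2 ^ y * (M * f + 3 * (M * (g + y))) + 3 * (M * f + M)
    bound = begin
      G * c ≡⟨ ring (G ∷ 2 ^ y ∷ f ∷ n ∷ g + y ∷ []) (X0 :* (X1 :* (X2 :+ con 3 :* (X3 :* X4)) :+ con 3 :* (X2 :+ X3)))
                 (X1 :* (X0 :* X2 :+ con 3 :* (X0 :* X3 :* X4)) :+ con 3 :* (X0 :* X2 :+ X0 :* X3)) refl refl ⟩
      2 ^ y * (G * f + 3 * (G * n * (g + y))) + 3 * (G * f + G * n)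
            ≡⟨ cong (λ k → 2 ^ y * (G * f + 3 * (k * (g + y))) + 3 * (G * f + k)) Gn≡M ⟩
      2 ^ y * (G * f + 3 * (M * (g + y))) + 3 * (G * f + M)
            ≤⟨ lin (2 ^ y ∷ G ∷ M ∷ f ∷ M * (g + y) ∷ []) (X0 :* (X1 :* X3 :+ con 3 :* X4) :+ con 3 :* (X1 :* X3 :+ X2) :≤ X0 :* (X2 :* X3 :+ con 3 :* X4) :+ con 3 :* (X2 :* X3 :+ X2))
                 (hyp (X0 :* X3 :+ con 3 :* X3) (X1 :≤ X2) G≤M ∷ []) refl ⟩
      2 ^ y * (M * f + 3 * (M * (g + y))) + 3 * (M * f + M) ∎

  layout-length : bits Top.total ≤ 2 ^ g → length layout ≤ f + (3 * (M + bits Top.total) + groups)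
  layout-length short = ≤-trans (≤-reflexive Top.length-parr) (+-monoʳ-≤ f (+-monoˡ-≤ groups
    (≤-trans (≤-reflexive (ring (G ∷ bits Top.total ∷ []) (X0 :* (con 3 :* X1)) (con 3 :* (X0 :* X1)) refl refl)) (*-monoʳ-≤ 3 few))))
    where
    few : G * bits Top.total ≤ M + bits Top.total
    few with ≤-total m g
    ... | inj₁ m≤g = ≤-trans (≤-reflexive (trans (cong (λ k → 2 ^ k * bits Top.total) (m≤n⇒m∸n≡0 m≤g)) (*-identityˡ _))) (m≤n+m _ M)
    ... | inj₂ g≤m = ≤-trans (*-monoʳ-≤ G short) (≤-trans (≤-reflexive (trans (sym (pow-+ (m ∸ g) g)) (cong (2 ^_) (m∸n+n≡m g≤m)))) (m≤m+n M _))

  widths-narrow : ∀ {B} → f + M + S ≤ B → Top.total ≤ B → 3 * bits B < 2 ^ f → Narrow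
  widths-narrow {B} small top small-B = narrow (≤-<-trans (*-monoʳ-≤ 3 (bits-mono top)) small-B) λ {γ} γ< →
    ≤-<-trans (*-monoʳ-≤ 3 (bits-mono (≤-trans (+-mono-≤ (+-monoʳ-≤ f (pow-mono (m⊓n≤m m g))) (members-≤ γ<)) small))) small-B

module Hashing where
  open import Data.Nat.Divisibility using (_∣_; divides; _∣?_; ∣-trans; ∣⇒≤; m∣m*n; ∣n⇒∣m*n)
  open import Data.List.Membership.Propositional using (_∈_)
  open import Data.List.Relation.Unary.Any using (here; there)
  open import Data.List.Relation.Unary.All as All using (All; []; _∷_)
  open import Data.List.Relation.Unary.AllPairs using ([]; _∷_)
  open import Data.List.Relation.Unary.Unique.Propositional using (Unique)

  ∑ : List ℕ → (ℕ → ℕ) → ℕ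
  ∑ [] f = 0
  ∑ (x ∷ l) f = f x + ∑ l f

  ∑-mono : ∀ l {f g} → (∀ {x} → x ∈ l → f x ≤ g x) → ∑ l f ≤ ∑ l g
  ∑-mono [] h = z≤n
  ∑-mono (x ∷ l) h = +-mono-≤ (h (here refl)) (∑-mono l (h ∘ there))

  ∑-const : ∀ l c → ∑ l (λ _ → c) ≡ length l * c
  ∑-const [] c = refl
  ∑-const (x ∷ l) c = cong (c +_) (∑-const l c)

  ∑-+ : ∀ l f g → ∑ l (λ x → f x + g x) ≡ ∑ l f + ∑ l g
  ∑-+ [] f g = refl
  ∑-+ (x ∷ l) f g = trans (cong (f x + g x +_) (∑-+ l f g))
    (ring (f x ∷ g x ∷ ∑ l f ∷ ∑ l g ∷ []) (X0 :+ X1 :+ (X2 :+ X3)) (X0 :+ X2 :+ (X1 :+ X3)) refl refl)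

  ∑-*ˡ : ∀ l c f → ∑ l (λ x → c * f x) ≡ c * ∑ l f
  ∑-*ˡ [] c f = sym (*-zeroʳ c)
  ∑-*ˡ (x ∷ l) c f = trans (cong (c * f x +_) (∑-*ˡ l c f)) (sym (*-distribˡ-+ c (f x) _))

  ∑-∈ : ∀ {x l} f → x ∈ l → f x ≤ ∑ l f
  ∑-∈ {l = y ∷ l} f (here refl) = m≤m+n (f y) _
  ∑-∈ {l = y ∷ l} f (there h) = ≤-trans (∑-∈ f h) (m≤n+m _ (f y))

  Σ<-∑ : ∀ n l (f : ℕ → ℕ → ℕ) → Σ< n (λ a → ∑ l (f a)) ≡ ∑ l (λ x → Σ< n (λ a → f a x))
  Σ<-∑ n [] f = trans (Σ<-const n 0) (*-zeroʳ n)
  Σ<-∑ n (x ∷ l) f = trans (Σ<-+ n (λ a → f a x) (λ a → ∑ l (f a))) (cong (Σ< n (λ a → f a x) +_) (Σ<-∑ n l f))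

  ∑-cong : ∀ l {f g : ℕ → ℕ} → (∀ x → f x ≡ g x) → ∑ l f ≡ ∑ l g
  ∑-cong [] h = refl
  ∑-cong (x ∷ l) h = cong₂ _+_ (h x) (∑-cong l h)

  below-average : ∀ n (f : ℕ → ℕ) → 0 < n → ∃[ a ] (a < n × f a * n ≤ Σ< n f)
  below-average n f n>0 with argmin n n>0
    where
    argmin : ∀ n → 0 < n → ∃[ a ] (a < n × (∀ b → b < n → f a ≤ f b))
    argmin (suc zero) _ = 0 , z<s , λ { zero _ → ≤-refl ; (suc _) (s≤s ()) }
    argmin (suc n@(suc _)) _ with argmin n z<s
    ... | a , a<n , min with f a ≤? f n
    ... | yes fa≤fn = a , m<n⇒m<1+n a<n , λ b b< → case-≤ b b<
      where
      case-≤ : ∀ b → b < suc n → f a ≤ f b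
      case-≤ b b< with b ≟ n
      ... | yes refl = fa≤fn
      ... | no b≢n = min b (≤∧≢⇒< (s≤s⁻¹ b<) b≢n)
    ... | no fa≰fn = n , n<1+n n , λ b b< → case-≤ b b<
      where
      case-≤ : ∀ b → b < suc n → f n ≤ f b
      case-≤ b b< with b ≟ n
      ... | yes refl = ≤-refl
      ... | no b≢n = ≤-trans (<⇒≤ (≰⇒> fa≰fn)) (min b (≤∧≢⇒< (s≤s⁻¹ b<) b≢n))
  ... | a , a<n , min = a , a<n , ≤-trans (≤-reflexive (trans (*-comm (f a) n) (sym (Σ<-const n (f a))))) (Σ<-mono n min)

  count-increasing : ∀ n (P : ℕ → Bool) (code : ℕ → ℕ) B → (∀ {a} → a < n → P a ≡ true → code a < B) →
    (∀ {a b} → a < b → b < n → P a ≡ true → P b ≡ true → code a < code b) → Σ< n (b2n ∘ P) ≤ B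
  count-increasing zero P code B bound inc = z≤n
  count-increasing (suc n) P code B bound inc with P n in Pn
  ... | true = ≤-trans (≤-reflexive (+-comm _ 1)) (≤-trans (s≤s (count-increasing n P code (code n)
                  (λ a<n Pa → inc a<n (n<1+n n) Pa Pn) (λ a<b b<n → inc a<b (m<n⇒m<1+n b<n)))) (bound (n<1+n n) Pn))
  ... | false = ≤-trans (≤-reflexive (+-identityʳ _)) (count-increasing n P code B (bound ∘ m<n⇒m<1+n)
                  (λ a<b b<n → inc a<b (m<n⇒m<1+n b<n)))

  slot : ℕ → ℕ → ℕ → ℕ → ℕ
  slot W m a x = (a * x %% 2 ^ (W + m)) // 2 ^ W

  slot-< : ∀ W m a x → slot W m a x < 2 ^ m
  slot-< W m a x = <-*⇒//-< (<-≤-trans (%%-< (a * x) (pow>0 (W + m))) (≤-reflexive (trans (pow-+ W m) (*-comm (2 ^ W) (2 ^ m)))))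

  module _ (W m : ℕ) {x y : ℕ} (y<x : y < x) (x<K : x < 2 ^ W) where

    private
      K Q z R : ℕ
      K = 2 ^ W
      Q = 2 ^ (W + m)
      z = x ∸ y
      R = suc (2 * K // z)
      z>0 : 0 < z
      z>0 = m<n⇒0<n∸m y<x
      z<K : z < K
      z<K = ≤-<-trans (m∸n≤m x y) x<K
      K≤Q : K ≤ Q
      K≤Q = pow-mono (m≤m+n W m)

      same : ℕ → Bool
      same a = slot W m a x ≡ᵇ slot W m a y

      b code : ℕ → ℕ
      b a = a * z + K
      code a = b a // Q * R + b a %% Q // z

      -- Multiplying by a moves two colliding points to a distance of less than
      -- K on the circle of length Q, so a (x - y) + K is less than 2 K there.
      near : ∀ a → 2 * K ≤ Q → same a ≡ true → b a %% Q < 2 * K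
      near a 2K≤Q coll = subst (_< 2 * K) (sym residue) gap<
        where
        X = a * x %% Q
        Y = a * y %% Q
        i = a * x // Q
        j = a * y // Q
        Q>0 = pow>0 (W + m)
        K>0 = pow>0 W
        cell≡ : X // K ≡ Y // K
        cell≡ = ≡ᵇ⇒≡ _ _ (subst T (sym coll) tt)
        X<Y+K : X < Y + K
        X<Y+K = <-≤-trans (<-//-suc X K>0) (subst (λ c → suc c * K ≤ Y + K) (sym cell≡)
          (≤-trans (≤-reflexive (+-comm K _)) (+-monoˡ-≤ K (//-*-≤ Y K))))
        Y<X+K : Y < X + K
        Y<X+K = <-≤-trans (<-//-suc Y K>0) (subst (λ c → suc c * K ≤ X + K) cell≡
          (≤-trans (≤-reflexive (+-comm K _)) (+-monoˡ-≤ K (//-*-≤ X K))))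
        az+ay : a * z + a * y ≡ a * x
        az+ay = trans (sym (*-distribˡ-+ a z y)) (cong (a *_) (m∸n+n≡m (<⇒≤ y<x)))
        sum≡ : a * z + (Y + j * Q) ≡ X + i * Q
        sum≡ = trans (cong (a * z +_) (sym (div-mod (a * y) Q>0))) (trans az+ay (div-mod (a * x) Q>0))
        j≤i : j ≤ i
        j≤i = //-mono Q (*-monoʳ-≤ a (<⇒≤ y<x))
        d = i ∸ j
        g = X + K ∸ Y
        gap< : g < 2 * K
        gap< = +-cancelʳ-< Y g (2 * K) (subst (_< 2 * K + Y) (sym (m∸n+n≡m (<⇒≤ Y<X+K)))
          (lin (X ∷ Y ∷ K ∷ []) (con 1 :+ (X0 :+ X2) :≤ con 2 :* X2 :+ X1) (hyp (con 1) (con 1 :+ X0 :≤ X1 :+ X2) X<Y+K ∷ []) refl))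
        b≡ : b a ≡ g + d * Q
        b≡ = +-cancelʳ-≡ (Y + j * Q) _ _ (begin
          a * z + K + (Y + j * Q) ≡⟨ ring (a * z ∷ K ∷ Y ∷ j * Q ∷ []) (X0 :+ X1 :+ (X2 :+ X3)) (X0 :+ (X2 :+ X3) :+ X1) refl refl ⟩
          a * z + (Y + j * Q) + K ≡⟨ cong (_+ K) sum≡ ⟩
          X + i * Q + K ≡⟨ cong₂ (λ c e → X + c * Q + e) (sym (m∸n+n≡m j≤i)) refl ⟩
          X + (d + j) * Q + K ≡⟨ ring (X ∷ d ∷ j ∷ Q ∷ K ∷ []) (X0 :+ (X1 :+ X2) :* X3 :+ X4) (X0 :+ X4 :+ (X1 :* X3 :+ X2 :* X3)) refl refl ⟩
          X + K + (d * Q + j * Q) ≡⟨ cong (_+ (d * Q + j * Q)) (sym (m∸n+n≡m (<⇒≤ Y<X+K))) ⟩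
          g + Y + (d * Q + j * Q) ≡⟨ ring (g ∷ Y ∷ d * Q ∷ j * Q ∷ []) (X0 :+ X1 :+ (X2 :+ X3)) (X0 :+ X2 :+ (X1 :+ X3)) refl refl ⟩
          g + d * Q + (Y + j * Q) ∎)
          where open ≡-Reasoning
        residue : b a %% Q ≡ g
        residue = trans (cong (_%% Q) b≡) (%%-* g d (<-≤-trans gap< 2K≤Q))

      code-< : ∀ {a} → a < Q → b a %% Q < 2 * K → code a < suc z * R
      code-< {a} a<Q near = begin-strict
        code a <⟨ +-monoʳ-< (b a // Q * R) (s≤s (//-mono z (<⇒≤ near))) ⟩
        b a // Q * R + R ≡⟨ +-comm _ R ⟩
        suc (b a // Q) * R ≤⟨ *-monoˡ-≤ R (<-*⇒//-< {suc z} b<) ⟩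
        suc z * R ∎
        where
        open ≤-Reasoning
        b< : b a < suc z * Q
        b< = lin (a ∷ z ∷ K ∷ Q ∷ []) (con 1 :+ (X0 :* X1 :+ X2) :≤ X3 :+ X1 :* X3)
          (hyp X1 (con 1 :+ X0 :≤ X3) a<Q ∷ hyp (con 1) (X2 :≤ X3) K≤Q ∷ hyp (con 1) (con 1 :≤ X1) z>0 ∷ []) refl

      code-inc : ∀ {a a′} → a < a′ → b a %% Q < 2 * K → b a′ %% Q < 2 * K → code a < code a′
      code-inc {a} {a′} a<a′ na na′ with b a // Q ≟ b a′ // Q
      ... | yes same-turn = subst (λ t → t * R + b a %% Q // z < code a′) (sym same-turn) (+-monoʳ-< (b a′ // Q * R) step)
        where
        Q>0 = pow>0 (W + m)
        rem≤ : b a %% Q + z ≤ b a′ %% Q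
        rem≤ = +-cancelʳ-≤ (b a′ // Q * Q) _ _ (begin
          b a %% Q + z + b a′ // Q * Q ≡⟨ ring (b a %% Q ∷ z ∷ b a′ // Q * Q ∷ []) (X0 :+ X1 :+ X2) (X0 :+ X2 :+ X1) refl refl ⟩
          b a %% Q + b a′ // Q * Q + z ≡⟨ cong (λ t → b a %% Q + t * Q + z) (sym same-turn) ⟩
          b a %% Q + b a // Q * Q + z ≡⟨ cong (_+ z) (sym (div-mod (b a) Q>0)) ⟩
          b a + z ≤⟨ lin (a ∷ a′ ∷ z ∷ K ∷ []) (X0 :* X2 :+ X3 :+ X2 :≤ X1 :* X2 :+ X3) (hyp X2 (con 1 :+ X0 :≤ X1) a<a′ ∷ []) refl ⟩
          b a′ ≡⟨ div-mod (b a′) Q>0 ⟩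
          b a′ %% Q + b a′ // Q * Q ∎)
          where open ≤-Reasoning
        step : b a %% Q // z < b a′ %% Q // z
        step = *-≤⇒≤-// z>0 (≤-trans (≤-reflexive (+-comm z _)) (≤-trans (+-monoˡ-≤ z (//-*-≤ (b a %% Q) z)) rem≤))
      ... | no diff = begin-strict
        code a <⟨ +-monoʳ-< (b a // Q * R) (s≤s (//-mono z (<⇒≤ na))) ⟩
        b a // Q * R + R ≡⟨ +-comm _ R ⟩
        suc (b a // Q) * R ≤⟨ *-monoˡ-≤ R (≤∧≢⇒< (//-mono Q (+-monoˡ-≤ K (*-monoˡ-≤ z (<⇒≤ a<a′)))) diff) ⟩
        b a′ // Q * R ≤⟨ m≤m+n _ _ ⟩
        code a′ ∎
        where open ≤-Reasoning

    slot-collisions : Σ< (2 ^ (W + m)) (λ a → b2n (slot W m a x ≡ᵇ slot W m a y)) ≤ 8 * 2 ^ W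
    slot-collisions with 2 * K ≤? Q
    ... | yes 2K≤Q = ≤-trans (count-increasing Q same code (suc z * R)
            (λ {a} a<Q sm → code-< a<Q (near a 2K≤Q sm)) (λ {a} {b} a<b _ sa sb → code-inc a<b (near a 2K≤Q sa) (near b 2K≤Q sb)))
            (lin (z ∷ K ∷ 2 * K // z ∷ []) ((con 1 :+ X0) :* (con 1 :+ X2) :≤ con 8 :* X1)
              (hyp (con 1) (X2 :* X0 :≤ con 2 :* X1) (//-*-≤ (2 * K) z) ∷ hyp (con 1) (X2 :≤ con 2 :* X1) (//-≤ (2 * K) z)
               ∷ hyp (con 1) (con 1 :+ X0 :≤ X1) z<K ∷ []) refl)
    ... | no 2K≰Q = ≤-trans (Σ<-mono Q (λ a _ → b2n-≤ (same a))) (≤-trans (≤-reflexive (trans (Σ<-const Q 1) (*-identityʳ Q)))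
            (≤-trans (<⇒≤ (≰⇒> 2K≰Q)) (*-monoˡ-≤ K {2} {8} (s≤s (s≤s z≤n)))))

  infix 4 _≠ᵇ_
  _≠ᵇ_ : ℕ → ℕ → Bool
  x ≠ᵇ y = not (x ≡ᵇ y)

  ≡ᵇ-true : ∀ {x y} → (x ≡ᵇ y) ≡ true → x ≡ y
  ≡ᵇ-true {x} {y} e = ≡ᵇ⇒≡ x y (subst T (sym e) tt)

  ≡ᵇ-same : ∀ x → (x ≡ᵇ x) ≡ true
  ≡ᵇ-same zero = refl
  ≡ᵇ-same (suc x) = ≡ᵇ-same x

  ≡ᵇ-false : ∀ {x y} → x ≢ y → (x ≡ᵇ y) ≡ false
  ≡ᵇ-false {x} {y} ne with x ≡ᵇ y in e
  ... | true = ⊥-elim (ne (≡ᵇ-true e))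
  ... | false = refl

  ≡ᵇ-sym : ∀ x y → (x ≡ᵇ y) ≡ (y ≡ᵇ x)
  ≡ᵇ-sym zero zero = refl
  ≡ᵇ-sym zero (suc y) = refl
  ≡ᵇ-sym (suc x) zero = refl
  ≡ᵇ-sym (suc x) (suc y) = ≡ᵇ-sym x y

  slot-collisions-≢ : ∀ W m {x y} → x ≢ y → x < 2 ^ W → y < 2 ^ W →
    Σ< (2 ^ (W + m)) (λ a → b2n (slot W m a x ≡ᵇ slot W m a y)) ≤ 8 * 2 ^ W
  slot-collisions-≢ W m {x} {y} x≢y x< y< with <-cmp x y
  ... | tri< x<y _ _ = ≤-trans (≤-reflexive (Σ<-cong (2 ^ (W + m)) (λ a _ → cong b2n (≡ᵇ-sym (slot W m a x) (slot W m a y))))) (slot-collisions W m x<y y<)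
  ... | tri≈ _ e _ = ⊥-elim (x≢y e)
  ... | tri> _ _ gt = slot-collisions W m gt x<

  binom : ℕ → ℕ → ℕ
  binom n zero = 1
  binom zero (suc k) = 0
  binom (suc n) (suc k) = binom n k + binom n (suc k)

  binom-absorb : ∀ n k → suc k * binom (suc n) (suc k) ≡ suc n * binom n k
  binom-absorb zero zero = refl
  binom-absorb zero (suc k) = *-zeroʳ (2 + k)
  binom-absorb (suc n) zero = begin
    1 * (1 + binom (suc n) 1) ≡⟨ cong (λ x → 1 * (1 + x)) (trans (sym (*-identityˡ _)) (binom-absorb n 0)) ⟩
    1 * (1 + suc n * 1) ≡⟨ ring (n ∷ []) (con 1 :* (con 1 :+ (con 1 :+ X0) :* con 1)) ((con 2 :+ X0) :* con 1) refl refl ⟩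
    suc (suc n) * 1 ∎
    where open ≡-Reasoning
  binom-absorb (suc n) (suc k) = begin
    suc (suc k) * (B + binom (suc n) (2 + k)) ≡⟨ *-distribˡ-+ (2 + k) B _ ⟩
    suc (suc k) * B + suc (suc k) * binom (suc n) (2 + k) ≡⟨ cong₂ (λ x y → B + x + y) (binom-absorb n k) (binom-absorb n (suc k)) ⟩
    B + suc n * binom n k + suc n * binom n (suc k) ≡⟨ ring (n ∷ binom n k ∷ binom n (suc k) ∷ []) (X1 :+ X2 :+ (con 1 :+ X0) :* X1 :+ (con 1 :+ X0) :* X2) ((con 2 :+ X0) :* (X1 :+ X2)) refl refl ⟩
    suc (suc n) * B ∎
    where
    open ≡-Reasoning
    B = binom (suc n) (suc k)

  2^n≤central : ∀ n → 2 ^ n ≤ binom (n + n) n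
  2^n≤central zero = ≤-refl
  2^n≤central (suc n) = subst (λ k → 2 ^ suc n ≤ binom (suc k) (suc n)) (sym (+-suc n n))
    (≤-trans (≤-reflexive (cong (2 ^ n +_) (+-identityʳ (2 ^ n))))
      (+-mono-≤ (≤-trans (2^n≤central n) (left n)) (≤-trans (2^n≤central n) (m≤m+n _ _))))
    where
    left : ∀ n → binom (n + n) n ≤ binom (suc (n + n)) n
    left zero = ≤-refl
    left (suc n) = m≤n+m _ (binom (suc n + suc n) n)

  -- Leibniz's harmonic triangle: 1 / (m + 1) C(n, m + 1) is an integral
  -- combination of the reciprocals of 1, …, n.
  harmonic : ∀ D N → (∀ q → q < N → suc q ∣ D) → ∀ m n → n < N → m ≤ n → suc m * binom (suc n) (suc m) ∣ D
  harmonic D N all zero n n<N _ = subst (_∣ D) (sym (trans (binom-absorb n 0) (*-identityʳ (suc n)))) (all n n<N)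
  harmonic D N all (suc m) (suc n) n<N (s≤s m≤n)
    with harmonic D N all m n (<⇒≤ n<N) m≤n | harmonic D N all m (suc n) n<N (m≤n⇒m≤1+n m≤n)
  ... | divides A D≡A | divides B D≡B = divides (A ∸ B) (begin
    D ≡⟨ sym (m+n∸m≡n (B * Y) D) ⟩
    B * Y + D ∸ B * Y ≡⟨ cong (_∸ B * Y) (sym (*-cancelˡ-≡ _ _ (suc m) scaled)) ⟩
    A * Y ∸ B * Y ≡⟨ sym (*-distribʳ-∸ Y A B) ⟩
    (A ∸ B) * Y ≡⟨ cong ((A ∸ B) *_) (sym (binom-absorb (suc n) (suc m))) ⟩
    (A ∸ B) * (suc (suc m) * binom (2 + n) (2 + m)) ∎)
    where
    open ≡-Reasoning
    c = binom (suc n) (suc m)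
    c₀ = binom (suc n) m
    Y = (2 + n) * c
    abs : suc m * (c₀ + c) ≡ (2 + n) * c₀
    abs = binom-absorb (suc n) m
    scaled : suc m * (A * Y) ≡ suc m * (B * Y + D)
    scaled = +-cancelʳ-≡ (B * suc m * ((2 + n) * c₀)) _ _ (begin
      suc m * (A * Y) + B * suc m * ((2 + n) * c₀)
        ≡⟨ ring (m ∷ A ∷ n ∷ c ∷ B ∷ c₀ ∷ []) ((con 1 :+ X0) :* (X1 :* ((con 2 :+ X2) :* X3)) :+ X4 :* (con 1 :+ X0) :* ((con 2 :+ X2) :* X5))
             ((con 2 :+ X2) :* (X1 :* ((con 1 :+ X0) :* X3)) :+ (con 1 :+ X0) :* (X4 :* ((con 2 :+ X2) :* X5))) refl refl ⟩
      (2 + n) * (A * (suc m * c)) + suc m * (B * ((2 + n) * c₀))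
        ≡⟨ cong₂ (λ x y → (2 + n) * x + suc m * (B * y)) (sym D≡A) (sym abs) ⟩
      (2 + n) * D + suc m * (B * (suc m * (c₀ + c)))
        ≡⟨ cong (λ x → (2 + n) * D + suc m * x) (sym D≡B) ⟩
      (2 + n) * D + suc m * D
        ≡⟨ cong (λ x → (2 + n) * x + suc m * D) D≡B ⟩
      (2 + n) * (B * (suc m * (c₀ + c))) + suc m * D
        ≡⟨ ring (m ∷ n ∷ c ∷ B ∷ c₀ ∷ D ∷ [])
             ((con 2 :+ X1) :* (X3 :* ((con 1 :+ X0) :* (X4 :+ X2))) :+ (con 1 :+ X0) :* X5)
             ((con 1 :+ X0) :* (X3 :* ((con 2 :+ X1) :* X2) :+ X5) :+ X3 :* (con 1 :+ X0) :* ((con 2 :+ X1) :* X4)) refl refl ⟩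
      suc m * (B * Y + D) + B * suc m * ((2 + n) * c₀) ∎)

  nondivisor : ∀ D n → 0 < D → D < 2 ^ n → ∃[ q ] (q < n + n × ¬ (suc q ∣ D))
  nondivisor D zero D>0 D< = ⊥-elim (<-irrefl refl (<-≤-trans D< D>0))
  nondivisor D (suc n) D>0 D< with search (suc n + suc n)
    where
    search : ∀ N → (∃[ q ] (q < N × ¬ (suc q ∣ D))) ⊎ (∀ q → q < N → suc q ∣ D)
    search zero = inj₂ λ q ()
    search (suc N) with search N
    ... | inj₁ (q , q<N , ndiv) = inj₁ (q , m<n⇒m<1+n q<N , ndiv)
    ... | inj₂ all with suc N ∣? D
    ... | no ndiv = inj₁ (N , n<1+n N , ndiv)
    ... | yes q∣ = inj₂ λ q q< → extend q q<
      where
      extend : ∀ q → q < suc N → suc q ∣ D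
      extend q q< with q ≟ N
      ... | yes refl = q∣
      ... | no q≢N = all q (≤∧≢⇒< (s≤s⁻¹ q<) q≢N)
  ... | inj₁ found = found
  ... | inj₂ all = ⊥-elim (<-irrefl refl (<-≤-trans D< (≤-trans (2^n≤central (suc n)) (≤-trans (m≤m+n _ _)
          (∣⇒≤ {{>-nonZero D>0}} (harmonic D (suc n + suc n) all n (n + suc n) ≤-refl (m≤m+n n (suc n))))))))

  private
    gap : ℕ → ℕ → ℕ
    gap x y = if x ≡ᵇ y then 1 else (x ∸ y) + (y ∸ x)

    gap>0 : ∀ x y → 0 < gap x y
    gap>0 x y with x ≡ᵇ y in e
    ... | true = z<s
    ... | false with <-cmp x y
    ... | tri< x<y _ _ = ≤-trans (m<n⇒0<n∸m x<y) (m≤n+m _ (x ∸ y))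
    ... | tri≈ _ refl _ = ⊥-elim (λ₁ (trans (sym e) (≡ᵇ-same x)))
      where
      λ₁ : false ≢ true
      λ₁ ()
    ... | tri> _ _ gt = ≤-trans (m<n⇒0<n∸m gt) (m≤m+n _ (y ∸ x))

    gap-≤ : ∀ {κ} x y → x < 2 ^ κ → y < 2 ^ κ → gap x y ≤ 2 ^ κ
    gap-≤ {κ} x y x< y< with x ≡ᵇ y
    ... | true = pow>0 κ
    ... | false with ≤-total x y
    ... | inj₁ le = subst (λ d → d + (y ∸ x) ≤ 2 ^ κ) (sym (m≤n⇒m∸n≡0 le)) (≤-trans (m∸n≤m y x) (<⇒≤ y<))
    ... | inj₂ le = subst (λ d → x ∸ y + d ≤ 2 ^ κ) (sym (m≤n⇒m∸n≡0 le)) (≤-trans (≤-reflexive (+-identityʳ _)) (≤-trans (m∸n≤m x y) (<⇒≤ x<)))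

    ∏ : List ℕ → (ℕ → ℕ) → ℕ
    ∏ [] f = 1
    ∏ (x ∷ l) f = f x * ∏ l f

    ∏>0 : ∀ l {f} → (∀ x → 0 < f x) → 0 < ∏ l f
    ∏>0 [] h = z<s
    ∏>0 (x ∷ l) h = *-mono-≤ (h x) (∏>0 l h)

    ∏-≤ : ∀ l {f} e → (∀ {x} → x ∈ l → f x ≤ 2 ^ e) → ∏ l f ≤ 2 ^ (length l * e)
    ∏-≤ [] e h = ≤-refl
    ∏-≤ (x ∷ l) e h = ≤-trans (*-mono-≤ (h (here refl)) (∏-≤ l e (h ∘ there))) (≤-reflexive (sym (pow-+ e (length l * e))))

    ∏-∣ : ∀ {x l} f → x ∈ l → f x ∣ ∏ l f
    ∏-∣ {l = y ∷ l} f (here refl) = m∣m*n (∏ l f)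
    ∏-∣ {l = y ∷ l} f (there h) = ∣n⇒∣m*n (f y) (∏-∣ f h)

    same-residue : ∀ q x y → x %% suc q ≡ y %% suc q → x ≤ y → suc q ∣ y ∸ x
    same-residue q x y e x≤y = divides (y // suc q ∸ x // suc q) (begin
      y ∸ x ≡⟨ cong₂ _∸_ (div-mod y {suc q} z<s) (div-mod x {suc q} z<s) ⟩
      y %% suc q + y // suc q * suc q ∸ (x %% suc q + x // suc q * suc q) ≡⟨ cong (λ r → y %% suc q + y // suc q * suc q ∸ (r + x // suc q * suc q)) e ⟩
      y %% suc q + y // suc q * suc q ∸ (y %% suc q + x // suc q * suc q) ≡⟨ [m+n]∸[m+o]≡n∸o (y %% suc q) _ _ ⟩
      y // suc q * suc q ∸ x // suc q * suc q ≡⟨ sym (*-distribʳ-∸ (suc q) (y // suc q) (x // suc q)) ⟩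
      (y // suc q ∸ x // suc q) * suc q ∎)
      where open ≡-Reasoning

  -- Any number that does not divide the product of the differences will do.
  separating : ∀ κ l → (∀ {x} → x ∈ l → x < 2 ^ κ) →
    ∃[ q ] (0 < q × q ≤ 2 * suc (length l * (length l * κ)) × (∀ {x y} → x ∈ l → y ∈ l → x ≢ y → x %% q ≢ y %% q))
  separating κ l small with nondivisor D E D>0 D<
    where
    D = ∏ l (λ x → ∏ l (gap x))
    E = suc (length l * (length l * κ))
    D>0 : 0 < D
    D>0 = ∏>0 l (λ x → ∏>0 l (gap>0 x))
    D< : D < 2 ^ E
    D< = ≤-<-trans (∏-≤ l (length l * κ) (λ {x} x∈l → ∏-≤ l κ (λ {y} y∈l → gap-≤ {κ} x y (small x∈l) (small y∈l)))) (pow-mono-< {length l * (length l * κ)} ≤-refl)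
  ... | q , q< , ndiv = suc q , z<s , ≤-trans q< (≤-reflexive (cong (E +_) (sym (+-identityʳ E)))) , λ {x} {y} x∈l y∈l x≢y e →
    ndiv (∣-trans (sep x y x≢y e) (∣-trans (∏-∣ (gap x) y∈l) (∏-∣ (λ x → ∏ l (gap x)) x∈l)))
    where
    E = suc (length l * (length l * κ))
    sep : ∀ x y → x ≢ y → x %% suc q ≡ y %% suc q → suc q ∣ gap x y
    sep x y x≢y e rewrite ≡ᵇ-false x≢y with ≤-total x y
    ... | inj₁ le rewrite m≤n⇒m∸n≡0 le = same-residue q x y e le
    ... | inj₂ le rewrite m≤n⇒m∸n≡0 le | +-identityʳ (x ∸ y) = same-residue q y x (sym e) le

  coll : (ℕ → ℕ) → List ℕ → ℕ
  coll h l = ∑ l (λ x → ∑ l (λ y → b2n ((x ≠ᵇ y) ∧ (h x ≡ᵇ h y))))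

  record HashFunction (κ m : ℕ) (l : List ℕ) : Set where
    field
      W q a : ℕ
      q>0 : 0 < q
      q< : q < 2 ^ W
      a< : a < 2 ^ (W + m)
      W≤ : W ≤ bits (2 * suc (length l * (length l * κ)))
    hash : ℕ → ℕ
    hash x = slot W m a (x %% q)
    field
      coll≤ : coll hash l * 2 ^ m ≤ 8 * (length l * length l)

  findHash : ∀ κ m l → (∀ {x} → x ∈ l → x < 2 ^ κ) → HashFunction κ m l
  findHash κ m l small with separating κ l small
  ... | q , q>0 , q≤ , sep = record
    { W = W ; q = q ; a = proj₁ best ; q>0 = q>0 ; q< = <-bits q ; a< = proj₁ (proj₂ best)
    ; W≤ = bits-mono q≤ ; coll≤ = *-cancelˡ-≤ (2 ^ W) {{m^n≢0 2 W}} (begin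
        2 ^ W * (C (proj₁ best) * 2 ^ m) ≡⟨ ring (2 ^ W ∷ C (proj₁ best) ∷ 2 ^ m ∷ []) (X0 :* (X1 :* X2)) (X1 :* (X0 :* X2)) refl refl ⟩
        C (proj₁ best) * (2 ^ W * 2 ^ m) ≡⟨ cong (C (proj₁ best) *_) (pow-+ W m) ⟨
        C (proj₁ best) * 2 ^ (W + m) ≤⟨ proj₂ (proj₂ best) ⟩
        Σ< (2 ^ (W + m)) C ≤⟨ total ⟩
        length l * (length l * (8 * 2 ^ W)) ≡⟨ ring (length l ∷ 2 ^ W ∷ []) (X0 :* (X0 :* (con 8 :* X1))) (X1 :* (con 8 :* (X0 :* X0))) refl refl ⟩
        2 ^ W * (8 * (length l * length l)) ∎) }
    where
    open ≤-Reasoning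
    W = bits q
    C : ℕ → ℕ
    C a = coll (λ x → slot W m a (x %% q)) l
    best = below-average (2 ^ (W + m)) C (pow>0 (W + m))
    pair : ∀ {x y} → x ∈ l → y ∈ l → Σ< (2 ^ (W + m)) (λ a → b2n ((x ≠ᵇ y) ∧ (slot W m a (x %% q) ≡ᵇ slot W m a (y %% q)))) ≤ 8 * 2 ^ W
    pair {x} {y} x∈ y∈ with x ≟ y
    ... | yes refl rewrite ≡ᵇ-same x = subst (_≤ 8 * 2 ^ W) (sym (trans (Σ<-const (2 ^ (W + m)) 0) (*-zeroʳ (2 ^ (W + m))))) z≤n
    ... | no x≢y rewrite ≡ᵇ-false x≢y = slot-collisions-≢ W m (sep x∈ y∈ x≢y) (<-trans (%%-< x q>0) (<-bits q)) (<-trans (%%-< y q>0) (<-bits q))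
    total : Σ< (2 ^ (W + m)) C ≤ length l * (length l * (8 * 2 ^ W))
    total = begin
      Σ< (2 ^ (W + m)) C ≡⟨ Σ<-∑ (2 ^ (W + m)) l (λ a x → ∑ l (λ y → b2n ((x ≠ᵇ y) ∧ (slot W m a (x %% q) ≡ᵇ slot W m a (y %% q))))) ⟩
      ∑ l (λ x → Σ< (2 ^ (W + m)) (λ a → ∑ l (λ y → b2n ((x ≠ᵇ y) ∧ (slot W m a (x %% q) ≡ᵇ slot W m a (y %% q))))))
        ≡⟨ ∑-cong l (λ x → Σ<-∑ (2 ^ (W + m)) l (λ a y → b2n ((x ≠ᵇ y) ∧ (slot W m a (x %% q) ≡ᵇ slot W m a (y %% q))))) ⟩
      ∑ l (λ x → ∑ l (λ y → Σ< (2 ^ (W + m)) (λ a → b2n ((x ≠ᵇ y) ∧ (slot W m a (x %% q) ≡ᵇ slot W m a (y %% q))))))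
        ≤⟨ ∑-mono l (λ x∈ → ≤-trans (∑-mono l (λ y∈ → pair x∈ y∈)) (≤-reflexive (∑-const l (8 * 2 ^ W)))) ⟩
      ∑ l (λ x → length l * (8 * 2 ^ W)) ≡⟨ ∑-const l (length l * (8 * 2 ^ W)) ⟩
      length l * (length l * (8 * 2 ^ W)) ∎

  abstract
    hashFunction : ∀ κ m l → (∀ {x} → x ∈ l → x < 2 ^ κ) → HashFunction κ m l
    hashFunction = findHash

  coll-zero : ∀ {h l} → coll h l ≡ 0 → ∀ {x y} → x ∈ l → y ∈ l → h x ≡ h y → x ≡ y
  coll-zero {h} {l} c0 {x} {y} x∈ y∈ hx≡hy with x ≟ y
  ... | yes e = e
  ... | no x≢y = ⊥-elim (1≰0 (subst (_≤ 0) one (≤-trans (∑-∈ (λ y → b2n ((x ≠ᵇ y) ∧ (h x ≡ᵇ h y))) y∈)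
          (≤-trans (∑-∈ (λ x → ∑ l (λ y → b2n ((x ≠ᵇ y) ∧ (h x ≡ᵇ h y)))) x∈) (≤-reflexive c0)))))
    where
    1≰0 : ¬ (1 ≤ 0)
    1≰0 ()
    one : b2n ((x ≠ᵇ y) ∧ (h x ≡ᵇ h y)) ≡ 1
    one rewrite ≡ᵇ-false x≢y | hx≡hy | ≡ᵇ-same (h y) = refl

  cell : (ℕ → ℕ) → List ℕ → ℕ → List ℕ
  cell h [] c = []
  cell h (x ∷ l) c = if h x ≡ᵇ c then x ∷ cell h l c else cell h l c

  ∈-cell : ∀ h {l c x} → x ∈ l → h x ≡ c → x ∈ cell h l c
  ∈-cell h {y ∷ l} {c} (here refl) e rewrite e | ≡ᵇ-same c = here refl
  ∈-cell h {y ∷ l} {c} (there x∈) e with h y ≡ᵇ c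
  ... | true = there (∈-cell h x∈ e)
  ... | false = ∈-cell h x∈ e

  cell-⊆ : ∀ h {l c x} → x ∈ cell h l c → x ∈ l
  cell-⊆ h {y ∷ l} {c} x∈ with h y ≡ᵇ c
  cell-⊆ h {y ∷ l} (here e) | true = here e
  cell-⊆ h {y ∷ l} (there x∈) | true = there (cell-⊆ h x∈)
  cell-⊆ h {y ∷ l} x∈ | false = there (cell-⊆ h x∈)

  length-cell : ∀ h l c → length (cell h l c) ≡ ∑ l (λ x → b2n (h x ≡ᵇ c))
  length-cell h [] c = refl
  length-cell h (x ∷ l) c with h x ≡ᵇ c
  ... | true = cong suc (length-cell h l c)
  ... | false = length-cell h l c

  ∑-*-∑ : ∀ l f → ∑ l f * ∑ l f ≡ ∑ l (λ x → ∑ l (λ y → f x * f y))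
  ∑-*-∑ l f = trans (*-comm (∑ l f) (∑ l f)) (trans (sym (∑-*ˡ l (∑ l f) f)) (∑-cong l λ x → trans (*-comm (∑ l f) (f x)) (sym (∑-*ˡ l (f x) f))))

  one-match : ∀ M s t → Σ< M (λ c → b2n (s ≡ᵇ c) * b2n (t ≡ᵇ c)) ≤ b2n (s ≡ᵇ t)
  one-match M s t = count s t (only M s t)
    where
    only : ∀ M s t → Σ< M (λ c → b2n (s ≡ᵇ c) * b2n (t ≡ᵇ c)) ≤ b2n (s ≡ᵇ t) * b2n (s <ᵇ M)
    only zero s t = z≤n
    only (suc M) s t with s ≟ M
    ... | yes refl rewrite ≡ᵇ-same s | +-identityʳ (b2n (t ≡ᵇ s)) | ≡ᵇ-sym t s = ≤-trans (+-monoˡ-≤ (b2n (s ≡ᵇ t)) (only s s t))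
          (subst₂ (λ a b → b2n (s ≡ᵇ t) * b2n a + b2n (s ≡ᵇ t) ≤ b2n (s ≡ᵇ t) * b2n b) (sym (irr s)) (sym (suc-lt s))
            (≤-reflexive (trans (cong (_+ b2n (s ≡ᵇ t)) (*-zeroʳ (b2n (s ≡ᵇ t)))) (sym (*-identityʳ _)))))
      where
      irr : ∀ s → (s <ᵇ s) ≡ false
      irr zero = refl
      irr (suc s) = irr s
      suc-lt : ∀ s → (s <ᵇ suc s) ≡ true
      suc-lt zero = refl
      suc-lt (suc s) = suc-lt s
    ... | no s≢M rewrite ≡ᵇ-false s≢M | +-identityʳ (Σ< M (λ c → b2n (s ≡ᵇ c) * b2n (t ≡ᵇ c))) =
          ≤-trans (only M s t) (*-monoʳ-≤ (b2n (s ≡ᵇ t)) (lt-mono s M))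
      where
      lt-mono : ∀ s M → b2n (s <ᵇ M) ≤ b2n (s <ᵇ suc M)
      lt-mono s zero = z≤n
      lt-mono zero (suc M) = ≤-refl
      lt-mono (suc s) (suc M) = lt-mono s M
    count : ∀ s t {x} → x ≤ b2n (s ≡ᵇ t) * b2n (s <ᵇ M) → x ≤ b2n (s ≡ᵇ t)
    count s t h = ≤-trans h (≤-trans (*-monoʳ-≤ (b2n (s ≡ᵇ t)) (b2n-≤ (s <ᵇ M))) (≤-reflexive (*-identityʳ _)))

  ∑-unique : ∀ {l} x → Unique l → ∑ l (λ y → b2n (x ≡ᵇ y)) ≤ 1
  ∑-unique x [] = z≤n
  ∑-unique {y ∷ l} x (fresh ∷ un) with x ≟ y
  ... | yes refl rewrite ≡ᵇ-same x = s≤s (absent fresh)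
    where
    absent : ∀ {l} → All (x ≢_) l → ∑ l (λ y → b2n (x ≡ᵇ y)) ≤ 0
    absent [] = z≤n
    absent (ne ∷ nes) rewrite ≡ᵇ-false ne = absent nes
  ... | no x≢y rewrite ≡ᵇ-false x≢y = ∑-unique x un

  Σ-cell² : ∀ M h l → Unique l → Σ< M (λ c → length (cell h l c) * length (cell h l c)) ≤ length l + coll h l
  Σ-cell² M h l un = begin
    Σ< M (λ c → length (cell h l c) * length (cell h l c))
      ≡⟨ Σ<-cong M (λ c _ → trans (cong₂ _*_ (length-cell h l c) (length-cell h l c)) (∑-*-∑ l (λ x → b2n (h x ≡ᵇ c)))) ⟩
    Σ< M (λ c → ∑ l (λ x → ∑ l (λ y → b2n (h x ≡ᵇ c) * b2n (h y ≡ᵇ c))))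
      ≡⟨ Σ<-∑ M l (λ c x → ∑ l (λ y → b2n (h x ≡ᵇ c) * b2n (h y ≡ᵇ c))) ⟩
    ∑ l (λ x → Σ< M (λ c → ∑ l (λ y → b2n (h x ≡ᵇ c) * b2n (h y ≡ᵇ c))))
      ≡⟨ ∑-cong l (λ x → Σ<-∑ M l (λ c y → b2n (h x ≡ᵇ c) * b2n (h y ≡ᵇ c))) ⟩
    ∑ l (λ x → ∑ l (λ y → Σ< M (λ c → b2n (h x ≡ᵇ c) * b2n (h y ≡ᵇ c))))
      ≤⟨ ∑-mono l (λ {x} _ → ∑-mono l (λ {y} _ → ≤-trans (one-match M (h x) (h y)) (split x y))) ⟩
    ∑ l (λ x → ∑ l (λ y → b2n (x ≡ᵇ y) + b2n ((x ≠ᵇ y) ∧ (h x ≡ᵇ h y))))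
      ≡⟨ ∑-cong l (λ x → ∑-+ l (λ y → b2n (x ≡ᵇ y)) (λ y → b2n ((x ≠ᵇ y) ∧ (h x ≡ᵇ h y)))) ⟩
    ∑ l (λ x → ∑ l (λ y → b2n (x ≡ᵇ y)) + ∑ l (λ y → b2n ((x ≠ᵇ y) ∧ (h x ≡ᵇ h y))))
      ≡⟨ ∑-+ l (λ x → ∑ l (λ y → b2n (x ≡ᵇ y))) _ ⟩
    ∑ l (λ x → ∑ l (λ y → b2n (x ≡ᵇ y))) + coll h l
      ≤⟨ +-monoˡ-≤ (coll h l) (≤-trans (∑-mono l (λ {x} _ → ∑-unique x un)) (≤-reflexive (trans (∑-const l 1) (*-identityʳ _)))) ⟩
    length l + coll h l ∎
    where
    open ≤-Reasoning
    split : ∀ x y → b2n (h x ≡ᵇ h y) ≤ b2n (x ≡ᵇ y) + b2n ((x ≠ᵇ y) ∧ (h x ≡ᵇ h y))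
    split x y with x ≡ᵇ y
    ... | true = b2n-≤ (h x ≡ᵇ h y)
    ... | false = ≤-refl

open Hashing

module RetrievalTables where
  open import Data.List.Membership.Propositional using (_∈_)
  open import Data.List.Relation.Unary.Any using (here; there)
  open import Data.List.Relation.Unary.Unique.Propositional using (Unique)

  header : ∀ (f : ℕ) {κ m l} → HashFunction κ m l → Bits
  header f {m = m} H = enc f W ++ (enc f m ++ (enc W q ++ enc (W + m) a))
    where open HashFunction H

  length-header : ∀ f {κ m l} (H : HashFunction κ m l) → length (header f H) ≡ f + (f + (HashFunction.W H + (HashFunction.W H + m)))
  length-header f {m = m} H = trans (length-++ (enc f W)) (cong₂ _+_ (length-enc f W)
    (trans (length-++ (enc f m)) (cong₂ _+_ (length-enc f m)
      (trans (length-++ (enc W q)) (cong₂ _+_ (length-enc W q) (length-enc (W + m) a))))))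
    where open HashFunction H

  module _ {k} (W f p : Expr k) where

    opaque
      hdrW hdrm hdrq hdra headerEnd : Expr k
      hdrW = rd W p f
      hdrm = rd W (add′ p f) f
      hdrq = rd W (add′ (add′ p f) f) hdrW
      hdra = rd W (add′ (add′ (add′ p f) f) hdrW) (add′ hdrW hdrm)
      headerEnd = add′ (add′ (add′ (add′ p f) f) hdrW) (add′ hdrW hdrm)

      slotE : Expr k → Expr k
      slotE x = div′ (rem′ (mul′ hdra (rem′ x hdrq)) (pow′ (add′ hdrW hdrm))) (pow′ hdrW)

  entry : (ℕ → ℕ) → (ℕ → ℕ) → List ℕ → ℕ → ℕ
  entry h val [] s = 0
  entry h val (x ∷ l) s = if h x ≡ᵇ s then val x else entry h val l s

  entry-∈ : ∀ {h val l} → (∀ {x y} → x ∈ l → y ∈ l → h x ≡ h y → x ≡ y) → ∀ {x} → x ∈ l → entry h val l (h x) ≡ val x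
  entry-∈ {h} {val} {y ∷ l} inj {x} x∈ with h y ≟ h x
  ... | yes e rewrite e | ≡ᵇ-same (h x) = cong val (inj (here refl) x∈ e)
  entry-∈ {h} {val} {y ∷ l} inj {x} (here refl) | no ne = ⊥-elim (ne refl)
    where open import Data.Empty using (⊥-elim)
  entry-∈ {h} {val} {y ∷ l} inj {x} (there x∈) | no ne rewrite ≡ᵇ-false ne = entry-∈ (λ a b → inj (there a) (there b)) x∈

  entry-< : ∀ h {val l B} s → 0 < B → (∀ {x} → x ∈ l → val x < B) → entry h val l s < B
  entry-< h {l = []} s B>0 small = B>0
  entry-< h {l = x ∷ l} s B>0 small with h x ≡ᵇ s
  ... | true = small (here refl)
  ... | false = entry-< h s B>0 (small ∘ there)

  -- A product by a numeral is unfolded during conversion, hence `abstract`.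
  abstract
    c₀ : ℕ
    c₀ = 4000
    c₀≡ : c₀ ≡ 4000
    c₀≡ = refl

  -- A static function on l: values are stored without the keys, so looking up a
  -- key outside l returns an arbitrary number.
  module Retrieval (κ : ℕ) (l : List ℕ) (small : ∀ {x} → x ∈ l → x < 2 ^ κ) (unique : Unique l)
    (v : ℕ) (val : ℕ → ℕ) (val< : ∀ {x} → x ∈ l → val x < 2 ^ v) (f : ℕ) where

    N m₀ : ℕ
    N = length l
    m₀ = bits N

    H₀ : HashFunction κ m₀ l
    H₀ = hashFunction κ m₀ l small

    open HashFunction H₀ using () renaming (hash to hash₀; W to W₀)

    bucket : ℕ → List ℕ
    bucket = cell hash₀ l

    m₁ : ℕ → ℕ
    m₁ c = bits (8 * (length (bucket c) * length (bucket c)))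

    H₁ : ∀ c → HashFunction κ (m₁ c) (bucket c)
    H₁ c = hashFunction κ (m₁ c) (bucket c) (small ∘ cell-⊆ hash₀)

    table : ℕ → Bits
    table c = cat (2 ^ m₁ c) (λ s → enc v (entry (HashFunction.hash (H₁ c)) val (bucket c) s))

    cellBits : ℕ → Bits
    cellBits c = header f (H₁ c) ++ table c

    open Layout.Store m₀ f f cellBits public using (layout; Narrow; narrow; module Top)
    open StoreLength m₀ f f cellBits

    abstract
      retrieval : Bits
      retrieval = header f H₀ ++ layout

      retrieval-def : retrieval ≡ header f H₀ ++ layout
      retrieval-def = refl

    b : ℕ → ℕ
    b c = length (bucket c)

    b≤N : ∀ c → b c ≤ N
    b≤N c = ≤-trans (≤-reflexive (length-cell hash₀ l c)) (≤-trans (∑-mono l (λ _ → b2n-≤ _)) (≤-reflexive (trans (∑-const l 1) (*-identityʳ N))))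

    perfect : ∀ c {x y} → x ∈ bucket c → y ∈ bucket c → HashFunction.hash (H₁ c) x ≡ HashFunction.hash (H₁ c) y → x ≡ y
    perfect c = coll-zero {HashFunction.hash (H₁ c)} {bucket c} (n<1⇒n≡0 (*-cancelʳ-< (2 ^ m₁ c) _ 1
      (≤-<-trans (HashFunction.coll≤ (H₁ c)) (<-≤-trans (<-bits (8 * (b c * b c))) (≤-reflexive (sym (*-identityˡ _)))))))

    private
      Σb² : Σ< M (λ c → b c * b c) ≤ 9 * N
      Σb² = ≤-trans (Σ-cell² M hash₀ l unique) (+-monoʳ-≤ N few)
        where
        C = coll hash₀ l
        few : C ≤ 8 * N
        few with C ≤? 8 * N
        ... | yes h = h
        ... | no h = ⊥-elim (<-irrefl refl (≤-trans
                (lin (C ∷ N ∷ 2 ^ m₀ ∷ []) (con 1 :+ con 8 :* (X1 :* X1) :≤ X0 :* X2)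
                  (hyp (X2) (con 1 :+ con 8 :* X1 :≤ X0) (≰⇒> h) ∷ hyp (con 8 :* X1 :+ con 1) (con 1 :+ X1 :≤ X2) (<-bits N) ∷ []) refl)
                (HashFunction.coll≤ H₀)))
          where open import Data.Empty using (⊥-elim)

    module Size (κ≤ : bits κ ≤ f) where

      hash-width : ∀ {n} → bits (2 * suc (n * (n * κ))) ≤ 2 + 2 * n + f
      hash-width {n} = bits-≤ (begin-strict
        2 * suc (n * (n * κ)) ≤⟨ *-monoʳ-≤ 2 (≤-trans (s≤s (≤-reflexive (sym (*-assoc n n κ)))) (m<n+m _ z<s)) ⟩
        2 * suc (n * n * κ) ≤⟨ *-monoʳ-≤ 2 (*-mono-< (*-mono-< (n<2^n n) (n<2^n n)) (<-≤-trans (<-bits κ) (pow-mono κ≤))) ⟩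
        2 * (2 ^ n * 2 ^ n * 2 ^ f) <⟨ lin (P ∷ []) (con 1 :+ con 2 :* X0 :≤ con 4 :* X0) (hyp (con 2) (con 1 :≤ X0) (*-mono-≤ (*-mono-≤ (pow>0 n) (pow>0 n)) (pow>0 f)) ∷ []) refl ⟩
        4 * (2 ^ n * 2 ^ n * 2 ^ f) ≡⟨ trans (cong (4 *_) (trans (cong (_* 2 ^ f) (sym (pow-+ n n))) (sym (pow-+ (n + n) f)))) (sym (pow-+ 2 (n + n + f))) ⟩
        2 ^ (2 + (n + n + f)) ≡⟨ cong (2 ^_) (ring (n ∷ f ∷ []) (con 2 :+ (X0 :+ X0 :+ X1)) (con 2 :+ con 2 :* X0 :+ X1) refl refl) ⟩
        2 ^ (2 + 2 * n + f) ∎)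
        where
        open ≤-Reasoning
        P = 2 ^ n * 2 ^ n * 2 ^ f

      length-cellBits : ∀ c → length (cellBits c) ≤ (4 * f + 4 + v) + (12 + 16 * v) * (b c * b c)
      length-cellBits c = begin
        length (cellBits c) ≡⟨ length-++ (header f (H₁ c)) ⟩
        length (header f (H₁ c)) + length (table c) ≡⟨ cong₂ _+_ (length-header f (H₁ c)) (length-cat-const (2 ^ m₁ c) _ (λ s → length-enc v _)) ⟩
        f + (f + (W + (W + m₁ c))) + 2 ^ m₁ c * v
          ≤⟨ lin (f ∷ W ∷ m₁ c ∷ 2 ^ m₁ c ∷ v ∷ b c ∷ []) (X0 :+ (X0 :+ (X1 :+ (X1 :+ X2))) :+ X3 :* X4 :≤ con 4 :* X0 :+ con 4 :+ X4 :+ (con 12 :+ con 16 :* X4) :* (X5 :* X5))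
               (hyp (con 2) (X1 :≤ con 2 :+ con 2 :* X5 :+ X0) (≤-trans (HashFunction.W≤ (H₁ c)) (hash-width {b c}))
                ∷ hyp (con 1) (X2 :≤ con 8 :* (X5 :* X5)) (bits≤ (8 * (b c * b c)))
                ∷ hyp X4 (X3 :≤ con 1 :+ con 2 :* (con 8 :* (X5 :* X5))) (2^bits-≤ (8 * (b c * b c)))
                ∷ hyp (con 4) (X5 :≤ X5 :* X5) (n≤n² (b c)) ∷ []) refl ⟩
        (4 * f + 4 + v) + (12 + 16 * v) * (b c * b c) ∎
        where
        open ≤-Reasoning
        W = HashFunction.W (H₁ c)
        n≤n² : ∀ n → n ≤ n * n
        n≤n² zero = z≤n
        n≤n² (suc n) = m≤m+n (suc n) _

      cells : S ≤ M * (4 * f + 4 + v) + (12 + 16 * v) * (9 * N)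
      cells = begin
        S ≤⟨ Σ<-mono M (λ c _ → length-cellBits c) ⟩
        Σ< M (λ c → (4 * f + 4 + v) + (12 + 16 * v) * (b c * b c)) ≡⟨ Σ<-+ M _ _ ⟩
        Σ< M (λ c → 4 * f + 4 + v) + Σ< M (λ c → (12 + 16 * v) * (b c * b c)) ≡⟨ cong₂ _+_ (Σ<-const M _) (Σ<-*ˡ M (12 + 16 * v) _) ⟩
        M * (4 * f + 4 + v) + (12 + 16 * v) * Σ< M (λ c → b c * b c) ≤⟨ +-monoʳ-≤ (M * (4 * f + 4 + v)) (*-monoʳ-≤ (12 + 16 * v) Σb²) ⟩
        M * (4 * f + 4 + v) + (12 + 16 * v) * (9 * N) ∎
        where open ≤-Reasoning

      bound : ℕ
      bound = c₀ * ((1 + f + v) * (1 + N))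

      private
        M≤ : M ≤ 1 + 2 * N
        M≤ = 2^bits-≤ N

        groups≤ : groups ≤ 4 * (M * f) + 3 * (M * f) + 3 * M + 4 * S
        groups≤ = ≤-trans (≤-reflexive (sym (*-identityˡ groups))) (≤-trans (groups-≤ 0)
          (lin (M ∷ f ∷ S ∷ []) (con 1 :* (X0 :* X1 :+ con 3 :* (X0 :* (X1 :+ con 0))) :+ con 3 :* (X0 :* X1 :+ X0) :+ con 4 :* X2 :≤
            con 4 :* (X0 :* X1) :+ con 3 :* (X0 :* X1) :+ con 3 :* X0 :+ con 4 :* X2) [] refl))

      all≤ : f + (f + (W₀ + (W₀ + m₀))) + (f + (3 * (M + (f + G + groups)) + groups)) ≤ bound
      all≤ = lin (f ∷ W₀ ∷ m₀ ∷ M ∷ G ∷ groups ∷ S ∷ v ∷ N ∷ c₀ ∷ [])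
        (X0 :+ (X0 :+ (X1 :+ (X1 :+ X2))) :+ (X0 :+ (con 3 :* (X3 :+ (X0 :+ X4 :+ X5)) :+ X5)) :≤ X9 :* ((con 1 :+ X0 :+ X7) :* (con 1 :+ X8)))
        ( hyp (con 2) (X1 :≤ con 2 :+ con 2 :* X8 :+ X0) (≤-trans (HashFunction.W≤ H₀) (hash-width {N}))
        ∷ hyp (con 1) (X2 :≤ X8) (bits≤ N)
        ∷ hyp (con 3) (X4 :≤ X3) G≤M
        ∷ hyp (con 4) (X5 :≤ con 4 :* (X3 :* X0) :+ con 3 :* (X3 :* X0) :+ con 3 :* X3 :+ con 4 :* X6) groups≤
        ∷ hyp (con 16) (X6 :≤ X3 :* (con 4 :* X0 :+ con 4 :+ X7) :+ (con 12 :+ con 16 :* X7) :* (con 9 :* X8)) cells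
        ∷ hyp (con 200 :* (con 1 :+ X0 :+ X7)) (X3 :≤ con 1 :+ con 2 :* X8) M≤
        ∷ hyp ((con 1 :+ X0 :+ X7) :* (con 1 :+ X8)) (con 4000 :≤ X9) (≤-reflexive (sym c₀≡)) ∷ []) refl

      total≤ : Top.total ≤ bound
      total≤ = ≤-trans (lin (f ∷ G ∷ groups ∷ M ∷ W₀ ∷ m₀ ∷ []) (X0 :+ X1 :+ X2 :≤ X0 :+ (X0 :+ (X4 :+ (X4 :+ X5))) :+ (X0 :+ (con 3 :* (X3 :+ (X0 :+ X1 :+ X2)) :+ X2))) [] refl) all≤

      small≤ : f + M + S ≤ bound
      small≤ = lin (f ∷ M ∷ S ∷ v ∷ N ∷ c₀ ∷ []) (X0 :+ X1 :+ X2 :≤ X5 :* ((con 1 :+ X0 :+ X3) :* (con 1 :+ X4)))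
        ( hyp (con 1) (X2 :≤ X1 :* (con 4 :* X0 :+ con 4 :+ X3) :+ (con 12 :+ con 16 :* X3) :* (con 9 :* X4)) cells
        ∷ hyp (con 10 :* (con 1 :+ X0 :+ X3)) (X1 :≤ con 1 :+ con 2 :* X4) M≤
        ∷ hyp ((con 1 :+ X0 :+ X3) :* (con 1 :+ X4)) (con 4000 :≤ X5) (≤-reflexive (sym c₀≡)) ∷ []) refl

      module _ (fits : 3 * bits bound < 2 ^ f) where

        narrow′ : Narrow
        narrow′ = widths-narrow small≤ total≤ fits

        length-retrieval : length retrieval ≤ bound
        length-retrieval = begin
          length retrieval ≡⟨ trans (cong length retrieval-def) (length-++ (header f H₀)) ⟩
          length (header f H₀) + length layout ≡⟨ cong (_+ length layout) (length-header f H₀) ⟩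
          f + (f + (W₀ + (W₀ + m₀))) + length layout
            ≤⟨ +-monoʳ-≤ _ (layout-length (≤-trans (bits-mono total≤) (≤-trans (m≤n*m (bits bound) 3) (<⇒≤ fits)))) ⟩
          f + (f + (W₀ + (W₀ + m₀))) + (f + (3 * (M + bits Top.total) + groups))
            ≤⟨ +-monoʳ-≤ (f + (f + (W₀ + (W₀ + m₀)))) (+-monoʳ-≤ f (+-monoˡ-≤ groups (*-monoʳ-≤ 3 (+-monoʳ-≤ M (bits≤ Top.total))))) ⟩
          f + (f + (W₀ + (W₀ + m₀))) + (f + (3 * (M + (f + G + groups)) + groups))
            ≤⟨ all≤ ⟩
          bound ∎
          where open ≤-Reasoning

open RetrievalTables

module RetrievalQueries where
  open import Data.List.Membership.Propositional using (_∈_)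
  open import Data.List.Relation.Unary.Unique.Propositional using (Unique)

  opaque
    entryE retE : ∀ {k} → Expr k → Expr k → Expr k → Expr k → Expr k → Expr k
    entryE W f v c x = rd W (add′ (headerEnd W f c) (mul′ (slotE W f c x) v)) v
    retE W f v p x = entryE W f v (storeE W f f (headerEnd W f p) (slotE W f p x)) x

    retE-def : ∀ {k} (W f v p x : Expr k) → retE W f v p x ≡ entryE W f v (storeE W f f (headerEnd W f p) (slotE W f p x)) x
    retE-def W f v p x = refl

  module RetrievalLookup {k : ℕ} (u : ℕ) (u>0 : 0 < u) (R : Fin k → Word (F * u)) (β : ℕ → Bool)
    (Z : ℕ) (Z< : Z < 2 ^ (1 * u)) {W : Expr k} (⇓W : Semantics._⇓_∶_ u u>0 R β W (F * u) 7)
    {f : ℕ} {fE : Expr k} (⇓f : Semantics._⇓_∶_ u u>0 R β fE f 1) (2^f≤ : 2 ^ f ≤ 1 * u) where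

    open Layout.Lookup u u>0 R β Z Z< ⇓W

    f≤ : f ≤ 1 * u
    f≤ = ≤-trans (<⇒≤ (n<2^n f)) 2^f≤

    module _ {κ m l} (H : HashFunction κ m l) (rest : Bits) {p : ℕ} {e : Expr k} (⇓p : e ⇓ p ∶ 1)
      (here : At β Z p (header f H ++ rest)) (W₁< : HashFunction.W H < 2 ^ f) (m< : m < 2 ^ f) where
      open HashFunction H renaming (W to W₁)

      private
        W₁≤ : W₁ ≤ 1 * u
        W₁≤ = ≤-trans (<⇒≤ W₁<) 2^f≤
        m≤ : m ≤ 1 * u
        m≤ = ≤-trans (<⇒≤ m<) 2^f≤
        W+m≤ : W₁ + m ≤ 2 * u
        W+m≤ = ≤-trans (+-mono-≤ W₁≤ m≤) (≤-reflexive (ring (u ∷ []) (con 1 :* X0 :+ con 1 :* X0) (con 2 :* X0) refl refl))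
        part = At-++ˡ (header f H) here
        at₂ : At β Z (p + f) (enc f m ++ (enc W₁ q ++ enc (W₁ + m) a))
        at₂ = subst (λ n → At β Z (p + n) (enc f m ++ (enc W₁ q ++ enc (W₁ + m) a))) (length-enc f W₁) (At-++ʳ (enc f W₁) part)
        at₃ : At β Z (p + f + f) (enc W₁ q ++ enc (W₁ + m) a)
        at₃ = subst (λ n → At β Z (p + f + n) (enc W₁ q ++ enc (W₁ + m) a)) (length-enc f m) (At-++ʳ (enc f m) at₂)
        at₄ : At β Z (p + f + f + W₁) (enc (W₁ + m) a)
        at₄ = subst (λ n → At β Z (p + f + f + n) (enc (W₁ + m) a)) (length-enc W₁ q) (At-++ʳ (enc W₁ q) at₃)

      At-rest : At β Z (p + f + f + W₁ + (W₁ + m)) rest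
      At-rest = subst (λ n → At β Z n rest) (trans (cong (p +_) (length-header f H))
        (ring (p ∷ f ∷ W₁ ∷ m ∷ []) (X0 :+ (X1 :+ (X1 :+ (X2 :+ (X2 :+ X3))))) (X0 :+ X1 :+ X1 :+ X2 :+ (X2 :+ X3)) refl refl))
        (At-++ʳ (header f H) here)

      opaque
        unfolding hdrW hdrm hdrq hdra headerEnd slotE

        private
          ⇓W₁ : hdrW W fE e ⇓ W₁ ∶ 1
          ⇓W₁ = cast (At-enc W₁< (At-++ˡ (enc f W₁) part)) (⇓rd ⇓W 1 ⇓p ⇓f f≤)
          ⇓m : hdrm W fE e ⇓ m ∶ 1
          ⇓m = cast (At-enc m< (At-++ˡ (enc f m) at₂)) (⇓rd ⇓W 1 (⇓add ⇓p ⇓f) ⇓f f≤)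
          ⇓q : hdrq W fE e ⇓ q ∶ 1
          ⇓q = cast (At-enc q< (At-++ˡ (enc W₁ q) at₃)) (⇓rd ⇓W 1 (⇓add (⇓add ⇓p ⇓f) ⇓f) ⇓W₁ W₁≤)
          ⇓a : hdra W fE e ⇓ a ∶ 2
          ⇓a = cast (At-enc a< at₄) (⇓rd ⇓W 2 (⇓add (⇓add (⇓add ⇓p ⇓f) ⇓f) ⇓W₁) (⇓add ⇓W₁ ⇓m) W+m≤)

        ⇓slot : ∀ {x} {e′ : Expr k} → e′ ⇓ x ∶ 2 → slotE W fE e e′ ⇓ hash x ∶ 1
        ⇓slot {x} ⇓x = rebound (⇓div (⇓rem (⇓mul ⇓a (⇓rem ⇓x ⇓q)) (⇓pow (⇓add ⇓W₁ ⇓m) 2 W+m≤)) (⇓pow ⇓W₁ 1 W₁≤))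
          (<-≤-trans (slot-< W₁ m a (x %% q)) (pow-mono m≤))

        ⇓headerEnd : headerEnd W fE e ⇓ p + f + f + W₁ + (W₁ + m) ∶ 1
        ⇓headerEnd = At-∶ rest At-rest (⇓add (⇓add (⇓add (⇓add ⇓p ⇓f) ⇓f) ⇓W₁) (⇓add ⇓W₁ ⇓m))

    module _ (κ : ℕ) (l : List ℕ) (small : ∀ {x} → x ∈ l → x < 2 ^ κ) (unique : Unique l)
      (v : ℕ) (val : ℕ → ℕ) (val< : ∀ {x} → x ∈ l → val x < 2 ^ v) where

      open Retrieval κ l small unique v val val< f

      module _ (fitting : Narrow)
        (widths : bits (8 * suc (N * (N * suc κ))) < 2 ^ f)
        {vE : Expr k} (⇓v : vE ⇓ v ∶ 1) (v≤ : v ≤ 1 * u)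
        {p : ℕ} {e : Expr k} (⇓p : e ⇓ p ∶ 1) (there : At β Z p retrieval) where

        private
          here : At β Z p (header f H₀ ++ layout)
          here = subst (At β Z p) retrieval-def there

        private
          wide : ∀ {n} → n ≤ N → bits (2 * suc (n * (n * κ))) < 2 ^ f
          wide {n} n≤N = ≤-<-trans (bits-mono (*-mono-≤ {2} {8} (s≤s (s≤s z≤n)) (s≤s (*-mono-≤ n≤N (*-mono-≤ n≤N (n≤1+n κ)))))) widths
          m₀< : m₀ < 2 ^ f
          m₀< = ≤-<-trans (bits-mono (lin (N ∷ κ ∷ []) (X0 :≤ con 8 :* (con 1 :+ X0 :* (X0 :* (con 1 :+ X1)))) (hyp (con 1) (X0 :≤ X0 :* X0) (n≤n² N) ∷ []) refl)) widths
            where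
            n≤n² : ∀ n → n ≤ n * n
            n≤n² zero = z≤n
            n≤n² (suc n) = m≤m+n (suc n) _
          m₁< : ∀ c → m₁ c < 2 ^ f
          m₁< c = ≤-<-trans (bits-mono (*-monoʳ-≤ 8 (≤-trans (*-mono-≤ (b≤N c) (b≤N c))
            (lin (N ∷ κ ∷ []) (X0 :* X0 :≤ con 1 :+ X0 :* (X0 :* (con 1 :+ X1))) [] refl)))) widths

        opaque
          unfolding entryE

          ⇓entry : ∀ {h s} {e₁ e′ : Expr k} → headerEnd W fE e₁ ⇓ h ∶ 1 → slotE W fE e₁ e′ ⇓ s ∶ 1 → entryE W fE vE e₁ e′ ⇓ read β (h + s * v) v ∶ 1
          ⇓entry ⇓h ⇓s = ⇓rd ⇓W 1 (⇓add ⇓h (⇓mul ⇓s ⇓v)) ⇓v v≤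

        private
          in-cell : ∀ {x c} {e′ e₁ : Expr k} {q} → HashFunction.hash H₀ x ≡ c → e′ ⇓ x ∶ 2 → x ∈ l → e₁ ⇓ q ∶ 1 → At β Z q (cellBits c) →
            entryE W fE vE e₁ e′ ⇓ val x ∶ 1
          in-cell {x} {c} hx ⇓x x∈l ⇓c at-c = cast (trans (At-enc entry<′ in-table) (entry-∈ {(HashFunction.hash (H₁ c))} {val} (perfect c) x∈cell))
            (⇓entry ⇓end₁ ⇓s₁)
            where
            W₁< = ≤-<-trans (HashFunction.W≤ (H₁ c)) (wide (b≤N c))
            ⇓s₁ = ⇓slot (H₁ c) (table c) ⇓c at-c W₁< (m₁< c) ⇓x
            ⇓end₁ = ⇓headerEnd (H₁ c) (table c) ⇓c at-c W₁< (m₁< c)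
            x∈cell : x ∈ bucket c
            x∈cell = ∈-cell (HashFunction.hash H₀) x∈l hx
            entry<′ : entry (HashFunction.hash (H₁ c)) val (bucket c) ((HashFunction.hash (H₁ c)) x) < 2 ^ v
            entry<′ = entry-< (HashFunction.hash (H₁ c)) ((HashFunction.hash (H₁ c)) x) (pow>0 v) (val< ∘ cell-⊆ (HashFunction.hash H₀))
            in-table = At-cat-const (2 ^ m₁ c) (λ s → enc v (entry (HashFunction.hash (H₁ c)) val (bucket c) s))
              (slot-< (HashFunction.W (H₁ c)) (m₁ c) (HashFunction.a (H₁ c)) (x %% HashFunction.q (H₁ c))) (λ s → length-enc v _)
              (At-rest (H₁ c) (table c) ⇓c at-c W₁< (m₁< c))

        ⇓ret : ∀ {x} {e′ : Expr k} → e′ ⇓ x ∶ 2 → x ∈ l → retE W fE vE e e′ ⇓ val x ∶ 1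
        ⇓ret {x} {e′} ⇓x x∈l = subst (_⇓ val x ∶ 1) (sym (retE-def W fE vE e e′)) (in-cell refl ⇓x x∈l (proj₁ (proj₂ found)) (proj₂ (proj₂ found)))
          where
          W₀< = ≤-<-trans (HashFunction.W≤ H₀) (wide ≤-refl)
          ⇓s₀ = ⇓slot H₀ layout ⇓p here W₀< m₀< ⇓x
          found = ⇓store {m = m₀} {g = f} {f = f} {b = cellBits} ⇓f f≤ ⇓f f≤ fitting 2^f≤
            (⇓headerEnd H₀ layout ⇓p here W₀< m₀<) (At-rest H₀ layout ⇓p here W₀< m₀<) ⇓s₀ (slot-< (HashFunction.W H₀) m₀ (HashFunction.a H₀) (x %% HashFunction.q H₀))

open RetrievalQueries

module KeyRanks where
  open import Data.List using (deduplicate)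
  open import Data.List.Properties using (length-deduplicate)
  open import Data.List.Membership.Propositional using (_∈_)
  open import Data.List.Membership.Propositional.Properties using (∈-++⁺ˡ; ∈-++⁺ʳ; ∈-++⁻; ∈-deduplicate⁺; ∈-deduplicate⁻)
  open import Data.List.Relation.Unary.Any using (here; there)
  open import Data.List.Relation.Unary.Unique.Propositional using (Unique)
  open import Data.List.Relation.Unary.Unique.DecPropositional.Properties _≟_ using (deduplicate-!)

  flat : List ℕ → (ℕ → List ℕ) → List ℕ
  flat [] f = []
  flat (x ∷ l) f = f x ++ flat l f

  ∈-flat : ∀ {l x y} (f : ℕ → List ℕ) → x ∈ l → y ∈ f x → y ∈ flat l f
  ∈-flat f (here refl) y∈ = ∈-++⁺ˡ y∈
  ∈-flat {x₀ ∷ l} f (there x∈) y∈ = ∈-++⁺ʳ (f x₀) (∈-flat f x∈ y∈)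

  flat-all : ∀ {l} (f : ℕ → List ℕ) {Q : ℕ → Set} → (∀ {x} → x ∈ l → ∀ {y} → y ∈ f x → Q y) → ∀ {y} → y ∈ flat l f → Q y
  flat-all {x ∷ l} f h y∈ with ∈-++⁻ (f x) y∈
  ... | inj₁ y∈x = h (here refl) y∈x
  ... | inj₂ y∈l = flat-all f (h ∘ there) y∈l

  length-flat : ∀ l f → length (flat l f) ≡ ∑ l (length ∘ f)
  length-flat [] f = refl
  length-flat (x ∷ l) f = trans (length-++ (f x)) (cong (length (f x) +_) (length-flat l f))

  range : ℕ → List ℕ
  range zero = []
  range (suc n) = n ∷ range n

  ∈-range : ∀ {i n} → i < n → i ∈ range n
  ∈-range {i} {suc n} i<n with i ≟ n
  ... | yes refl = here refl
  ... | no i≢n = there (∈-range (≤∧≢⇒< (s≤s⁻¹ i<n) i≢n))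

  range-< : ∀ {i n} → i ∈ range n → i < n
  range-< {n = suc n} (here refl) = n<1+n n
  range-< {n = suc n} (there i∈) = m<n⇒m<1+n (range-< i∈)

  ∑-range : ∀ n f → ∑ (range n) f ≡ Σ< n f
  ∑-range zero f = refl
  ∑-range (suc n) f = trans (cong (f n +_) (∑-range n f)) (+-comm (f n) _)

  abstract
    distinct : List ℕ → List ℕ
    distinct = deduplicate _≟_

    ∈-distinct : ∀ {x l} → x ∈ l → x ∈ distinct l
    ∈-distinct = ∈-deduplicate⁺ _≟_

    distinct-∈ : ∀ {x} l → x ∈ distinct l → x ∈ l
    distinct-∈ l = ∈-deduplicate⁻ _≟_ l

    distinct-unique : ∀ l → Unique (distinct l)
    distinct-unique = deduplicate-!

    length-distinct : ∀ l → length (distinct l) ≤ length l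
    length-distinct = length-deduplicate _≟_

  -- The tag false stands for the least and true for the greatest key of a node.
  -- The node (p , t) is the interval of the x with x // 2 ^ t = p.
  module KeySet (χ : ℕ → Bool) where

    c : ℕ → ℕ
    c n = Σ< n (b2n ∘ χ)

    c-mono : ∀ {m n} → m ≤ n → c m ≤ c n
    c-mono = Σ<-prefix (b2n ∘ χ)

    c-suc : ∀ {x} → χ x ≡ true → c (suc x) ≡ suc (c x)
    c-suc {x} e rewrite e = +-comm (c x) 1

    c-< : ∀ {x n} → χ x ≡ true → x < n → c x < c n
    c-< {n = n} e x<n = subst (_≤ c n) (c-suc e) (c-mono x<n)

    key-at : ∀ {i} n → i < c n → ∃[ x ] (x < n × χ x ≡ true × c x ≡ i)
    key-at {i} (suc n) i< with i <? c n
    ... | yes i<′ = let x , x<n , e , e≡ = key-at n i<′ in x , m<n⇒m<1+n x<n , e , e≡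
    ... | no i≮ with χ n in e
    ... | true = n , n<1+n n , e , ≤-antisym (≮⇒≥ i≮) (s≤s⁻¹ (≤-trans i< (≤-reflexive (+-comm (c n) 1))))
    ... | false = ⊥-elim (i≮ (subst (i <_) (+-identityʳ (c n)) i<))

    rank : Bool → ℕ → ℕ → ℕ
    rank false p t = c (p * 2 ^ t)
    rank true p t = c (suc p * 2 ^ t) ∸ 1

    Extreme : Bool → ℕ → ℕ → Set
    Extreme tag x t = rank tag (x // 2 ^ t) t ≡ c x

    Extreme? : ∀ tag x t → Dec (Extreme tag x t)
    Extreme? tag x t = rank tag (x // 2 ^ t) t ≟ c x

    node-lower : ∀ x t → x // 2 ^ t * 2 ^ t ≤ x
    node-lower x t = //-*-≤ x (2 ^ t)

    node-upper : ∀ x t → x < suc (x // 2 ^ t) * 2 ^ t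
    node-upper x t = <-//-suc x (pow>0 t)

    c-upper : ∀ {x} t → χ x ≡ true → suc (c x) ≤ c (suc (x // 2 ^ t) * 2 ^ t)
    c-upper {x} t e = subst (_≤ c (suc (x // 2 ^ t) * 2 ^ t)) (c-suc e) (c-mono (node-upper x t))

    Extreme-0 : ∀ tag {x} → χ x ≡ true → Extreme tag x 0
    Extreme-0 false {x} e = cong c (trans (*-identityʳ (x // 1)) x//1)
      where
      x//1 : x // 1 ≡ x
      x//1 = trans (cong (_// 1) (sym (*-identityʳ x))) (//-* 0 x z<s)
    Extreme-0 true {x} e = trans (cong (λ y → c y ∸ 1) (trans (*-identityʳ (suc (x // 1))) (cong suc x//1))) (cong (_∸ 1) (c-suc e))
      where
      x//1 : x // 1 ≡ x
      x//1 = trans (cong (_// 1) (sym (*-identityʳ x))) (//-* 0 x z<s)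

    pow-split : ∀ {t t′} → t ≤ t′ → 2 ^ t′ ≡ 2 ^ (t′ ∸ t) * 2 ^ t
    pow-split {t} {t′} t≤t′ = trans (cong (2 ^_) (sym (m∸n+n≡m t≤t′))) (pow-+ (t′ ∸ t) t)

    lower-mono : ∀ x {t t′} → t ≤ t′ → x // 2 ^ t′ * 2 ^ t′ ≤ x // 2 ^ t * 2 ^ t
    lower-mono x {t} {t′} t≤t′ = subst (_≤ x // 2 ^ t * 2 ^ t) (sym e≡) (*-monoˡ-≤ (2 ^ t) {x // 2 ^ t′ * 2 ^ (t′ ∸ t)} {x // 2 ^ t}
        (*-≤⇒≤-// (pow>0 t) (≤-trans (≤-reflexive (sym e≡)) (node-lower x t′))))
      where
      e≡ : x // 2 ^ t′ * 2 ^ t′ ≡ x // 2 ^ t′ * 2 ^ (t′ ∸ t) * 2 ^ t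
      e≡ = trans (cong (x // 2 ^ t′ *_) (pow-split t≤t′)) (sym (*-assoc (x // 2 ^ t′) (2 ^ (t′ ∸ t)) (2 ^ t)))

    upper-mono : ∀ x {t t′} → t ≤ t′ → suc (x // 2 ^ t) * 2 ^ t ≤ suc (x // 2 ^ t′) * 2 ^ t′
    upper-mono x {t} {t′} t≤t′ = subst (suc (x // 2 ^ t) * 2 ^ t ≤_) (sym e≡) (*-monoˡ-≤ (2 ^ t) {suc (x // 2 ^ t)} {suc (x // 2 ^ t′) * 2 ^ (t′ ∸ t)}
        (<-*⇒//-< {suc (x // 2 ^ t′) * 2 ^ (t′ ∸ t)} {x} {2 ^ t} (<-≤-trans (node-upper x t′) (≤-reflexive e≡))))
      where
      e≡ : suc (x // 2 ^ t′) * 2 ^ t′ ≡ suc (x // 2 ^ t′) * 2 ^ (t′ ∸ t) * 2 ^ t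
      e≡ = trans (cong (suc (x // 2 ^ t′) *_) (pow-split t≤t′)) (sym (*-assoc (suc (x // 2 ^ t′)) (2 ^ (t′ ∸ t)) (2 ^ t)))

    Extreme-down : ∀ tag {x t t′} → χ x ≡ true → t ≤ t′ → Extreme tag x t′ → Extreme tag x t
    Extreme-down false {x} {t} {t′} e t≤t′ ext = ≤-antisym (c-mono (node-lower x t))
      (subst (_≤ c (x // 2 ^ t * 2 ^ t)) ext (c-mono (lower-mono x t≤t′)))
    Extreme-down true {x} {t} {t′} e t≤t′ ext = ≤-antisym
      (subst (c (suc (x // 2 ^ t) * 2 ^ t) ∸ 1 ≤_) ext (∸-monoˡ-≤ 1 (c-mono (upper-mono x t≤t′))))
      (∸-monoˡ-≤ 1 (c-upper t e))

    extreme : ∀ tag {y} t → χ y ≡ true → ∃[ x ] (χ x ≡ true × x // 2 ^ t ≡ y // 2 ^ t × Extreme tag x t ×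
      (tag ≡ false → x ≤ y) × (tag ≡ true → y ≤ x))
    extreme tag {y} t e = pick (rank tag p t) (rank≥ tag) (rank< tag) {refl}
      where
      p = y // 2 ^ t
      lo = p * 2 ^ t
      hi = suc p * 2 ^ t
      lo<hi : c lo < c hi
      lo<hi = ≤-trans (s≤s (c-mono (node-lower y t))) (c-upper t e)
      rank≥ : ∀ tag → c lo ≤ rank tag p t
      rank≥ false = ≤-refl
      rank≥ true = ∸-monoˡ-≤ 1 lo<hi
      rank< : ∀ tag → rank tag p t < c hi
      rank< false = lo<hi
      rank< true = ≤-reflexive (m+[n∸m]≡n {1} (≤-trans (s≤s z≤n) lo<hi))
      pick : ∀ i → c lo ≤ i → i < c hi → {e≡ : i ≡ rank tag p t} → ∃[ x ] (χ x ≡ true × x // 2 ^ t ≡ p × Extreme tag x t ×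
        (tag ≡ false → x ≤ y) × (tag ≡ true → y ≤ x))
      pick i lo≤i i<hi {e≡} with key-at hi i<hi
      ... | x , x<hi , ex , cx = x , ex , node , trans (cong (λ q → rank tag q t) node) (trans (sym e≡) (sym cx)) , least-key , greatest-key
        where
        x≥lo : lo ≤ x
        x≥lo with lo ≤? x
        ... | yes h = h
        ... | no h = ⊥-elim (<-irrefl (trans cx refl) (<-≤-trans (c-< ex (≰⇒> h)) lo≤i))
        node : x // 2 ^ t ≡ p
        node = //-unique x≥lo x<hi
        least-key : tag ≡ false → x ≤ y
        least-key refl with x ≤? y
        ... | yes h = h
        ... | no h = ⊥-elim (<-irrefl refl (<-≤-trans (c-< e (≰⇒> h)) (≤-trans (≤-reflexive (trans cx e≡)) (c-mono (node-lower y t)))))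
        greatest-key : tag ≡ true → y ≤ x
        greatest-key refl with y ≤? x
        ... | yes h = h
        ... | no h = ⊥-elim (<-irrefl refl (<-≤-trans (subst (_< c y) (trans cx e≡) (c-< ex (≰⇒> h))) (∸-monoˡ-≤ 1 (c-upper t e))))

    module _ (ℓ : ℕ) (tag : Bool) (x : ℕ) where

      private
        ext? : ∀ i → Dec (Extreme tag x (ℓ ∸ i))
        ext? i = Extreme? tag x (ℓ ∸ i)

      coarsest : ℕ
      coarsest = ℓ ∸ least ext? ℓ

      coarsest-≤ : coarsest ≤ ℓ
      coarsest-≤ = m∸n≤m ℓ (least ext? ℓ)

      coarsest-extreme : χ x ≡ true → Extreme tag x coarsest
      coarsest-extreme e = least-holds ext? ℓ (subst (Extreme tag x) (sym (n∸n≡0 ℓ)) (Extreme-0 tag e))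

      coarsest-max : ∀ {t} → t ≤ ℓ → Extreme tag x t → t ≤ coarsest
      coarsest-max {t} t≤ℓ ext = ≤-trans (≤-reflexive (sym (m∸[m∸n]≡n t≤ℓ)))
        (∸-monoʳ-≤ ℓ (least-min ext? ℓ {ℓ ∸ t} (subst (Extreme tag x) (sym (m∸[m∸n]≡n t≤ℓ)) ext)))

  roundUp : ℕ → ℕ → ℕ
  roundUp t n = (t + n ∸ 1) // n * n

  roundUp-≥ : ∀ t {n} → 0 < n → t ≤ roundUp t n
  roundUp-≥ t {n} n>0 = s≤s⁻¹ (+-cancelʳ-≤ (n ∸ 1) (suc t) (suc (roundUp t n)) (begin
    suc t + (n ∸ 1) ≡⟨ cong suc (sym (+-∸-assoc t n>0)) ⟩
    suc (t + n ∸ 1) ≤⟨ <-//-suc (t + n ∸ 1) n>0 ⟩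
    n + roundUp t n ≡⟨ cong (_+ roundUp t n) (sym (m+[n∸m]≡n {1} n>0)) ⟩
    suc (n ∸ 1) + roundUp t n ≡⟨ +-comm (suc (n ∸ 1)) _ ⟩
    roundUp t n + suc (n ∸ 1) ≡⟨ +-suc (roundUp t n) (n ∸ 1) ⟩
    suc (roundUp t n) + (n ∸ 1) ∎))
    where open ≤-Reasoning

  roundUp-< : ∀ t {n} → 0 < n → roundUp t n < t + n
  roundUp-< t {n} n>0 = ≤-trans (s≤s (//-*-≤ (t + n ∸ 1) n)) (≤-reflexive (m+[n∸m]≡n {1} (≤-trans n>0 (m≤n+m n t))))

  -- Level t is replaced by its roundings to multiples of ρ ^ j, capped at ℓ. A
  -- key that is extreme exactly up to level T needs to be filed only under the
  -- last ρ multiples of each ρ ^ j up to T: the coarsest rounding of t that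
  -- does not exceed T is one of these.
  module Levels (ℓ r S : ℕ) (ℓ< : ℓ < 2 ^ (r * S)) where

    ρ^ : ℕ → ℕ
    ρ^ j = 2 ^ (r * j)

    rounded : ℕ → ℕ → ℕ
    rounded t j = roundUp t (ρ^ j) ⊓ ℓ

    multiple : ℕ → ℕ → ℕ → List ℕ
    multiple T j i = (T // ρ^ j ∸ i) * ρ^ j ∷ []

    multiples : ℕ → ℕ → List ℕ
    multiples T j = flat (range (2 ^ r)) (multiple T j)

    filed : ℕ → List ℕ
    filed T = T ∷ flat (range (suc S)) (multiples T)

    filed-≤ : ∀ T {t} → t ∈ filed T → t ≤ T
    filed-≤ T (here refl) = ≤-refl
    filed-≤ T (there t∈) = flat-all {range (suc S)} (multiples T) {_≤ T} (λ {j} _ → flat-all {range (2 ^ r)} (multiple T j) {_≤ T} (λ {i} _ → λ { (here refl) →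
      ≤-trans (*-monoˡ-≤ (ρ^ j) (m∸n≤m (T // ρ^ j) i)) (//-*-≤ T (ρ^ j)) })) t∈

    length-filed : ∀ T → length (filed T) ≡ 1 + suc S * 2 ^ r
    length-filed T = cong suc (trans (length-flat (range (suc S)) (multiples T)) (trans (∑-cong (range (suc S)) {g = λ _ → 2 ^ r} (λ j →
      trans (length-flat (range (2 ^ r)) (multiple T j)) (trans (∑-range (2 ^ r) (λ _ → 1)) (trans (Σ<-const (2 ^ r) 1) (*-identityʳ (2 ^ r))))))
      (trans (∑-range (suc S) (λ _ → 2 ^ r)) (Σ<-const (suc S) (2 ^ r)))))

    file : ∀ T j i → j ≤ S → i < 2 ^ r → (T // ρ^ j ∸ i) * ρ^ j ∈ filed T
    file T j i j≤S i< = there (∈-flat (multiples T) (∈-range (s≤s j≤S)) (∈-flat (multiple T j) (∈-range i<) (here refl)))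

    hit : ∀ {t T} → t ≤ T → T ≤ ℓ → ∃[ j ] (j ≤ S × rounded t j ∈ filed T × rounded t j ≤ T)
    hit {t} {T} t≤T T≤ℓ = go S 0 (+-identityʳ S) start
      where
      start : rounded t 0 ≤ T
      start = ≤-trans (m⊓n≤m _ ℓ) (≤-trans (≤-reflexive (trans (cong (λ k → roundUp t (2 ^ k)) (*-zeroʳ r)) round1)) t≤T)
        where
        round1 : roundUp t 1 ≡ t
        round1 = ≤-antisym (s≤s⁻¹ (≤-trans (roundUp-< t z<s) (≤-reflexive (+-comm t 1)))) (roundUp-≥ t z<s)
      capped : ∀ j → ℓ ≤ roundUp t (ρ^ j) → rounded t j ≤ T → rounded t j ∈ filed T
      capped j big le = subst (_∈ filed T) (sym (trans e≡ (sym T≡ℓ))) (here refl)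
        where
        e≡ = m≥n⇒m⊓n≡n big
        T≡ℓ : T ≡ ℓ
        T≡ℓ = ≤-antisym T≤ℓ (subst (_≤ T) e≡ le)
      go : ∀ fuel j → fuel + j ≡ S → rounded t j ≤ T → ∃[ j ] (j ≤ S × rounded t j ∈ filed T × rounded t j ≤ T)
      go zero j refl le with roundUp t (ρ^ j) ≤? ℓ
      ... | no big = j , ≤-refl , capped j (<⇒≤ (≰⇒> big)) le , le
      ... | yes small = j , ≤-refl , subst (_∈ filed T) (sym both) (file T j 0 ≤-refl (pow>0 r)) , le
        where
        a = (t + ρ^ j ∸ 1) // ρ^ j
        a≡0 : a ≡ 0
        a≡0 = n<1⇒n≡0 (*-cancelʳ-< (ρ^ j) a 1 (≤-<-trans small (<-≤-trans ℓ< (≤-reflexive (sym (*-identityˡ (ρ^ j)))))))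
        both : rounded t j ≡ (T // ρ^ j ∸ 0) * ρ^ j
        both = trans (m≤n⇒m⊓n≡m small) (trans (cong (_* ρ^ j) a≡0) (sym (cong (λ q → (q ∸ 0) * ρ^ j) (//-small (≤-<-trans T≤ℓ ℓ<)))))
      go (suc fuel) j e≡ le with rounded t (suc j) ≤? T
      ... | yes le′ = go fuel (suc j) (trans (+-suc fuel j) e≡) le′
      ... | no nle with roundUp t (ρ^ j) ≤? ℓ
      ... | no big = j , j≤S , capped j (<⇒≤ (≰⇒> big)) le , le
        where
        j≤S : j ≤ S
        j≤S = ≤-trans (m≤n+m j (suc fuel)) (≤-reflexive e≡)
      ... | yes small = j , j≤S , subst (_∈ filed T) same (file T j (A ∸ a) j≤S close) , le
        where
        j≤S : j ≤ S
        j≤S = ≤-trans (m≤n+m j (suc fuel)) (≤-reflexive e≡)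
        a = (t + ρ^ j ∸ 1) // ρ^ j
        A = T // ρ^ j
        here≡ : rounded t j ≡ a * ρ^ j
        here≡ = m≤n⇒m⊓n≡m small
        a≤A : a ≤ A
        a≤A = *-≤⇒≤-// (pow>0 (r * j)) (subst (_≤ T) here≡ le)
        same : (A ∸ (A ∸ a)) * ρ^ j ≡ rounded t j
        same = trans (cong (_* ρ^ j) (m∸[m∸n]≡n a≤A)) (sym here≡)
        ρ^suc : ρ^ (suc j) ≡ 2 ^ r * ρ^ j
        ρ^suc = trans (cong (2 ^_) (*-suc r j)) (pow-+ r (r * j))
        A< : A < a + 2 ^ r
        A< = *-cancelʳ-< (ρ^ j) A (a + 2 ^ r) (begin-strict
          A * ρ^ j ≤⟨ //-*-≤ T (ρ^ j) ⟩
          T <⟨ ≰⇒> nle ⟩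
          rounded t (suc j) ≤⟨ m⊓n≤m _ ℓ ⟩
          roundUp t (ρ^ (suc j)) ≤⟨ <⇒≤ (roundUp-< t (pow>0 (r * suc j))) ⟩
          t + ρ^ (suc j) ≤⟨ +-monoˡ-≤ _ (roundUp-≥ t (pow>0 (r * j))) ⟩
          a * ρ^ j + ρ^ (suc j) ≡⟨ cong (a * ρ^ j +_) ρ^suc ⟩
          a * ρ^ j + 2 ^ r * ρ^ j ≡⟨ *-distribʳ-+ (ρ^ j) a (2 ^ r) ⟨
          (a + 2 ^ r) * ρ^ j ∎)
          where open ≤-Reasoning
        close : A ∸ a < 2 ^ r
        close = +-cancelʳ-< a (A ∸ a) (2 ^ r) (<-≤-trans (subst (_< a + 2 ^ r) (sym (m∸n+n≡m a≤A)) A<) (≤-reflexive (+-comm a (2 ^ r))))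

    rounded-≥ : ∀ {t} j → t ≤ ℓ → t ≤ rounded t j
    rounded-≥ {t} j t≤ℓ = ⊓-glb (roundUp-≥ t (pow>0 (r * j))) t≤ℓ

open KeyRanks

module Landmarks where
  open import Data.List.Membership.Propositional using (_∈_)
  open import Data.List.Membership.Propositional.Properties using (∈-++⁺ˡ; ∈-++⁺ʳ; ∈-++⁻)
  open import Data.List.Relation.Unary.Any using (here; there)
  open import Relation.Nullary.Decidable using (_⊎-dec_)

  -- A node is coded as a number, to serve as a hash key; 2 ^ τ exceeds all levels.
  module Code (τ : ℕ) where

    code : Bool → ℕ → ℕ → ℕ
    code tag t p = (p * 2 ^ τ + t) * 2 + b2n tag

    decTag : ℕ → Bool
    decTag x = x %% 2 ≡ᵇ 1

    decLevel decNode : ℕ → ℕ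
    decLevel x = x // 2 %% 2 ^ τ
    decNode x = x // 2 // 2 ^ τ

    private
      b2n<2 : ∀ b → b2n b < 2
      b2n<2 b = s≤s (b2n-≤ b)

      half≡ : ∀ tag t p → code tag t p // 2 ≡ p * 2 ^ τ + t
      half≡ tag t p = trans (cong (_// 2) (+-comm _ (b2n tag))) (//-* (b2n tag) (p * 2 ^ τ + t) (b2n<2 tag))

    decTag-code : ∀ tag t p → decTag (code tag t p) ≡ tag
    decTag-code tag t p = trans (cong (_≡ᵇ 1) (trans (cong (_%% 2) (+-comm _ (b2n tag))) (%%-* (b2n tag) (p * 2 ^ τ + t) (b2n<2 tag)))) (tag≡ tag)
      where
      tag≡ : ∀ b → (b2n b ≡ᵇ 1) ≡ b
      tag≡ true = refl
      tag≡ false = refl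

    decLevel-code : ∀ tag {t} p → t < 2 ^ τ → decLevel (code tag t p) ≡ t
    decLevel-code tag {t} p t< = trans (cong (_%% 2 ^ τ) (trans (half≡ tag t p) (+-comm _ t))) (%%-* t p t<)

    decNode-code : ∀ tag {t} p → t < 2 ^ τ → decNode (code tag t p) ≡ p
    decNode-code tag {t} p t< = trans (cong (_// 2 ^ τ) (trans (half≡ tag t p) (+-comm _ t))) (//-* t p t<)

    code-< : ∀ tag {t p} ℓ → t < 2 ^ τ → p < 2 ^ ℓ → code tag t p < 2 ^ (ℓ + τ + 1)
    code-< tag {t} {p} ℓ t< p< = <-≤-trans (lin (p ∷ t ∷ b2n tag ∷ 2 ^ τ ∷ 2 ^ ℓ ∷ [])
      (con 1 :+ ((X0 :* X3 :+ X1) :* con 2 :+ X2) :≤ X4 :* X3 :* con 2)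
      (hyp (con 2 :* X3) (con 1 :+ X0 :≤ X4) p< ∷ hyp (con 2) (con 1 :+ X1 :≤ X3) t< ∷ hyp (con 1) (X2 :≤ con 1) (b2n-≤ tag) ∷ []) refl)
      (≤-reflexive (trans (cong (_* 2) (sym (pow-+ ℓ τ))) (sym (pow-+ (ℓ + τ) 1))))

  module Structure (χ : ℕ → Bool) (ℓ r S τ δ : ℕ) (ℓ<ρ : ℓ < 2 ^ (r * S)) (ℓ<τ : ℓ < 2 ^ τ) where

    open KeySet χ public
    open Levels ℓ r S ℓ<ρ public
    open Code τ public

    size D : ℕ
    size = c (2 ^ ℓ)
    D = 2 ^ δ

    count : ℕ → ℕ → ℕ
    count z t = Σ< (2 ^ t) (λ j → b2n (χ (z * 2 ^ t + j)))

    c-node : ∀ z t → c (suc z * 2 ^ t) ≡ c (z * 2 ^ t) + count z t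
    c-node z t = trans (cong c (+-comm (2 ^ t) (z * 2 ^ t))) (Σ<-split (z * 2 ^ t) (2 ^ t) (b2n ∘ χ))

    heavy? : ∀ z t → Dec (D < count z t)
    heavy? z t = D <? count z t

    -- The locator of a node is itself if it is heavy, and else its coarsest
    -- ancestor that is not heavy.
    locator? : ∀ p t i → Dec (D < count (p // 2 ^ suc i) (suc (t + i)) ⊎ ℓ ≤ t + i)
    locator? p t i = heavy? (p // 2 ^ suc i) (suc (t + i)) ⊎-dec (ℓ ≤? t + i)

    lift locLevel locNode : ℕ → ℕ → ℕ
    lift p t = least (locator? p t) (ℓ ∸ t)
    locLevel p t = t + lift p t
    locNode p t = p // 2 ^ lift p t

    base : Bool → ℕ → ℕ → ℕ
    base tag m q with heavy? q m
    ... | yes _ = rank tag q m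
    ... | no _ = c (q * 2 ^ m)

    v₁ v₂ : ℕ
    v₁ = τ + suc δ
    v₂ = bits size

    val₁ val₂ : ℕ → ℕ
    val₁ x = (locLevel p t ⊓ ℓ) + ((rank tag p t ∸ base tag (locLevel p t) (locNode p t)) ⊓ D) * 2 ^ τ
      where
      tag = decTag x
      t = decLevel x
      p = decNode x
    val₂ x = base (decTag x) (decLevel x) (decNode x) ⊓ size

    val₁-< : ∀ x → val₁ x < 2 ^ v₁
    val₁-< x = <-≤-trans (lin (m ∷ d ∷ 2 ^ τ ∷ D ∷ []) (con 1 :+ (X0 :+ X1 :* X2) :≤ X2 :* (con 2 :* X3))
      (hyp (con 1) (con 1 :+ X0 :≤ X2) (≤-<-trans (m⊓n≤n _ ℓ) ℓ<τ) ∷ hyp X2 (X1 :≤ X3) (m⊓n≤n _ D) ∷ hyp X2 (con 1 :≤ X3) (pow>0 δ) ∷ []) refl)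
      (≤-reflexive (sym (pow-+ τ (suc δ))))
      where
      tag = decTag x
      t = decLevel x
      p = decNode x
      m = locLevel p t ⊓ ℓ
      d = (rank tag p t ∸ base tag (locLevel p t) (locNode p t)) ⊓ D

    val₂-< : ∀ x → val₂ x < 2 ^ v₂
    val₂-< x = ≤-<-trans (m⊓n≤n _ size) (<-bits size)

    handlesAt : Bool → ℕ → ℕ → List ℕ
    handlesAt tag x t = code tag t (x // 2 ^ t) ∷ []

    handlesOf : Bool → ℕ → List ℕ
    handlesOf tag x = flat (filed (coarsest ℓ tag x)) (handlesAt tag x)

    handlesBoth : ℕ → List ℕ
    handlesBoth x = if χ x then handlesOf false x ++ handlesOf true x else []

    handles : List ℕ
    handles = flat (range (2 ^ ℓ)) handlesBoth

    children : ℕ → ℕ → List ℕ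
    children t z with heavy? z (suc t)
    ... | yes _ = code false t (2 * z) ∷ code false t (1 + 2 * z) ∷ code true t (2 * z) ∷ code true t (1 + 2 * z) ∷ []
    ... | no _ = []

    childrenAt : ℕ → List ℕ
    childrenAt t = flat (range (2 ^ (ℓ ∸ suc t))) (children t)

    locators : List ℕ
    locators = code false ℓ 0 ∷ code true ℓ 0 ∷ flat (range ℓ) childrenAt

    κ : ℕ
    κ = ℓ + τ + 1

    ≤ℓ⇒<τ : ∀ {t} → t ≤ ℓ → t < 2 ^ τ
    ≤ℓ⇒<τ t≤ℓ = ≤-<-trans t≤ℓ ℓ<τ

    handles-< : ∀ {y} → y ∈ handles → y < 2 ^ κ
    handles-< = flat-all {range (2 ^ ℓ)} handlesBoth {λ y → y < 2 ^ κ} (λ {x} x∈ → both (χ x) (range-< x∈))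
      where
      one : ∀ tag {x} → x < 2 ^ ℓ → ∀ {y} → y ∈ handlesOf tag x → y < 2 ^ κ
      one tag {x} x< = flat-all {filed (coarsest ℓ tag x)} (handlesAt tag x) {λ y → y < 2 ^ κ} (λ {t} t∈ → λ { (here refl) →
        code-< tag ℓ (≤ℓ⇒<τ (≤-trans (filed-≤ _ t∈) (coarsest-≤ ℓ tag x))) (≤-<-trans (//-≤ x (2 ^ t)) x<) })
      both : ∀ b {x} → x < 2 ^ ℓ → ∀ {y} → y ∈ (if b then handlesOf false x ++ handlesOf true x else []) → y < 2 ^ κ
      both true {x} x< y∈ = [ one false x< , one true x< ]′ (∈-++⁻ (handlesOf false x) y∈)

    locators-< : ∀ {y} → y ∈ locators → y < 2 ^ κ
    locators-< (here refl) = code-< false ℓ ℓ<τ (pow>0 ℓ)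
    locators-< (there (here refl)) = code-< true ℓ ℓ<τ (pow>0 ℓ)
    locators-< (there (there y∈)) = flat-all {range ℓ} childrenAt {λ y → y < 2 ^ κ} (λ {t} t∈ →
      flat-all {range (2 ^ (ℓ ∸ suc t))} (children t) {λ y → y < 2 ^ κ} (λ {z} z∈ → child t z (range-< t∈) (range-< z∈))) y∈
      where
      child : ∀ t z → t < ℓ → z < 2 ^ (ℓ ∸ suc t) → ∀ {y} → y ∈ children t z → y < 2 ^ κ
      child t z t< z< y∈ with heavy? z (suc t)
      ... | yes _ = pick y∈
        where
        z′< : 1 + 2 * z < 2 ^ ℓ
        z′< = <-≤-trans (lin (z ∷ 2 ^ (ℓ ∸ suc t) ∷ []) (con 1 :+ (con 1 :+ con 2 :* X0) :≤ con 2 :* X1) (hyp (con 2) (con 1 :+ X0 :≤ X1) z< ∷ []) refl)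
          (pow-mono {suc (ℓ ∸ suc t)} (≤-trans (≤-reflexive (sym (+-∸-assoc 1 t<))) (m∸n≤m ℓ t)))
        z″< : 2 * z < 2 ^ ℓ
        z″< = <-trans (n<1+n _) z′<
        t<τ = ≤ℓ⇒<τ (<⇒≤ t<)
        pick : ∀ {y} → y ∈ code false t (2 * z) ∷ code false t (1 + 2 * z) ∷ code true t (2 * z) ∷ code true t (1 + 2 * z) ∷ [] → y < 2 ^ κ
        pick (here refl) = code-< false ℓ t<τ z″<
        pick (there (here refl)) = code-< false ℓ t<τ z′<
        pick (there (there (here refl))) = code-< true ℓ t<τ z″<
        pick (there (there (there (here refl)))) = code-< true ℓ t<τ z′<

    length-handles : length handles ≤ size * (2 * (1 + suc S * 2 ^ r))
    length-handles = ≤-trans (≤-reflexive (trans (length-flat (range (2 ^ ℓ)) handlesBoth) (∑-range (2 ^ ℓ) (length ∘ handlesBoth))))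
      (≤-trans (Σ<-mono (2 ^ ℓ) (λ x _ → each x (χ x))) (≤-reflexive (Σ<-*ʳ (2 ^ ℓ) (2 * L) (b2n ∘ χ))))
      where
      L = 1 + suc S * 2 ^ r
      one : ∀ tag x → length (handlesOf tag x) ≡ L
      one tag x = trans (length-flat (filed (coarsest ℓ tag x)) (handlesAt tag x)) (trans (∑-const (filed (coarsest ℓ tag x)) 1) (trans (*-identityʳ _) (length-filed _)))
      each : ∀ x b → length (if b then handlesOf false x ++ handlesOf true x else []) ≤ b2n b * (2 * L)
      each x true = ≤-reflexive (trans (length-++ (handlesOf false x)) (trans (cong₂ _+_ (one false x) (one true x))
        (ring (L ∷ []) (X0 :+ X0) (con 1 :* (con 2 :* X0)) refl refl)))
      each x false = z≤n

    Σ-count : ∀ {t} → t ≤ ℓ → Σ< (2 ^ (ℓ ∸ t)) (λ z → count z t) ≡ size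
    Σ-count {t} t≤ℓ = trans (sym (Σ<-blocks (2 ^ (ℓ ∸ t)) (2 ^ t) (b2n ∘ χ))) (cong c (sym (pow-split t≤ℓ)))

    length-locators : length locators * D ≤ 2 * D + 4 * (ℓ * size)
    length-locators = begin
      length locators * D ≡⟨ cong (λ n → (2 + n) * D) (trans (length-flat (range ℓ) childrenAt) (∑-range ℓ (length ∘ childrenAt))) ⟩
      (2 + Σ< ℓ (length ∘ childrenAt)) * D ≡⟨ *-distribʳ-+ D 2 (Σ< ℓ (length ∘ childrenAt)) ⟩
      2 * D + Σ< ℓ (length ∘ childrenAt) * D ≡⟨ cong (2 * D +_) (Σ<-*ʳ ℓ D (length ∘ childrenAt)) ⟨
      2 * D + Σ< ℓ (λ t → length (childrenAt t) * D) ≤⟨ +-monoʳ-≤ (2 * D) (≤-trans (Σ<-mono ℓ (λ t t< → level t t<)) (≤-reflexive (Σ<-const ℓ (4 * size)))) ⟩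
      2 * D + ℓ * (4 * size) ≡⟨ cong (2 * D +_) (ring (ℓ ∷ size ∷ []) (X0 :* (con 4 :* X1)) (con 4 :* (X0 :* X1)) refl refl) ⟩
      2 * D + 4 * (ℓ * size) ∎
      where
      open ≤-Reasoning
      node : ∀ t z → length (children t z) * D ≤ 4 * count z (suc t)
      node t z with heavy? z (suc t)
      ... | yes h = *-monoʳ-≤ 4 (<⇒≤ h)
      ... | no _ = z≤n
      level : ∀ t → t < ℓ → length (childrenAt t) * D ≤ 4 * size
      level t t< = begin
        length (childrenAt t) * D ≡⟨ cong (_* D) (trans (length-flat (range n) (children t)) (∑-range n (length ∘ children t))) ⟩
        Σ< n (length ∘ children t) * D ≡⟨ Σ<-*ʳ n D (length ∘ children t) ⟨
        Σ< n (λ z → length (children t z) * D) ≤⟨ Σ<-mono n (λ z _ → node t z) ⟩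
        Σ< n (λ z → 4 * count z (suc t)) ≡⟨ Σ<-*ˡ n 4 (λ z → count z (suc t)) ⟩
        4 * Σ< n (λ z → count z (suc t)) ≡⟨ cong (4 *_) (Σ-count t<) ⟩
        4 * size ∎
        where n = 2 ^ (ℓ ∸ suc t)

    module Located {tag x t} (ex : χ x ≡ true) (x< : x < 2 ^ ℓ) (t≤ℓ : t ≤ ℓ) (ext : Extreme tag x t) where

      p i m q : ℕ
      p = x // 2 ^ t
      i = lift p t
      m = locLevel p t
      q = locNode p t

      m≤ℓ : m ≤ ℓ
      m≤ℓ = ≤-trans (+-monoʳ-≤ t (least-≤ (locator? p t) (ℓ ∸ t))) (≤-reflexive (m+[n∸m]≡n t≤ℓ))

      q≡ : q ≡ x // 2 ^ m
      q≡ = trans (sym (//-// x (pow>0 t) (pow>0 i))) (cong (x //_) (sym (pow-+ t i)))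

      private
        found : D < count (p // 2 ^ suc i) (suc m) ⊎ ℓ ≤ m
        found = least-holds (locator? p t) (ℓ ∸ t) (inj₂ (≤-reflexive (sym (m+[n∸m]≡n t≤ℓ))))

        q//2 : p // 2 ^ suc i ≡ q // 2
        q//2 = trans (cong (p //_) (*-comm 2 (2 ^ i))) (//-// p (pow>0 i) (z<s {1}))

        heavy-self : D < count q m → m ≡ t × q ≡ p
        heavy-self h = mt , trans q≡ (cong (λ j → x // 2 ^ j) mt)
          where
          i≡0 : i ≡ 0
          i≡0 = stop i refl
            where
            stop : ∀ j → i ≡ j → i ≡ 0
            stop zero e≡ = e≡
            stop (suc j) e≡ = ⊥-elim (<-irrefl refl (≤-trans (≤-reflexive (sym e≡)) (least-min (locator? p t) (ℓ ∸ t) {j}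
              (inj₁ (subst₂ (λ a b → D < count a b) (cong (λ n → p // 2 ^ n) e≡) (trans (cong (t +_) e≡) (+-suc t j)) h)))))
          mt : m ≡ t
          mt = trans (cong (t +_) i≡0) (+-identityʳ t)

      base-cases : base tag m q ≡ c x ⊎ (base tag m q ≡ c (q * 2 ^ m) × count q m ≤ D)
      base-cases with heavy? q m
      ... | yes h = inj₁ (trans (cong₂ (rank tag) (proj₂ (heavy-self h)) (proj₁ (heavy-self h))) ext)
      ... | no nh = inj₂ (refl , ≮⇒≥ nh)

      base≤ : base tag m q ≤ c x
      base≤ with base-cases
      ... | inj₁ e≡ = ≤-reflexive e≡
      ... | inj₂ (e≡ , _) = ≤-trans (≤-reflexive e≡) (c-mono (subst (λ z → z * 2 ^ m ≤ x) (sym q≡) (node-lower x m)))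

      offset≤ : c x ∸ base tag m q ≤ D
      offset≤ with base-cases
      ... | inj₁ e≡ = ≤-trans (≤-reflexive (m≤n⇒m∸n≡0 (≤-reflexive (sym e≡)))) z≤n
      ... | inj₂ (e≡ , light) = ≤-trans (≤-reflexive (cong (c x ∸_) e≡)) (≤-trans
            (∸-monoˡ-≤ (c (q * 2 ^ m)) (≤-trans (c-mono (<⇒≤ (subst (λ z → x < suc z * 2 ^ m) (sym q≡) (node-upper x m)))) (≤-reflexive (c-node q m))))
            (≤-trans (≤-reflexive (m+n∸m≡n (c (q * 2 ^ m)) (count q m))) light))

      c≤size : c x ≤ size
      c≤size = c-mono (<⇒≤ x<)

      val₁-handle : val₁ (code tag t p) ≡ m + (c x ∸ base tag m q) * 2 ^ τ
      val₁-handle rewrite decTag-code tag t p | decLevel-code tag {t} p (≤ℓ⇒<τ t≤ℓ) | decNode-code tag {t} p (≤ℓ⇒<τ t≤ℓ) | ext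
        | m≤n⇒m⊓n≡m m≤ℓ | m≤n⇒m⊓n≡m offset≤ = refl

      val₂-locator : val₂ (code tag m q) ≡ base tag m q
      val₂-locator rewrite decTag-code tag m q | decLevel-code tag {m} q (≤ℓ⇒<τ m≤ℓ) | decNode-code tag {m} q (≤ℓ⇒<τ m≤ℓ)
        = m≤n⇒m⊓n≡m (≤-trans base≤ c≤size)

      handle-∈ : t ∈ filed (coarsest ℓ tag x) → code tag t p ∈ handles
      handle-∈ t∈ = ∈-flat handlesBoth (∈-range x<) (subst (λ b → code tag t p ∈ (if b then handlesOf false x ++ handlesOf true x else [])) (sym ex) (side tag (∈-flat (handlesAt tag x) t∈ (here refl))))
        where
        side : ∀ tag′ {y} → y ∈ handlesOf tag′ x → y ∈ handlesOf false x ++ handlesOf true x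
        side false y∈ = ∈-++⁺ˡ y∈
        side true y∈ = ∈-++⁺ʳ (handlesOf false x) y∈

      locator-∈ : code tag m q ∈ locators
      locator-∈ with m <? ℓ
      ... | no m≮ℓ = subst₂ (λ a b → code tag a b ∈ locators) (≤-antisym (≮⇒≥ m≮ℓ) m≤ℓ) (sym q≡0) (root tag)
        where
        root : ∀ tag → code tag ℓ 0 ∈ locators
        root false = here refl
        root true = there (here refl)
        q≡0 : q ≡ 0
        q≡0 = trans q≡ (//-small (<-≤-trans x< (pow-mono (≮⇒≥ m≮ℓ))))
      ... | yes m<ℓ = there (there (∈-flat childrenAt (∈-range m<ℓ) (∈-flat (children m) (∈-range parent<) child)))
        where
        parent-heavy : D < count (q // 2) (suc m)
        parent-heavy = [ subst (λ z → D < count z (suc m)) q//2 , (λ ℓ≤m → ⊥-elim (<-irrefl refl (<-≤-trans m<ℓ ℓ≤m))) ]′ found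
        parent< : q // 2 < 2 ^ (ℓ ∸ suc m)
        parent< = <-*⇒//-< (subst (_< 2 ^ (ℓ ∸ suc m) * 2) (sym q≡) (<-*⇒//-< {2 ^ (ℓ ∸ suc m) * 2} {x} {2 ^ m}
          (<-≤-trans x< (≤-reflexive (trans (pow-split m<ℓ) (sym (*-assoc (2 ^ (ℓ ∸ suc m)) 2 (2 ^ m))))))))
        parity≡ : q ≡ 2 * (q // 2) ⊎ q ≡ 1 + 2 * (q // 2)
        parity≡ with q %% 2 | %%-< q {2} z<s | div-mod q {2} z<s
        ... | 0 | _ | e≡ = inj₁ (trans e≡ (*-comm (q // 2) 2))
        ... | 1 | _ | e≡ = inj₂ (trans e≡ (cong suc (*-comm (q // 2) 2)))
        ... | suc (suc _) | s≤s (s≤s ()) | _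
        child : code tag m q ∈ children m (q // 2)
        child with heavy? (q // 2) (suc m)
        ... | no nh = ⊥-elim (nh parent-heavy)
        ... | yes _ = pick tag parity≡
          where
          z = q // 2
          pick : ∀ tag → q ≡ 2 * z ⊎ q ≡ 1 + 2 * z → code tag m q ∈ code false m (2 * z) ∷ code false m (1 + 2 * z) ∷ code true m (2 * z) ∷ code true m (1 + 2 * z) ∷ []
          pick false (inj₁ e) = here (cong (code false m) e)
          pick false (inj₂ e) = there (here (cong (code false m) e))
          pick true (inj₁ e) = there (there (here (cong (code true m) e)))
          pick true (inj₂ e) = there (there (there (here (cong (code true m) e))))

open Landmarks

open import Data.List using (map)
open import Data.List.Membership.Propositional using (_∈_)

module BucketBits (χ : ℕ → Bool) (ℓ r S τ δ f : ℕ) (ℓ<ρ : ℓ < 2 ^ (r * S)) (ℓ<τ : ℓ < 2 ^ τ) where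

  open Structure χ ℓ r S τ δ ℓ<ρ ℓ<τ public

  hs ls : List ℕ
  hs = distinct handles
  ls = distinct locators

  hs-< : ∀ {x} → x ∈ hs → x < 2 ^ κ
  hs-< = handles-< ∘ distinct-∈ handles
  ls-< : ∀ {x} → x ∈ ls → x < 2 ^ κ
  ls-< = locators-< ∘ distinct-∈ locators

  module R₁ = Retrieval κ hs hs-< (distinct-unique handles) v₁ val₁ (λ {x} _ → val₁-< x) f
  module R₂ = Retrieval κ ls ls-< (distinct-unique locators) v₂ val₂ (λ {x} _ → val₂-< x) f

  keyBits : ℕ → Bits
  keyBits y = if χ y then enc ℓ y else []

  keys : Bits
  keys = cat (2 ^ ℓ) keyBits

  tableBits : ℕ → Bits
  tableBits zero = R₁.retrieval
  tableBits (suc _) = R₂.retrieval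

  module Tables = Parr f 2 tableBits

  opaque
    bucketBits : Bits
    bucketBits = enc f v₂ ++ (enc v₂ size ++ (keys ++ Tables.parr))

    bucketBits-def : bucketBits ≡ enc f v₂ ++ (enc v₂ size ++ (keys ++ Tables.parr))
    bucketBits-def = refl

  Σ-keyBits : ∀ n → Σ< n (length ∘ keyBits) ≡ c n * ℓ
  Σ-keyBits n = trans (Σ<-cong n (λ y _ → each y (χ y))) (Σ<-*ʳ n ℓ (b2n ∘ χ))
    where
    each : ∀ y b → length (if b then enc ℓ y else []) ≡ b2n b * ℓ
    each y true = trans (length-enc ℓ y) (sym (+-identityʳ ℓ))
    each y false = refl

  length-keys : length keys ≡ size * ℓ
  length-keys = trans (length-cat (2 ^ ℓ) keyBits) (Σ-keyBits (2 ^ ℓ))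

  size≤ : size ≤ 2 ^ ℓ
  size≤ = ≤-trans (Σ<-mono (2 ^ ℓ) (λ x _ → b2n-≤ (χ x))) (≤-reflexive (trans (Σ<-const (2 ^ ℓ) 1) (*-identityʳ _)))

  v₂≤ : v₂ ≤ suc ℓ
  v₂≤ = bits-≤ (≤-<-trans size≤ (pow-mono-< (n<1+n ℓ)))

  N₁≤ : R₁.N ≤ size * (2 * (1 + suc S * 2 ^ r))
  N₁≤ = ≤-trans (length-distinct handles) length-handles

  N₂≤ : R₂.N * D ≤ 2 * D + 4 * (ℓ * size)
  N₂≤ = ≤-trans (*-monoˡ-≤ D (length-distinct locators)) length-locators

  module Sizes (κ≤ : bits κ ≤ f) (Nₘ V : ℕ) (N₁≤Nₘ : R₁.N ≤ Nₘ) (N₂≤Nₘ : R₂.N ≤ Nₘ) (v₁≤V : v₁ ≤ V) (v₂≤V : v₂ ≤ V)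
    (hash-fits : bits (8 * suc (Nₘ * (Nₘ * suc κ))) < 2 ^ f)
    (total-fits : 3 * bits (2 + f + c₀ * (2 * ((1 + f + V) * (1 + Nₘ)))) < 2 ^ f) where

    module Z₁ = R₁.Size κ≤
    module Z₂ = R₂.Size κ≤

    private
      Bm : ℕ
      Bm = (1 + f + V) * (1 + Nₘ)
      part≤ : ∀ {v N} → v ≤ V → N ≤ Nₘ → (1 + f + v) * (1 + N) ≤ Bm
      part≤ v≤ N≤ = *-mono-≤ (+-monoʳ-≤ (1 + f) v≤) (s≤s N≤)
      B≤ : ∀ {x} → x ≤ Bm → c₀ * x ≤ 2 + f + c₀ * (2 * Bm)
      B≤ {x} h = lin (x ∷ Bm ∷ f ∷ c₀ ∷ []) (X3 :* X0 :≤ con 2 :+ X2 :+ X3 :* (con 2 :* X1)) (hyp X3 (X0 :≤ X1) h ∷ []) refl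
      hash≤ : ∀ {N} → N ≤ Nₘ → bits (8 * suc (N * (N * suc κ))) < 2 ^ f
      hash≤ N≤ = ≤-<-trans (bits-mono (*-monoʳ-≤ 8 (s≤s (*-mono-≤ N≤ (*-monoˡ-≤ (suc κ) N≤))))) hash-fits

    fits₁ : 3 * bits Z₁.bound < 2 ^ f
    fits₁ = ≤-<-trans (*-monoʳ-≤ 3 (bits-mono {Z₁.bound} (B≤ {(1 + f + v₁) * (1 + R₁.N)} (part≤ v₁≤V N₁≤Nₘ)))) total-fits
    fits₂ : 3 * bits Z₂.bound < 2 ^ f
    fits₂ = ≤-<-trans (*-monoʳ-≤ 3 (bits-mono {Z₂.bound} (B≤ {(1 + f + v₂) * (1 + R₂.N)} (part≤ v₂≤V N₂≤Nₘ)))) total-fits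

    narrow₁ : R₁.Narrow
    narrow₁ = Z₁.narrow′ fits₁
    narrow₂ : R₂.Narrow
    narrow₂ = Z₂.narrow′ fits₂

    widths₁ : bits (8 * suc (R₁.N * (R₁.N * suc κ))) < 2 ^ f
    widths₁ = hash≤ N₁≤Nₘ
    widths₂ : bits (8 * suc (R₂.N * (R₂.N * suc κ))) < 2 ^ f
    widths₂ = hash≤ N₂≤Nₘ

    tables≤ : Tables.total ≤ f + 2 + (Z₁.bound + Z₂.bound)
    tables≤ = +-monoʳ-≤ (f + 2) (+-mono-≤ (Z₁.length-retrieval fits₁) (Z₂.length-retrieval fits₂))

    tables-width : Tables.width < 2 ^ f
    tables-width = ≤-<-trans (*-monoʳ-≤ 3 (bits-mono (≤-trans tables≤
      (lin (f ∷ ((1 + f + v₁) * (1 + R₁.N)) ∷ ((1 + f + v₂) * (1 + R₂.N)) ∷ Bm ∷ c₀ ∷ [])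
        (X0 :+ con 2 :+ (X4 :* X1 :+ X4 :* X2) :≤ con 2 :+ X0 :+ X4 :* (con 2 :* X3))
        (hyp X4 (X1 :≤ X3) (part≤ v₁≤V N₁≤Nₘ) ∷ hyp X4 (X2 :≤ X3) (part≤ v₂≤V N₂≤Nₘ) ∷ []) refl)))) total-fits

    length-bucketBits : length bucketBits ≤ size * ℓ + (2 * f + v₂ + 7 * (f + 2 + (Z₁.bound + Z₂.bound)))
    length-bucketBits = begin
      length bucketBits ≡⟨ trans (cong length bucketBits-def) (trans (length-++ (enc f v₂)) (cong₂ _+_ (length-enc f v₂) (trans (length-++ (enc v₂ size)) (cong₂ _+_ (length-enc v₂ size)
                             (trans (length-++ keys) (cong₂ _+_ length-keys Tables.length-parr)))))) ⟩
      f + (v₂ + (size * ℓ + (f + (2 * (3 * bits Tables.total) + T₀))))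
        ≤⟨ lin (f ∷ v₂ ∷ size * ℓ ∷ bits Tables.total ∷ T₀ ∷ Tables.total ∷ B ∷ [])
             (X0 :+ (X1 :+ (X2 :+ (X0 :+ (con 2 :* (con 3 :* X3) :+ X4)))) :≤ X2 :+ (con 2 :* X0 :+ X1 :+ con 7 :* (X0 :+ con 2 :+ X6)))
             (hyp (con 6) (X3 :≤ X5) (bits≤ Tables.total) ∷ hyp (con 1) (X0 :+ con 2 :+ X4 :≤ X0 :+ con 2 :+ X6) tables≤ ∷ hyp (con 6) (X5 :≤ X0 :+ con 2 :+ X6) tables≤ ∷ []) refl ⟩
      size * ℓ + (2 * f + v₂ + 7 * (f + 2 + B)) ∎
      where
      open ≤-Reasoning
      T₀ = Σ< 2 (length ∘ tableBits)
      B = Z₁.bound + Z₂.bound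

<ᵇ-true : ∀ {m n} → m < n → (m <ᵇ n) ≡ true
<ᵇ-true {m} {n} h with m <ᵇ n | <⇒<ᵇ h
... | true | _ = refl

<ᵇ-false : ∀ {m n} → n ≤ m → (m <ᵇ n) ≡ false
<ᵇ-false {m} {n} h with m <ᵇ n in e
... | false = refl
... | true = ⊥-elim (<-irrefl refl (<-≤-trans (<ᵇ⇒< m n (subst T (sym e) tt)) h))

<ᵇ-true⁻ : ∀ {m n} → (m <ᵇ n) ≡ true → m < n
<ᵇ-true⁻ {m} {n} e = <ᵇ⇒< m n (subst T (sym e) tt)

<ᵇ-false⁻ : ∀ {m n} → (m <ᵇ n) ≡ false → n ≤ m
<ᵇ-false⁻ {m} {n} e with m <? n
... | yes h = ⊥-elim (λ₁ (trans (sym (<ᵇ-true h)) e))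
  where
  λ₁ : true ≢ false
  λ₁ ()
... | no h = ≮⇒≥ h

∨-introˡ : ∀ {a} b → a ≡ true → a ∨ b ≡ true
∨-introˡ b refl = refl

∨-introʳ : ∀ a {b} → b ≡ true → a ∨ b ≡ true
∨-introʳ true h = refl
∨-introʳ false h = h

∨-elim : ∀ a {b} {P : Set} → (a ≡ true → P) → (b ≡ true → P) → a ∨ b ≡ true → P
∨-elim true f g h = f refl
∨-elim false f g h = g h

∧-elimˡ : ∀ a {b} → a ∧ b ≡ true → a ≡ true
∧-elimˡ true h = refl

∧-elimʳ : ∀ a {b} → a ∧ b ≡ true → b ≡ true
∧-elimʳ true h = h

∧-intro : ∀ {a b} → a ≡ true → b ≡ true → a ∧ b ≡ true
∧-intro refl refl = refl

not-true : ∀ {a} → not a ≡ true → a ≡ false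
not-true {false} h = refl

module _ {k : ℕ} where

  opaque
    minE orE : Expr k → Expr k → Expr k
    minE x y = add′ (mul′ (lt′ y x) y) (mul′ (sub′ (lit 1) (lt′ y x)) x)
    orE x y = lt′ (lit 0) (add′ x y)

    notE : Expr k → Expr k
    notE x = sub′ (lit 1) x

    selectE : Expr k → Expr k → Expr k → Expr k
    selectE c x y = add′ (mul′ c x) (mul′ (notE c) y)

  anyE : ℕ → (ℕ → Expr k) → Expr k
  anyE zero e = lit 0
  anyE (suc n) e = orE (e n) (anyE n e)

  module BucketE (W fE ℓE τE rE v₁E : Expr k) (S : ℕ) where

    opaque
      codeE : Bool → Expr k → Expr k → Expr k
      codeE tag t p = add′ (mul′ (add′ (mul′ p (pow′ τE)) t) (lit 2)) (lit (b2n tag))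

      stepE : ℕ → Expr k
      stepE j = pow′ (mul′ rE (lit j))

      roundE : Expr k → ℕ → Expr k
      roundE t j = minE (mul′ (div′ (sub′ (add′ t (stepE j)) (lit 1)) (stepE j)) (stepE j)) ℓE

      ancestorE : Expr k → Expr k → Expr k → Expr k
      ancestorE p t t′ = div′ p (pow′ (sub′ t′ t))

      levelE offsetE : Expr k → Expr k
      levelE a = rem′ a (pow′ τE)
      offsetE a = div′ a (pow′ τE)

    module _ (pos : Expr k) where

      opaque
        widthE sizeE keysE tablesE : Expr k
        widthE = rd W pos fE
        sizeE = rd W (add′ pos fE) widthE
        keysE = add′ (add′ pos fE) widthE
        tablesE = add′ keysE (mul′ sizeE ℓE)

        tableE : ℕ → Expr k
        tableE i = parrE W fE tablesE (lit i)

        fileE baseE locationE : Bool → Expr k → Expr k → Expr k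
        fileE tag t p = retE W fE v₁E (tableE 0) (codeE tag t p)
        baseE tag t p = retE W fE widthE (tableE 1) (codeE tag t p)
        locationE tag t p = add′ (baseE tag (levelE (fileE tag t p)) (ancestorE p t (levelE (fileE tag t p)))) (offsetE (fileE tag t p))

        keyE : Expr k → Expr k
        keyE e = rd W (add′ keysE (mul′ (rem′ e sizeE) ℓE)) ℓE

        testE : Expr k → Expr k → Expr k → Expr k
        testE lo hi e = mul′ (lt′ (lit 0) sizeE) (mul′ (notE (lt′ (keyE e) lo)) (notE (lt′ hi (keyE e))))

        candidateE : Bool → Expr k → Expr k → Expr k → Expr k → ℕ → Expr k
        candidateE tag t p lo hi j = testE lo hi (locationE tag (roundE t j) (ancestorE p t (roundE t j)))

        nodeE : Bool → Expr k → Expr k → Expr k → Expr k → Expr k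
        nodeE tag t p lo hi = anyE (suc S) (candidateE tag t p lo hi)

        bucketE : Expr k → Expr k → Expr k → Expr k
        bucketE t lo hi = orE (nodeE true t (div′ lo (pow′ t)) lo hi)
          (orE (nodeE false t (div′ hi (pow′ t)) lo hi) (nodeE false t (add′ (div′ lo (pow′ t)) (lit 1)) lo hi))

module Logic {k : ℕ} (u : ℕ) (u>0 : 0 < u) (R : Fin k → Word (F * u)) (β : ℕ → Bool) where

  open Semantics u u>0 R β

  private variable
    e e₁ e₂ : Expr k

  ⇓bool : ∀ {x i} b → x ≡ b2n b → e ⇓ x ∶ i → e ⇓ b2n b ∶ 1
  ⇓bool b refl h = rebound h (≤-<-trans (b2n-≤ b) 1<2^u)

  opaque
    unfolding minE orE notE selectE

    ⇓or : ∀ {a b} → e₁ ⇓ b2n a ∶ 1 → e₂ ⇓ b2n b ∶ 1 → orE e₁ e₂ ⇓ b2n (a ∨ b) ∶ 1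
    ⇓or {a = a} {b} h₁ h₂ = ⇓bool (a ∨ b) (same a b) (⇓lt (⇓lit 0) (⇓add h₁ h₂))
      where
      same : ∀ a b → b2n (0 <ᵇ b2n a + b2n b) ≡ b2n (a ∨ b)
      same true b = refl
      same false true = refl
      same false false = refl

    ⇓and : ∀ {a b} → e₁ ⇓ b2n a ∶ 1 → e₂ ⇓ b2n b ∶ 1 → mul′ e₁ e₂ ⇓ b2n (a ∧ b) ∶ 1
    ⇓and {a = a} {b} h₁ h₂ = ⇓bool (a ∧ b) (same a b) (⇓mul h₁ h₂)
      where
      same : ∀ a b → b2n a * b2n b ≡ b2n (a ∧ b)
      same true b = +-identityʳ (b2n b)
      same false b = refl

    ⇓not : ∀ {a} → e ⇓ b2n a ∶ 1 → notE e ⇓ b2n (not a) ∶ 1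
    ⇓not {a = a} h = ⇓bool (not a) (same a) (⇓sub (b2n-≤ a) (⇓lit 1) h)
      where
      same : ∀ a → 1 ∸ b2n a ≡ b2n (not a)
      same true = refl
      same false = refl

    ⇓select : ∀ {x y i j} b → {_ : True (suc (suc i ⊔ suc j) ≤? F)} {_ : True (suc i ≤? F)} {_ : True (suc j ≤? F)} →
      e ⇓ b2n b ∶ 1 → e₁ ⇓ x ∶ i → e₂ ⇓ y ∶ j →
      selectE e e₁ e₂ ⇓ (if b then x else y) ∶ suc (suc i ⊔ suc j)
    ⇓select {x = x} {y} b {p} {p₁} {p₂} h h₁ h₂ = cast (same b) (⇓add (⇓mul h h₁ {p₁}) (⇓mul (⇓not h) h₂ {p₂}) {p})
      where
      same : ∀ b → b2n b * x + b2n (not b) * y ≡ (if b then x else y)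
      same true = trans (+-identityʳ _) (+-identityʳ x)
      same false = +-identityʳ y

    ⇓min : ∀ {x y i} → {_ : True (suc (suc 1 ⊔ suc i) ≤? F)} {_ : True (suc i ≤? F)} → e₁ ⇓ x ∶ i → e₂ ⇓ y ∶ 1 → minE e₁ e₂ ⇓ x ⊓ y ∶ 1
    ⇓min {x = x} {y} {i} {p} {p₁} h₁ h₂ = cast same (rebound (⇓select (y <ᵇ x) {p} {tt} {p₁} (⇓lt h₂ h₁) h₂ h₁) (≤-<-trans (≤-trans (≤-reflexive same) (m⊓n≤n x y)) (bnd h₂)))
      where
      same : (if y <ᵇ x then y else x) ≡ x ⊓ y
      same with y <ᵇ x in e
      ... | true = sym (m≥n⇒m⊓n≡n (<⇒≤ (<ᵇ-true⁻ {y} e)))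
      ... | false = sym (m≤n⇒m⊓n≡m (<ᵇ-false⁻ {y} e))

  record Decides (e : Expr k) (Sound Complete : Set) : Set where
    constructor decides
    field
      answer : Bool
      evaluate : e ⇓ b2n answer ∶ 1
      sound : answer ≡ true → Sound
      complete : Complete → answer ≡ true

  private variable
    P Q Q′ : Set

  or-decides : Decides e₁ P Q → Decides e₂ P Q′ → Decides (orE e₁ e₂) P (Q ⊎ Q′)
  or-decides (decides a h s c) (decides a′ h′ s′ c′) =
    decides (a ∨ a′) (⇓or h h′) (∨-elim a s s′) [ ∨-introˡ a′ ∘ c , ∨-introʳ a ∘ c′ ]′

  any-decides : ∀ n (es : ℕ → Expr k) {Qs : ℕ → Set} → (∀ j → j < n → Decides (es j) P (Qs j)) →
    Decides (anyE n es) P (∃[ j ] (j < n × Qs j))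
  any-decides zero es h = decides false (raise (⇓lit 0)) (λ ()) (λ { (_ , () , _) })
  any-decides {P = P} (suc n) es {Qs} h = weaken (or-decides (h n (n<1+n n)) (any-decides n es (λ j j<n → h j (m<n⇒m<1+n j<n))))
    where
    weaken : ∀ {e} → Decides e P (Qs n ⊎ (∃[ j ] (j < n × Qs j))) → Decides e P (∃[ j ] (j < suc n × Qs j))
    weaken (decides a v s c) = decides a v s λ { (j , j< , q) → c (split j j< q) }
      where
      split : ∀ j → j < suc n → Qs j → Qs n ⊎ (∃[ j ] (j < n × Qs j))
      split j j< q with j ≟ n
      ... | yes refl = inj₁ q
      ... | no j≢n = inj₂ (j , ≤∧≢⇒< (s≤s⁻¹ j<) j≢n , q)

  refine : Decides e P Q → (Q′ → Q) → Decides e P Q′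
  refine (decides a v s c) f = decides a v s (c ∘ f)

module Interval (χ : ℕ → Bool) (ℓ : ℕ) where

  open KeySet χ

  Hit : ℕ → ℕ → Set
  Hit lo hi = ∃[ x ] (x < 2 ^ ℓ × χ x ≡ true × lo ≤ x × x ≤ hi)

  next-node< : ∀ {lo hi} t → lo ≤ hi → hi < 2 ^ ℓ → lo // 2 ^ t + 1 < 2 ^ suc ℓ
  next-node< {lo} t lo≤hi hi< = begin-strict
    lo // 2 ^ t + 1 ≤⟨ +-monoˡ-≤ 1 (//-≤ lo (2 ^ t)) ⟩
    lo + 1 ≡⟨ +-comm lo 1 ⟩
    suc lo ≤⟨ ≤-<-trans lo≤hi hi< ⟩
    2 ^ ℓ <⟨ pow-mono-< (n<1+n ℓ) ⟩
    2 ^ suc ℓ ∎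
    where open ≤-Reasoning

  -- An interval of length about 2 ^ t meets at most three nodes of level t.
  three-nodes : ∀ {lo hi t} → t ≤ ℓ → lo ≤ hi → hi < 2 ^ ℓ → hi ∸ lo < 2 * 2 ^ t → (t ≡ 0 ⊎ 2 ^ t ≤ hi ∸ lo) → Hit lo hi →
    (∃[ x ] (x < 2 ^ ℓ × χ x ≡ true × x // 2 ^ t ≡ lo // 2 ^ t × Extreme true x t × lo ≤ x × x ≤ hi)) ⊎
    ((∃[ x ] (x < 2 ^ ℓ × χ x ≡ true × x // 2 ^ t ≡ hi // 2 ^ t × Extreme false x t × lo ≤ x × x ≤ hi)) ⊎
     (∃[ x ] (x < 2 ^ ℓ × χ x ≡ true × x // 2 ^ t ≡ lo // 2 ^ t + 1 × Extreme false x t × lo ≤ x × x ≤ hi)))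
  three-nodes {lo} {hi} {t} t≤ℓ lo≤hi hi< short long = split
    where
    P = 2 ^ t
    A = lo // P
    B = hi // P
    within : ∀ {x y} → x // P ≡ y // P → y < 2 ^ ℓ → x < 2 ^ ℓ
    within {x} {y} e y< = <-≤-trans (subst (λ z → x < suc z * P) e (<-//-suc x (pow>0 t))) (≤-trans (*-monoˡ-≤ P (<-*⇒//-< {2 ^ (ℓ ∸ t)} {y} {P} (<-≤-trans y< (≤-reflexive (pow-split t≤ℓ))))) (≤-reflexive (sym (pow-split t≤ℓ))))
    NodeHit : Bool → ℕ → Set
    NodeHit tag p = ∃[ x ] (x < 2 ^ ℓ × χ x ≡ true × x // 2 ^ t ≡ p × Extreme tag x t × lo ≤ x × x ≤ hi)
    split : Hit lo hi → NodeHit true A ⊎ (NodeHit false B ⊎ NodeHit false (A + 1))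
    split (y , y< , ey , lo≤y , y≤hi) = place (y // P ≟ A) (y // P ≟ B)
      where
      Y = y // P
      A≤Y = //-mono P lo≤y
      Y≤B = //-mono P y≤hi
      unit : ∀ n → n ≡ n // 1
      unit n = sym (trans (cong (_// 1) (sym (*-identityʳ n))) (//-* 0 n z<s))
      single : A ≡ B → lo ≡ hi × t ≡ 0
      single A≡B = [ (λ { refl → trans (unit lo) (trans A≡B (sym (unit hi))) , refl }) , (λ P≤ → ⊥-elim (<-irrefl refl (<-≤-trans gap< P≤))) ]′ long
        where
        gap< : hi ∸ lo < P
        gap< = +-cancelʳ-< lo (hi ∸ lo) P (subst (_< P + lo) (sym (m∸n+n≡m lo≤hi)) (<-≤-trans (<-//-suc hi (pow>0 t))
          (+-monoʳ-≤ P (subst (λ z → z * P ≤ lo) A≡B (//-*-≤ lo P)))))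
      Key : Bool → Set
      Key tag = ∃[ x ] (χ x ≡ true × x // P ≡ Y × Extreme tag x t × (tag ≡ false → x ≤ y) × (tag ≡ true → y ≤ x))
      greatest : Y ≡ A → Key true → NodeHit true A
      greatest Y≡A (x , ex , xY , ext , _ , y≤x) = x , within xY y< , ex , trans xY Y≡A , ext , ≤-trans lo≤y (y≤x refl) , x≤hi (A ≟ B)
        where
        x≤hi : Dec (A ≡ B) → x ≤ hi
        x≤hi (no A≢B) = ≤-trans (<⇒≤ (<-//-suc x (pow>0 t))) (≤-trans (*-monoˡ-≤ P (subst (_< B) (sym (trans xY Y≡A)) (≤∧≢⇒< (//-mono P lo≤hi) A≢B))) (//-*-≤ hi P))
        x≤hi (yes A≡B) = ≤-reflexive (trans (trans (unit x) (trans (cong (λ s → x // 2 ^ s) (sym t≡0)) (trans xY (trans Y≡A A≡B)))) (trans (cong (λ s → hi // 2 ^ s) t≡0) (sym (unit hi))))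
          where
          t≡0 : t ≡ 0
          t≡0 = proj₂ (single A≡B)
      least-of : ∀ {p} → Y ≡ p → A < Y → Key false → NodeHit false p
      least-of Y≡p A<Y (x , ex , xY , ext , x≤y , _) = x , within xY y< , ex , trans xY Y≡p , ext , lo≤x , ≤-trans (x≤y refl) y≤hi
        where
        lo≤x : lo ≤ x
        lo≤x = ≤-trans (<⇒≤ (<-//-suc lo (pow>0 t))) (≤-trans (*-monoˡ-≤ P (subst (A <_) (sym xY) A<Y)) (//-*-≤ x P))
      B<A+3 : B < A + 3
      B<A+3 = *-cancelʳ-< P B (A + 3) (begin-strict
        B * P ≤⟨ //-*-≤ hi P ⟩
        hi ≡⟨ m+[n∸m]≡n lo≤hi ⟨
        lo + (hi ∸ lo) <⟨ +-mono-≤-< (<⇒≤ (<-//-suc lo (pow>0 t))) short ⟩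
        suc A * P + 2 * P ≡⟨ ring (A ∷ P ∷ []) ((con 1 :+ X0) :* X1 :+ con 2 :* X1) ((X0 :+ con 3) :* X1) refl refl ⟩
        (A + 3) * P ∎)
        where open ≤-Reasoning
      place : Dec (Y ≡ A) → Dec (Y ≡ B) → NodeHit true A ⊎ (NodeHit false B ⊎ NodeHit false (A + 1))
      place (yes Y≡A) _ = inj₁ (greatest Y≡A (extreme true t ey))
      place (no Y≢A) (yes Y≡B) = inj₂ (inj₁ (least-of Y≡B (≤∧≢⇒< A≤Y (Y≢A ∘ sym)) (extreme false t ey)))
      place (no Y≢A) (no Y≢B) = inj₂ (inj₂ (least-of Y≡A+1 A<Y (extreme false t ey)))
        where
        A<Y : A < Y
        A<Y = ≤∧≢⇒< A≤Y (Y≢A ∘ sym)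
        Y≡A+1 : Y ≡ A + 1
        Y≡A+1 = ≤-antisym (s≤s⁻¹ (s≤s⁻¹ (≤-trans (s≤s (≤∧≢⇒< Y≤B Y≢B)) (≤-trans B<A+3 (≤-reflexive (trans (+-comm A 3) (cong (suc ∘ suc) (+-comm 1 A)))))))) (≤-trans (≤-reflexive (+-comm A 1)) A<Y)

module BucketLookup {k : ℕ} (u : ℕ) (u>0 : 0 < u) (R : Fin k → Word (F * u)) (β : ℕ → Bool)
  (Z : ℕ) (Z< : Z < 2 ^ (1 * u)) {W : Expr k} (⇓W : Semantics._⇓_∶_ u u>0 R β W (F * u) 7)
  {f : ℕ} {fE : Expr k} (⇓f : Semantics._⇓_∶_ u u>0 R β fE f 1) (2^f≤ : 2 ^ f ≤ 1 * u)
  (χ : ℕ → Bool) (ℓ r S τ δ : ℕ) (ℓ<ρ : ℓ < 2 ^ (r * S)) (ℓ<τ : ℓ < 2 ^ τ) where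

  open BucketBits χ ℓ r S τ δ f ℓ<ρ ℓ<τ

  module _ {ℓE τE rE v₁E : Expr k} (⇓ℓ : Semantics._⇓_∶_ u u>0 R β ℓE ℓ 1) (⇓τ : Semantics._⇓_∶_ u u>0 R β τE τ 1)
    (⇓r : Semantics._⇓_∶_ u u>0 R β rE r 1) (⇓v₁ : Semantics._⇓_∶_ u u>0 R β v₁E v₁ 1)
    (ℓ< : suc ℓ ≤ 1 * u) (τ≤ : τ ≤ 1 * u) (v₁≤ : v₁ ≤ 1 * u) (rS≤ : r * S ≤ 1 * u) (S≤ : S ≤ 1 * u)
    (v₂< : v₂ < 2 ^ f) (narrow₁ : R₁.Narrow) (narrow₂ : R₂.Narrow)
    (widths₁ : bits (8 * suc (R₁.N * (R₁.N * suc κ))) < 2 ^ f) (widths₂ : bits (8 * suc (R₂.N * (R₂.N * suc κ))) < 2 ^ f)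
    (tables-width : Tables.width < 2 ^ f)
    {pos : ℕ} {posE : Expr k} (⇓pos : Semantics._⇓_∶_ u u>0 R β posE pos 1) (here : At β Z pos bucketBits) where

    open RetrievalLookup u u>0 R β Z Z< ⇓W ⇓f 2^f≤
    open Layout.Lookup u u>0 R β Z Z< ⇓W
    open Logic u u>0 R β
    open BucketE W fE ℓE τE rE v₁E S

    v₂≤u : v₂ ≤ 1 * u
    v₂≤u = ≤-trans (<⇒≤ v₂<) 2^f≤

    ℓ≤u : ℓ ≤ 1 * u
    ℓ≤u = ≤-trans (n≤1+n ℓ) ℓ<

    κ≤ : κ ≤ 2 * u
    κ≤ = lin (ℓ ∷ τ ∷ u ∷ []) (X0 :+ X1 :+ con 1 :≤ con 2 :* X2)
      (hyp (con 1) (con 1 :+ X0 :≤ con 1 :* X2) ℓ< ∷ hyp (con 1) (X1 :≤ con 1 :* X2) τ≤ ∷ []) refl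

    private
      parts : At β Z pos (enc f v₂ ++ (enc v₂ size ++ (keys ++ Tables.parr)))
      parts = subst (At β Z pos) bucketBits-def here
      at-size : At β Z (pos + f) (enc v₂ size ++ (keys ++ Tables.parr))
      at-size = subst (λ n → At β Z (pos + n) (enc v₂ size ++ (keys ++ Tables.parr))) (length-enc f v₂) (At-++ʳ (enc f v₂) parts)
      keysPos = pos + f + v₂
      at-keys : At β Z keysPos (keys ++ Tables.parr)
      at-keys = subst (λ n → At β Z (pos + f + n) (keys ++ Tables.parr)) (length-enc v₂ size) (At-++ʳ (enc v₂ size) at-size)
      at-tables : At β Z (keysPos + size * ℓ) Tables.parr
      at-tables = subst (λ n → At β Z (keysPos + n) Tables.parr) length-keys (At-++ʳ keys at-keys)

    opaque
      unfolding widthE sizeE keysE tablesE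

      private
        ⇓width : widthE posE ⇓ v₂ ∶ 1
        ⇓width = cast (At-enc v₂< (At-++ˡ (enc f v₂) parts)) (⇓rd ⇓W 1 ⇓pos ⇓f f≤)
        ⇓size : sizeE posE ⇓ size ∶ 1
        ⇓size = cast (At-enc (<-bits size) (At-++ˡ (enc v₂ size) at-size)) (⇓rd ⇓W 1 (⇓add ⇓pos ⇓f) ⇓width v₂≤u)
        ⇓keys : keysE posE ⇓ keysPos ∶ 1
        ⇓keys = At-∶ (keys ++ Tables.parr) at-keys (⇓add (⇓add ⇓pos ⇓f) ⇓width)
        ⇓tables : tablesE posE ⇓ keysPos + size * ℓ ∶ 1
        ⇓tables = At-∶ Tables.parr at-tables (⇓add ⇓keys (⇓mul ⇓size ⇓ℓ))

    opaque
      unfolding tableE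

      private
        ⇓table₁ : Σ[ q ∈ ℕ ] (tableE posE 0 ⇓ q ∶ 1) × At β Z q R₁.retrieval
        ⇓table₁ = ⇓parr {n = 2} {b = tableBits} ⇓f f≤ tables-width (≤-trans (<⇒≤ tables-width) 2^f≤) ⇓tables at-tables (raise (⇓lit 0)) z<s
        ⇓table₂ : Σ[ q ∈ ℕ ] (tableE posE 1 ⇓ q ∶ 1) × At β Z q R₂.retrieval
        ⇓table₂ = ⇓parr {n = 2} {b = tableBits} ⇓f f≤ tables-width (≤-trans (<⇒≤ tables-width) 2^f≤) ⇓tables at-tables (⇓lit 1) (s≤s z<s)

    private
      lookup₁ : ∀ {q} {e e′ : Expr k} → e ⇓ q ∶ 1 → At β Z q R₁.retrieval → ∀ {x} → e′ ⇓ x ∶ 2 → x ∈ hs → retE W fE v₁E e e′ ⇓ val₁ x ∶ 1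
      lookup₁ ⇓q at-q = ⇓ret κ hs hs-< (distinct-unique handles) v₁ val₁ (λ {x} _ → val₁-< x) narrow₁ widths₁ ⇓v₁ v₁≤ ⇓q at-q
      lookup₂ : ∀ {q} {e e′ : Expr k} → e ⇓ q ∶ 1 → At β Z q R₂.retrieval → ∀ {x} → e′ ⇓ x ∶ 2 → x ∈ ls → retE W fE (widthE posE) e e′ ⇓ val₂ x ∶ 1
      lookup₂ ⇓q at-q = ⇓ret κ ls ls-< (distinct-unique locators) v₂ val₂ (λ {x} _ → val₂-< x) narrow₂ widths₂ ⇓width v₂≤u ⇓q at-q

    ⇓tag : ∀ tag → lit (b2n tag) ⇓ b2n tag ∶ 1
    ⇓tag true = ⇓lit 1
    ⇓tag false = raise (⇓lit 0)

    ⇓//2^ : ∀ {x t} {e e′ : Expr k} → e ⇓ x ∶ 1 → e′ ⇓ t ∶ 1 → t ≤ ℓ → div′ e (pow′ e′) ⇓ x // 2 ^ t ∶ 1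
    ⇓//2^ ⇓x ⇓t t≤ = ⇓div ⇓x (⇓pow ⇓t 1 (≤-trans t≤ ℓ≤u))

    opaque
      unfolding codeE stepE roundE ancestorE levelE offsetE

      ⇓code : ∀ tag {t p} {tE pE : Expr k} → tE ⇓ t ∶ 1 → pE ⇓ p ∶ 1 → t ≤ ℓ → p < 2 ^ ℓ → codeE tag tE pE ⇓ code tag t p ∶ 2
      ⇓code tag {t} {p} ⇓t ⇓p t≤ p< = rebound (⇓add (⇓mul (⇓add (⇓mul ⇓p (⇓pow ⇓τ 1 τ≤)) ⇓t) (⇓lit 2)) (⇓tag tag))
          (<-≤-trans (code-< tag ℓ (≤ℓ⇒<τ t≤) p<) (pow-mono κ≤))

      ⇓step : ∀ {j} → j ≤ S → stepE j ⇓ ρ^ j ∶ 2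
      ⇓step j≤S = ⇓pow (⇓mul ⇓r (⇓num (≤-<-trans (≤-trans j≤S S≤) (n<2^n (1 * u))))) 1 (≤-trans (*-monoʳ-≤ r j≤S) rS≤)

      ⇓round : ∀ {t j} {tE : Expr k} → tE ⇓ t ∶ 1 → j ≤ S → roundE tE j ⇓ rounded t j ∶ 1
      ⇓round {t} {j} ⇓t j≤S = ⇓min (⇓mul (⇓div (⇓sub (≤-trans (pow>0 (r * j)) (m≤n+m _ t)) (⇓add ⇓t (⇓step j≤S)) (⇓lit 1)) (⇓step j≤S)) (⇓step j≤S)) ⇓ℓ

      ⇓ancestor : ∀ {p t t′} {pE tE tE′ : Expr k} → pE ⇓ p ∶ 1 → tE ⇓ t ∶ 1 → tE′ ⇓ t′ ∶ 1 → t ≤ t′ → t′ ≤ ℓ → ancestorE pE tE tE′ ⇓ p // 2 ^ (t′ ∸ t) ∶ 1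
      ⇓ancestor {t = t} {t′} ⇓p ⇓t ⇓t′ t≤ t′≤ = ⇓//2^ ⇓p (⇓sub t≤ ⇓t′ ⇓t) (≤-trans (m∸n≤m t′ t) t′≤)

      ⇓level : ∀ {m d} {e : Expr k} → e ⇓ m + d * 2 ^ τ ∶ 1 → m ≤ ℓ → levelE e ⇓ m ∶ 1
      ⇓level {m} {d} ⇓a m≤ = cast (%%-* m d (≤ℓ⇒<τ m≤)) (⇓rem ⇓a (⇓pow ⇓τ 1 τ≤))

      ⇓offset : ∀ {m d} {e : Expr k} → e ⇓ m + d * 2 ^ τ ∶ 1 → m ≤ ℓ → offsetE e ⇓ d ∶ 1
      ⇓offset {m} {d} ⇓a m≤ = cast (//-* m d (≤ℓ⇒<τ m≤)) (⇓div ⇓a (⇓pow ⇓τ 1 τ≤))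

    opaque
      unfolding fileE baseE locationE

      ⇓file : ∀ tag {t p} {tE pE : Expr k} → tE ⇓ t ∶ 1 → pE ⇓ p ∶ 1 → t ≤ ℓ → p < 2 ^ ℓ → code tag t p ∈ handles →
        fileE posE tag tE pE ⇓ val₁ (code tag t p) ∶ 1
      ⇓file tag {t} {p} ⇓t ⇓p t≤ p< h∈ = lookup₁ (proj₁ (proj₂ ⇓table₁)) (proj₂ (proj₂ ⇓table₁)) {code tag t p} (⇓code tag ⇓t ⇓p t≤ p<) (∈-distinct h∈)

      ⇓base : ∀ tag {t p} {tE pE : Expr k} → tE ⇓ t ∶ 1 → pE ⇓ p ∶ 1 → t ≤ ℓ → p < 2 ^ ℓ → code tag t p ∈ locators →
        baseE posE tag tE pE ⇓ val₂ (code tag t p) ∶ 1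
      ⇓base tag {t} {p} ⇓t ⇓p t≤ p< l∈ = lookup₂ (proj₁ (proj₂ ⇓table₂)) (proj₂ (proj₂ ⇓table₂)) {code tag t p} (⇓code tag ⇓t ⇓p t≤ p<) (∈-distinct l∈)

      location-sum : ∀ tag {b d} {tE pE : Expr k} → baseE posE tag (levelE (fileE posE tag tE pE)) (ancestorE pE tE (levelE (fileE posE tag tE pE))) ⇓ b ∶ 1 →
        offsetE (fileE posE tag tE pE) ⇓ d ∶ 1 → ⟪ locationE posE tag tE pE ⟫ ≡ b + d
      location-sum tag ⇓b ⇓d = val (⇓add ⇓b ⇓d)

    private
      ⇓located : ∀ tag {t p m i q b d} {tE pE : Expr k} → tE ⇓ t ∶ 1 → pE ⇓ p ∶ 1 → t ≤ ℓ → p < 2 ^ ℓ →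
        code tag t p ∈ handles → val₁ (code tag t p) ≡ m + d * 2 ^ τ → m ≤ ℓ → m ≡ t + i → q ≡ p // 2 ^ i → q < 2 ^ ℓ →
        code tag m q ∈ locators → val₂ (code tag m q) ≡ b → ⟪ locationE posE tag tE pE ⟫ ≡ b + d
      ⇓located tag {t} {p} {m} {i} {q} {b} {d} {tE} {pE} ⇓t ⇓p t≤ p< h∈ v₁≡ m≤ m≡ q≡ q< l∈ v₂≡ =
        location-sum tag (cast v₂≡ (⇓base tag {m} {q} ⇓m ⇓q m≤ q< l∈)) (⇓offset {m} {d} ⇓a m≤)
        where
        ⇓a : fileE posE tag tE pE ⇓ m + d * 2 ^ τ ∶ 1
        ⇓a = cast v₁≡ (⇓file tag {t} {p} ⇓t ⇓p t≤ p< h∈)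
        ⇓m : levelE (fileE posE tag tE pE) ⇓ m ∶ 1
        ⇓m = ⇓level {m} {d} ⇓a m≤
        lift≡ : m ∸ t ≡ i
        lift≡ = trans (cong (_∸ t) m≡) (m+n∸m≡n t i)
        ⇓q : ancestorE pE tE (levelE (fileE posE tag tE pE)) ⇓ q ∶ 1
        ⇓q = cast (trans (cong (λ j → p // 2 ^ j) lift≡) (sym q≡)) (⇓ancestor ⇓p ⇓t ⇓m (≤-trans (m≤m+n t i) (≤-reflexive (sym m≡))) m≤)

    ⇓location : ∀ {tag x t} {tE pE : Expr k} → χ x ≡ true → x < 2 ^ ℓ → t ≤ ℓ → Extreme tag x t → t ∈ filed (coarsest ℓ tag x) →
      tE ⇓ t ∶ 1 → pE ⇓ x // 2 ^ t ∶ 1 → ⟪ locationE posE tag tE pE ⟫ ≡ c x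
    ⇓location {tag} {x} {t} ex x< t≤ℓ ext t∈ ⇓t ⇓p = trans
        (⇓located tag {t} {p} {m} {i} {q} ⇓t ⇓p t≤ℓ (≤-<-trans (//-≤ x (2 ^ t)) x<) (handle-∈ t∈) val₁-handle m≤ℓ refl refl
          (subst (_< 2 ^ ℓ) (sym q≡) (≤-<-trans (//-≤ x (2 ^ m)) x<)) locator-∈ val₂-locator)
        (m+[n∸m]≡n base≤)
      where open Located {tag} {x} {t} ex x< t≤ℓ ext

    open Interval χ ℓ using (Hit; three-nodes; next-node<)

    module _ {lo hi : ℕ} {loE hiE : Expr k} (⇓lo : loE ⇓ lo ∶ 1) (⇓hi : hiE ⇓ hi ∶ 1) where

      opaque
        unfolding keyE testE

        ⇓key : ∀ e → ⟪ e ⟫ %% size < 2 ^ (1 * u) → keyE posE e ⇓ read β (keysPos + ⟪ e ⟫ %% size * ℓ) ℓ ∶ 1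
        ⇓key e j< = ⇓rd ⇓W 1 (⇓add ⇓keys (⇓mul (rebound {j = 1} (⇓rem {i = F} (refl ⟨ ⟪⟫-< e ⟩) ⇓size) j<) ⇓ℓ)) ⇓ℓ ℓ≤u

        ⇓test : ∀ {e y} → keyE posE e ⇓ y ∶ 1 → testE posE loE hiE e ⇓ b2n ((0 <ᵇ size) ∧ (not (y <ᵇ lo) ∧ not (hi <ᵇ y))) ∶ 1
        ⇓test ⇓y = ⇓and (⇓lt (⇓lit 0) ⇓size) (⇓and (⇓not (⇓lt ⇓y ⇓lo)) (⇓not (⇓lt ⇓hi ⇓y)))

      private
        at-keys′ : At β Z keysPos keys
        at-keys′ = At-++ˡ {p = keysPos} keys {Tables.parr} at-keys

        at-key : ∀ {x} → x < 2 ^ ℓ → At β Z (keysPos + c x * ℓ) (keyBits x)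
        at-key {x} x< = subst (λ n → At β Z (keysPos + n) (keyBits x)) (Σ-keyBits x) (At-cat {p = keysPos} (2 ^ ℓ) keyBits {x} x< at-keys′)

        at-enc : ∀ {x} → x < 2 ^ ℓ → χ x ≡ true → At β Z (keysPos + c x * ℓ) (enc ℓ x)
        at-enc {x} x< ex = subst (λ b → At β Z (keysPos + c x * ℓ) (if b then enc ℓ x else [])) ex (at-key x<)

        read-key : ∀ {x} → x < 2 ^ ℓ → χ x ≡ true → read β (keysPos + c x * ℓ) ℓ ≡ x
        read-key {x} x< ex = At-enc {β} {Z} {keysPos + c x * ℓ} {ℓ} {x} x< (at-enc x< ex)

        small-index : ∀ y n → n ≤ 2 ^ ℓ → y %% n < 2 ^ (1 * u)
        small-index y zero _ = pow>0 (1 * u)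
        small-index y (suc n) h = <-≤-trans (%%-< y (z<s {n})) (≤-trans h (pow-mono ℓ≤u))

        at-location : ∀ {j y} → read β (keysPos + j * ℓ) ℓ ≡ y → (y <ᵇ lo) ≡ false → (hi <ᵇ y) ≡ false →
          (∃[ x ] (x < 2 ^ ℓ × χ x ≡ true × c x ≡ j)) → Hit lo hi
        at-location {j} {y} y≡ lo≤y y≤hi (x , x< , ex , cx) = x , x< , ex , subst (lo ≤_) y≡x (<ᵇ-false⁻ {y} lo≤y) , subst (_≤ hi) y≡x (<ᵇ-false⁻ {hi} y≤hi)
          where
          y≡x : y ≡ x
          y≡x = trans (sym y≡) (trans (cong (λ n → read β (keysPos + n * ℓ) ℓ) (sym cx)) (read-key x< ex))

        genuine : ∀ j y → read β (keysPos + j * ℓ) ℓ ≡ y → j < size → (y <ᵇ lo) ≡ false → (hi <ᵇ y) ≡ false → Hit lo hi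
        genuine j y y≡ j< lo≤y y≤hi = at-location y≡ lo≤y y≤hi (key-at (2 ^ ℓ) j<)

        test-of : ∀ {e : Expr k} j y → ⟪ e ⟫ %% size ≡ j → read β (keysPos + j * ℓ) ℓ ≡ y →
          testE posE loE hiE e ⇓ b2n ((0 <ᵇ size) ∧ (not (y <ᵇ lo) ∧ not (hi <ᵇ y))) ∶ 1 →
          Decides (testE posE loE hiE e) (Hit lo hi) (∃[ x ] (x < 2 ^ ℓ × χ x ≡ true × ⟪ e ⟫ ≡ c x × lo ≤ x × x ≤ hi))
        test-of {e} j y j≡ y≡ ⇓e = decides _ ⇓e sound complete
          where
          sound : (0 <ᵇ size) ∧ (not (y <ᵇ lo) ∧ not (hi <ᵇ y)) ≡ true → Hit lo hi
          sound h = genuine j y y≡ (subst (_< size) j≡ (%%-< ⟪ e ⟫ (<ᵇ-true⁻ {0} (∧-elimˡ (0 <ᵇ size) h))))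
            (not-true (∧-elimˡ (not (y <ᵇ lo)) (∧-elimʳ (0 <ᵇ size) h))) (not-true (∧-elimʳ (not (y <ᵇ lo)) (∧-elimʳ (0 <ᵇ size) h)))
          complete : (∃[ x ] (x < 2 ^ ℓ × χ x ≡ true × ⟪ e ⟫ ≡ c x × lo ≤ x × x ≤ hi)) → (0 <ᵇ size) ∧ (not (y <ᵇ lo) ∧ not (hi <ᵇ y)) ≡ true
          complete (x , x< , ex , loc , lo≤ , ≤hi) = ∧-intro (<ᵇ-true (≤-<-trans z≤n (c-< ex x<)))
              (∧-intro (cong not (<ᵇ-false (subst (lo ≤_) (sym y≡x) lo≤))) (cong not (<ᵇ-false (subst (_≤ hi) (sym y≡x) ≤hi))))
            where
            y≡x : y ≡ x
            y≡x = trans (sym y≡) (trans (cong (λ n → read β (keysPos + n * ℓ) ℓ) (trans (sym j≡) (trans (cong (_%% size) loc) (%%-small (c-< ex x<))))) (read-key x< ex))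

      -- Whatever the location, the test looks at a genuine key.
      test-decides : ∀ e → Decides (testE posE loE hiE e) (Hit lo hi) (∃[ x ] (x < 2 ^ ℓ × χ x ≡ true × ⟪ e ⟫ ≡ c x × lo ≤ x × x ≤ hi))
      test-decides e = test-of (⟪ e ⟫ %% size) _ refl refl (⇓test (⇓key e (small-index ⟪ e ⟫ size size≤)))

      opaque
        unfolding candidateE nodeE bucketE

        node-any : ∀ tag {tE pE : Expr k} {P} {Qs : ℕ → Set} →
          (∀ j → j < suc S → Decides (testE posE loE hiE (locationE posE tag (roundE tE j) (ancestorE pE tE (roundE tE j)))) P (Qs j)) →
          Decides (nodeE posE tag tE pE loE hiE) P (∃[ j ] (j < suc S × Qs j))
        node-any tag {tE} {pE} = any-decides (suc S) (candidateE posE tag tE pE loE hiE)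

        bucket-any : ∀ {tE : Expr k} {P Q₁ Q₂ Q₃} → Decides (nodeE posE true tE (div′ loE (pow′ tE)) loE hiE) P Q₁ →
          Decides (nodeE posE false tE (div′ hiE (pow′ tE)) loE hiE) P Q₂ → Decides (nodeE posE false tE (add′ (div′ loE (pow′ tE)) (lit 1)) loE hiE) P Q₃ →
          Decides (bucketE posE tE loE hiE) P (Q₁ ⊎ (Q₂ ⊎ Q₃))
        bucket-any d₁ d₂ d₃ = or-decides d₁ (or-decides d₂ d₃)

      node-decides : ∀ tag {t p} {tE pE : Expr k} → tE ⇓ t ∶ 1 → t ≤ ℓ → pE ⇓ p ∶ 1 →
        Decides (nodeE posE tag tE pE loE hiE) (Hit lo hi)
          (∃[ x ] (x < 2 ^ ℓ × χ x ≡ true × x // 2 ^ t ≡ p × Extreme tag x t × lo ≤ x × x ≤ hi))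
      node-decides tag {t} {p} {tE} {pE} ⇓t t≤ℓ ⇓p = refine (node-any tag {tE} {pE} (λ j _ → test-decides (locationE posE tag (roundE tE j) (ancestorE pE tE (roundE tE j))))) λ { (x , x< , ex , xp , ext , lo≤ , ≤hi) →
        let j , j≤S , t∈ , le = hit {t} {coarsest ℓ tag x} (coarsest-max ℓ tag x t≤ℓ ext) (coarsest-≤ ℓ tag x) in
        j , s≤s j≤S , x , x< , ex ,
        ⇓location ex x< (m⊓n≤n _ ℓ) (Extreme-down tag ex le (coarsest-extreme ℓ tag x ex)) t∈ (⇓round ⇓t j≤S)
          (cast (trans (cong (_// 2 ^ (rounded t j ∸ t)) (sym xp)) (nested x j)) (⇓ancestor ⇓p ⇓t (⇓round ⇓t j≤S) (rounded-≥ j t≤ℓ) (m⊓n≤n _ ℓ))) ,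
        lo≤ , ≤hi }
        where
        nested : ∀ x j → x // 2 ^ t // 2 ^ (rounded t j ∸ t) ≡ x // 2 ^ rounded t j
        nested x j = trans (sym (//-// x (pow>0 t) (pow>0 (rounded t j ∸ t)))) (cong (x //_) (trans (sym (pow-+ t (rounded t j ∸ t))) (cong (2 ^_) (m+[n∸m]≡n (rounded-≥ j t≤ℓ)))))

      bucket-decides : ∀ {t} {tE : Expr k} → tE ⇓ t ∶ 1 → t ≤ ℓ → lo ≤ hi → hi < 2 ^ ℓ → hi ∸ lo < 2 * 2 ^ t → (t ≡ 0 ⊎ 2 ^ t ≤ hi ∸ lo) →
        Decides (bucketE posE tE loE hiE) (Hit lo hi) (Hit lo hi)
      bucket-decides {t} {tE} ⇓t t≤ℓ lo≤hi hi< short long = refine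
        (bucket-any (node-decides true ⇓t t≤ℓ (⇓//2^ ⇓lo ⇓t t≤ℓ)) (node-decides false ⇓t t≤ℓ (⇓//2^ ⇓hi ⇓t t≤ℓ))
          (node-decides false ⇓t t≤ℓ (rebound (⇓add (⇓//2^ ⇓lo ⇓t t≤ℓ) (⇓lit 1)) (<-≤-trans (next-node< t lo≤hi hi<) (pow-mono ℓ<)))))
        (three-nodes t≤ℓ lo≤hi hi< short long)

<-bits-iff : ∀ {i e} → i < bits e → 2 ^ i ≤ e
<-bits-iff {i} {e} h with 2 ^ i ≤? e
... | yes le = le
... | no nle = ⊥-elim (<-irrefl refl (<-≤-trans h (bits-≤ (≰⇒> nle))))

bits-unique : ∀ {e t} → 2 ^ t ≤ e → e < 2 ^ suc t → bits e ≡ suc t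
bits-unique {e} {t} lo hi = ≤-antisym (bits-≤ hi) (pow-cancel-< (≤-<-trans lo (<-bits e)))

bitAnd : ℕ → ℕ → ℕ → ℕ
bitAnd zero x y = 0
bitAnd (suc f) x y = x %% 2 * (y %% 2) + 2 * bitAnd f (x // 2) (y // 2)

value-and : ∀ {w} (x y : Word w) → value (zipWith Data.Bool._∧_ x y) ≡ bitAnd w (value x) (value y)
value-and [] [] = refl
value-and {suc w} (a ∷ x) (b ∷ y) = cong₂ (λ p q → p + 2 * q)
  (trans (bit a b) (cong₂ _*_ (sym (low a x)) (sym (low b y))))
  (trans (value-and x y) (cong₂ (bitAnd w) (sym (high a x)) (sym (high b y))))
  where
  n : Bool → ℕ
  n b = if b then 1 else 0
  n<2 : ∀ b → n b < 2
  n<2 true = s≤s (s≤s z≤n)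
  n<2 false = s≤s z≤n
  bit : ∀ a b → n (a ∧ b) ≡ n a * n b
  bit true true = refl
  bit true false = refl
  bit false b = refl
  low : ∀ {w} a (x : Word w) → (n a + 2 * value x) %% 2 ≡ n a
  low a x = trans (cong (λ m → (n a + m) %% 2) (*-comm 2 (value x))) (%%-* (n a) (value x) (n<2 a))
  high : ∀ {w} a (x : Word w) → (n a + 2 * value x) // 2 ≡ value x
  high a x = trans (cong (λ m → (n a + m) // 2) (*-comm 2 (value x))) (//-* (n a) (value x) (n<2 a))

bitAnd-0 : ∀ f x → bitAnd f x 0 ≡ 0
bitAnd-0 zero x = refl
bitAnd-0 (suc f) x = cong₂ (λ a b → a + 2 * b) (*-zeroʳ (x %% 2)) (bitAnd-0 f (x // 2))

%%2-< : ∀ x → x %% 2 < 2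
%%2-< x = %%-< x z<s

bitAnd-split : ∀ a b x {y₀} y₁ → y₀ < 2 ^ a → bitAnd (a + b) x (y₀ + y₁ * 2 ^ a) ≡ bitAnd a x y₀ + bitAnd b (x // 2 ^ a) y₁ * 2 ^ a
bitAnd-split zero b x {y₀} y₁ h rewrite n<1⇒n≡0 h = trans (cong₂ (bitAnd b) (sym x//1) (*-identityʳ y₁)) (sym (*-identityʳ _))
  where
  x//1 : x // 1 ≡ x
  x//1 = trans (cong (_// 1) (sym (*-identityʳ x))) (//-* 0 x z<s)
bitAnd-split (suc a) b x {y₀} y₁ h = begin
  x %% 2 * ((y₀ + y₁ * (2 * 2 ^ a)) %% 2) + 2 * bitAnd (a + b) (x // 2) ((y₀ + y₁ * (2 * 2 ^ a)) // 2)
    ≡⟨ cong₂ (λ p q → x %% 2 * p + 2 * bitAnd (a + b) (x // 2) q) low high ⟩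
  x %% 2 * (y₀ %% 2) + 2 * bitAnd (a + b) (x // 2) (y₀ // 2 + y₁ * 2 ^ a)
    ≡⟨ cong (λ p → x %% 2 * (y₀ %% 2) + 2 * p) (bitAnd-split a b (x // 2) y₁ half<) ⟩
  x %% 2 * (y₀ %% 2) + 2 * (bitAnd a (x // 2) (y₀ // 2) + bitAnd b (x // 2 // 2 ^ a) y₁ * 2 ^ a)
    ≡⟨ cong (λ p → x %% 2 * (y₀ %% 2) + 2 * (bitAnd a (x // 2) (y₀ // 2) + bitAnd b p y₁ * 2 ^ a)) (sym (//-// x (z<s {1}) (pow>0 a))) ⟩
  x %% 2 * (y₀ %% 2) + 2 * (bitAnd a (x // 2) (y₀ // 2) + bitAnd b (x // (2 * 2 ^ a)) y₁ * 2 ^ a)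
    ≡⟨ ring (x %% 2 * (y₀ %% 2) ∷ bitAnd a (x // 2) (y₀ // 2) ∷ bitAnd b (x // (2 * 2 ^ a)) y₁ ∷ 2 ^ a ∷ [])
         (X0 :+ con 2 :* (X1 :+ X2 :* X3)) (X0 :+ con 2 :* X1 :+ X2 :* (con 2 :* X3)) refl refl ⟩
  bitAnd (suc a) x y₀ + bitAnd b (x // 2 ^ suc a) y₁ * 2 ^ suc a ∎
  where
  open ≡-Reasoning
  half< : y₀ // 2 < 2 ^ a
  half< = <-*⇒//-< (<-≤-trans h (≤-reflexive (*-comm 2 (2 ^ a))))
  y≡ : y₀ + y₁ * (2 * 2 ^ a) ≡ y₀ %% 2 + (y₀ // 2 + y₁ * 2 ^ a) * 2
  y≡ = trans (cong (_+ y₁ * (2 * 2 ^ a)) (div-mod y₀ {2} z<s)) (ring (y₀ %% 2 ∷ y₀ // 2 ∷ y₁ ∷ 2 ^ a ∷ []) (X0 :+ X1 :* con 2 :+ X2 :* (con 2 :* X3)) (X0 :+ (X1 :+ X2 :* X3) :* con 2) refl refl)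
  low : (y₀ + y₁ * (2 * 2 ^ a)) %% 2 ≡ y₀ %% 2
  low = trans (cong (_%% 2) y≡) (%%-* (y₀ %% 2) (y₀ // 2 + y₁ * 2 ^ a) (%%2-< y₀))
  high : (y₀ + y₁ * (2 * 2 ^ a)) // 2 ≡ y₀ // 2 + y₁ * 2 ^ a
  high = trans (cong (_// 2) y≡) (//-* (y₀ %% 2) (y₀ // 2 + y₁ * 2 ^ a) (%%2-< y₀))

bitAnd-ones : ∀ a b x → bitAnd (a + b) x (2 ^ a ∸ 1) ≡ x %% 2 ^ a
bitAnd-ones zero b x = trans (bitAnd-0 b x) (sym (n<1⇒n≡0 (%%-< x z<s)))
bitAnd-ones (suc a) b x = begin
  x %% 2 * (ones %% 2) + 2 * bitAnd (a + b) (x // 2) (ones // 2) ≡⟨ cong₂ (λ p q → x %% 2 * p + 2 * bitAnd (a + b) (x // 2) q) low high ⟩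
  x %% 2 * 1 + 2 * bitAnd (a + b) (x // 2) (2 ^ a ∸ 1) ≡⟨ cong₂ (λ p q → p + 2 * q) (*-identityʳ (x %% 2)) (bitAnd-ones a b (x // 2)) ⟩
  x %% 2 + 2 * (x // 2 %% 2 ^ a) ≡⟨ sym (%%-* _ (x // 2 // 2 ^ a) small) ⟩
  (x %% 2 + 2 * (x // 2 %% 2 ^ a) + x // 2 // 2 ^ a * 2 ^ suc a) %% 2 ^ suc a ≡⟨ cong (_%% 2 ^ suc a) (sym x≡) ⟩
  x %% 2 ^ suc a ∎
  where
  open ≡-Reasoning
  ones = 2 ^ suc a ∸ 1
  ones≡ : ones ≡ 1 + (2 ^ a ∸ 1) * 2
  ones≡ = +-cancelʳ-≡ 1 ones (1 + (2 ^ a ∸ 1) * 2) (trans (m∸n+n≡m (pow>0 (suc a))) (trans (cong (2 *_) (sym (m∸n+n≡m (pow>0 a))))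
    (ring (2 ^ a ∸ 1 ∷ []) (con 2 :* (X0 :+ con 1)) (con 1 :+ X0 :* con 2 :+ con 1) refl refl)))
  low : ones %% 2 ≡ 1
  low = trans (cong (_%% 2) ones≡) (%%-* 1 (2 ^ a ∸ 1) (s≤s (s≤s z≤n)))
  high : ones // 2 ≡ 2 ^ a ∸ 1
  high = trans (cong (_// 2) ones≡) (//-* 1 (2 ^ a ∸ 1) (s≤s (s≤s z≤n)))
  small : x %% 2 + 2 * (x // 2 %% 2 ^ a) < 2 ^ suc a
  small = lin (x %% 2 ∷ x // 2 %% 2 ^ a ∷ 2 ^ a ∷ []) (con 1 :+ (X0 :+ con 2 :* X1) :≤ con 2 :* X2)
    (hyp (con 1) (con 1 :+ X0 :≤ con 2) (%%2-< x) ∷ hyp (con 2) (con 1 :+ X1 :≤ X2) (%%-< (x // 2) (pow>0 a)) ∷ []) refl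
  x≡ : x ≡ x %% 2 + 2 * (x // 2 %% 2 ^ a) + x // 2 // 2 ^ a * 2 ^ suc a
  x≡ = trans (div-mod x {2} z<s) (trans (cong (λ m → x %% 2 + m * 2) (div-mod (x // 2) (pow>0 a)))
    (ring (x %% 2 ∷ x // 2 %% 2 ^ a ∷ x // 2 // 2 ^ a ∷ 2 ^ a ∷ []) (X0 :+ (X1 :+ X2 :* X3) :* con 2) (X0 :+ con 2 :* X1 :+ X2 :* (con 2 :* X3)) refl refl))

-- Numbers given by their digits, least significant first.
digits : ℕ → ℕ → (ℕ → ℕ) → ℕ
digits X zero v = 0
digits X (suc n) v = v 0 + digits X n (v ∘ suc) * X

shifted : ℕ → ℕ → ℕ → ℕ
shifted X x zero = x
shifted X x (suc i) = shifted X (x // X) i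

digits-cong : ∀ X n {v v′} → (∀ i → v i ≡ v′ i) → digits X n v ≡ digits X n v′
digits-cong X zero h = refl
digits-cong X (suc n) h = cong₂ (λ a b → a + b * X) (h 0) (digits-cong X n (h ∘ suc))

digits-+ : ∀ X n v v′ → digits X n v + digits X n v′ ≡ digits X n (λ i → v i + v′ i)
digits-+ X zero v v′ = refl
digits-+ X (suc n) v v′ = trans (ring (v 0 ∷ v′ 0 ∷ digits X n (v ∘ suc) ∷ digits X n (v′ ∘ suc) ∷ X ∷ [])
  (X0 :+ X2 :* X4 :+ (X1 :+ X3 :* X4)) (X0 :+ X1 :+ (X2 :+ X3) :* X4) refl refl)
  (cong (λ d → v 0 + v′ 0 + d * X) (digits-+ X n (v ∘ suc) (v′ ∘ suc)))

digits-* : ∀ X n c v → c * digits X n v ≡ digits X n (λ i → c * v i)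
digits-* X zero c v = *-zeroʳ c
digits-* X (suc n) c v = trans (ring (c ∷ v 0 ∷ digits X n (v ∘ suc) ∷ X ∷ []) (X0 :* (X1 :+ X2 :* X3)) (X0 :* X1 :+ X0 :* X2 :* X3) refl refl)
  (cong (λ d → c * v 0 + d * X) (digits-* X n c (v ∘ suc)))

digits-< : ∀ X n v → (∀ i → v i < X) → digits X n v < X ^ n
digits-< X zero v h = z<s
digits-< X (suc n) v h = lin (v 0 ∷ digits X n (v ∘ suc) ∷ X ∷ X ^ n ∷ []) (con 1 :+ (X0 :+ X1 :* X2) :≤ X2 :* X3)
  (hyp (con 1) (con 1 :+ X0 :≤ X2) (h 0) ∷ hyp X2 (con 1 :+ X1 :≤ X3) (digits-< X n (v ∘ suc) (h ∘ suc)) ∷ []) refl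

-- Since X ≡ a modulo X − a, reduction modulo X − a replaces the base X by a.
digits-%% : ∀ a m n v → digits a n v < m → digits (a + m) n v %% m ≡ digits a n v
digits-%% a m n v small = trans (cong (_%% m) (proj₂ (multiple n v))) (%%-* (digits a n v) (proj₁ (multiple n v)) small)
  where
  multiple : ∀ n v → ∃[ c ] digits (a + m) n v ≡ digits a n v + c * m
  multiple zero v = 0 , refl
  multiple (suc n) v with multiple n (v ∘ suc)
  ... | c , eq′ = c * (a + m) + digits a n (v ∘ suc) , trans (cong (λ d → v 0 + d * (a + m)) eq′)
    (ring (v 0 ∷ digits a n (v ∘ suc) ∷ c ∷ m ∷ a ∷ []) (X0 :+ (X1 :+ X2 :* X3) :* (X4 :+ X3)) (X0 :+ X1 :* X4 :+ (X2 :* (X4 :+ X3) :+ X1) :* X3) refl refl)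

module Base (b : ℕ) where

  B X : ℕ
  B = suc b
  X = 2 ^ B

  and-mask : ∀ n r m x → m < X → bitAnd (n * B + r) x (digits X n (λ _ → m)) ≡ digits X n (λ i → bitAnd B (shifted X x i) m)
  and-mask zero r m x m< = bitAnd-0 r x
  and-mask (suc n) r m x m< = trans (cong (λ f → bitAnd f x (digits X (suc n) (λ _ → m))) (+-assoc B (n * B) r))
    (trans (bitAnd-split B (n * B + r) x (digits X n (λ _ → m)) m<) (cong (λ d → bitAnd B x m + d * X) (and-mask n r m (x // X) m<)))

  top : ℕ → ℕ
  top v = (v // 2 ^ b) %% 2

  and-top : ∀ n r v → (∀ i → v i < X) → bitAnd (n * B + r) (digits X n v) (digits X n (λ _ → 2 ^ b)) ≡ 2 ^ b * digits X n (top ∘ v)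
  and-top n r v v< = trans (and-mask n r (2 ^ b) (digits X n v) (pow-mono-< (n<1+n b))) (trans (each n v v<) (sym (digits-* X n (2 ^ b) (top ∘ v))))
    where
    topBit : ∀ x → bitAnd B x (2 ^ b) ≡ 2 ^ b * top x
    topBit x = trans (cong₂ (λ f y → bitAnd f x y) (+-comm 1 b) (sym (+-identityʳ (2 ^ b)))) (trans (bitAnd-split b 1 x 1 (pow>0 b))
      (trans (cong₂ _+_ (bitAnd-0 b x) refl) (ring (x // 2 ^ b %% 2 ∷ 2 ^ b ∷ []) ((X0 :* con 1 :+ con 2 :* con 0) :* X1) (X1 :* X0) refl refl)))
    lowDigit : ∀ v₀ rest → top (v₀ + rest * X) ≡ top v₀
    lowDigit v₀ rest = trans (cong (_%% 2) shift) (trans (cong (λ z → (z + rest * 2) %% 2) (div-mod (v₀ // 2 ^ b) {2} z<s))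
      (trans (cong (_%% 2) (ring (v₀ // 2 ^ b %% 2 ∷ v₀ // 2 ^ b // 2 ∷ rest ∷ []) (X0 :+ X1 :* con 2 :+ X2 :* con 2) (X0 :+ (X1 :+ X2) :* con 2) refl refl))
        (%%-* (top v₀) (v₀ // 2 ^ b // 2 + rest) (%%2-< (v₀ // 2 ^ b)))))
      where
      shift : (v₀ + rest * X) // 2 ^ b ≡ v₀ // 2 ^ b + rest * 2
      shift = trans (cong (λ z → (z + rest * X) // 2 ^ b) (div-mod v₀ (pow>0 b))) (trans (cong (_// 2 ^ b)
        (ring (v₀ %% 2 ^ b ∷ v₀ // 2 ^ b ∷ rest ∷ 2 ^ b ∷ []) (X0 :+ X1 :* X3 :+ X2 :* (con 2 :* X3)) (X0 :+ (X1 :+ X2 :* con 2) :* X3) refl refl))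
        (//-* (v₀ %% 2 ^ b) (v₀ // 2 ^ b + rest * 2) (%%-< v₀ (pow>0 b))))
    each : ∀ n v → (∀ i → v i < X) → digits X n (λ i → bitAnd B (shifted X (digits X n v) i) (2 ^ b)) ≡ digits X n (λ i → 2 ^ b * top (v i))
    each zero v v< = refl
    each (suc n) v v< = cong₂ (λ p q → p + q * X) (trans (topBit (v 0 + digits X n (v ∘ suc) * X)) (cong (2 ^ b *_) (lowDigit (v 0) (digits X n (v ∘ suc)))))
      (trans (cong (λ z → digits X n (λ i → bitAnd B (shifted X z i) (2 ^ b))) (//-* (v 0) (digits X n (v ∘ suc)) (v< 0))) (each n (v ∘ suc) (v< ∘ suc)))

  top-1 : ∀ {v} → 2 ^ b ≤ v → v < X → top v ≡ 1
  top-1 {v} lo hi = cong (_%% 2) (//-unique {v} {2 ^ b} {1} (≤-trans (≤-reflexive (+-identityʳ (2 ^ b))) lo) hi)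

  top-0 : ∀ {v} → v < 2 ^ b → top v ≡ 0
  top-0 {v} lo = cong (_%% 2) (//-small {v} {2 ^ b} lo)

digits-1 : ∀ n v → digits 1 n v ≡ Σ< n v
digits-1 zero v = refl
digits-1 (suc n) v = trans (cong (v 0 +_) (trans (*-identityʳ _) (digits-1 n (v ∘ suc)))) (head n v)
  where
  head : ∀ n v → v 0 + Σ< n (v ∘ suc) ≡ Σ< (suc n) v
  head zero v = +-comm (v 0) 0
  head (suc n) v = trans (sym (+-assoc (v 0) _ _)) (cong (_+ v (suc n)) (head n v))

count-< : ∀ n m → m ≤ n → Σ< n (λ i → b2n (i <ᵇ m)) ≡ m
count-< zero zero h = refl
count-< (suc n) m h with m ≟ suc n
... | yes refl = trans (cong₂ _+_ (trans (Σ<-cong n (λ i i<n → cong b2n (trans (<ᵇ-true (m<n⇒m<1+n i<n)) (sym (<ᵇ-true i<n))))) (count-< n n ≤-refl)) (cong b2n (<ᵇ-true (n<1+n n)))) (+-comm n 1)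
... | no m≢ = trans (cong₂ _+_ (count-< n m m≤n) (cong b2n (<ᵇ-false m≤n))) (+-identityʳ m)
  where m≤n = s≤s⁻¹ (≤∧≢⇒< h m≢)

2^-^ : ∀ a n → (2 ^ a) ^ n ≡ 2 ^ (a * n)
2^-^ a n = ^-*-assoc 2 a n

-- A number of up to 2 n blocks of h = n + 1 bits is reduced to the number
-- whose bits tell which blocks are nonzero. Two blocks form a digit in base X.
module Blocks (n : ℕ) where

  h N b : ℕ
  h = suc n
  N = n + n
  b = suc N

  open Base b public

  X≡ : X ≡ 2 ^ h * 2 ^ h
  X≡ = trans (cong (2 ^_) (cong suc (sym (+-suc n n)))) (pow-+ h h)

  φ : ℕ → ℕ
  φ z = top (z %% 2 ^ h + (2 ^ b ∸ 1))

  private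
    low< : ∀ z → z %% 2 ^ h ≤ 2 ^ b
    low< z = ≤-trans (<⇒≤ (%%-< z (pow>0 h))) (pow-mono (s≤s (m≤m+n n n)))

  digit-< : ∀ z → z %% 2 ^ h + (2 ^ b ∸ 1) < X
  digit-< z = begin-strict
    z %% 2 ^ h + (2 ^ b ∸ 1) <⟨ +-mono-≤-< (low< z) (≤-reflexive (m+[n∸m]≡n {1} (pow>0 b))) ⟩
    2 ^ b + 2 ^ b ≡⟨ cong (2 ^ b +_) (+-identityʳ (2 ^ b)) ⟨
    X ∎
    where open ≤-Reasoning

  φ-zero : ∀ z → z %% 2 ^ h ≡ 0 → φ z ≡ 0
  φ-zero z e rewrite e = top-0 (≤-reflexive (m+[n∸m]≡n {1} (pow>0 b)))

  φ-pos : ∀ z → 0 < z %% 2 ^ h → φ z ≡ 1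
  φ-pos z pos = top-1 (≤-trans (≤-reflexive (sym (m+[n∸m]≡n {1} (pow>0 b)))) (+-monoˡ-≤ (2 ^ b ∸ 1) pos)) (digit-< z)

  φ-≤ : ∀ z → φ z ≤ 1
  φ-≤ z = s≤s⁻¹ (%%2-< ((z %% 2 ^ h + (2 ^ b ∸ 1)) // 2 ^ b))

  summary : ℕ → ℕ → ℕ
  summary zero z = 0
  summary (suc m) z = φ z + 2 * summary m (z // 2 ^ h)

  summary-< : ∀ m z → summary m z < 2 ^ m
  summary-< zero z = z<s
  summary-< (suc m) z = lin (φ z ∷ summary m (z // 2 ^ h) ∷ 2 ^ m ∷ []) (con 1 :+ (X0 :+ con 2 :* X1) :≤ con 2 :* X2)
    (hyp (con 1) (X0 :≤ con 1) (φ-≤ z) ∷ hyp (con 2) (con 1 :+ X1 :≤ X2) (summary-< m (z // 2 ^ h)) ∷ []) refl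

  summary-zero : ∀ m z → z < 2 ^ (h * m) → summary m z ≡ 0 → z ≡ 0
  summary-zero zero z z< _ = n<1⇒n≡0 (subst (λ e → z < 2 ^ e) (*-zeroʳ h) z<)
  summary-zero (suc m) z z< s≡0 = trans (div-mod z (pow>0 h)) (cong₂ (λ a c → a + c * 2 ^ h) low rest)
    where
    low : z %% 2 ^ h ≡ 0
    low = n≮0⇒n≡0 λ pos → 1≢0 (trans (sym (φ-pos z pos)) (m+n≡0⇒m≡0 (φ z) s≡0))
      where
      1≢0 : 1 ≢ 0
      1≢0 ()
      n≮0⇒n≡0 : ∀ {n} → ¬ (0 < n) → n ≡ 0
      n≮0⇒n≡0 h = n≤0⇒n≡0 (≮⇒≥ h)
    rest : z // 2 ^ h ≡ 0
    rest = summary-zero m (z // 2 ^ h) (<-*⇒//-< (<-≤-trans z< (≤-reflexive (trans (cong (2 ^_) (trans (*-suc h m) (+-comm h (h * m)))) (pow-+ (h * m) h)))))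
      (m+n≡0⇒m≡0 _ (m+n≡0⇒n≡0 (φ z) s≡0))

  summary-lower : ∀ m z j → z < 2 ^ (h * j) → summary m z < 2 ^ j
  summary-lower zero z j z< = pow>0 j
  summary-lower (suc m) z zero z< rewrite n<1⇒n≡0 (subst (λ e → z < 2 ^ e) (*-zeroʳ h) z<) = s≤s (≤-reflexive (zeros (suc m)))
    where
    zeros : ∀ m → summary m 0 ≡ 0
    zeros zero = refl
    zeros (suc m) = trans (cong₂ (λ a c → a + 2 * c) (φ-zero 0 (%%-small (pow>0 h))) (trans (cong (summary m) (//-small (pow>0 h))) (zeros m))) refl
  summary-lower (suc m) z (suc j) z< = lin (φ z ∷ summary m (z // 2 ^ h) ∷ 2 ^ j ∷ []) (con 1 :+ (X0 :+ con 2 :* X1) :≤ con 2 :* X2)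
    (hyp (con 1) (X0 :≤ con 1) (φ-≤ z) ∷ hyp (con 2) (con 1 :+ X1 :≤ X2) (summary-lower m (z // 2 ^ h) j
      (<-*⇒//-< (<-≤-trans z< (≤-reflexive (trans (cong (2 ^_) (trans (*-suc h j) (+-comm h (h * j)))) (pow-+ (h * j) h)))))) ∷ []) refl

  summary-upper : ∀ m z j → z < 2 ^ (h * m) → summary m z < 2 ^ j → z < 2 ^ (h * j)
  summary-upper m z zero z< s< = ≤-trans (s≤s (≤-reflexive (summary-zero m z z< (n<1⇒n≡0 s<)))) (pow>0 (h * 0))
  summary-upper zero z (suc j) z< s< = <-≤-trans z< (pow-mono {h * 0} {h * suc j} (≤-trans (≤-reflexive (*-zeroʳ h)) z≤n))
  summary-upper (suc m) z (suc j) z< s< = <-≤-trans (<-//-suc z (pow>0 h)) (≤-trans (*-monoˡ-≤ (2 ^ h)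
      (summary-upper m (z // 2 ^ h) j (<-*⇒//-< (<-≤-trans z< (≤-reflexive (split m))))
        (*-cancelˡ-< 2 (summary m (z // 2 ^ h)) (2 ^ j) (≤-<-trans (m≤n+m _ (φ z)) s<)))) (≤-reflexive (sym (split j))))
    where
    split : ∀ m → 2 ^ (h * suc m) ≡ 2 ^ (h * m) * 2 ^ h
    split m = trans (cong (2 ^_) (trans (*-suc h m) (+-comm h (h * m)))) (pow-+ (h * m) h)

  maskC addC topC repC powC topC′ : ℕ
  maskC = digits X n (λ _ → 2 ^ h ∸ 1)
  addC = digits X n (λ _ → 2 ^ b ∸ 1)
  topC = digits X n (λ _ → 2 ^ b)
  repC = digits X N (λ _ → 1)
  powC = digits X N (λ i → 2 ^ b ∸ 2 ^ i)
  topC′ = digits X N (λ _ → 2 ^ b)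

  low-blocks : ∀ r z → bitAnd (n * B + r) z maskC ≡ digits X n (λ i → shifted X z i %% 2 ^ h)
  low-blocks r z = trans (and-mask n r (2 ^ h ∸ 1) z (≤-trans (≤-reflexive (m+[n∸m]≡n {1} (pow>0 h))) (pow-mono (s≤s (≤-trans (m≤m+n n n) (n≤1+n N))))))
    (digits-cong X n λ i → trans (cong (λ f → bitAnd f (shifted X z i) (2 ^ h ∸ 1)) (cong suc (sym (+-suc n n)))) (bitAnd-ones h h (shifted X z i)))

  flagged : ∀ r z → bitAnd (n * B + r) (digits X n (λ i → shifted X z i %% 2 ^ h) + addC) topC ≡ 2 ^ b * digits X n (φ ∘ shifted X z)
  flagged r z = trans (cong (λ d → bitAnd (n * B + r) d topC) (digits-+ X n _ _)) (and-top n r _ (λ i → digit-< (shifted X z i)))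

  shifted-// : ∀ z i → shifted X (z // 2 ^ h) i ≡ shifted X z i // 2 ^ h
  shifted-// z zero = refl
  shifted-// z (suc i) = trans (cong (λ y → shifted X y i) swap) (shifted-// (z // X) i)
    where
    swap : z // 2 ^ h // X ≡ z // X // 2 ^ h
    swap = trans (sym (//-// z (pow>0 h) (pow>0 B))) (trans (cong (z //_) (*-comm (2 ^ h) X)) (//-// z (pow>0 B) (pow>0 h)))

  base-4 : ∀ m z → digits 4 m (λ i → φ (shifted X z i) + 2 * φ (shifted X z i // 2 ^ h)) ≡ summary (m + m) z
  base-4 zero z = refl
  base-4 (suc m) z = begin
    φ z + 2 * φ (z // 2 ^ h) + digits 4 m (λ i → φ (shifted X (z // X) i) + 2 * φ (shifted X (z // X) i // 2 ^ h)) * 4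
      ≡⟨ cong (λ d → φ z + 2 * φ (z // 2 ^ h) + d * 4) (base-4 m (z // X)) ⟩
    φ z + 2 * φ (z // 2 ^ h) + summary (m + m) (z // X) * 4
      ≡⟨ ring (φ z ∷ φ (z // 2 ^ h) ∷ summary (m + m) (z // X) ∷ []) (X0 :+ con 2 :* X1 :+ X2 :* con 4) (X0 :+ con 2 :* (X1 :+ con 2 :* X2)) refl refl ⟩
    φ z + 2 * (φ (z // 2 ^ h) + 2 * summary (m + m) (z // X))
      ≡⟨ cong (λ y → φ z + 2 * (φ (z // 2 ^ h) + 2 * summary (m + m) y)) (trans (cong (z //_) X≡) (//-// z (pow>0 h) (pow>0 h))) ⟩
    summary (suc (suc (m + m))) z
      ≡⟨ cong (λ k → summary (suc k) z) (sym (+-suc m m)) ⟩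
    summary (suc m + suc m) z ∎
    where open ≡-Reasoning

  X-4 : 4 + (X ∸ 4) ≡ X
  X-4 = m+[n∸m]≡n {4} {X} (≤-trans (m≤m*n 4 (2 ^ N) {{m^n≢0 2 N}}) (≤-reflexive (*-assoc 2 2 (2 ^ N))))

  private
    X≡4*2^N : X ≡ 4 * 2 ^ N
    X≡4*2^N = sym (*-assoc 2 2 (2 ^ N))

  collected : 0 < n → ∀ z → (digits X n (φ ∘ shifted X z) + 2 * digits X n (φ ∘ shifted X (z // 2 ^ h))) %% (X ∸ 4) ≡ summary N z
  collected n>0 z = begin
    (digits X n (φ ∘ shifted X z) + 2 * digits X n (φ ∘ shifted X (z // 2 ^ h))) %% (X ∸ 4)
      ≡⟨ cong (_%% (X ∸ 4)) (trans (cong₂ _+_ refl (trans (digits-* X n 2 _) (digits-cong X n (λ i → cong (λ y → 2 * φ y) (shifted-// z i))))) (digits-+ X n _ _)) ⟩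
    digits X n v %% (X ∸ 4) ≡⟨ cong (λ x → digits x n v %% (X ∸ 4)) (sym X-4) ⟩
    digits (4 + (X ∸ 4)) n v %% (X ∸ 4) ≡⟨ digits-%% 4 (X ∸ 4) n v (subst (_< X ∸ 4) (sym (base-4 n z)) fits) ⟩
    digits 4 n v ≡⟨ base-4 n z ⟩
    summary N z ∎
    where
    open ≡-Reasoning
    v : ℕ → ℕ
    v i = φ (shifted X z i) + 2 * φ (shifted X z i // 2 ^ h)
    fits : summary N z < X ∸ 4
    fits = <-≤-trans (summary-< N z) (+-cancelˡ-≤ 4 _ _ (≤-trans (lin (2 ^ N ∷ []) (con 4 :+ X0 :≤ con 4 :* X0) (hyp (con 3) (con 2 :≤ X0) (pow-mono {1} (≤-trans n>0 (m≤m+n n n))) ∷ []) refl)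
      (≤-reflexive (trans (sym X≡4*2^N) (sym X-4)))))

  compared : ∀ r {e} → e < 2 ^ N → bitAnd (N * B + r) (e * repC + powC) topC′ ≡ 2 ^ b * digits X N (λ i → b2n (i <ᵇ bits e))
  compared r {e} e< = trans (cong (λ d → bitAnd (N * B + r) d topC′) (trans (cong (_+ powC) (trans (digits-* X N e (λ _ → 1)) (digits-cong X N (λ _ → *-identityʳ e)))) (digits-+ X N _ _)))
    (trans (and-top N r v v<) (cong (2 ^ b *_) (digits-cong X N flag)))
    where
    v : ℕ → ℕ
    v i = e + (2 ^ b ∸ 2 ^ i)
    e<b : e < 2 ^ b
    e<b = <-trans e< (pow-mono-< (n<1+n N))
    v< : ∀ i → v i < X
    v< i = <-≤-trans (+-mono-<-≤ e<b (m∸n≤m (2 ^ b) (2 ^ i))) (≤-reflexive (cong (2 ^ b +_) (sym (+-identityʳ (2 ^ b)))))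
    flag : ∀ i → top (v i) ≡ b2n (i <ᵇ bits e)
    flag i with i <? bits e
    ... | yes i< rewrite <ᵇ-true i< = top-1 (≤-trans (≤-reflexive (sym (m+[n∸m]≡n {2 ^ i} (≤-trans (<-bits-iff i<) (<⇒≤ e<b))))) (+-monoˡ-≤ _ (<-bits-iff i<))) (v< i)
    ... | no i≮ rewrite <ᵇ-false (≮⇒≥ i≮) = top-0 below
      where
      e<i : e < 2 ^ i
      e<i = <-≤-trans (<-bits e) (pow-mono (≮⇒≥ i≮))
      below : v i < 2 ^ b
      below with 2 ^ i ≤? 2 ^ b
      ... | yes le = <-≤-trans (+-monoˡ-< _ e<i) (≤-reflexive (m+[n∸m]≡n le))
      ... | no nle = subst (λ d → e + d < 2 ^ b) (sym (m≤n⇒m∸n≡0 (<⇒≤ (≰⇒> nle)))) (subst (_< 2 ^ b) (sym (+-identityʳ e)) e<b)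

  counted : ∀ {e} → e < 2 ^ N → digits X N (λ i → b2n (i <ᵇ bits e)) %% (X ∸ 1) ≡ bits e
  counted {e} e< = trans (cong (λ x → digits x N (λ i → b2n (i <ᵇ bits e)) %% (X ∸ 1)) (sym (m+[n∸m]≡n {1} (pow>0 B))))
    (trans (digits-%% 1 (X ∸ 1) N _ (subst (_< X ∸ 1) (sym total) fits)) total)
    where
    total : digits 1 N (λ i → b2n (i <ᵇ bits e)) ≡ bits e
    total = trans (digits-1 N _) (count-< N (bits e) (bits-≤ e<))
    fits : bits e < X ∸ 1
    fits = ≤-<-trans (bits-≤ e<) (+-cancelˡ-< 1 _ _ (<-≤-trans (lin (N ∷ 2 ^ N ∷ []) (con 1 :+ (con 1 :+ X0) :≤ con 4 :* X1) (hyp (con 2) (con 1 :+ X0 :≤ X1) (n<2^n N) ∷ []) refl)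
      (≤-reflexive (trans (sym X≡4*2^N) (sym (m+[n∸m]≡n {1} (pow>0 B)))))))

module MsbE {k : ℕ} (hE bE maskE addE topE repE powE topE′ : Expr k) where

  opaque
    XE : Expr k
    XE = mul′ (lit 2) (pow′ bE)

    flagsE blocksE bitsE indexE restE logE : Expr k → Expr k
    flagsE z = div′ (and′ (add′ (and′ z maskE) addE) topE) (pow′ bE)
    blocksE z = rem′ (add′ (flagsE z) (mul′ (lit 2) (flagsE (div′ z (pow′ hE))))) (sub′ XE (lit 4))
    bitsE e = rem′ (div′ (and′ (add′ (mul′ e repE) powE) topE′) (pow′ bE)) (sub′ XE (lit 1))
    indexE z = mul′ hE (sub′ (bitsE (blocksE z)) (lit 1))
    restE z = div′ z (pow′ (indexE z))
    logE z = add′ (indexE z) (sub′ (bitsE (restE z)) (lit 1))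

module MsbLookup {k : ℕ} (u : ℕ) (u>0 : 0 < u) (R : Fin k → Word (F * u)) (β : ℕ → Bool) where

  open Semantics u u>0 R β
  open Logic u u>0 R β

  private variable
    e e₁ e₂ : Expr k

  opaque
    unfolding Semantics.⟪_⟫

    ⇓and-bits : ∀ {x y i j r} l → e₁ ⇓ x ∶ i → e₂ ⇓ y ∶ j → bitAnd w x y ≡ r → r < 2 ^ (l * u) → and′ e₁ e₂ ⇓ r ∶ l
    ⇓and-bits {e₁ = e₁} {e₂ = e₂} l (refl ⟨ _ ⟩) (refl ⟨ _ ⟩) h b = trans (value-and (eval R (mem β w) e₁) (eval R (mem β w) e₂)) h ⟨ b ⟩

  module _ (n : ℕ) (n>0 : 0 < n) where

    open Blocks n

    module _ {hE bE maskE addE topE repE powE topE′ : Expr k}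
      (⇓h : hE ⇓ h ∶ 1) (⇓b : bE ⇓ b ∶ 1)
      (⇓mask : maskE ⇓ maskC ∶ 16) (⇓addC : addE ⇓ addC ∶ 16) (⇓top : topE ⇓ topC ∶ 16)
      (⇓rep : repE ⇓ repC ∶ 16) (⇓powC : powE ⇓ powC ∶ 16) (⇓top′ : topE′ ⇓ topC′ ∶ 16)
      (NB≤ : N * B ≤ 16 * u) (b≤ : b ≤ 1 * u) where

      open MsbE hE bE maskE addE topE repE powE topE′

      private
        room : ∀ m → m * B ≤ 16 * u → w ≡ m * B + (w ∸ m * B)
        room m h = sym (m+[n∸m]≡n (≤-trans h (*-monoˡ-≤ u (toWitness {a? = 16 ≤? F} _))))
        nB≤ : n * B ≤ 16 * u
        nB≤ = ≤-trans (*-monoˡ-≤ B (m≤m+n n n)) NB≤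
        h≤ : h ≤ 1 * u
        h≤ = ≤-trans (s≤s (m≤m+n n n)) b≤
        digits-small : ∀ m v → m * B ≤ 16 * u → (∀ i → v i < X) → digits X m v < 2 ^ (16 * u)
        digits-small m v le v< = <-≤-trans (digits-< X m v v<) (≤-trans (≤-reflexive (trans (2^-^ B m) (cong (2 ^_) (*-comm B m)))) (pow-mono le))
        2b<X : ∀ {d} → d ≤ 1 → 2 ^ b * d < X
        2b<X {d} d≤ = ≤-<-trans (≤-trans (*-monoʳ-≤ (2 ^ b) d≤) (≤-reflexive (*-identityʳ (2 ^ b)))) (pow-mono-< (n<1+n b))
        exact : ∀ c → 2 ^ b * c // 2 ^ b ≡ c
        exact c = trans (cong (_// 2 ^ b) (*-comm (2 ^ b) c)) (//-* 0 c (pow>0 b))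

      opaque
        unfolding XE flagsE blocksE bitsE indexE restE logE

        private
          ⇓X : XE ⇓ X ∶ 4
          ⇓X = ⇓mul (⇓lit 2) (⇓pow ⇓b 1 b≤)

        ⇓flags : ∀ {z i} → e ⇓ z ∶ i → flagsE e ⇓ digits X n (φ ∘ shifted X z) ∶ 16
        ⇓flags {z = z} ⇓z = cast (exact _) (⇓div (⇓and-bits 16 (⇓add (⇓and-bits 16 ⇓z ⇓mask
            (trans (cong (λ f → bitAnd f z maskC) (room n nB≤)) (low-blocks (w ∸ n * B) z))
            (digits-small n _ nB≤ (λ i → ≤-<-trans (m≤m+n _ _) (digit-< (shifted X z i))))) ⇓addC) ⇓top
            (trans (cong (λ f → bitAnd f (digits X n (λ i → shifted X z i %% 2 ^ h) + addC) topC) (room n nB≤)) (flagged (w ∸ n * B) z))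
            (subst (_< 2 ^ (16 * u)) (sym (digits-* X n (2 ^ b) _)) (digits-small n _ nB≤ (λ i → 2b<X (φ-≤ (shifted X z i))))))
          (⇓pow ⇓b 1 b≤))

        ⇓blocks : ∀ {z i} → {_ : True (i ≤? F)} → e ⇓ z ∶ i → blocksE e ⇓ summary N z ∶ 1
        ⇓blocks {z = z} {_} {p} ⇓z = rebound (cast (collected n>0 z) (⇓rem (⇓add (⇓flags ⇓z) (⇓mul (⇓lit 2) (⇓flags (⇓div ⇓z (⇓pow ⇓h 1 h≤) {p}))))
            (⇓sub (≤-trans (m≤m+n 4 (X ∸ 4)) (≤-reflexive X-4)) ⇓X (⇓lit 4))))
          (<-≤-trans (summary-< N z) (pow-mono (≤-trans (n≤1+n N) b≤)))

        ⇓bits : ∀ {x} → e ⇓ x ∶ 1 → x < 2 ^ N → bitsE e ⇓ bits x ∶ 1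
        ⇓bits {x = x} ⇓x x< = rebound (cast (trans (cong (_%% (X ∸ 1)) (exact _)) (counted x<)) (⇓rem (⇓div (⇓and-bits 16 (⇓add (⇓mul ⇓x ⇓rep) ⇓powC) ⇓top′
            (trans (cong (λ f → bitAnd f (x * repC + powC) topC′) (room N NB≤)) (compared (w ∸ N * B) x<))
            (subst (_< 2 ^ (16 * u)) (sym (digits-* X N (2 ^ b) _)) (digits-small N _ NB≤ (λ i → 2b<X (b2n-≤ (i <ᵇ bits x))))))
          (⇓pow ⇓b 1 b≤)) (⇓sub (pow>0 B) ⇓X (⇓lit 1))))
          (≤-<-trans (bits-≤ x<) (<-≤-trans (n<2^n N) (pow-mono (≤-trans (n≤1+n N) b≤))))

        ⇓index : ∀ {z} → e ⇓ z ∶ 1 → 0 < bits (summary N z) → indexE e ⇓ h * (bits (summary N z) ∸ 1) ∶ 2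
        ⇓index {z = z} ⇓z pos = ⇓mul ⇓h (⇓sub pos (⇓bits (⇓blocks ⇓z) (summary-< N z)) (⇓lit 1))

        ⇓rest : ∀ {z I} → e ⇓ z ∶ 1 → indexE e ⇓ I ∶ 2 → I ≤ 16 * u → restE e ⇓ z // 2 ^ I ∶ 1
        ⇓rest ⇓z ⇓I I≤ = ⇓div ⇓z (⇓pow ⇓I 16 I≤)

        ⇓log-sum : ∀ {I x} → indexE e ⇓ I ∶ 2 → restE e ⇓ x ∶ 1 → x < 2 ^ N → 0 < bits x → logE e ⇓ I + (bits x ∸ 1) ∶ 3
        ⇓log-sum ⇓I ⇓x x< pos = ⇓add ⇓I (⇓sub pos (⇓bits ⇓x x<) (⇓lit 1))

      ⇓log : ∀ {z} → e ⇓ z ∶ 1 → 0 < z → z < 2 ^ (h * N) → z < 2 ^ (1 * u) → logE e ⇓ bits z ∸ 1 ∶ 1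
      ⇓log {e = e} {z} ⇓z z>0 z< z<u = rebound (cast total (⇓log-sum {e = e} ⇓I (⇓rest ⇓z ⇓I I≤) (<-≤-trans y< (pow-mono h≤N)) (bits-pos y>0)))
          (≤-<-trans (m∸n≤m (bits z) 1) (≤-<-trans (bits-≤ z<u) (n<2^n (1 * u))))
        where
        bits-pos : ∀ {x} → 0 < x → 0 < bits x
        bits-pos {x} x>0 with bits x in eq′
        ... | zero = ⊥-elim (<-irrefl refl (<-≤-trans (subst (λ t → x < 2 ^ t) eq′ (<-bits x)) x>0))
        ... | suc _ = z<s
        s = summary N z
        s>0 : 0 < s
        s>0 = n≢0⇒n>0 (λ s≡0 → <-irrefl (sym (summary-zero N z z< s≡0)) z>0)
        L = bits s ∸ 1
        L≡ : suc L ≡ bits s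
        L≡ = m+[n∸m]≡n {1} (bits-pos s>0)
        I = h * L
        ⇓I : indexE e ⇓ I ∶ 2
        ⇓I = ⇓index ⇓z (bits-pos s>0)
        y = z // 2 ^ I
        z-hi : z < 2 ^ (h * suc L)
        z-hi = summary-upper N z (suc L) z< (subst (λ t → s < 2 ^ t) (sym L≡) (<-bits s))
        z-lo : 2 ^ I ≤ z
        z-lo = ≮⇒≥ λ z<I → <-irrefl refl (<-≤-trans (summary-lower N z L z<I) (<-bits-iff (≤-reflexive L≡)))
        y< : y < 2 ^ h
        y< = <-*⇒//-< (<-≤-trans z-hi (≤-reflexive (trans (cong (2 ^_) (*-suc h L)) (pow-+ h I))))
        y>0 : 0 < y
        y>0 = *-≤⇒≤-// (pow>0 I) (≤-trans (≤-reflexive (*-identityˡ (2 ^ I))) z-lo)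
        h≤N : h ≤ N
        h≤N = ≤-trans (≤-reflexive (+-comm 1 n)) (+-monoʳ-≤ n n>0)
        I≤ : I ≤ 16 * u
        I≤ = ≤-trans (*-monoʳ-≤ h (s≤s⁻¹ (≤-trans (≤-reflexive L≡) (≤-trans (bits-≤ (summary-< N z)) (n≤1+n N)))))
          (≤-trans (≤-reflexive (*-comm h N)) (≤-trans (*-monoʳ-≤ N (s≤s (≤-trans (m≤m+n n n) (n≤1+n N)))) NB≤))
        m = bits y ∸ 1
        m≡ : suc m ≡ bits y
        m≡ = m+[n∸m]≡n {1} (bits-pos y>0)
        total : I + (bits y ∸ 1) ≡ bits z ∸ 1
        total = cong (_∸ 1) (sym (bits-unique {z} {I + m} lo hi))
          where
          lo : 2 ^ (I + m) ≤ z
          lo = ≤-trans (≤-reflexive (trans (cong (2 ^_) (+-comm I m)) (pow-+ m I))) (≤-trans (*-monoˡ-≤ (2 ^ I) (<-bits-iff (≤-reflexive m≡))) (//-*-≤ z (2 ^ I)))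
          hi : z < 2 ^ suc (I + m)
          hi = <-≤-trans (<-//-suc z (pow>0 I)) (≤-trans (*-monoˡ-≤ (2 ^ I) (subst (λ t → y < 2 ^ t) (sym m≡) (<-bits y)))
            (≤-reflexive (trans (sym (pow-+ (suc m) I)) (cong (λ t → 2 ^ suc t) (+-comm m I)))))

module NormalBits (ψ : ℕ → Bool) (e ℓ r S τ δ f fₜ : ℕ) (ℓ<ρ : ℓ < 2 ^ (r * S)) (ℓ<τ : ℓ < 2 ^ τ) where

  χ : ℕ → ℕ → Bool
  χ i y = ψ (i * 2 ^ ℓ + y)

  blob : ℕ → Bits
  blob i = BucketBits.bucketBits (χ i) ℓ r S τ δ f ℓ<ρ ℓ<τ

  open Layout.Store e fₜ fₜ blob public using (layout; Narrow; narrow; module Top)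

record MsbParams (k : ℕ) : Set where
  field hE bE maskE addE topE repE powE topE′ : Expr k

module _ {k : ℕ} (W : Expr k) (mp : MsbParams k) where
  open MsbParams mp
  open MsbE hE bE maskE addE topE repE powE topE′ using (logE)

  module NormalE (fE fₜE ℓE τE rE v₁E : Expr k) (S : ℕ) where
    open BucketE W fE ℓE τE rE v₁E S

    opaque
      bucketPosE withinE : Expr k → Expr k
      bucketPosE x = storeE W fₜE fₜE (lit 0) (div′ x (pow′ ℓE))
      withinE x = rem′ x (pow′ ℓE)

      gapE : Expr k → Expr k → Expr k
      gapE lo hi = add′ (sub′ hi lo) (lt′ (sub′ hi lo) (lit 1))

      intervalE normalE : Expr k → Expr k → Expr k
      intervalE lo hi = logE (gapE (withinE lo) (withinE hi))
      normalE lo hi = bucketE (bucketPosE lo) (intervalE lo hi) (withinE lo) (withinE hi)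

gap-facts : ∀ ℓ {z} → z < 2 ^ ℓ → let z′ = z + b2n (z <ᵇ 1); t = bits z′ ∸ 1 in
  0 < z′ × z′ < 2 ^ suc ℓ × t ≤ ℓ × z < 2 * 2 ^ t × (t ≡ 0 ⊎ 2 ^ t ≤ z)
gap-facts ℓ {z} z< = z′>0 , z′< , s≤s⁻¹ (≤-trans (≤-reflexive t≡) (bits-≤ z′<)) ,
    ≤-<-trans (m≤m+n z _) (subst (λ s → z′ < 2 ^ s) (sym t≡) (<-bits z′)) ,
    [ (λ h → inj₁ (trans (cong (λ y → bits y ∸ 1) (proj₂ h)) (m≤n⇒m∸n≡0 (bits≤ 1)))) , (λ h → inj₂ (≤-trans (<-bits-iff (≤-reflexive t≡)) (≤-reflexive (proj₂ h)))) ]′ (cases z)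
  where
  z′ t : ℕ
  z′ = z + b2n (z <ᵇ 1)
  t = bits z′ ∸ 1
  cases : ∀ z → (z ≡ 0 × z + b2n (z <ᵇ 1) ≡ 1) ⊎ (0 < z × z + b2n (z <ᵇ 1) ≡ z)
  cases zero = inj₁ (refl , refl)
  cases (suc y) = inj₂ (z<s , +-identityʳ (suc y))
  z′>0 : 0 < z′
  z′>0 = [ (λ h → ≤-reflexive (sym (proj₂ h))) , (λ h → subst (0 <_) (sym (proj₂ h)) (proj₁ h)) ]′ (cases z)
  z′< : z′ < 2 ^ suc ℓ
  z′< = [ (λ h → subst (_< 2 ^ suc ℓ) (sym (proj₂ h)) (pow-mono-< {0} {suc ℓ} z<s)) , (λ h → subst (_< 2 ^ suc ℓ) (sym (proj₂ h)) (<-trans z< (pow-mono-< {ℓ} {suc ℓ} (n<1+n ℓ)))) ]′ (cases z)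
  t≡ : suc t ≡ bits z′
  t≡ = m+[n∸m]≡n {1} (pow-cancel-< (≤-<-trans z′>0 (<-bits z′)))

module Window (ψ : ℕ → Bool) (ℓ : ℕ) {lo hi : ℕ} (lo≤hi : lo ≤ hi) (same : lo // 2 ^ ℓ ≡ hi // 2 ^ ℓ) where

  i lo′ hi′ : ℕ
  i = lo // 2 ^ ℓ
  lo′ = lo %% 2 ^ ℓ
  hi′ = hi %% 2 ^ ℓ

  lo≡ : lo ≡ i * 2 ^ ℓ + lo′
  lo≡ = trans (div-mod lo (pow>0 ℓ)) (+-comm lo′ _)
  hi≡ : hi ≡ i * 2 ^ ℓ + hi′
  hi≡ = trans (div-mod hi (pow>0 ℓ)) (trans (+-comm hi′ _) (cong (λ j → j * 2 ^ ℓ + hi′) (sym same)))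
  lo′≤hi′ : lo′ ≤ hi′
  lo′≤hi′ = +-cancelˡ-≤ (i * 2 ^ ℓ) lo′ hi′ (subst₂ _≤_ lo≡ hi≡ lo≤hi)
  hi′< : hi′ < 2 ^ ℓ
  hi′< = %%-< hi (pow>0 ℓ)

  Global Local : Set
  Global = ∃[ x ] (ψ x ≡ true × lo ≤ x × x ≤ hi)
  Local = ∃[ x ] (x < 2 ^ ℓ × ψ (i * 2 ^ ℓ + x) ≡ true × lo′ ≤ x × x ≤ hi′)

  outward : Local → Global
  outward (x , _ , ex , lo≤ , ≤hi) = i * 2 ^ ℓ + x , ex , subst (_≤ i * 2 ^ ℓ + x) (sym lo≡) (+-monoʳ-≤ _ lo≤) , subst (i * 2 ^ ℓ + x ≤_) (sym hi≡) (+-monoʳ-≤ _ ≤hi)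

  inward : Global → Local
  inward (x , ex , lo≤ , ≤hi) = x′ , ≤-<-trans x′≤ hi′< , subst (λ y → ψ y ≡ true) x≡ ex , lo′≤ , x′≤
    where
    x′ = x ∸ i * 2 ^ ℓ
    x≡ : x ≡ i * 2 ^ ℓ + x′
    x≡ = sym (m+[n∸m]≡n (≤-trans (//-*-≤ lo (2 ^ ℓ)) lo≤))
    lo′≤ : lo′ ≤ x′
    lo′≤ = +-cancelˡ-≤ (i * 2 ^ ℓ) lo′ x′ (subst₂ _≤_ lo≡ x≡ lo≤)
    x′≤ : x′ ≤ hi′
    x′≤ = +-cancelˡ-≤ (i * 2 ^ ℓ) x′ hi′ (subst₂ _≤_ x≡ hi≡ ≤hi)

module NormalLookup {k : ℕ} (u : ℕ) (u>0 : 0 < u) (R : Fin k → Word (F * u)) (β : ℕ → Bool)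
  (Z : ℕ) (Z< : Z < 2 ^ (1 * u)) {W : Expr k} (⇓W : Semantics._⇓_∶_ u u>0 R β W (F * u) 7)
  (ψ : ℕ → Bool) (e ℓ r S τ δ f fₜ : ℕ) (ℓ<ρ : ℓ < 2 ^ (r * S)) (ℓ<τ : ℓ < 2 ^ τ)
  {fE : Expr k} (⇓f : Semantics._⇓_∶_ u u>0 R β fE f 1) (2^f≤ : 2 ^ f ≤ 1 * u)
  {fₜE : Expr k} (⇓fₜ : Semantics._⇓_∶_ u u>0 R β fₜE fₜ 1) (2^fₜ≤ : 2 ^ fₜ ≤ 1 * u)
  {ℓE τE rE v₁E : Expr k} (⇓ℓ : Semantics._⇓_∶_ u u>0 R β ℓE ℓ 1) (⇓τ : Semantics._⇓_∶_ u u>0 R β τE τ 1)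
  (⇓r : Semantics._⇓_∶_ u u>0 R β rE r 1) (⇓v₁ : Semantics._⇓_∶_ u u>0 R β v₁E (τ + suc δ) 1)
  (ℓ< : suc ℓ ≤ 1 * u) (τ≤ : τ ≤ 1 * u) (v₁≤ : τ + suc δ ≤ 1 * u) (rS≤ : r * S ≤ 1 * u) (S≤ : S ≤ 1 * u) where

  open NormalBits ψ e ℓ r S τ δ f fₜ ℓ<ρ ℓ<τ
  module Bucket (i : ℕ) = BucketBits (χ i) ℓ r S τ δ f ℓ<ρ ℓ<τ

  module _ (v₂< : ∀ i → i < 2 ^ e → Bucket.v₂ i < 2 ^ f)
    (narrow₁ : ∀ i → i < 2 ^ e → Bucket.R₁.Narrow i) (narrow₂ : ∀ i → i < 2 ^ e → Bucket.R₂.Narrow i)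
    (widths₁ : ∀ i → i < 2 ^ e → bits (8 * suc (Bucket.R₁.N i * (Bucket.R₁.N i * suc (Bucket.κ i)))) < 2 ^ f)
    (widths₂ : ∀ i → i < 2 ^ e → bits (8 * suc (Bucket.R₂.N i * (Bucket.R₂.N i * suc (Bucket.κ i)))) < 2 ^ f)
    (tables-width : ∀ i → i < 2 ^ e → Bucket.Tables.width i < 2 ^ f)
    (fitting : Narrow) (here : At β Z 0 layout)
    (n : ℕ) (n>0 : 0 < n)
    (mp : MsbParams k) where

    open Blocks n using (h; N; b; B; maskC; addC; topC; repC; powC; topC′)
    open MsbParams mp

    module _ (⇓h : Semantics._⇓_∶_ u u>0 R β hE h 1) (⇓b : Semantics._⇓_∶_ u u>0 R β bE b 1)
      (⇓mask : Semantics._⇓_∶_ u u>0 R β maskE maskC 16) (⇓addC : Semantics._⇓_∶_ u u>0 R β addE addC 16)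
      (⇓top : Semantics._⇓_∶_ u u>0 R β topE topC 16) (⇓rep : Semantics._⇓_∶_ u u>0 R β repE repC 16)
      (⇓powC : Semantics._⇓_∶_ u u>0 R β powE powC 16) (⇓top′ : Semantics._⇓_∶_ u u>0 R β topE′ topC′ 16)
      (NB≤ : N * B ≤ 16 * u) (b≤ : b ≤ 1 * u) (ℓ<hN : ℓ < h * N) where

      open Layout.Lookup u u>0 R β Z Z< ⇓W
      open Logic u u>0 R β
      open NormalE W mp fE fₜE ℓE τE rE v₁E S
      open BucketE W fE ℓE τE rE v₁E S
      open MsbE hE bE maskE addE topE repE powE topE′ using (logE)
      open MsbLookup u u>0 R β

      private
        ℓ≤u : ℓ ≤ 1 * u
        ℓ≤u = ≤-trans (n≤1+n ℓ) ℓ<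
        fₜ≤ : fₜ ≤ 1 * u
        fₜ≤ = ≤-trans (<⇒≤ (n<2^n fₜ)) 2^fₜ≤

      gap : ℕ → ℕ → ℕ
      gap lo hi = hi ∸ lo + b2n (hi ∸ lo <ᵇ 1)

      opaque
        unfolding bucketPosE withinE gapE intervalE normalE

        ⇓bucketPos : ∀ {x} {E : Expr k} → E ⇓ x ∶ 1 → x // 2 ^ ℓ < 2 ^ e → Σ[ q ∈ ℕ ] (bucketPosE E ⇓ q ∶ 1) × At β Z q (blob (x // 2 ^ ℓ))
        ⇓bucketPos ⇓x i< = ⇓store {m = e} {g = fₜ} {f = fₜ} {b = blob} ⇓fₜ fₜ≤ ⇓fₜ fₜ≤ fitting 2^fₜ≤ (raise (⇓lit 0)) here (⇓div ⇓x (⇓pow ⇓ℓ 1 ℓ≤u)) i<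

        ⇓within : ∀ {x} {E : Expr k} → E ⇓ x ∶ 1 → withinE E ⇓ x %% 2 ^ ℓ ∶ 1
        ⇓within ⇓x = ⇓rem ⇓x (⇓pow ⇓ℓ 1 ℓ≤u)

        ⇓gap : ∀ {lo hi} {loE hiE : Expr k} → loE ⇓ lo ∶ 1 → hiE ⇓ hi ∶ 1 → lo ≤ hi → gap lo hi < 2 ^ (1 * u) → gapE loE hiE ⇓ gap lo hi ∶ 1
        ⇓gap ⇓lo ⇓hi lo≤hi small = rebound (⇓add (⇓sub lo≤hi ⇓hi ⇓lo) (⇓lt (⇓sub lo≤hi ⇓hi ⇓lo) (⇓lit 1))) small

        ⇓interval : ∀ {t} {loE hiE : Expr k} → logE (gapE (withinE loE) (withinE hiE)) ⇓ t ∶ 1 → intervalE loE hiE ⇓ t ∶ 1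
        ⇓interval ⇓t = ⇓t

        normal-bucket : ∀ {loE hiE : Expr k} {P Q} → Decides (bucketE (bucketPosE loE) (intervalE loE hiE) (withinE loE) (withinE hiE)) P Q → Decides (normalE loE hiE) P Q
        normal-bucket d = d

      private
        convert : ∀ {E : Expr k} {P Q P′ Q′ : Set} → (P → P′) → (Q′ → Q) → Decides E P Q → Decides E P′ Q′
        convert f g (decides a v s c) = decides a v (f ∘ s) (c ∘ g)

        in-bucket : ∀ i → i < 2 ^ e → ∀ {pos lo hi t} {posE loE hiE tE : Expr k} → posE ⇓ pos ∶ 1 → At β Z pos (blob i) → loE ⇓ lo ∶ 1 → hiE ⇓ hi ∶ 1 → tE ⇓ t ∶ 1 →
          t ≤ ℓ → lo ≤ hi → hi < 2 ^ ℓ → hi ∸ lo < 2 * 2 ^ t → (t ≡ 0 ⊎ 2 ^ t ≤ hi ∸ lo) →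
          Decides (bucketE posE tE loE hiE) (∃[ x ] (x < 2 ^ ℓ × χ i x ≡ true × lo ≤ x × x ≤ hi)) (∃[ x ] (x < 2 ^ ℓ × χ i x ≡ true × lo ≤ x × x ≤ hi))
        in-bucket i i< ⇓pos at-pos ⇓lo ⇓hi ⇓t =
          BucketLookup.bucket-decides u u>0 R β Z Z< ⇓W ⇓f 2^f≤ (χ i) ℓ r S τ δ ℓ<ρ ℓ<τ ⇓ℓ ⇓τ ⇓r ⇓v₁ ℓ< τ≤ v₁≤ rS≤ S≤
            (v₂< i i<) (narrow₁ i i<) (narrow₂ i i<) (widths₁ i i<) (widths₂ i i<) (tables-width i i<) ⇓pos at-pos ⇓lo ⇓hi ⇓t

        ⇓t : ∀ {lo hi} {loE hiE : Expr k} → loE ⇓ lo ∶ 1 → hiE ⇓ hi ∶ 1 → lo %% 2 ^ ℓ ≤ hi %% 2 ^ ℓ →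
          intervalE loE hiE ⇓ bits (gap (lo %% 2 ^ ℓ) (hi %% 2 ^ ℓ)) ∸ 1 ∶ 1
        ⇓t {lo} {hi} {loE} {hiE} ⇓lo ⇓hi lo≤hi = ⇓interval {loE = loE} {hiE} (⇓log n n>0 ⇓h ⇓b ⇓mask ⇓addC ⇓top ⇓rep ⇓powC ⇓top′ NB≤ b≤
            (⇓gap (⇓within ⇓lo) (⇓within ⇓hi) lo≤hi fits₁) (proj₁ facts) (<-≤-trans (proj₁ (proj₂ facts)) (pow-mono ℓ<hN)) fits₁)
          where
          facts = gap-facts ℓ {hi %% 2 ^ ℓ ∸ lo %% 2 ^ ℓ} (≤-<-trans (m∸n≤m (hi %% 2 ^ ℓ) (lo %% 2 ^ ℓ)) (%%-< hi (pow>0 ℓ)))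
          fits₁ : gap (lo %% 2 ^ ℓ) (hi %% 2 ^ ℓ) < 2 ^ (1 * u)
          fits₁ = <-≤-trans (proj₁ (proj₂ facts)) (pow-mono ℓ<)

      normal-decides : ∀ {lo hi} {loE hiE : Expr k} → loE ⇓ lo ∶ 1 → hiE ⇓ hi ∶ 1 → lo ≤ hi → hi < 2 ^ (e + ℓ) → lo // 2 ^ ℓ ≡ hi // 2 ^ ℓ →
        Decides (normalE loE hiE) (∃[ x ] (ψ x ≡ true × lo ≤ x × x ≤ hi)) (∃[ x ] (ψ x ≡ true × lo ≤ x × x ≤ hi))
      normal-decides {lo} {hi} {loE} {hiE} ⇓lo ⇓hi lo≤hi hi< same = normal-bucket (convert (Window.outward ψ ℓ lo≤hi same) (Window.inward ψ ℓ lo≤hi same)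
          (in-bucket (lo // 2 ^ ℓ) i< (proj₁ (proj₂ found)) (proj₂ (proj₂ found)) (⇓within ⇓lo) (⇓within ⇓hi) (⇓t ⇓lo ⇓hi lo′≤hi′)
            (proj₁ (proj₂ (proj₂ facts))) lo′≤hi′ (%%-< hi (pow>0 ℓ)) (proj₁ (proj₂ (proj₂ (proj₂ facts)))) (proj₂ (proj₂ (proj₂ (proj₂ facts))))))
        where
        lo′≤hi′ = Window.lo′≤hi′ ψ ℓ lo≤hi same
        facts = gap-facts ℓ {hi %% 2 ^ ℓ ∸ lo %% 2 ^ ℓ} (≤-<-trans (m∸n≤m (hi %% 2 ^ ℓ) (lo %% 2 ^ ℓ)) (%%-< hi (pow>0 ℓ)))
        i< : lo // 2 ^ ℓ < 2 ^ e
        i< = <-*⇒//-< (≤-<-trans lo≤hi (<-≤-trans hi< (≤-reflexive (pow-+ e ℓ))))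
        found = ⇓bucketPos ⇓lo i<

open import Data.Bool.Properties using (∨-assoc)

≡ᵇ-≡ : ∀ {m n} → m ≡ n → (m ≡ᵇ n) ≡ true
≡ᵇ-≡ {m} refl = ≡ᵇ-refl m

≡ᵇ-≢ : ∀ {m n} → m ≢ n → (m ≡ᵇ n) ≡ false
≡ᵇ-≢ {m} {n} ne with m ≡ᵇ n in e
... | true = ⊥-elim (ne (≡ᵇ⇒≡ m n (subst T (sym e) _)))
... | false = refl

stretch : (ℕ → Bool) → ℕ → ℕ → Bits
stretch β p zero = []
stretch β p (suc n) = β p ∷ stretch β (suc p) n

length-stretch : ∀ β p n → length (stretch β p n) ≡ n
length-stretch β p zero = refl
length-stretch β p (suc n) = cong suc (length-stretch β (suc p) n)

enc-read : ∀ β p n → enc n (read β p n) ≡ stretch β p n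
enc-read β p zero = refl
enc-read β p (suc n) = cong₂ _∷_ (low (β p)) (trans (cong (enc n) (high (β p))) (enc-read β (suc p) n))
  where
  r = read β (suc p) n
  low : ∀ b → ((b2n b + 2 * r) %% 2 ≡ᵇ 1) ≡ b
  low b = trans (cong (λ m → (b2n b + m) %% 2 ≡ᵇ 1) (*-comm 2 r)) (trans (cong (_≡ᵇ 1) (%%-* (b2n b) r (s≤s (b2n-≤ b)))) (bit b))
    where
    bit : ∀ b → (b2n b ≡ᵇ 1) ≡ b
    bit true = refl
    bit false = refl
  high : ∀ b → (b2n b + 2 * r) // 2 ≡ r
  high b = trans (cong (λ m → (b2n b + m) // 2) (*-comm 2 r)) (//-* (b2n b) r (s≤s (b2n-≤ b)))

stretch-At : ∀ {β Z p} xs n → At β Z p xs → length xs ≤ n → stretch β p n ≡ xs ++ stretch β (p + length xs) (n ∸ length xs)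
stretch-At {β} {Z} {p} [] n h le = cong (λ q → stretch β q n) (sym (+-identityʳ p))
stretch-At {β} {Z} {p} (x ∷ xs) (suc n) (h , hs) (s≤s le) = cong₂ _∷_ h (trans (stretch-At xs n hs le)
  (cong (λ q → xs ++ stretch β q (n ∸ length xs)) (sym (+-suc p (length xs)))))

stretch-self : ∀ {β Z p} f n → At β Z p (stretch f 0 n) → ∀ {i} → i < n → β (p + i) ≡ f i
stretch-self {β} {Z} f n h i<n = go f 0 n h i<n
  where
  go : ∀ f q n {p} → At β Z p (stretch f q n) → ∀ {i} → i < n → β (p + i) ≡ f (q + i)
  go f q (suc n) {p} (e , h) {zero} _ = trans (cong β (+-identityʳ p)) (trans e (cong f (sym (+-identityʳ q))))
  go f q (suc n) {p} (e , h) {suc i} i< = trans (cong β (+-suc p i)) (trans (go f (suc q) n h (s<s⁻¹ i<)) (cong f (sym (+-suc q i))))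

read-pos : ∀ β p n → (0 <ᵇ read β p n) ≡ true → ∃[ i ] (i < n × β (p + i) ≡ true)
read-pos β p (suc n) h with β p in e
... | true = 0 , z<s , trans (cong β (+-identityʳ p)) e
... | false = let i , i< , b = read-pos β (suc p) n (<ᵇ-true {0} {read β (suc p) n} (*-cancelˡ-< 2 0 (read β (suc p) n) (<ᵇ-true⁻ {0} h))) in suc i , s<s i< , trans (cong β (+-suc p i)) b

pos-read : ∀ β p n {i} → i < n → β (p + i) ≡ true → 0 < read β p n
pos-read β p (suc n) {zero} _ b rewrite trans (cong β (sym (+-identityʳ p))) b = z<s
pos-read β p (suc n) {suc i} i< b = <-≤-trans (*-mono-≤ {1} {2} (s≤s z≤n) (pos-read β (suc p) n (s<s⁻¹ i<) (trans (cong β (sym (+-suc p i))) b))) (m≤n+m _ (b2n (β p)))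

-- The code of a set of points: bucket by bucket, each point as a 1 followed
-- by the h low bits of the point, and a 0 at the end of the bucket.
module SetCode (h : ℕ) where

  low : ℕ → Bits → ℕ
  low zero xs = 0
  low (suc l) [] = 0
  low (suc l) (x ∷ xs) = b2n x + 2 * low l xs

  low-enc : ∀ l v rest → low l (enc l v ++ rest) ≡ v %% 2 ^ l
  low-enc l v rest = trans (shape l v rest) (trans (sym (At-enc-mod′ l v)) refl)
    where
    shape : ∀ l v rest → low l (enc l v ++ rest) ≡ low l (enc l v)
    shape zero v rest = refl
    shape (suc l) v rest = cong (λ t → b2n (v %% 2 ≡ᵇ 1) + 2 * t) (shape l (v // 2) rest)
    At-enc-mod′ : ∀ l v → v %% 2 ^ l ≡ low l (enc l v)
    At-enc-mod′ l v = sym (trans (same l (enc l v) 0 (length-enc l v) (λ _ → refl)) (At-enc-mod {bit (enc l v)} {l} l v (self (enc l v) 0 (≤-reflexive (length-enc l v)) (λ _ → refl))))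
      where
      bit : Bits → ℕ → Bool
      bit [] _ = false
      bit (x ∷ xs) zero = x
      bit (x ∷ xs) (suc i) = bit xs i
      same : ∀ l xs {β} p → length xs ≡ l → (∀ i → bit xs i ≡ β (p + i)) → low l xs ≡ read β p l
      same zero [] p e h = refl
      same (suc l) (x ∷ xs) {β} p e h = cong₂ (λ a b → b2n a + 2 * b) (trans (h 0) (cong β (+-identityʳ p))) (same l xs (suc p) (suc-injective e) (λ i → trans (h (suc i)) (cong β (+-suc p i))))
      self : ∀ xs {β Z} p → p + length xs ≤ Z → (∀ i → bit xs i ≡ β (p + i)) → At β Z p xs
      self [] p le h = ≤-trans (≤-reflexive (sym (+-identityʳ p))) le
      self (x ∷ xs) {β} p le h = sym (trans (h 0) (cong β (+-identityʳ p))) , self xs (suc p) (≤-trans (≤-reflexive (sym (+-suc p (length xs)))) le) (λ i → trans (h (suc i)) (cong β (+-suc p i)))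

  -- decode p skips s bits, and then parses r buckets starting with bucket b;
  -- it tells whether p is among the points.
  decode : ℕ → ℕ → ℕ → ℕ → Bits → Bool
  decode p (suc s) b r (x ∷ xs) = decode p s b r xs
  decode p zero b (suc r) (false ∷ xs) = decode p zero (suc b) r xs
  decode p zero b (suc r) (true ∷ xs) = (p ≡ᵇ b * 2 ^ h + low h xs) ∨ decode p h b (suc r) xs
  decode p zero b zero xs = false
  decode p s b r [] = false

  decode-skip : ∀ p l v b r rest → decode p l b r (enc l v ++ rest) ≡ decode p 0 b r rest
  decode-skip p zero v b r rest = refl
  decode-skip p (suc l) v b r rest = decode-skip p l (v // 2) b r rest

  module _ (χ : ℕ → Bool) where

    pointCode : ℕ → Bits
    pointCode q = if χ q then true ∷ enc h (q %% 2 ^ h) else []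

    bucketCode : ℕ → ℕ → Bits
    bucketCode zero q = []
    bucketCode (suc n) q = pointCode q ++ bucketCode n (suc q)

    setCode : ℕ → ℕ → Bits
    setCode zero b = []
    setCode (suc r) b = bucketCode (2 ^ h) (b * 2 ^ h) ++ (false ∷ setCode r (suc b))

    among : ℕ → ℕ → ℕ → Bool
    among p zero q = false
    among p (suc n) q = ((p ≡ᵇ q) ∧ χ q) ∨ among p n (suc q)

    decode-bucket : ∀ p b r n q rest → b * 2 ^ h ≤ q → q + n ≤ suc b * 2 ^ h →
      decode p 0 b (suc r) (bucketCode n q ++ rest) ≡ among p n q ∨ decode p 0 b (suc r) rest
    decode-bucket p b r zero q rest lo hi = refl
    decode-bucket p b r (suc n) q rest lo hi = trans (cong (decode p 0 b (suc r)) (++-assoc (pointCode q) (bucketCode n (suc q)) rest))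
      (trans (point (χ q)) (trans (cong (((p ≡ᵇ q) ∧ χ q) ∨_) (decode-bucket p b r n (suc q) rest (m≤n⇒m≤1+n lo) (≤-trans (≤-reflexive (sym (+-suc q n))) hi)))
        (sym (∨-assoc ((p ≡ᵇ q) ∧ χ q) _ _))))
      where
      q< : q < suc b * 2 ^ h
      q< = <-≤-trans (m<m+n q z<s) hi
      bucket≡ : q // 2 ^ h ≡ b
      bucket≡ = //-unique lo q<
      position : b * 2 ^ h + q %% 2 ^ h ≡ q
      position = trans (cong (λ z → z * 2 ^ h + q %% 2 ^ h) (sym bucket≡)) (trans (+-comm _ (q %% 2 ^ h)) (sym (div-mod q (pow>0 h))))
      tl = bucketCode n (suc q) ++ rest
      point : ∀ c → decode p 0 b (suc r) ((if c then true ∷ enc h (q %% 2 ^ h) else []) ++ tl) ≡ ((p ≡ᵇ q) ∧ c) ∨ decode p 0 b (suc r) tl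
      point true = cong₂ _∨_ (trans (cong (p ≡ᵇ_) (trans (cong (b * 2 ^ h +_) (trans (low-enc h (q %% 2 ^ h) tl) (%%-small (%%-< q (pow>0 h))))) position)) (sym (∧-true (p ≡ᵇ q))))
          (decode-skip p h (q %% 2 ^ h) b (suc r) tl)
        where
        ∧-true : ∀ b → b ∧ true ≡ b
        ∧-true true = refl
        ∧-true false = refl
      point false = cong (_∨ decode p 0 b (suc r) tl) (sym (∧-false (p ≡ᵇ q)))
        where
        ∧-false : ∀ b → b ∧ false ≡ false
        ∧-false true = refl
        ∧-false false = refl

    among-in : ∀ p n q → q ≤ p → p < q + n → among p n q ≡ χ p
    among-in p zero q lo hi = ⊥-elim (<-irrefl refl (<-≤-trans hi (≤-trans (≤-reflexive (+-identityʳ q)) lo)))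
    among-in p (suc n) q lo hi with p ≟ q
    ... | yes refl rewrite ≡ᵇ-≡ {p} refl = trans (cong (χ p ∨_) (among-out p n (suc p) (n<1+n p))) (∨-false (χ p))
      where
      ∨-false : ∀ b → b ∨ false ≡ b
      ∨-false true = refl
      ∨-false false = refl
      among-out : ∀ p n q → p < q → among p n q ≡ false
      among-out p zero q h = refl
      among-out p (suc n) q h rewrite ≡ᵇ-≢ (<⇒≢ h) = among-out p n (suc q) (m<n⇒m<1+n h)
    ... | no p≢q rewrite ≡ᵇ-≢ p≢q = among-in p n (suc q) (≤∧≢⇒< lo (p≢q ∘ sym)) (<-≤-trans hi (≤-reflexive (+-suc q n)))

    among-false : ∀ p n q → (p < q ⊎ q + n ≤ p) → among p n q ≡ false
    among-false p zero q h = refl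
    among-false p (suc n) q (inj₁ h) rewrite ≡ᵇ-≢ (<⇒≢ h) = among-false p n (suc q) (inj₁ (m<n⇒m<1+n h))
    among-false p (suc n) q (inj₂ h) rewrite ≡ᵇ-≢ (<⇒≢ (<-≤-trans (m<m+n q z<s) h) ∘ sym) = among-false p n (suc q) (inj₂ (≤-trans (≤-reflexive (sym (+-suc q n))) h))

    decode-set : ∀ p r b rest → b * 2 ^ h ≤ p → p < (b + r) * 2 ^ h → decode p 0 b r (setCode r b ++ rest) ≡ χ p
    decode-set p zero b rest lo hi = ⊥-elim (<-irrefl refl (<-≤-trans hi (≤-trans (≤-reflexive (cong (_* 2 ^ h) (+-identityʳ b))) lo)))
    decode-set p (suc r) b rest lo hi = trans (cong (decode p 0 b (suc r)) (++-assoc (bucketCode (2 ^ h) (b * 2 ^ h)) (false ∷ setCode r (suc b)) rest))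
      (trans (decode-bucket p b r (2 ^ h) (b * 2 ^ h) (false ∷ setCode r (suc b) ++ rest) ≤-refl (≤-reflexive (+-comm (b * 2 ^ h) (2 ^ h)))) (choose (p <? suc b * 2 ^ h)))
      where
      end≡ : b * 2 ^ h + 2 ^ h ≡ suc b * 2 ^ h
      end≡ = +-comm (b * 2 ^ h) (2 ^ h)
      after : ∀ p r b rest → p < b * 2 ^ h → decode p 0 b r (setCode r b ++ rest) ≡ false
      after p zero b rest h′ = refl
      after p (suc r) b rest h′ = trans (cong (decode p 0 b (suc r)) (++-assoc (bucketCode (2 ^ h) (b * 2 ^ h)) (false ∷ setCode r (suc b)) rest))
        (trans (decode-bucket p b r (2 ^ h) (b * 2 ^ h) (false ∷ setCode r (suc b) ++ rest) ≤-refl (≤-reflexive (+-comm (b * 2 ^ h) (2 ^ h))))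
          (trans (cong (_∨ decode p 0 (suc b) r (setCode r (suc b) ++ rest)) (among-false p (2 ^ h) (b * 2 ^ h) (inj₁ h′))) (after p r (suc b) rest (<-≤-trans h′ (m≤n+m _ (2 ^ h))))))
      choose : Dec (p < suc b * 2 ^ h) → among p (2 ^ h) (b * 2 ^ h) ∨ decode p 0 (suc b) r (setCode r (suc b) ++ rest) ≡ χ p
      choose (yes here) = trans (cong₂ _∨_ (among-in p (2 ^ h) (b * 2 ^ h) lo (<-≤-trans here (≤-reflexive (sym end≡)))) (after p r (suc b) rest here)) (∨-false (χ p))
        where
        ∨-false : ∀ b → b ∨ false ≡ b
        ∨-false true = refl
        ∨-false false = refl
      choose (no later) = trans (cong (_∨ decode p 0 (suc b) r (setCode r (suc b) ++ rest)) (among-false p (2 ^ h) (b * 2 ^ h) (inj₂ (≤-trans (≤-reflexive end≡) (≮⇒≥ later)))))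
        (decode-set p r (suc b) rest (≮⇒≥ later) (<-≤-trans hi (≤-reflexive (cong (_* 2 ^ h) (+-suc b r)))))

    length-setCode : ∀ r b → length (setCode r b) ≡ r + Σ< (r * 2 ^ h) (λ j → b2n (χ (b * 2 ^ h + j))) * suc h
    length-setCode zero b = refl
    length-setCode (suc r) b = begin
      length (setCode (suc r) b) ≡⟨ length-++ (bucketCode (2 ^ h) (b * 2 ^ h)) ⟩
      length (bucketCode (2 ^ h) (b * 2 ^ h)) + suc (length (setCode r (suc b))) ≡⟨ cong₂ (λ x y → x + suc y) (points (2 ^ h) (b * 2 ^ h)) (length-setCode r (suc b)) ⟩
      Σ< (2 ^ h) (λ j → b2n (χ (b * 2 ^ h + j))) * suc h + suc (r + Σ< (r * 2 ^ h) (λ j → b2n (χ (suc b * 2 ^ h + j))) * suc h)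
        ≡⟨ ring (Σ< (2 ^ h) (λ j → b2n (χ (b * 2 ^ h + j))) ∷ suc h ∷ r ∷ Σ< (r * 2 ^ h) (λ j → b2n (χ (suc b * 2 ^ h + j))) ∷ [])
             (X0 :* X1 :+ (con 1 :+ (X2 :+ X3 :* X1))) (con 1 :+ X2 :+ (X0 :+ X3) :* X1) refl refl ⟩
      suc r + (Σ< (2 ^ h) (λ j → b2n (χ (b * 2 ^ h + j))) + Σ< (r * 2 ^ h) (λ j → b2n (χ (suc b * 2 ^ h + j)))) * suc h
        ≡⟨ cong (λ x → suc r + (Σ< (2 ^ h) (λ j → b2n (χ (b * 2 ^ h + j))) + x) * suc h)
             (Σ<-cong (r * 2 ^ h) (λ j _ → cong (b2n ∘ χ) (trans (cong (_+ j) (+-comm (2 ^ h) (b * 2 ^ h))) (+-assoc (b * 2 ^ h) (2 ^ h) j)))) ⟩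
      suc r + (Σ< (2 ^ h) (λ j → b2n (χ (b * 2 ^ h + j))) + Σ< (r * 2 ^ h) (λ j → b2n (χ (b * 2 ^ h + (2 ^ h + j))))) * suc h
        ≡⟨ cong (λ x → suc r + x * suc h) (sym (Σ<-split (2 ^ h) (r * 2 ^ h) (λ j → b2n (χ (b * 2 ^ h + j))))) ⟩
      suc r + Σ< (suc r * 2 ^ h) (λ j → b2n (χ (b * 2 ^ h + j))) * suc h ∎
      where
      open ≡-Reasoning
      points : ∀ n q → length (bucketCode n q) ≡ Σ< n (λ j → b2n (χ (q + j))) * suc h
      points zero q = refl
      points (suc n) q = trans (length-++ (pointCode q)) (trans (cong₂ _+_ (one (χ q)) (points n (suc q)))
        (trans (sym (*-distribʳ-+ (suc h) (b2n (χ q)) _)) (cong (_* suc h) (shift n q))))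
        where
        one : ∀ c → length (if c then true ∷ enc h (q %% 2 ^ h) else []) ≡ b2n c * suc h
        one true = trans (cong suc (length-enc h _)) (sym (+-identityʳ (suc h)))
        one false = refl
        shift : ∀ n q → b2n (χ q) + Σ< n (λ j → b2n (χ (suc q + j))) ≡ Σ< (suc n) (λ j → b2n (χ (q + j)))
        shift zero q = trans (+-identityʳ (b2n (χ q))) (cong (b2n ∘ χ) (sym (+-identityʳ q)))
        shift (suc n) q = trans (sym (+-assoc (b2n (χ q)) _ _)) (cong₂ _+_ (shift n q) (cong (b2n ∘ χ) (sym (+-suc q n))))

-- Blocks of 2 ^ y points, y being so small that all 2 ^ (2 ^ y) codes of a
-- block have an entry in a table. A block is stored in code if that is shorter
-- than its bitmap.
module TinyBits (ψ : ℕ → Bool) (m y h fₜ : ℕ) (h≤y : h ≤ y) where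

  open SetCode h

  P : ℕ
  P = 2 ^ y

  χ : ℕ → ℕ → Bool
  χ i j = ψ (i * P + j)

  code : ℕ → Bits
  code i = setCode (χ i) (2 ^ (y ∸ h)) 0

  blobBy : ∀ i → Dec (length (code i) ≤ P) → Bits
  blobBy i (yes _) = false ∷ code i
  blobBy i (no _) = true ∷ stretch (χ i) 0 P

  blob : ℕ → Bits
  blob i = blobBy i (length (code i) ≤? P)

  decoded : ℕ → ℕ → Bool
  decoded c j = decode j 0 0 (2 ^ (y ∸ h)) (enc P c)

  table : Bits
  table = cat (2 ^ P) (λ c → stretch (decoded c) 0 P)

  open Layout.Store m fₜ fₜ blob public using (layout; Narrow; narrow; module Top)

  contents : Bits
  contents = table ++ layout

  length-table : length table ≡ 2 ^ P * P
  length-table = length-cat-const (2 ^ P) _ (λ c → length-stretch (decoded c) 0 P)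

  buckets≡ : 2 ^ (y ∸ h) * 2 ^ h ≡ P
  buckets≡ = trans (sym (pow-+ (y ∸ h) h)) (cong (2 ^_) (m∸n+n≡m h≤y))

  decoded-code : ∀ {β Z p i j} → At β Z p (code i) → length (code i) ≤ P → j < P → decoded (read β p P) j ≡ χ i j
  decoded-code {β} {Z} {p} {i} {j} at le j< = trans (cong (decode j 0 0 (2 ^ (y ∸ h))) (trans (enc-read β p P) (stretch-At (code i) P at le)))
    (decode-set (χ i) j (2 ^ (y ∸ h)) 0 _ z≤n (<-≤-trans j< (≤-reflexive (sym buckets≡))))

  module _ {β Z p i} (at : At β Z p (blob i)) (table-at : At β Z 0 table) where

    c : ℕ
    c = read β (p + 1) P

    bitmapAt : Bool → ℕ
    bitmapAt b = if b then p + 1 else c * P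

    bitmap-at : ∃[ b ] (read β p 1 ≡ b2n b × (∀ {j} → j < P → β (bitmapAt b + j) ≡ χ i j))
    bitmap-at = by (length (code i) ≤? P) at
      where
      by : ∀ d → At β Z p (blobBy i d) → ∃[ b ] (read β p 1 ≡ b2n b × (∀ {j} → j < P → β (bitmapAt b + j) ≡ χ i j))
      by (yes le) (e , h′) = false , cong (λ b → b2n b + 0) e , λ {j} j< →
        trans (stretch-self (decoded c) P (subst (λ q → At β Z q (stretch (decoded c) 0 P)) refl
          (At-cat-const (2 ^ P) (λ c → stretch (decoded c) 0 P) (read-< β (p + 1) P) (λ c → length-stretch (decoded c) 0 P) table-at)) j<)
          (decoded-code {β} {Z} {p + 1} {i} (subst (λ q → At β Z q (code i)) (+-comm 1 p) h′) le j<)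
      by (no _) (e , h′) = true , cong (λ b → b2n b + 0) e , λ {j} j< →
        stretch-self (χ i) P (subst (λ q → At β Z q (stretch (χ i) 0 P)) (+-comm 1 p) h′) j<

  length-blob : ∀ i → length (blob i) ≤ 1 + length (code i)
  length-blob i = by (length (code i) ≤? P)
    where
    by : ∀ d → length (blobBy i d) ≤ 1 + length (code i)
    by (yes _) = ≤-refl
    by (no nle) = s≤s (≤-trans (≤-reflexive (length-stretch (χ i) 0 P)) (<⇒≤ (≰⇒> nle)))

  Σ-blobs : Σ< (2 ^ m) (length ∘ blob) ≤ 2 ^ m * (1 + 2 ^ (y ∸ h)) + Σ< (2 ^ m * P) (b2n ∘ ψ) * suc h
  Σ-blobs = begin
    Σ< (2 ^ m) (length ∘ blob) ≤⟨ Σ<-mono (2 ^ m) (λ i _ → ≤-trans (length-blob i) (≤-reflexive (cong suc (trans (length-setCode (χ i) (2 ^ (y ∸ h)) 0) (cong (λ k → 2 ^ (y ∸ h) + Σ< k (b2n ∘ χ i) * suc h) buckets≡))))) ⟩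
    Σ< (2 ^ m) (λ i → 1 + 2 ^ (y ∸ h) + Σ< P (b2n ∘ χ i) * suc h) ≡⟨ Σ<-+ (2 ^ m) (λ _ → 1 + 2 ^ (y ∸ h)) (λ i → Σ< P (b2n ∘ χ i) * suc h) ⟩
    Σ< (2 ^ m) (λ _ → 1 + 2 ^ (y ∸ h)) + Σ< (2 ^ m) (λ i → Σ< P (b2n ∘ χ i) * suc h)
      ≡⟨ cong₂ _+_ (Σ<-const (2 ^ m) (1 + 2 ^ (y ∸ h))) (trans (Σ<-*ʳ (2 ^ m) (suc h) (λ i → Σ< P (b2n ∘ χ i))) (cong (_* suc h) (sym (Σ<-blocks (2 ^ m) P (b2n ∘ ψ))))) ⟩
    2 ^ m * (1 + 2 ^ (y ∸ h)) + Σ< (2 ^ m * P) (b2n ∘ ψ) * suc h ∎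
    where open ≤-Reasoning

module TinyE {k : ℕ} (W fₜE yE PE startE : Expr k) where

  opaque
    blockE : Expr k → Expr k
    blockE x = storeE W fₜE fₜE startE (div′ x (pow′ yE))

    bitmapE : Expr k → Expr k
    bitmapE pos = selectE (rd W pos (lit 1)) (add′ pos (lit 1)) (mul′ (rd W (add′ pos (lit 1)) PE) PE)

    tinyE : Expr k → Expr k → Expr k
    tinyE lo hi = lt′ (lit 0) (rd W (add′ (bitmapE (blockE lo)) (rem′ lo PE)) (add′ (sub′ hi lo) (lit 1)))

module TinyLookup {k : ℕ} (u : ℕ) (u>0 : 0 < u) (R : Fin k → Word (F * u)) (β : ℕ → Bool)
  (Z : ℕ) (Z< : Z < 2 ^ (1 * u)) {W : Expr k} (⇓W : Semantics._⇓_∶_ u u>0 R β W (F * u) 7)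
  (ψ : ℕ → Bool) (m y h fₜ : ℕ) (h≤y : h ≤ y) where

  open TinyBits ψ m y h fₜ h≤y

  module _ {fₜE yE PE startE : Expr k} (⇓fₜ : Semantics._⇓_∶_ u u>0 R β fₜE fₜ 1) (2^fₜ≤ : 2 ^ fₜ ≤ 1 * u)
    (⇓y : Semantics._⇓_∶_ u u>0 R β yE y 1) (⇓P : Semantics._⇓_∶_ u u>0 R β PE P 1) (⇓start : Semantics._⇓_∶_ u u>0 R β startE (2 ^ P * P) 1)
    (P≤ : P ≤ 1 * u) (1≤ : 1 ≤ 1 * u) (fitting : Narrow) (here : At β Z 0 contents) where

    open Layout.Lookup u u>0 R β Z Z< ⇓W
    open Logic u u>0 R β
    open TinyE W fₜE yE PE startE

    private
      fₜ≤ : fₜ ≤ 1 * u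
      fₜ≤ = ≤-trans (<⇒≤ (n<2^n fₜ)) 2^fₜ≤
      y≤ : y ≤ 1 * u
      y≤ = ≤-trans (<⇒≤ (n<2^n y)) P≤
      at-table : At β Z 0 table
      at-table = At-++ˡ {p = 0} table {layout} here
      at-layout : At β Z (2 ^ P * P) layout
      at-layout = subst (λ q → At β Z q layout) length-table (At-++ʳ {p = 0} table {layout} here)

    opaque
      unfolding blockE bitmapE tinyE

      ⇓block : ∀ {x} {E : Expr k} → E ⇓ x ∶ 1 → x // P < 2 ^ m → Σ[ q ∈ ℕ ] (blockE E ⇓ q ∶ 1) × At β Z q (blob (x // P))
      ⇓block ⇓x i< = ⇓store {m = m} {g = fₜ} {f = fₜ} {b = blob} ⇓fₜ fₜ≤ ⇓fₜ fₜ≤ fitting 2^fₜ≤ ⇓start at-layout (⇓div ⇓x (⇓pow ⇓y 1 y≤)) i<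

      ⇓bitmap : ∀ {pos} {E : Expr k} b → E ⇓ pos ∶ 1 → read β pos 1 ≡ b2n b → bitmapE E ⇓ (if b then pos + 1 else read β (pos + 1) P * P) ∶ 4
      ⇓bitmap b ⇓pos flag = ⇓select b (cast flag (⇓rd ⇓W 1 ⇓pos (⇓lit 1) 1≤)) (⇓add ⇓pos (⇓lit 1)) (⇓mul (⇓rd ⇓W 1 (⇓add ⇓pos (⇓lit 1)) ⇓P P≤) ⇓P)

      ⇓tiny : ∀ {lo hi q} {loE hiE : Expr k} → loE ⇓ lo ∶ 1 → hiE ⇓ hi ∶ 1 → lo ≤ hi → hi ∸ lo + 1 ≤ 1 * u → bitmapE (blockE loE) ⇓ q ∶ 4 →
        tinyE loE hiE ⇓ b2n (0 <ᵇ read β (q + lo %% P) (hi ∸ lo + 1)) ∶ 1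
      ⇓tiny ⇓lo ⇓hi lo≤hi len ⇓q = ⇓lt (⇓lit 0) (⇓rd ⇓W 1 (⇓add ⇓q (⇓rem ⇓lo ⇓P)) (⇓add (⇓sub lo≤hi ⇓hi ⇓lo) (⇓lit 1)) len)

    private
      decide : ∀ {lo hi q} {E : Expr k} → lo ≤ hi → lo // P ≡ hi // P → (∀ {j} → j < P → β (q + j) ≡ χ (lo // P) j) →
        E ⇓ b2n (0 <ᵇ read β (q + lo %% P) (hi ∸ lo + 1)) ∶ 1 →
        Decides E (∃[ x ] (ψ x ≡ true × lo ≤ x × x ≤ hi)) (∃[ x ] (ψ x ≡ true × lo ≤ x × x ≤ hi))
      decide {lo} {hi} {q} lo≤hi same bitmap ⇓e = decides _ ⇓e sound complete
        where
        P>0 = pow>0 y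
        i = lo // P
        point : ∀ {x} → lo ≤ x → x ≤ hi → i * P + x %% P ≡ x
        point {x} lo≤ ≤hi = trans (cong (λ b → b * P + x %% P) (≤-antisym (//-mono P lo≤) (≤-trans (//-mono P ≤hi) (≤-reflexive (sym same))))) (trans (+-comm _ (x %% P)) (sym (div-mod x P>0)))
        bit-value : ∀ {x} → lo ≤ x → x ≤ hi → β (q + lo %% P + (x ∸ lo)) ≡ ψ x
        bit-value {x} lo≤ ≤hi = trans (cong β (trans (+-assoc q (lo %% P) (x ∸ lo)) (cong (q +_) shift))) (trans (bitmap (%%-< x P>0)) (cong ψ (point lo≤ ≤hi)))
          where
          shift : lo %% P + (x ∸ lo) ≡ x %% P
          shift = +-cancelˡ-≡ (i * P) _ _ (trans (sym (+-assoc (i * P) _ _)) (trans (cong (_+ (x ∸ lo)) (point ≤-refl lo≤hi)) (trans (m+[n∸m]≡n lo≤) (sym (point lo≤ ≤hi)))))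
        sound : (0 <ᵇ read β (q + lo %% P) (hi ∸ lo + 1)) ≡ true → ∃[ x ] (ψ x ≡ true × lo ≤ x × x ≤ hi)
        sound h′ = let j , j< , b = read-pos β (q + lo %% P) (hi ∸ lo + 1) h′
                       le = ≤-trans (+-monoʳ-≤ lo (s≤s⁻¹ (≤-trans j< (≤-reflexive (+-comm (hi ∸ lo) 1))))) (≤-reflexive (m+[n∸m]≡n lo≤hi)) in
          lo + j , trans (sym (bit-value (m≤m+n lo j) le)) (trans (cong (λ d → β (q + lo %% P + d)) (m+n∸m≡n lo j)) b) , m≤m+n lo j , le
        complete : ∃[ x ] (ψ x ≡ true × lo ≤ x × x ≤ hi) → (0 <ᵇ read β (q + lo %% P) (hi ∸ lo + 1)) ≡ true
        complete (x , ex , lo≤ , ≤hi) = <ᵇ-true (pos-read β (q + lo %% P) (hi ∸ lo + 1) (≤-trans (s≤s (∸-monoˡ-≤ lo ≤hi)) (≤-reflexive (+-comm 1 (hi ∸ lo)))) (trans (bit-value lo≤ ≤hi) ex))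

      bitmap-of : ∀ {q i} → At β Z q (blob i) → ∃[ b ] (read β q 1 ≡ b2n b × (∀ {j} → j < P → β ((if b then q + 1 else read β (q + 1) P * P) + j) ≡ χ i j))
      bitmap-of {q} {i} at = bitmap-at {β} {Z} {q} {i} at at-table

    tiny-decides : ∀ {lo hi} {loE hiE : Expr k} → loE ⇓ lo ∶ 1 → hiE ⇓ hi ∶ 1 → lo ≤ hi → hi < 2 ^ (m + y) → lo // P ≡ hi // P →
      Decides (tinyE loE hiE) (∃[ x ] (ψ x ≡ true × lo ≤ x × x ≤ hi)) (∃[ x ] (ψ x ≡ true × lo ≤ x × x ≤ hi))
    tiny-decides {lo} {hi} ⇓lo ⇓hi lo≤hi hi< same = decide lo≤hi same (proj₂ (proj₂ flagged))
        (⇓tiny ⇓lo ⇓hi lo≤hi (≤-trans short P≤) (⇓bitmap (proj₁ flagged) (proj₁ (proj₂ found)) (proj₁ (proj₂ flagged))))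
      where
      i< : lo // P < 2 ^ m
      i< = <-*⇒//-< (≤-<-trans lo≤hi (<-≤-trans hi< (≤-reflexive (pow-+ m y))))
      found = ⇓block ⇓lo i<
      flagged = bitmap-of {proj₁ found} {lo // P} (proj₂ (proj₂ found))
      short : hi ∸ lo + 1 ≤ P
      short = ≤-trans (≤-reflexive (+-comm (hi ∸ lo) 1)) (+-cancelˡ-≤ lo _ _ (≤-trans (≤-reflexive (trans (+-suc lo (hi ∸ lo)) (cong suc (m+[n∸m]≡n lo≤hi))))
        (≤-trans (<-//-suc hi (pow>0 y)) (≤-trans (≤-reflexive (cong (λ b → P + b * P) (sym same))) (≤-trans (≤-reflexive (+-comm P _)) (+-monoˡ-≤ P (//-*-≤ lo P)))))))

bits-≤-pow : ∀ {n} k → n ≤ 2 ^ k → bits n ≤ suc k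
bits-≤-pow k le = bits-≤ (≤-<-trans le (pow-mono-< (n<1+n k)))

bits-+ : ∀ m n → bits (m + n) ≤ 1 + (bits m + bits n)
bits-+ m n = bits-≤ (<-≤-trans (+-mono-≤-< (<⇒≤ (<-≤-trans (<-bits m) (pow-mono (m≤m+n (bits m) (bits n))))) (<-≤-trans (<-bits n) (pow-mono (m≤n+m (bits n) (bits m)))))
  (≤-reflexive (cong (2 ^ (bits m + bits n) +_) (sym (+-identityʳ _)))))

bits-slow : ∀ n → 64 * bits n ≤ 384 + n
bits-slow n = ≤-trans (*-monoʳ-≤ 64 (bits-tail n 6)) (≤-trans (≤-reflexive (trans (*-distribˡ-+ 64 6 (n // 64)) (cong (384 +_) (*-comm 64 (n // 64))))) (+-monoʳ-≤ 384 (//-*-≤ n 64)))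

bits-c₀ : bits c₀ ≤ 13
bits-c₀ = ≤-trans (bits-mono {c₀} {4096} (≤-trans (≤-reflexive c₀≡) (≤ᵇ⇒≤ 4000 4096 _))) (bits-≤-pow 12 ≤-refl)

module Numbers (S : ℕ) (S>0 : 0 < S) (nb ℓ₁ : ℕ) where

  e ℓ b r K f V Nₘ : ℕ
  e = nb ∸ suc (bits ℓ₁)
  ℓ = nb + ℓ₁ ∸ e
  b = bits (suc ℓ)
  r = b // S + 1
  K = 4 * S + 128
  f = bits (K * suc ℓ)
  V = 3 * ℓ + 4
  Nₘ = 2 ^ ℓ * (2 * (1 + suc S * 2 ^ r))

  e≤ : e ≤ nb
  e≤ = m∸n≤m nb (suc (bits ℓ₁))

  e+ℓ≡ : e + ℓ ≡ nb + ℓ₁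
  e+ℓ≡ = m+[n∸m]≡n (≤-trans e≤ (m≤m+n nb ℓ₁))

  ℓ₁≤ℓ : ℓ₁ ≤ ℓ
  ℓ₁≤ℓ = +-cancelˡ-≤ e ℓ₁ ℓ (≤-trans (+-monoˡ-≤ ℓ₁ e≤) (≤-reflexive (sym e+ℓ≡)))

  ℓ≤ : ℓ ≤ ℓ₁ + suc (bits ℓ₁)
  ℓ≤ = +-cancelˡ-≤ e ℓ _ (≤-trans (≤-reflexive e+ℓ≡) (≤-trans (+-monoˡ-≤ ℓ₁ (m≤n+m∸n nb (suc (bits ℓ₁))))
    (≤-reflexive (ring (suc (bits ℓ₁) ∷ e ∷ ℓ₁ ∷ []) (X0 :+ X1 :+ X2) (X1 :+ (X2 :+ X0)) refl refl))))

  ℓ≤υ : ℓ ≤ nb + ℓ₁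
  ℓ≤υ = m∸n≤m (nb + ℓ₁) e

  ℓ<2^b : suc ℓ < 2 ^ b
  ℓ<2^b = <-bits (suc ℓ)

  b≤ : b ≤ suc ℓ
  b≤ = bits≤ (suc ℓ)

  b≤rS : b ≤ r * S
  b≤rS = ≤-trans (<⇒≤ (<-//-suc b S>0)) (≤-reflexive (cong (_* S) (+-comm 1 (b // S))))

  ℓ<ρ : ℓ < 2 ^ (r * S)
  ℓ<ρ = <-≤-trans (<-trans (n<1+n ℓ) ℓ<2^b) (pow-mono b≤rS)

  ℓ<τ : ℓ < 2 ^ b
  ℓ<τ = <-trans (n<1+n ℓ) ℓ<2^b

  r≤ : r ≤ 2 + ℓ
  r≤ = ≤-trans (≤-reflexive (+-comm (b // S) 1)) (s≤s (≤-trans (//-≤ b S) b≤))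

  K< : K * suc ℓ < 2 ^ f
  K< = <-bits (K * suc ℓ)

  f≤ : f ≤ bits K + b
  f≤ = bits-* K (suc ℓ)

  2^f≤ : 2 ^ f ≤ 1 + 2 * (K * suc ℓ)
  2^f≤ = 2^bits-≤ (K * suc ℓ)

  κ≤ : bits (ℓ + b + 1) ≤ f
  κ≤ = bits-mono (lin (ℓ ∷ b ∷ S ∷ []) (X0 :+ X1 :+ con 1 :≤ (con 4 :* X2 :+ con 128) :* (con 1 :+ X0)) (hyp (con 1) (X1 :≤ con 1 :+ X0) b≤ ∷ []) refl)

  Q : ℕ
  Q = ℓ + (S + (r + 2))

  ρ-factor : 2 * (1 + suc S * 2 ^ r) ≤ 2 ^ (S + (r + 2))
  ρ-factor = begin
    2 * (1 + suc S * 2 ^ r) ≤⟨ *-monoʳ-≤ 2 (+-mono-≤ (*-mono-≤ (pow>0 S) (pow>0 r)) (*-monoˡ-≤ (2 ^ r) (n<2^n S))) ⟩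
    2 * (2 ^ S * 2 ^ r + 2 ^ S * 2 ^ r) ≡⟨ ring (2 ^ S ∷ 2 ^ r ∷ []) (con 2 :* (X0 :* X1 :+ X0 :* X1)) (X0 :* (X1 :* con 4)) refl refl ⟩
    2 ^ S * (2 ^ r * 4) ≡⟨ cong (2 ^ S *_) (pow-+ r 2) ⟨
    2 ^ S * 2 ^ (r + 2) ≡⟨ pow-+ S (r + 2) ⟨
    2 ^ (S + (r + 2)) ∎
    where open ≤-Reasoning

  Nₘ≤ : Nₘ ≤ 2 ^ Q
  Nₘ≤ = ≤-trans (*-monoʳ-≤ (2 ^ ℓ) ρ-factor) (≤-reflexive (sym (pow-+ ℓ (S + (r + 2)))))

  bits-Nₘ : bits Nₘ ≤ suc Q
  bits-Nₘ = bits-≤-pow Q Nₘ≤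

  bits-1+Nₘ : bits (1 + Nₘ) ≤ suc Q
  bits-1+Nₘ = bits-≤ (<-≤-trans (s≤s (s≤s Nₘ≤)) (≤-trans (lin (2 ^ Q ∷ []) (con 2 :+ X0 :≤ con 2 :* X0) (hyp (con 1) (con 2 :≤ X0) (≤-trans (pow-mono {1} {Q} 1≤Q) ≤-refl) ∷ []) refl) ≤-refl))
    where
    1≤Q : 1 ≤ Q
    1≤Q = ≤-trans (≤-trans (s≤s z≤n) (m≤n+m 2 r)) (≤-trans (m≤n+m _ S) (m≤n+m _ ℓ))

  hash-fits : bits (8 * suc (Nₘ * (Nₘ * suc (ℓ + b + 1)))) < 2 ^ f
  hash-fits = ≤-<-trans (begin
    bits (8 * suc (Nₘ * (Nₘ * suc κ))) ≤⟨ ≤-trans (bits-* 8 _) (+-mono-≤ (bits-≤-pow 3 ≤-refl) ≤-refl) ⟩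
    4 + bits (1 + Nₘ * (Nₘ * suc κ)) ≤⟨ +-monoʳ-≤ 4 (≤-trans (bits-+ 1 _) (s≤s (+-mono-≤ (bits≤ 1) (≤-trans (bits-* Nₘ _) (+-mono-≤ bits-Nₘ (≤-trans (bits-* Nₘ _) (+-mono-≤ bits-Nₘ (bits≤ (suc κ))))))))) ⟩
    4 + (1 + (1 + (suc Q + (suc Q + suc κ)))) ≤⟨ lin (ℓ ∷ S ∷ r ∷ b ∷ []) (con 4 :+ (con 1 :+ (con 1 :+ (con 1 :+ (X0 :+ (X1 :+ (X2 :+ con 2))) :+ (con 1 :+ (X0 :+ (X1 :+ (X2 :+ con 2))) :+ (con 1 :+ (X0 :+ X3 :+ con 1))))))
        :≤ (con 4 :* X1 :+ con 128) :* (con 1 :+ X0)) (hyp (con 2) (X2 :≤ con 2 :+ X0) r≤ ∷ hyp (con 1) (X3 :≤ con 1 :+ X0) b≤ ∷ []) refl ⟩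
    K * suc ℓ ∎) K<
    where
    open ≤-Reasoning
    κ = ℓ + b + 1

  total-fits : 3 * bits (2 + f + c₀ * (2 * ((1 + f + V) * (1 + Nₘ)))) < 2 ^ f
  total-fits = ≤-<-trans (*-cancelˡ-≤ 64 (begin
    64 * (3 * bits (2 + f + c₀ * (2 * Y))) ≤⟨ *-monoʳ-≤ 64 (*-monoʳ-≤ 3 (≤-trans (bits-mono small) (≤-trans (bits-* c₀ (4 * Y)) (+-mono-≤ bits-c₀ (≤-trans (bits-* 4 Y) (+-mono-≤ (bits-≤-pow 2 ≤-refl) (≤-trans (bits-* (1 + f + V) (1 + Nₘ)) (+-mono-≤ (bits≤ (1 + f + V)) bits-1+Nₘ)))))))) ⟩
    64 * (3 * (13 + (3 + ((1 + f + V) + suc Q)))) ≤⟨ lin (ℓ ∷ S ∷ r ∷ b ∷ f ∷ bits K ∷ []) (con 64 :* (con 3 :* (con 13 :+ (con 3 :+ ((con 1 :+ X4 :+ (con 3 :* X0 :+ con 4)) :+ (con 1 :+ (X0 :+ (X1 :+ (X2 :+ con 2))))))))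
           :≤ con 64 :* ((con 4 :* X1 :+ con 128) :* (con 1 :+ X0)))
           (hyp (con 192) (X2 :≤ con 2 :+ X0) r≤ ∷ hyp (con 192) (X3 :≤ con 1 :+ X0) b≤ ∷ hyp (con 192) (X4 :≤ X5 :+ X3) f≤ ∷ hyp (con 3) (con 64 :* X5 :≤ con 384 :+ (con 4 :* X1 :+ con 128)) (bits-slow K) ∷ []) refl ⟩
    64 * (K * suc ℓ) ∎)) K<
    where
    open ≤-Reasoning
    Y = (1 + f + V) * (1 + Nₘ)
    small : 2 + f + c₀ * (2 * Y) ≤ c₀ * (4 * Y)
    small = lin (f ∷ V ∷ Nₘ ∷ c₀ ∷ []) (con 2 :+ X0 :+ X3 :* (con 2 :* ((con 1 :+ X0 :+ X1) :* (con 1 :+ X2))) :≤ X3 :* (con 4 :* ((con 1 :+ X0 :+ X1) :* (con 1 :+ X2))))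
      (hyp (con 2 :* ((con 1 :+ X0 :+ X1) :* (con 1 :+ X2))) (con 1 :≤ X3) (subst (1 ≤_) (sym c₀≡) (s≤s z≤n)) ∷ []) refl

module Overhead (S : ℕ) (S>0 : 0 < S) (nb ℓ₁ : ℕ) where
  open Numbers S S>0 nb ℓ₁

  abstract
    H G Ω : ℕ
    H = 1 + suc S * 2 ^ r
    G = 2 + f + 3 * b
    Ω = 150 * (c₀ * (G * H))

    H≡ : H ≡ 1 + suc S * 2 ^ r
    H≡ = refl
    Ω≡ : Ω ≡ 150 * (c₀ * (G * H))
    Ω≡ = refl
    G≡ : G ≡ 2 + f + 3 * b
    G≡ = refl

  N₁-H : ∀ {size N₁} → N₁ ≤ size * (2 * (1 + suc S * 2 ^ r)) → N₁ ≤ size * (2 * H)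
  N₁-H {size} {N₁} = subst (λ t → N₁ ≤ size * (2 * t)) (sym H≡)

  bucket-overhead : ∀ {size v₂ N₁ N₂} → v₂ ≤ size → v₂ ≤ suc ℓ → N₁ ≤ size * (2 * H) →
    N₂ * 2 ^ (2 * b) ≤ 2 * 2 ^ (2 * b) + 4 * (ℓ * size) → N₂ ≤ 2 + 4 * size ×
    2 * f + v₂ + 7 * (f + 2 + (c₀ * ((1 + f + (b + suc (2 * b))) * (1 + N₁)) + c₀ * ((1 + f + v₂) * (1 + N₂)))) ≤ Ω * (1 + size)
  bucket-overhead {size} {v₂} {N₁} {N₂} v₂≤ v₂≤ℓ N₁≤ N₂D≤ = N₂≤ , sum c₀ G H Ω f v₂ N₁ N₂ size b (subst (1 ≤_) (sym c₀≡) (s≤s z≤n)) (≤-reflexive (sym G≡)) (subst (1 ≤_) (sym H≡) (s≤s z≤n)) (≤-reflexive (sym Ω≡)) v₂≤ N₁≤ N₂≤ v₂N₂≤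
    where
    D = 2 ^ (2 * b)
    D>0 : 0 < D
    D>0 = pow>0 (2 * b)
    D≥ : suc ℓ * suc ℓ ≤ D
    D≥ = ≤-trans (*-mono-≤ (<⇒≤ ℓ<2^b) (<⇒≤ ℓ<2^b)) (≤-reflexive (trans (sym (pow-+ b b)) (cong (λ x → 2 ^ (b + x)) (sym (+-identityʳ b)))))
    N₂≤ : N₂ ≤ 2 + 4 * size
    N₂≤ = *-cancelʳ-≤ N₂ (2 + 4 * size) D {{>-nonZero D>0}} (≤-trans N₂D≤
      (lin (D ∷ ℓ ∷ size ∷ []) (con 2 :* X0 :+ con 4 :* (X1 :* X2) :≤ (con 2 :+ con 4 :* X2) :* X0)
        (hyp (con 4 :* X2) ((con 1 :+ X1) :* (con 1 :+ X1) :≤ X0) D≥ ∷ []) refl))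
    v₂N₂≤ : v₂ * N₂ ≤ 6 * size
    v₂N₂≤ = *-cancelʳ-≤ (v₂ * N₂) (6 * size) D {{>-nonZero D>0}} (lin (v₂ ∷ N₂ ∷ D ∷ ℓ ∷ size ∷ [])
      (X0 :* X1 :* X2 :≤ con 6 :* X4 :* X2)
      (hyp X0 (X1 :* X2 :≤ con 2 :* X2 :+ con 4 :* (X3 :* X4)) N₂D≤ ∷ hyp (con 2 :* X2) (X0 :≤ X4) v₂≤
       ∷ hyp (con 4 :* (X3 :* X4)) (X0 :≤ con 1 :+ X3) v₂≤ℓ ∷ hyp (con 4 :* X4) ((con 1 :+ X3) :* (con 1 :+ X3) :≤ X2) D≥ ∷ []) refl)
    sum : ∀ c G H Ω f v₂ N₁ N₂ size b → 1 ≤ c → 2 + f + 3 * b ≤ G → 1 ≤ H → 150 * (c * (G * H)) ≤ Ω → v₂ ≤ size → N₁ ≤ size * (2 * H) → N₂ ≤ 2 + 4 * size → v₂ * N₂ ≤ 6 * size →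
      2 * f + v₂ + 7 * (f + 2 + (c * ((1 + f + (b + suc (2 * b))) * (1 + N₁)) + c * ((1 + f + v₂) * (1 + N₂)))) ≤ Ω * (1 + size)
    sum c G H Ω f v₂ N₁ N₂ size b c≥ G≥ H≥ Ω≥ v₂≤ N₁≤ N₂≤ v₂N₂≤ = begin
      2 * f + v₂ + 7 * (f + 2 + (c * ((1 + f + (b + suc (2 * b))) * (1 + N₁)) + c * ((1 + f + v₂) * (1 + N₂))))
        ≤⟨ lin (f ∷ v₂ ∷ N₁ ∷ N₂ ∷ size ∷ b ∷ G ∷ c ∷ [])
             (con 2 :* X0 :+ X1 :+ con 7 :* (X0 :+ con 2 :+ (X7 :* ((con 1 :+ X0 :+ (X5 :+ (con 1 :+ con 2 :* X5))) :* (con 1 :+ X2)) :+ X7 :* ((con 1 :+ X0 :+ X1) :* (con 1 :+ X3))))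
                :≤ X7 :* (con 7 :* (X6 :* (con 1 :+ X2))) :+ X7 :* (con 100 :* (X6 :* (con 1 :+ X4))))
             (hyp (X7 :* (con 7 :* (con 1 :+ X2) :+ con 100 :* (con 1 :+ X4))) (con 2 :+ X0 :+ con 3 :* X5 :≤ X6) G≥
              ∷ hyp (X7 :* (con 7 :* (con 1 :+ X0))) (X3 :≤ con 2 :+ con 4 :* X4) N₂≤
              ∷ hyp (X7 :* con 7) (X1 :* X3 :≤ con 6 :* X4) v₂N₂≤
              ∷ hyp (con 1 :+ con 7 :* X7) (X1 :≤ X4) v₂≤ ∷ hyp (con 14 :+ con 9 :* X0 :+ X4) (con 1 :≤ X7) c≥ ∷ []) refl ⟩
      c * (7 * (G * (1 + N₁))) + c * (100 * (G * (1 + size)))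
        ≤⟨ lin (G ∷ H ∷ Ω ∷ N₁ ∷ size ∷ c ∷ []) (X5 :* (con 7 :* (X0 :* (con 1 :+ X3))) :+ X5 :* (con 100 :* (X0 :* (con 1 :+ X4))) :≤ X2 :* (con 1 :+ X4))
             (hyp (X5 :* (con 7 :* X0)) (X3 :≤ X4 :* (con 2 :* X1)) N₁≤ ∷ hyp (X5 :* (con 120 :* X0 :* (con 1 :+ X4))) (con 1 :≤ X1) H≥ ∷ hyp (con 1 :+ X4) (con 150 :* (X5 :* (X0 :* X1)) :≤ X2) Ω≥ ∷ []) refl ⟩
      Ω * (1 + size) ∎
      where open ≤-Reasoning

  N₁-fits : ∀ {size N₁} → size ≤ 2 ^ ℓ → N₁ ≤ size * (2 * (1 + suc S * 2 ^ r)) → N₁ ≤ Nₘ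
  N₁-fits size≤ le = ≤-trans le (*-monoˡ-≤ (2 * (1 + suc S * 2 ^ r)) size≤)

  N₂-fits : ∀ {size N₂} → size ≤ 2 ^ ℓ → N₂ ≤ 2 + 4 * size → N₂ ≤ Nₘ
  N₂-fits {size} {N₂} size≤ le = lin (N₂ ∷ size ∷ 2 ^ ℓ ∷ S ∷ 2 ^ r ∷ []) (X0 :≤ X2 :* (con 2 :* (con 1 :+ (con 1 :+ X3) :* X4)))
    (hyp (con 1) (X0 :≤ con 2 :+ con 4 :* X1) le ∷ hyp (con 4) (X1 :≤ X2) size≤ ∷ hyp (con 2) (con 1 :≤ X2) (pow>0 ℓ) ∷ hyp (con 2 :* X2) (con 2 :≤ X4) (pow-mono {1} {r} (m≤n+m 1 (b // S))) ∷ []) refl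

module BucketFit (S : ℕ) (S>0 : 0 < S) (nb ℓ₁ : ℕ) (χ : ℕ → Bool) where

  open Numbers S S>0 nb ℓ₁
  open BucketBits χ ℓ r S b (2 * b) f ℓ<ρ ℓ<τ
  open Overhead S S>0 nb ℓ₁

  over = bucket-overhead {size} {v₂} {R₁.N} {R₂.N} (bits≤ size) v₂≤ (N₁-H {size} N₁≤) N₂≤

  module Fitting = Sizes κ≤ Nₘ V (N₁-fits {size} size≤ N₁≤) (N₂-fits {size} size≤ (proj₁ over))
    (lin (b ∷ ℓ ∷ []) (X0 :+ (con 1 :+ con 2 :* X0) :≤ con 3 :* X1 :+ con 4) (hyp (con 3) (X0 :≤ con 1 :+ X1) b≤ ∷ []) refl)
    (≤-trans v₂≤ (lin (ℓ ∷ []) (con 1 :+ X0 :≤ con 3 :* X0 :+ con 4) [] refl)) hash-fits total-fits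

  v₂< : v₂ < 2 ^ f
  v₂< = ≤-<-trans v₂≤ (≤-<-trans (m≤n*m (suc ℓ) K {{>-nonZero (≤-trans (s≤s z≤n) (m≤n+m 128 (4 * S)))}}) K<)

  length-bucket : length bucketBits ≤ size * ℓ + Ω * (1 + size)
  length-bucket = ≤-trans Fitting.length-bucketBits (+-monoʳ-≤ (size * ℓ) (proj₂ over))

root-≤ : ∀ {S} b → 0 < S → b ≤ S * 2 ^ (b // S)
root-≤ {S} b S>0 = ≤-trans (<⇒≤ (<-//-suc b S>0)) (≤-trans (≤-reflexive (*-comm (suc (b // S)) S)) (*-monoʳ-≤ S (n<2^n (b // S))))

root^-≤ : ∀ S b → (2 ^ (b // S)) ^ S ≤ 2 ^ b
root^-≤ S b = ≤-trans (≤-reflexive (^-*-assoc 2 (b // S) S)) (pow-mono (//-*-≤ b S))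

module NormalStore (S : ℕ) (S>0 : 0 < S) (nb ℓ₁ n : ℕ) (n>0 : 0 < n) (nb≤ : nb ≤ n) (n< : n < 2 ^ nb) (2^nb≤ : 2 ^ nb ≤ 1 + 2 * n)
  (regime : bits nb ≤ 2 * ℓ₁ + 6) where

  open Numbers S S>0 nb ℓ₁ public
  open Overhead S S>0 nb ℓ₁ public

  Kₜ : ℕ
  Kₜ = 20 * S + 1000

  abstract
    k : ℕ
    k = bits Kₜ
    k≡ : k ≡ bits Kₜ
    k≡ = refl

  fₜ M Ψ B : ℕ
  fₜ = bits (Kₜ * (nb + suc ℓ))
  M = 2 ^ e
  Ψ = Ω + k
  B = n * (ℓ + 400 * Ψ)

  M≤ : M ≤ 3 * n
  M≤ = ≤-trans (≤-trans (pow-mono e≤) 2^nb≤) (lin (n ∷ []) (con 1 :+ con 2 :* X0 :≤ con 3 :* X0) (hyp (con 1) (con 1 :≤ X0) n>0 ∷ []) refl)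

  bits-ℓ₁≤b : bits ℓ₁ ≤ b
  bits-ℓ₁≤b = bits-mono (≤-trans ℓ₁≤ℓ (n≤1+n ℓ))

  ℓ≤2^b : ℓ ≤ 2 ^ b
  ℓ≤2^b = <⇒≤ ℓ<τ

  M-log : M * bits nb ≤ n * (21 + b)
  M-log = by (suc (bits ℓ₁) ≤? nb)
    where
    by : Dec (suc (bits ℓ₁) ≤ nb) → M * bits nb ≤ n * (21 + b)
    by (yes le) = lin (M ∷ bits nb ∷ n ∷ b ∷ 2 ^ bits ℓ₁ ∷ ℓ₁ ∷ []) (X0 :* X1 :≤ X2 :* (con 21 :+ X3))
      (hyp X0 (X1 :≤ con 2 :* X5 :+ con 6) regime ∷ hyp (con 2 :* X0) (X5 :≤ X4) (<⇒≤ (<-bits ℓ₁)) ∷ hyp (con 1) (X0 :* (con 2 :* X4) :≤ con 1 :+ con 2 :* X2) whole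
       ∷ hyp (con 6) (X0 :≤ con 3 :* X2) M≤ ∷ hyp (con 1) (con 1 :≤ X2) n>0 ∷ []) refl
      where
      whole : M * (2 * 2 ^ bits ℓ₁) ≤ 1 + 2 * n
      whole = ≤-trans (≤-reflexive (trans (sym (pow-+ e (suc (bits ℓ₁)))) (cong (2 ^_) (m∸n+n≡m le)))) 2^nb≤
    by (no nle) = ≤-trans (≤-reflexive (trans (cong (λ x → 2 ^ x * bits nb) (m≤n⇒m∸n≡0 (<⇒≤ (≰⇒> nle)))) (*-identityˡ (bits nb))))
      (≤-trans (bits≤ nb) (≤-trans (s≤s⁻¹ (≰⇒> nle)) (≤-trans bits-ℓ₁≤b (≤-trans (m≤n+m b 21) (m≤n*m (21 + b) n {{>-nonZero n>0}})))))

  fₜ≤ : fₜ ≤ k + (1 + (bits nb + b))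
  fₜ≤ = ≤-trans (bits-* Kₜ (nb + suc ℓ)) (+-mono-≤ (≤-reflexive (sym k≡)) (bits-+ nb (suc ℓ)))

  M-fₜ : M * fₜ ≤ n * (3 * k + 24 + 4 * b)
  M-fₜ = lin (M ∷ fₜ ∷ n ∷ k ∷ b ∷ bits nb ∷ []) (X0 :* X1 :≤ X2 :* (con 3 :* X3 :+ con 24 :+ con 4 :* X4))
    (hyp X0 (X1 :≤ X3 :+ (con 1 :+ (X5 :+ X4))) fₜ≤ ∷ hyp (con 1) (X0 :* X5 :≤ X2 :* (con 21 :+ X4)) M-log ∷ hyp (X3 :+ con 1 :+ X4) (X0 :≤ con 3 :* X2) M≤ ∷ []) refl

  GH≥ : 2 + f + 3 * b ≤ Ω
  GH≥ = ≤-trans (≤-trans (≤-reflexive (sym G≡)) (≤-trans (≤-trans (≤-reflexive (sym (*-identityʳ G))) (*-monoʳ-≤ G (subst (1 ≤_) (sym H≡) (s≤s z≤n)))) (grow (G * H)))) (≤-reflexive (sym Ω≡))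
    where
    grow : ∀ x → x ≤ 150 * (c₀ * x)
    grow x = ≤-trans (m≤n*m x c₀ {{>-nonZero (subst (0 <_) (sym c₀≡) z<s)}}) (m≤n*m _ 150)

  b≤Ω : b ≤ Ω
  b≤Ω = ≤-trans (lin (b ∷ f ∷ []) (X0 :≤ con 2 :+ X1 :+ con 3 :* X0) [] refl) GH≥
  1≤Ω : 1 ≤ Ω
  1≤Ω = ≤-trans (s≤s z≤n) GH≥

  module Sums {Sτ groups : ℕ} (Sτ≤ : Sτ ≤ n * ℓ + Ω * (M + n))
    (groups≤ : 2 ^ b * groups ≤ 2 ^ b * (M * fₜ + 3 * (M * (fₜ + b))) + 3 * (M * fₜ + M) + (2 ^ b + 3) * Sτ) where

    Sτ≤′ : Sτ ≤ n * ℓ + 4 * (Ω * n)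
    Sτ≤′ = lin (Sτ ∷ n ∷ ℓ ∷ Ω ∷ M ∷ []) (X0 :≤ X1 :* X2 :+ con 4 :* (X3 :* X1)) (hyp (con 1) (X0 :≤ X1 :* X2 :+ X3 :* (X4 :+ X1)) Sτ≤ ∷ hyp X3 (X4 :≤ con 3 :* X1) M≤ ∷ []) refl

    groups≤′ : groups ≤ n * ℓ + n * (16 * Ω + 7 * (3 * k + 24 + 4 * b) + 9 * b + 12)
    groups≤′ = ≤-trans (*-cancelˡ-≤ (2 ^ b) {{>-nonZero (pow>0 b)}} first) second
      where
      first : 2 ^ b * groups ≤ 2 ^ b * (Sτ + 7 * (M * fₜ) + 3 * (M * b) + 3 * M + (3 * n + 12 * (Ω * n)))
      first = lin (2 ^ b ∷ groups ∷ M ∷ fₜ ∷ b ∷ Sτ ∷ n ∷ Ω ∷ ℓ ∷ []) (X0 :* X1 :≤ X0 :* (X5 :+ con 7 :* (X2 :* X3) :+ con 3 :* (X2 :* X4) :+ con 3 :* X2 :+ (con 3 :* X6 :+ con 12 :* (X7 :* X6))))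
        (hyp (con 1) (X0 :* X1 :≤ X0 :* (X2 :* X3 :+ con 3 :* (X2 :* (X3 :+ X4))) :+ con 3 :* (X2 :* X3 :+ X2) :+ (X0 :+ con 3) :* X5) groups≤
         ∷ hyp (con 3 :* (X2 :* X3 :+ X2) :+ con 12 :* (X7 :* X6)) (con 1 :≤ X0) (pow>0 b)
         ∷ hyp (con 3) (X5 :≤ X6 :* X8 :+ con 4 :* (X7 :* X6)) Sτ≤′ ∷ hyp (con 3 :* X6) (X8 :≤ X0) ℓ≤2^b ∷ []) refl
      second : Sτ + 7 * (M * fₜ) + 3 * (M * b) + 3 * M + (3 * n + 12 * (Ω * n)) ≤ n * ℓ + n * (16 * Ω + 7 * (3 * k + 24 + 4 * b) + 9 * b + 12)
      second = lin (M ∷ fₜ ∷ b ∷ Sτ ∷ n ∷ Ω ∷ ℓ ∷ k ∷ []) (X3 :+ con 7 :* (X0 :* X1) :+ con 3 :* (X0 :* X2) :+ con 3 :* X0 :+ (con 3 :* X4 :+ con 12 :* (X5 :* X4)) :≤ X4 :* X6 :+ X4 :* (con 16 :* X5 :+ con 7 :* (con 3 :* X7 :+ con 24 :+ con 4 :* X2) :+ con 9 :* X2 :+ con 12))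
        (hyp (con 1) (X3 :≤ X4 :* X6 :+ con 4 :* (X5 :* X4)) Sτ≤′ ∷ hyp (con 7) (X0 :* X1 :≤ X4 :* (con 3 :* X7 :+ con 24 :+ con 4 :* X2)) M-fₜ ∷ hyp (con 3 :* X2 :+ con 3) (X0 :≤ con 3 :* X4) M≤ ∷ []) refl

    groups≤″ : groups ≤ n * ℓ + n * (300 * Ψ)
    groups≤″ = ≤-trans groups≤′ (+-monoʳ-≤ (n * ℓ) (*-monoʳ-≤ n (lin (Ω ∷ k ∷ b ∷ []) (con 16 :* X0 :+ con 7 :* (con 3 :* X1 :+ con 24 :+ con 4 :* X2) :+ con 9 :* X2 :+ con 12 :≤ con 300 :* (X0 :+ X1))
      (hyp (con 37) (X2 :≤ X0) b≤Ω ∷ hyp (con 180) (con 1 :≤ X0) 1≤Ω ∷ []) refl)))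

    fₜ≤Mfₜ : fₜ ≤ M * fₜ
    fₜ≤Mfₜ = m≤n*m fₜ M {{>-nonZero (pow>0 e)}}

    around≤ : M * fₜ + M ≤ n * (60 * Ψ)
    around≤ = lin (M * fₜ ∷ M ∷ n ∷ Ω ∷ k ∷ b ∷ []) (X0 :+ X1 :≤ X2 :* (con 60 :* (X3 :+ X4)))
      (hyp (con 1) (X0 :≤ X2 :* (con 3 :* X4 :+ con 24 :+ con 4 :* X5)) M-fₜ ∷ hyp (con 1) (X1 :≤ con 3 :* X2) M≤ ∷ hyp (con 4 :* X2) (X5 :≤ X3) b≤Ω ∷ hyp (con 27 :* X2) (con 1 :≤ X3) 1≤Ω ∷ []) refl

    small≤ : fₜ + M + Sτ ≤ B
    small≤ = lin (fₜ ∷ M * fₜ ∷ M ∷ Sτ ∷ n ∷ ℓ ∷ Ω ∷ k ∷ []) (X0 :+ X2 :+ X3 :≤ X4 :* (X5 :+ con 400 :* (X6 :+ X7)))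
      (hyp (con 1) (X0 :≤ X1) fₜ≤Mfₜ ∷ hyp (con 1) (X1 :+ X2 :≤ X4 :* (con 60 :* (X6 :+ X7))) around≤ ∷ hyp (con 1) (X3 :≤ X4 :* X5 :+ con 4 :* (X6 :* X4)) Sτ≤′ ∷ []) refl

    total≤ : ∀ {g} → g ≤ M → fₜ + g + groups ≤ B
    total≤ {g} g≤ = lin (fₜ ∷ M * fₜ ∷ M ∷ groups ∷ n ∷ ℓ ∷ Ω ∷ k ∷ g ∷ []) (X0 :+ X8 :+ X3 :≤ X4 :* (X5 :+ con 400 :* (X6 :+ X7)))
      (hyp (con 1) (X0 :≤ X1) fₜ≤Mfₜ ∷ hyp (con 1) (X1 :+ X2 :≤ X4 :* (con 60 :* (X6 :+ X7))) around≤ ∷ hyp (con 1) (X3 :≤ X4 :* X5 :+ X4 :* (con 300 :* (X6 :+ X7))) groups≤″ ∷ hyp (con 1) (X8 :≤ X2) g≤ ∷ []) refl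

  bits-H : bits H ≤ S + (r + 2)
  bits-H = bits-≤ (<-≤-trans (m<m+n H (subst (0 <_) (sym H≡) z<s)) (≤-trans (≤-reflexive (trans (cong (H +_) (sym (+-identityʳ H))) (cong (2 *_) H≡))) ρ-factor))

  bits-Ω : bits Ω ≤ 27 + (bits K + (S + 5 * ℓ) + 6)
  bits-Ω = begin
    bits Ω ≡⟨ cong bits Ω≡ ⟩
    bits (150 * (c₀ * (G * H))) ≤⟨ ≤-trans (bits-* 150 (c₀ * (G * H))) (+-mono-≤ (≤-trans (bits-mono {150} {256} (≤ᵇ⇒≤ 150 256 _)) (bits-≤-pow 8 ≤-refl)) (≤-trans (bits-* c₀ (G * H)) (+-mono-≤ bits-c₀ (≤-trans (bits-* G H) (+-mono-≤ (bits≤ G) bits-H))))) ⟩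
    9 + (13 + (G + (S + (r + 2)))) ≤⟨ lin (G ∷ S ∷ r ∷ ℓ ∷ bits K ∷ f ∷ b ∷ []) (con 9 :+ (con 13 :+ (X0 :+ (X1 :+ (X2 :+ con 2)))) :≤ con 27 :+ (X4 :+ (X1 :+ con 5 :* X3) :+ con 6))
         (hyp (con 1) (X0 :≤ con 2 :+ X5 :+ con 3 :* X6) (≤-reflexive G≡) ∷ hyp (con 1) (X5 :≤ X4 :+ X6) f≤ ∷ hyp (con 4) (X6 :≤ con 1 :+ X3) b≤ ∷ hyp (con 1) (X2 :≤ con 2 :+ X3) r≤ ∷ []) refl ⟩
    27 + (bits K + (S + 5 * ℓ) + 6) ∎
    where open ≤-Reasoning

  bits-B : bits B ≤ nb + (1 + (b + (10 + (1 + (bits Ω + k)))))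
  bits-B = ≤-trans (bits-* n (ℓ + 400 * Ψ)) (+-mono-≤ (bits-≤ n<) (≤-trans (bits-+ ℓ (400 * Ψ)) (s≤s (+-mono-≤ (bits-mono (n≤1+n ℓ))
    (≤-trans (bits-* 400 Ψ) (+-mono-≤ (≤-trans (bits-mono {400} {512} (≤ᵇ⇒≤ 400 512 _)) (bits-≤-pow 9 ≤-refl)) (≤-trans (bits-+ Ω k) (s≤s (+-monoʳ-≤ (bits Ω) (bits≤ k))))))))))

  top-fits : 3 * bits B < 2 ^ fₜ
  top-fits = ≤-<-trans (*-cancelˡ-≤ 64 (lin (bits B ∷ nb ∷ b ∷ bits Ω ∷ k ∷ bits K ∷ S ∷ ℓ ∷ [])
      (con 64 :* (con 3 :* X0) :≤ con 64 :* ((con 20 :* X6 :+ con 1000) :* (X1 :+ (con 1 :+ X7))))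
      (hyp (con 192) (X0 :≤ X1 :+ (con 1 :+ (X2 :+ (con 10 :+ (con 1 :+ (X3 :+ X4)))))) bits-B ∷ hyp (con 192) (X3 :≤ con 27 :+ (X5 :+ (X6 :+ con 5 :* X7) :+ con 6)) bits-Ω
       ∷ hyp (con 192) (X2 :≤ con 1 :+ X7) b≤ ∷ hyp (con 3) (con 64 :* X5 :≤ con 384 :+ (con 4 :* X6 :+ con 128)) (bits-slow K)
       ∷ hyp (con 3) (con 64 :* X4 :≤ con 384 :+ (con 20 :* X6 :+ con 1000)) (≤-trans (≤-reflexive (cong (64 *_) k≡)) (bits-slow Kₜ)) ∷ []) refl)) (<-bits (Kₜ * (nb + suc ℓ)))

  layout≤ : ∀ {groups length} → fₜ + (3 * (M + bits B) + groups) ≥ length → groups ≤ n * ℓ + n * (300 * Ψ) → M * fₜ + M ≤ n * (60 * Ψ) → fₜ ≤ M * fₜ →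
    length ≤ n * ℓ₁ + n * (700 * Ψ)
  layout≤ {groups} {length} len groups≤ around fₜ≤M = lin (fₜ ∷ M ∷ bits B ∷ groups ∷ length ∷ n ∷ ℓ ∷ ℓ₁ ∷ Ψ ∷ M * fₜ ∷ [])
    (X4 :≤ X5 :* X7 :+ X5 :* (con 700 :* X8))
    (hyp (con 1) (X4 :≤ X0 :+ (con 3 :* (X1 :+ X2) :+ X3)) len ∷ hyp (con 1) (X3 :≤ X5 :* X6 :+ X5 :* (con 300 :* X8)) groups≤
     ∷ hyp (con 3) (X9 :+ X1 :≤ X5 :* (con 60 :* X8)) around ∷ hyp (con 1) (X0 :≤ X9) fₜ≤M ∷ hyp (con 3) (X2 :≤ X5 :* (con 20 :* X8)) bits-B′ ∷ hyp X5 (X6 :≤ X7 :+ con 2 :* X8) ℓ≤′ ∷ []) refl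
    where
    b≤Ψ : b ≤ Ψ
    b≤Ψ = ≤-trans b≤Ω (m≤m+n Ω k)
    1≤Ψ : 1 ≤ Ψ
    1≤Ψ = ≤-trans 1≤Ω (m≤m+n Ω k)
    ℓ≤′ : ℓ ≤ ℓ₁ + 2 * Ψ
    ℓ≤′ = lin (ℓ ∷ ℓ₁ ∷ bits ℓ₁ ∷ b ∷ Ψ ∷ []) (X0 :≤ X1 :+ con 2 :* X4) (hyp (con 1) (X0 :≤ X1 :+ (con 1 :+ X2)) ℓ≤ ∷ hyp (con 1) (X2 :≤ X3) bits-ℓ₁≤b ∷ hyp (con 1) (X3 :≤ X4) b≤Ψ ∷ hyp (con 1) (con 1 :≤ X4) 1≤Ψ ∷ []) refl
    bits-B′ : bits B ≤ n * (20 * Ψ)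
    bits-B′ = ≤-trans bits-B (lin (nb ∷ b ∷ bits Ω ∷ Ω ∷ k ∷ n ∷ []) (X0 :+ (con 1 :+ (X1 :+ (con 10 :+ (con 1 :+ (X2 :+ X4))))) :≤ X5 :* (con 20 :* (X3 :+ X4)))
      (hyp (con 1) (X0 :≤ X5) nb≤ ∷ hyp (con 1) (X1 :≤ X3) b≤Ω ∷ hyp (con 1) (X2 :≤ X3) (bits≤ Ω) ∷ hyp (con 12 :+ X5) (con 1 :≤ X3) 1≤Ω ∷ hyp (con 14 :* X3 :+ X4) (con 1 :≤ X5) n>0 ∷ []) refl)

  q : ℕ
  q = 2 ^ (b // S)

  q^S≤ : q ^ S ≤ 8 * suc ℓ₁
  q^S≤ = ≤-trans (root^-≤ S b) (≤-trans (2^bits-≤ (suc ℓ)) (lin (ℓ ∷ ℓ₁ ∷ bits ℓ₁ ∷ []) (con 1 :+ con 2 :* (con 1 :+ X0) :≤ con 8 :* (con 1 :+ X1))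
    (hyp (con 2) (X0 :≤ X1 :+ (con 1 :+ X2)) ℓ≤ ∷ hyp (con 2) (X2 :≤ X1) (bits≤ ℓ₁) ∷ []) refl))

overhead-constant : ℕ → ℕ
overhead-constant S = 150 * (c₀ * ((2 + bits (4 * S + 128) + 4 * S) * (2 * S + 3))) + bits (20 * S + 1000)

module _ (S : ℕ) (S>0 : 0 < S) (nb ℓ₁ n : ℕ) (n>0 : 0 < n) (nb≤ : nb ≤ n) (n< : n < 2 ^ nb) (2^nb≤ : 2 ^ nb ≤ 1 + 2 * n)
  (regime : bits nb ≤ 2 * ℓ₁ + 6) where

  open NormalStore S S>0 nb ℓ₁ n n>0 nb≤ n< 2^nb≤ regime

  Ψ≤ : Ψ ≤ overhead-constant S * (q * q)
  Ψ≤ = begin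
    Ω + k ≡⟨ cong₂ _+_ Ω≡ k≡ ⟩
    150 * (c₀ * (G * H)) + bits Kₜ ≤⟨ +-mono-≤ (*-monoʳ-≤ 150 (*-monoʳ-≤ c₀ (*-mono-≤ G≤ H≤))) (≤-trans (≤-reflexive (sym (*-identityʳ (bits Kₜ)))) (*-monoʳ-≤ (bits Kₜ) (*-mono-≤ (pow>0 (b // S)) (pow>0 (b // S))))) ⟩
    150 * (c₀ * ((2 + bits K + 4 * S) * q * ((2 * S + 3) * q))) + bits Kₜ * (q * q) ≡⟨ regroup 150 c₀ (2 + bits K + 4 * S) (2 * S + 3) (bits Kₜ) q ⟩
    overhead-constant S * (q * q) ∎
    where
    open ≤-Reasoning
    q≥1 = pow>0 (b // S)
    G≤ : G ≤ (2 + bits K + 4 * S) * q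
    G≤ = lin (G ∷ f ∷ b ∷ bits K ∷ S ∷ q ∷ []) (X0 :≤ (con 2 :+ X3 :+ con 4 :* X4) :* X5)
      (hyp (con 1) (X0 :≤ con 2 :+ X1 :+ con 3 :* X2) (≤-reflexive G≡) ∷ hyp (con 1) (X1 :≤ X3 :+ X2) f≤ ∷ hyp (con 4) (X2 :≤ X4 :* X5) (root-≤ b S>0) ∷ hyp (con 2 :+ X3) (con 1 :≤ X5) q≥1 ∷ []) refl
    H≤ : H ≤ (2 * S + 3) * q
    H≤ = ≤-trans (≤-reflexive (trans H≡ (cong (λ p → 1 + suc S * p) (trans (pow-+ (b // S) 1) (*-comm q 2)))))
      (lin (S ∷ q ∷ []) (con 1 :+ (con 1 :+ X0) :* (con 2 :* X1) :≤ (con 2 :* X0 :+ con 3) :* X1) (hyp (con 1) (con 1 :≤ X1) q≥1 ∷ []) refl)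
    regroup : ∀ a a′ x y z q → a * (a′ * (x * q * (y * q))) + z * (q * q) ≡ (a * (a′ * (x * y)) + z) * (q * q)
    regroup a a′ x y z q = ring (a ∷ a′ ∷ x ∷ y ∷ z ∷ q ∷ []) (X0 :* (X1 :* (X2 :* X5 :* (X3 :* X5))) :+ X4 :* (X5 :* X5)) ((X0 :* (X1 :* (X2 :* X3)) :+ X4) :* (X5 :* X5)) refl refl

overhead≥1 : ∀ S → 1 ≤ overhead-constant S
overhead≥1 S = ≤-trans (pow-cancel-< {0} {bits (20 * S + 1000)} (≤-<-trans (≤-trans (s≤s z≤n) (m≤n+m 1000 (20 * S))) (<-bits (20 * S + 1000)))) (m≤n+m (bits (20 * S + 1000)) _)

module NormalFit (S : ℕ) (S>0 : 0 < S) (nb ℓ₁ n : ℕ) (n>0 : 0 < n) (nb≤ : nb ≤ n) (n< : n < 2 ^ nb) (2^nb≤ : 2 ^ nb ≤ 1 + 2 * n)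
  (regime : bits nb ≤ 2 * ℓ₁ + 6) (ψ : ℕ → Bool) (few : Σ< (2 ^ (nb + ℓ₁)) (b2n ∘ ψ) ≤ n) where

  open NormalStore S S>0 nb ℓ₁ n n>0 nb≤ n< 2^nb≤ regime
  open NormalBits ψ e ℓ r S b (2 * b) f fₜ ℓ<ρ ℓ<τ public

  size : ℕ → ℕ
  size i = BucketBits.size (χ i) ℓ r S b (2 * b) f ℓ<ρ ℓ<τ

  Σ-sizes : Σ< (2 ^ e) size ≤ n
  Σ-sizes = ≤-trans (≤-reflexive (trans (sym (Σ<-blocks (2 ^ e) (2 ^ ℓ) (b2n ∘ ψ))) (cong (λ m → Σ< m (b2n ∘ ψ)) (trans (sym (pow-+ e ℓ)) (cong (2 ^_) e+ℓ≡))))) few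

  Σ-blobs : Σ< (2 ^ e) (length ∘ blob) ≤ n * ℓ + Ω * (2 ^ e + n)
  Σ-blobs = begin
    Σ< (2 ^ e) (length ∘ blob) ≤⟨ Σ<-mono (2 ^ e) (λ i _ → BucketFit.length-bucket S S>0 nb ℓ₁ (χ i)) ⟩
    Σ< (2 ^ e) (λ i → size i * ℓ + Ω * (1 + size i)) ≡⟨ Σ<-+ (2 ^ e) (λ i → size i * ℓ) (λ i → Ω * (1 + size i)) ⟩
    Σ< (2 ^ e) (λ i → size i * ℓ) + Σ< (2 ^ e) (λ i → Ω * (1 + size i)) ≡⟨ cong₂ _+_ (Σ<-*ʳ (2 ^ e) ℓ size) (trans (Σ<-*ˡ (2 ^ e) Ω (λ i → 1 + size i)) (cong (Ω *_) (trans (Σ<-+ (2 ^ e) (λ _ → 1) size) (cong (_+ Σ< (2 ^ e) size) (trans (Σ<-const (2 ^ e) 1) (*-identityʳ (2 ^ e))))))) ⟩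
    Σ< (2 ^ e) size * ℓ + Ω * (2 ^ e + Σ< (2 ^ e) size) ≤⟨ +-mono-≤ (*-monoˡ-≤ ℓ Σ-sizes) (*-monoʳ-≤ Ω (+-monoʳ-≤ (2 ^ e) Σ-sizes)) ⟩
    n * ℓ + Ω * (2 ^ e + n) ∎
    where
    open ≤-Reasoning

  module SL = StoreLength e fₜ fₜ blob
  open Sums Σ-blobs (SL.groups-≤ b)

  total-≤ : Top.total ≤ B
  total-≤ = total≤ SL.G≤M

  fitting : Narrow
  fitting = SL.widths-narrow {B} small≤ total-≤ top-fits

  length-layout : length layout ≤ n * ℓ₁ + n * (700 * Ψ)
  length-layout = layout≤ (≤-trans (SL.layout-length (≤-trans (bits-mono total-≤) (≤-trans (m≤n*m (bits B) 3) (<⇒≤ top-fits))))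
    (+-monoʳ-≤ fₜ (+-monoˡ-≤ SL.groups (*-monoʳ-≤ 3 (+-monoʳ-≤ M (bits-mono total-≤)))))) groups≤″ around≤ fₜ≤Mfₜ

module TinyNumbers (nb ℓ₁ n : ℕ) (n>0 : 0 < n) (nb≤ : nb ≤ n) (n< : n < 2 ^ nb) (2^nb≤ : 2 ^ nb ≤ 1 + 2 * n)
  (regime : 2 * ℓ₁ + 6 < bits nb) where

  y₀ y m fₜ M B : ℕ
  y₀ = bits nb
  y = y₀ ∸ 2
  m = nb + ℓ₁ ∸ y
  fₜ = bits (1000 * suc nb)
  M = 2 ^ m
  B = n * (ℓ₁ + 500)

  y₀≡ : y₀ ≡ 2 + y
  y₀≡ = sym (m+[n∸m]≡n {2} (≤-trans (≤-trans (s≤s (s≤s z≤n)) (m≤n+m 7 (2 * ℓ₁))) (≤-trans (≤-reflexive (+-suc (2 * ℓ₁) 6)) regime)))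

  2ℓ₁≤y : 2 * ℓ₁ ≤ y
  2ℓ₁≤y = +-cancelˡ-≤ 2 _ _ (≤-trans (≤-trans (≤-reflexive (+-comm 2 (2 * ℓ₁))) (+-monoʳ-≤ (2 * ℓ₁) (s≤s (s≤s z≤n)))) (≤-trans (<⇒≤ regime) (≤-reflexive y₀≡)))

  ℓ₁≤y : ℓ₁ ≤ y
  ℓ₁≤y = ≤-trans (m≤n*m ℓ₁ 2) 2ℓ₁≤y

  y≤nb : y ≤ nb
  y≤nb = ≤-trans (m∸n≤m y₀ 2) (bits≤ nb)

  m+y≡ : m + y ≡ nb + ℓ₁
  m+y≡ = m∸n+n≡m (≤-trans y≤nb (m≤m+n nb ℓ₁))

  2^nb≤3n : 2 ^ nb ≤ 3 * n
  2^nb≤3n = ≤-trans 2^nb≤ (lin (n ∷ []) (con 1 :+ con 2 :* X0 :≤ con 3 :* X0) (hyp (con 1) (con 1 :≤ X0) n>0 ∷ []) refl)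

  2P≤ : 2 * 2 ^ y ≤ nb
  2P≤ = s≤s⁻¹ (*-cancelˡ-< 2 (2 * 2 ^ y) (suc nb) (s≤s (≤-trans (≤-trans (≤-reflexive (cong (2 ^_) (sym y₀≡))) (2^bits-≤ nb))
    (≤-reflexive (sym (+-suc nb (nb + 0)))))))

  P≤nb : 2 ^ y ≤ nb
  P≤nb = ≤-trans (m≤n*m (2 ^ y) 2) 2P≤

  table≤ : 2 ^ (2 ^ y) * 2 ^ y ≤ 3 * n
  table≤ = ≤-trans (*-monoʳ-≤ (2 ^ (2 ^ y)) (<⇒≤ (n<2^n (2 ^ y)))) (≤-trans (≤-reflexive (trans (sym (pow-+ (2 ^ y) (2 ^ y))) (cong (λ x → 2 ^ (2 ^ y + x)) (sym (+-identityʳ (2 ^ y))))))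
    (≤-trans (pow-mono 2P≤) 2^nb≤3n))

  M-spread : M * 2 ^ (y ∸ ℓ₁) ≤ 3 * n
  M-spread = ≤-trans (≤-reflexive (trans (sym (pow-+ m (y ∸ ℓ₁))) (cong (2 ^_) (trans (sym (+-∸-assoc m ℓ₁≤y)) (trans (cong (_∸ ℓ₁) m+y≡) (m+n∸n≡m nb ℓ₁)))))) 2^nb≤3n

  M≤ : M ≤ 3 * n
  M≤ = ≤-trans (≤-trans (≤-reflexive (sym (*-identityʳ M))) (*-monoʳ-≤ M (pow>0 (y ∸ ℓ₁)))) M-spread

  M-y₀ : M * y₀ ≤ 6 * n
  M-y₀ = lin (M ∷ y₀ ∷ n ∷ y ∸ ℓ₁ ∷ 2 ^ (y ∸ ℓ₁) ∷ []) (X0 :* X1 :≤ con 6 :* X2)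
    (hyp X0 (X1 :≤ con 2 :+ con 2 :* X3) y₀≤ ∷ hyp (con 2 :* X0) (con 1 :+ X3 :≤ X4) (n<2^n (y ∸ ℓ₁)) ∷ hyp (con 2) (X0 :* X4 :≤ con 3 :* X2) M-spread ∷ []) refl
    where
    y₀≤ : y₀ ≤ 2 + 2 * (y ∸ ℓ₁)
    y₀≤ = ≤-trans (≤-reflexive y₀≡) (+-monoʳ-≤ 2 (lin (y ∷ ℓ₁ ∷ y ∸ ℓ₁ ∷ []) (X0 :≤ con 2 :* X2) (hyp (con 1) (con 2 :* X1 :≤ X0) 2ℓ₁≤y ∷ hyp (con 2) (X0 :≤ X1 :+ X2) (m≤n+m∸n y ℓ₁) ∷ []) refl))

  fₜ≤ : fₜ ≤ 12 + y₀
  fₜ≤ = ≤-trans (bits-* 1000 (suc nb)) (+-mono-≤ {_} {10} (≤-trans (bits-mono {1000} {1023} (≤ᵇ⇒≤ 1000 1023 _)) (bits-≤ {1023} {10} ≤-refl))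
    (≤-trans (bits-+ 1 nb) (s≤s (+-monoˡ-≤ y₀ (bits≤ 1)))))

  M-fₜ : M * fₜ ≤ 42 * n
  M-fₜ = lin (M ∷ fₜ ∷ n ∷ y₀ ∷ []) (X0 :* X1 :≤ con 42 :* X2)
    (hyp X0 (X1 :≤ con 12 :+ X3) fₜ≤ ∷ hyp (con 12) (X0 :≤ con 3 :* X2) M≤ ∷ hyp (con 1) (X0 :* X3 :≤ con 6 :* X2) M-y₀ ∷ []) refl

  ℓ₁≤nb : ℓ₁ ≤ nb
  ℓ₁≤nb = ≤-trans ℓ₁≤y y≤nb

  bits-B : bits B ≤ nb + (1 + (nb + 9))
  bits-B = ≤-trans (bits-* n (ℓ₁ + 500)) (+-mono-≤ (bits-≤ n<) (≤-trans (bits-+ ℓ₁ 500) (s≤s (+-mono-≤ (≤-trans (bits≤ ℓ₁) ℓ₁≤nb)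
    (≤-trans (bits-mono {500} {511} (≤ᵇ⇒≤ 500 511 _)) (bits-≤ {511} {9} ≤-refl))))))

  top-fits : 3 * bits B < 2 ^ fₜ
  top-fits = ≤-<-trans (lin (bits B ∷ nb ∷ []) (con 3 :* X0 :≤ con 1000 :* (con 1 :+ X1)) (hyp (con 3) (X0 :≤ X1 :+ (con 1 :+ (X1 :+ con 9))) bits-B ∷ []) refl) (<-bits (1000 * suc nb))

  module Sums {Sτ groups : ℕ} (Sτ≤ : Sτ ≤ M * (1 + 2 ^ (y ∸ ℓ₁)) + n * suc ℓ₁)
    (groups≤ : 2 ^ y₀ * groups ≤ 2 ^ y₀ * (M * fₜ + 3 * (M * (fₜ + y₀))) + 3 * (M * fₜ + M) + (2 ^ y₀ + 3) * Sτ) where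

    Sτ≤′ : Sτ ≤ n * (ℓ₁ + 7)
    Sτ≤′ = lin (Sτ ∷ M ∷ 2 ^ (y ∸ ℓ₁) ∷ n ∷ ℓ₁ ∷ []) (X0 :≤ X3 :* (X4 :+ con 7))
      (hyp (con 1) (X0 :≤ X1 :* (con 1 :+ X2) :+ X3 :* (con 1 :+ X4)) Sτ≤ ∷ hyp (con 1) (X1 :≤ con 3 :* X3) M≤ ∷ hyp (con 1) (X1 :* X2 :≤ con 3 :* X3) M-spread ∷ []) refl

    groups≤′ : groups ≤ n * (ℓ₁ + 352)
    groups≤′ = ≤-trans (*-cancelˡ-≤ (2 ^ y₀) {{>-nonZero (pow>0 y₀)}} first) second
      where
      ℓ₁< : 1 + ℓ₁ ≤ 2 ^ y₀
      ℓ₁< = ≤-trans (n<2^n ℓ₁) (pow-mono (≤-trans ℓ₁≤y (m∸n≤m y₀ 2)))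
      first : 2 ^ y₀ * groups ≤ 2 ^ y₀ * (Sτ + 7 * (M * fₜ) + 3 * (M * y₀) + 3 * M + 24 * n)
      first = lin (2 ^ y₀ ∷ groups ∷ M ∷ fₜ ∷ y₀ ∷ Sτ ∷ n ∷ ℓ₁ ∷ []) (X0 :* X1 :≤ X0 :* (X5 :+ con 7 :* (X2 :* X3) :+ con 3 :* (X2 :* X4) :+ con 3 :* X2 :+ con 24 :* X6))
        (hyp (con 1) (X0 :* X1 :≤ X0 :* (X2 :* X3 :+ con 3 :* (X2 :* (X3 :+ X4))) :+ con 3 :* (X2 :* X3 :+ X2) :+ (X0 :+ con 3) :* X5) groups≤
         ∷ hyp (con 3 :* (X2 :* X3 :+ X2) :+ con 18 :* X6) (con 1 :≤ X0) (pow>0 y₀)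
         ∷ hyp (con 3) (X5 :≤ X6 :* (X7 :+ con 7)) Sτ≤′ ∷ hyp (con 3 :* X6) (con 1 :+ X7 :≤ X0) ℓ₁< ∷ []) refl
      second : Sτ + 7 * (M * fₜ) + 3 * (M * y₀) + 3 * M + 24 * n ≤ n * (ℓ₁ + 352)
      second = lin (M * fₜ ∷ M * y₀ ∷ M ∷ Sτ ∷ n ∷ ℓ₁ ∷ []) (X3 :+ con 7 :* X0 :+ con 3 :* X1 :+ con 3 :* X2 :+ con 24 :* X4 :≤ X4 :* (X5 :+ con 352))
        (hyp (con 1) (X3 :≤ X4 :* (X5 :+ con 7)) Sτ≤′ ∷ hyp (con 7) (X0 :≤ con 42 :* X4) M-fₜ ∷ hyp (con 3) (X1 :≤ con 6 :* X4) M-y₀ ∷ hyp (con 3) (X2 :≤ con 3 :* X4) M≤ ∷ []) refl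

    fₜ≤Mfₜ : fₜ ≤ M * fₜ
    fₜ≤Mfₜ = m≤n*m fₜ M {{>-nonZero (pow>0 m)}}

    small≤ : fₜ + M + Sτ ≤ B
    small≤ = lin (fₜ ∷ M * fₜ ∷ M ∷ Sτ ∷ n ∷ ℓ₁ ∷ []) (X0 :+ X2 :+ X3 :≤ X4 :* (X5 :+ con 500))
      (hyp (con 1) (X0 :≤ X1) fₜ≤Mfₜ ∷ hyp (con 1) (X1 :≤ con 42 :* X4) M-fₜ ∷ hyp (con 1) (X2 :≤ con 3 :* X4) M≤ ∷ hyp (con 1) (X3 :≤ X4 :* (X5 :+ con 7)) Sτ≤′ ∷ []) refl

    total≤ : ∀ {g} → g ≤ M → fₜ + g + groups ≤ B
    total≤ {g} g≤ = lin (fₜ ∷ M * fₜ ∷ M ∷ groups ∷ n ∷ ℓ₁ ∷ g ∷ []) (X0 :+ X6 :+ X3 :≤ X4 :* (X5 :+ con 500))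
      (hyp (con 1) (X0 :≤ X1) fₜ≤Mfₜ ∷ hyp (con 1) (X1 :≤ con 42 :* X4) M-fₜ ∷ hyp (con 1) (X2 :≤ con 3 :* X4) M≤ ∷ hyp (con 1) (X3 :≤ X4 :* (X5 :+ con 352)) groups≤′ ∷ hyp (con 1) (X6 :≤ X2) g≤ ∷ []) refl

    all≤ : ∀ {len} → len ≤ fₜ + (3 * (M + bits B) + groups) → 2 ^ (2 ^ y) * 2 ^ y + len ≤ n * ℓ₁ + n * 500
    all≤ {len} len≤ = lin (2 ^ (2 ^ y) * 2 ^ y ∷ len ∷ fₜ ∷ M ∷ bits B ∷ groups ∷ n ∷ ℓ₁ ∷ nb ∷ M * fₜ ∷ []) (X0 :+ X1 :≤ X6 :* X7 :+ X6 :* con 500)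
      (hyp (con 1) (X1 :≤ X2 :+ (con 3 :* (X3 :+ X4) :+ X5)) len≤ ∷ hyp (con 1) (X0 :≤ con 3 :* X6) table≤ ∷ hyp (con 1) (X2 :≤ X9) fₜ≤Mfₜ ∷ hyp (con 1) (X9 :≤ con 42 :* X6) M-fₜ
       ∷ hyp (con 3) (X3 :≤ con 3 :* X6) M≤ ∷ hyp (con 3) (X4 :≤ X8 :+ (con 1 :+ (X8 :+ con 9))) bits-B ∷ hyp (con 6) (X8 :≤ X6) nb≤ ∷ hyp (con 30) (con 1 :≤ X6) n>0
       ∷ hyp (con 1) (X5 :≤ X6 :* (X7 :+ con 352)) groups≤′ ∷ []) refl

module TinyFit (nb ℓ₁ n : ℕ) (n>0 : 0 < n) (nb≤ : nb ≤ n) (n< : n < 2 ^ nb) (2^nb≤ : 2 ^ nb ≤ 1 + 2 * n)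
  (regime : 2 * ℓ₁ + 6 < bits nb) (ψ : ℕ → Bool) (few : Σ< (2 ^ (nb + ℓ₁)) (b2n ∘ ψ) ≤ n) where

  open TinyNumbers nb ℓ₁ n n>0 nb≤ n< 2^nb≤ regime
  open TinyBits ψ m y ℓ₁ fₜ ℓ₁≤y public

  module SL = StoreLength m fₜ fₜ blob

  open Sums (≤-trans Σ-blobs (+-monoʳ-≤ _ (*-monoˡ-≤ (suc ℓ₁) (≤-trans (≤-reflexive (cong (λ x → Σ< x (b2n ∘ ψ)) (trans (sym (pow-+ m y)) (cong (2 ^_) m+y≡)))) few)))) (SL.groups-≤ y₀)

  total-≤ : Top.total ≤ B
  total-≤ = total≤ SL.G≤M

  fitting : Narrow
  fitting = SL.widths-narrow {B} small≤ total-≤ top-fits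

  length-contents : length contents ≤ n * ℓ₁ + n * 500
  length-contents = ≤-trans (≤-reflexive (trans (length-++ table) (cong (_+ length layout) length-table)))
    (all≤ (≤-trans (SL.layout-length (≤-trans (bits-mono total-≤) (≤-trans (m≤n*m (bits B) 3) (<⇒≤ top-fits))))
      (+-monoʳ-≤ fₜ (+-monoˡ-≤ SL.groups (*-monoʳ-≤ 3 (+-monoʳ-≤ M (bits-mono total-≤)))))))

-- An interval shorter than a block meets at most two blocks.
module Split {a b Λ : ℕ} (Λ>0 : 0 < Λ) (a≤b : a ≤ b) (b< : b < a + Λ) where

  same : Bool
  same = not (a // Λ <ᵇ b // Λ)

  hi₁ lo₂ : ℕ
  hi₁ = if same then b %% Λ else Λ ∸ 1
  lo₂ = if same then a %% Λ else 0

  Within : ℕ → ℕ → ℕ → ℕ → Set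
  Within β l h x = x // Λ ≡ β × l ≤ x %% Λ × x %% Λ ≤ h

  private
    mono : a // Λ ≤ b // Λ
    mono = //-mono Λ a≤b

    pos : ∀ x → x ≡ x // Λ * Λ + x %% Λ
    pos x = trans (div-mod x Λ>0) (+-comm (x %% Λ) _)

    order : ∀ {x y} → x // Λ ≡ y // Λ → x %% Λ ≤ y %% Λ → x ≤ y
    order {x} {y} e h = subst₂ _≤_ (sym (pos x)) (trans (cong (λ β → β * Λ + y %% Λ) e) (sym (pos y))) (+-monoʳ-≤ (x // Λ * Λ) h)

    order⁻ : ∀ {x y} → x // Λ ≡ y // Λ → x ≤ y → x %% Λ ≤ y %% Λ
    order⁻ {x} {y} e h = +-cancelˡ-≤ (x // Λ * Λ) _ _ (subst₂ _≤_ (pos x) (trans (pos y) (cong (λ β → β * Λ + y %% Λ) (sym e))) h)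

    before : ∀ {x y} → x // Λ < y // Λ → x ≤ y
    before {x} {y} h = <⇒≤ (<-≤-trans (<-//-suc x Λ>0) (≤-trans (*-monoˡ-≤ Λ h) (//-*-≤ y Λ)))

    next : b // Λ ≤ suc (a // Λ)
    next = s≤s⁻¹ (<-*⇒//-< {2 + a // Λ} {b} {Λ} (<-≤-trans b< (≤-trans (+-monoˡ-≤ Λ (<⇒≤ (<-//-suc a Λ>0))) (≤-reflexive (+-comm (suc (a // Λ) * Λ) Λ)))))

    below : ∀ x → x %% Λ ≤ Λ ∸ 1
    below x = ∸-monoˡ-≤ 1 (%%-< x Λ>0)

    cases : (same ≡ true × a // Λ ≡ b // Λ) ⊎ (same ≡ false × a // Λ < b // Λ)
    cases with a // Λ <ᵇ b // Λ in e
    ... | true = inj₂ (refl , <ᵇ-true⁻ e)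
    ... | false = inj₁ (refl , ≤-antisym mono (<ᵇ-false⁻ e))

    hi₁≡ : ∀ {s} → same ≡ s → hi₁ ≡ (if s then b %% Λ else Λ ∸ 1)
    hi₁≡ refl = refl
    lo₂≡ : ∀ {s} → same ≡ s → lo₂ ≡ (if s then a %% Λ else 0)
    lo₂≡ refl = refl

  lo₁≤hi₁ : a %% Λ ≤ hi₁
  lo₁≤hi₁ = [ (λ (e , h) → subst (a %% Λ ≤_) (sym (hi₁≡ e)) (order⁻ {a} {b} h a≤b)) , (λ (e , h) → subst (a %% Λ ≤_) (sym (hi₁≡ e)) (below a)) ]′ cases

  hi₁< : hi₁ < Λ
  hi₁< = [ (λ (e , h) → subst (_< Λ) (sym (hi₁≡ e)) (%%-< b Λ>0)) , (λ (e , h) → subst (_< Λ) (sym (hi₁≡ e)) (≤-reflexive (m+[n∸m]≡n {1} Λ>0))) ]′ cases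

  lo₂≤hi₂ : lo₂ ≤ b %% Λ
  lo₂≤hi₂ = [ (λ (e , h) → subst (_≤ b %% Λ) (sym (lo₂≡ e)) (order⁻ {a} {b} h a≤b)) , (λ (e , h) → subst (_≤ b %% Λ) (sym (lo₂≡ e)) z≤n) ]′ cases

  cover : ∀ {x} → a ≤ x → x ≤ b → Within (a // Λ) (a %% Λ) hi₁ x ⊎ Within (b // Λ) lo₂ (b %% Λ) x
  cover {x} a≤x x≤b = [ one , two ]′ cases
    where
    one : same ≡ true × a // Λ ≡ b // Λ → Within (a // Λ) (a %% Λ) hi₁ x ⊎ Within (b // Λ) lo₂ (b %% Λ) x
    one (e , h) = inj₁ (β≡ , order⁻ (sym β≡) a≤x , subst (x %% Λ ≤_) (sym (hi₁≡ e)) (order⁻ (trans β≡ h) x≤b))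
      where
      β≡ : x // Λ ≡ a // Λ
      β≡ = ≤-antisym (≤-trans (//-mono Λ x≤b) (≤-reflexive (sym h))) (//-mono Λ a≤x)
    two : same ≡ false × a // Λ < b // Λ → Within (a // Λ) (a %% Λ) hi₁ x ⊎ Within (b // Λ) lo₂ (b %% Λ) x
    two (e , h) with x // Λ ≟ a // Λ
    ... | yes β≡ = inj₁ (β≡ , order⁻ (sym β≡) a≤x , subst (x %% Λ ≤_) (sym (hi₁≡ e)) (below x))
    ... | no β≢ = inj₂ (β≡ , subst (_≤ x %% Λ) (sym (lo₂≡ e)) z≤n , order⁻ β≡ x≤b)
      where
      β≡ : x // Λ ≡ b // Λ
      β≡ = ≤-antisym (//-mono Λ x≤b) (≤-trans next (≤∧≢⇒< (//-mono Λ a≤x) (β≢ ∘ sym)))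

  within₁ : ∀ {x} → Within (a // Λ) (a %% Λ) hi₁ x → a ≤ x × x ≤ b
  within₁ {x} (β≡ , l , h) = order (sym β≡) l ,
    [ (λ (e , h′) → order (trans β≡ h′) (subst (x %% Λ ≤_) (hi₁≡ e) h)) , (λ (e , h′) → before (subst (_< b // Λ) (sym β≡) h′)) ]′ cases

  within₂ : ∀ {x} → Within (b // Λ) lo₂ (b %% Λ) x → a ≤ x × x ≤ b
  within₂ {x} (β≡ , l , h) =
    [ (λ (e , h′) → order (trans h′ (sym β≡)) (subst (_≤ x %% Λ) (lo₂≡ e) l)) , (λ (e , h′) → before (subst (a // Λ <_) (sym β≡) h′)) ]′ cases , order β≡ h

address : ℕ → ℕ → ℕ → ℕ → ℕ → ℕ
address V μ A Λ x = slot V μ A (x // Λ) * Λ + x %% Λ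

module SlotWindow (ψ : ℕ → Bool) (V μ A Λ : ℕ) (Λ>0 : 0 < Λ) (β : ℕ) {l h : ℕ} (h<Λ : h < Λ) where

  s : ℕ
  s = slot V μ A β

  Stored : Set
  Stored = ∃[ q ] (ψ q ≡ true × s * Λ + l ≤ q × q ≤ s * Λ + h)

  Source : Set
  Source = ∃[ x ] ((x // Λ ≡ β × l ≤ x %% Λ × x %% Λ ≤ h) × ψ (address V μ A Λ x) ≡ true)

  from-stored : Stored → Source
  from-stored (q , ψq , lo , hi) = x , (x//Λ , subst (l ≤_) (sym x%%Λ) l≤o , subst (_≤ h) (sym x%%Λ) o≤h) , subst (λ p → ψ p ≡ true) q≡ ψq
    where
    o x : ℕ
    o = q ∸ s * Λ
    x = o + β * Λ
    q≡o : q ≡ s * Λ + o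
    q≡o = sym (m+[n∸m]≡n (≤-trans (m≤m+n (s * Λ) l) lo))
    l≤o : l ≤ o
    l≤o = +-cancelˡ-≤ (s * Λ) l o (≤-trans lo (≤-reflexive q≡o))
    o≤h : o ≤ h
    o≤h = +-cancelˡ-≤ (s * Λ) o h (≤-trans (≤-reflexive (sym q≡o)) hi)
    x//Λ : x // Λ ≡ β
    x//Λ = //-* o β (≤-<-trans o≤h h<Λ)
    x%%Λ : x %% Λ ≡ o
    x%%Λ = %%-* o β (≤-<-trans o≤h h<Λ)
    q≡ : q ≡ address V μ A Λ x
    q≡ = trans q≡o (sym (cong₂ (λ β o → slot V μ A β * Λ + o) x//Λ x%%Λ))

  to-stored : Source → Stored
  to-stored (x , (refl , l≤ , ≤h) , ψx) = address V μ A Λ x , ψx , +-monoʳ-≤ (s * Λ) l≤ , +-monoʳ-≤ (s * Λ) ≤h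

module _ {k : ℕ} where

  opaque
    blockSlotE : (ΛE AE QE VE : Expr k) → Expr k → Expr k
    blockSlotE ΛE AE QE VE x = div′ (rem′ (mul′ AE (div′ x ΛE)) QE) VE

    placeE : (ΛE AE QE VE : Expr k) → Expr k → Expr k → Expr k
    placeE ΛE AE QE VE x o = add′ (mul′ (blockSlotE ΛE AE QE VE x) ΛE) o

    sameE : Expr k → Expr k → Expr k → Expr k
    sameE ΛE a b = notE (lt′ (div′ a ΛE) (div′ b ΛE))

    hi₁E lo₂E offE : Expr k → Expr k → Expr k → Expr k
    hi₁E ΛE a b = selectE (sameE ΛE a b) (rem′ b ΛE) (sub′ ΛE (lit 1))
    lo₂E ΛE a b = selectE (sameE ΛE a b) (rem′ a ΛE) (lit 0)
    offE ΛE x _ = rem′ x ΛE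

  pairE : (ΛE AE QE VE : Expr k) (exactE : Expr k → Expr k → Expr k) → Expr k → Expr k → Expr k
  pairE ΛE AE QE VE exactE a b = orE
    (exactE (placeE ΛE AE QE VE a (offE ΛE a b)) (placeE ΛE AE QE VE a (hi₁E ΛE a b)))
    (exactE (placeE ΛE AE QE VE b (lo₂E ΛE a b)) (placeE ΛE AE QE VE b (offE ΛE b a)))

module TopLogic {k : ℕ} (u : ℕ) (u>0 : 0 < u) (R : Fin k → Word (F * u)) (β : ℕ → Bool) where

  open Semantics u u>0 R β
  open Logic u u>0 R β

  private variable
    e e₁ e₂ : Expr k

  opaque
    unfolding ⟪_⟫

    ⇓par : ∀ {x j} i {_ : True (j ≤? F)} → R i ≡ word w x → x < 2 ^ (j * u) → par i ⇓ x ∶ j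
    ⇓par {x} {j} i {p} h x< = trans (cong value h) (word-small {x} {j} {p} x<) ⟨ x< ⟩

    -- Whatever the other expression computes.
    ⇓mute : e₁ ⇓ 0 ∶ 1 → mul′ e₁ e₂ ⇓ 0 ∶ 1
    ⇓mute {e₂ = e₂} (z ⟨ b ⟩) = trans (cong (λ v → value (word w (v * value (eval R (mem β w) e₂)))) z) (word-small {0} {1} b) ⟨ b ⟩

    program-value : ∀ {v i} → e ⇓ v ∶ i → value (eval R (mem β w) e) ≡ v
    program-value h = val h

  convert : ∀ {P Q P′ Q′ : Set} → (P → P′) → (Q′ → Q) → Decides e P Q → Decides e P′ Q′
  convert f g (decides a v s c) = decides a v (f ∘ s) (c ∘ g)

  Exact : (Expr k → Expr k → Expr k) → (ℕ → Bool) → ℕ → ℕ → Set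
  Exact exactE ψ N Λ = ∀ {lo hi} {loE hiE : Expr k} → loE ⇓ lo ∶ 1 → hiE ⇓ hi ∶ 1 → lo ≤ hi → hi < N → lo // Λ ≡ hi // Λ →
    Decides (exactE loE hiE) (∃[ x ] (ψ x ≡ true × lo ≤ x × x ≤ hi)) (∃[ x ] (ψ x ≡ true × lo ≤ x × x ≤ hi))

  module Pair {Λ A V μ : ℕ} {ΛE AE QE VE : Expr k} (⇓Λ : ΛE ⇓ Λ ∶ 1) (⇓A : AE ⇓ A ∶ 1) (⇓Q : QE ⇓ 2 ^ (V + μ) ∶ 1) (⇓V : VE ⇓ 2 ^ V ∶ 1)
    (Λ>0 : 0 < Λ) (fits-in : 2 ^ μ * Λ < 2 ^ (1 * u)) where

    opaque
      unfolding blockSlotE placeE sameE hi₁E lo₂E offE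

      ⇓place : ∀ {x o} {xE oE : Expr k} {i} {_ : True (suc (2 ⊔ i) ≤? F)} → xE ⇓ x ∶ 1 → oE ⇓ o ∶ i → o < Λ → placeE ΛE AE QE VE xE oE ⇓ slot V μ A (x // Λ) * Λ + o ∶ 1
      ⇓place {x} {o} {xE} {i = i} {p} ⇓x ⇓o o< = rebound (⇓add (⇓mul ⇓slot₁ ⇓Λ) ⇓o {p}) (<-trans place< fits-in)
        where
        ⇓slot : blockSlotE ΛE AE QE VE xE ⇓ slot V μ A (x // Λ) ∶ 2
        ⇓slot = ⇓div (⇓rem (⇓mul ⇓A (⇓div ⇓x ⇓Λ)) ⇓Q) ⇓V
        slot≤ : slot V μ A (x // Λ) ≤ 2 ^ μ * Λ
        slot≤ = ≤-trans (<⇒≤ (slot-< V μ A (x // Λ))) (m≤m*n (2 ^ μ) Λ {{>-nonZero Λ>0}})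
        slot< : slot V μ A (x // Λ) < 2 ^ (1 * u)
        slot< = ≤-<-trans slot≤ fits-in
        ⇓slot₁ : blockSlotE ΛE AE QE VE xE ⇓ slot V μ A (x // Λ) ∶ 1
        ⇓slot₁ = rebound ⇓slot slot<
        place< : slot V μ A (x // Λ) * Λ + o < 2 ^ μ * Λ
        place< = <-≤-trans (+-monoʳ-< _ o<) (≤-trans (≤-reflexive (+-comm _ Λ)) (*-monoˡ-≤ Λ (slot-< V μ A (x // Λ))))

      ⇓off : ∀ {x} {xE yE : Expr k} → xE ⇓ x ∶ 1 → offE ΛE xE yE ⇓ x %% Λ ∶ 1
      ⇓off ⇓x = ⇓rem ⇓x ⇓Λ

      ⇓hi₁ : ∀ {a b} {aE bE : Expr k} → aE ⇓ a ∶ 1 → bE ⇓ b ∶ 1 → hi₁E ΛE aE bE ⇓ (if not (a // Λ <ᵇ b // Λ) then b %% Λ else Λ ∸ 1) ∶ 3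
      ⇓hi₁ {a} {b} ⇓a ⇓b = ⇓select (not (a // Λ <ᵇ b // Λ)) (⇓not (⇓lt (⇓div ⇓a ⇓Λ) (⇓div ⇓b ⇓Λ))) (⇓rem ⇓b ⇓Λ) (⇓sub Λ>0 ⇓Λ (⇓lit 1))

      ⇓lo₂ : ∀ {a b} {aE bE : Expr k} → aE ⇓ a ∶ 1 → bE ⇓ b ∶ 1 → lo₂E ΛE aE bE ⇓ (if not (a // Λ <ᵇ b // Λ) then a %% Λ else 0) ∶ 3
      ⇓lo₂ {a} {b} ⇓a ⇓b = ⇓select (not (a // Λ <ᵇ b // Λ)) (⇓not (⇓lt (⇓div ⇓a ⇓Λ) (⇓div ⇓b ⇓Λ))) (⇓rem ⇓a ⇓Λ) (⇓lit 0)

    place-bound : ∀ x {o} → o < Λ → slot V μ A x * Λ + o < 2 ^ μ * Λ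
    place-bound x o< = <-≤-trans (+-monoʳ-< _ o<) (≤-trans (≤-reflexive (+-comm _ Λ)) (*-monoˡ-≤ Λ (slot-< V μ A x)))

    same-block : ∀ s {l h} → l < Λ → h < Λ → (s * Λ + l) // Λ ≡ (s * Λ + h) // Λ
    same-block s {l} {h} l< h< = trans (block l<) (sym (block h<))
      where
      block : ∀ {o} → o < Λ → (s * Λ + o) // Λ ≡ s
      block {o} o< = trans (cong (_// Λ) (+-comm (s * Λ) o)) (//-* o s o<)

    module _ {ψ : ℕ → Bool} {exactE : Expr k → Expr k → Expr k} (exact : Exact exactE ψ (2 ^ μ * Λ) Λ) where

      pair-decides : ∀ {a b} {aE bE : Expr k} → aE ⇓ a ∶ 1 → bE ⇓ b ∶ 1 → a ≤ b → b < a + Λ →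
        Decides (pairE ΛE AE QE VE exactE aE bE) (∃[ x ] ((a ≤ x × x ≤ b) × ψ (address V μ A Λ x) ≡ true)) (∃[ x ] ((a ≤ x × x ≤ b) × ψ (address V μ A Λ x) ≡ true))
      pair-decides {a} {b} ⇓a ⇓b a≤b b< = refine (or-decides
          (convert (λ s → let x , p , e = W₁.from-stored s in x , within₁ p , e) W₁.to-stored
            (exact (⇓place ⇓a (⇓off ⇓a) (%%-< a Λ>0)) (⇓place ⇓a (⇓hi₁ ⇓a ⇓b) hi₁<) (+-monoʳ-≤ _ lo₁≤hi₁) (place-bound (a // Λ) hi₁<) (same-block (slot V μ A (a // Λ)) (%%-< a Λ>0) hi₁<)))
          (convert (λ s → let x , p , e = W₂.from-stored s in x , within₂ p , e) W₂.to-stored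
            (exact (⇓place ⇓b (⇓lo₂ ⇓a ⇓b) lo₂<) (⇓place ⇓b (⇓off ⇓b) (%%-< b Λ>0)) (+-monoʳ-≤ _ lo₂≤hi₂) (place-bound (b // Λ) (%%-< b Λ>0)) (same-block (slot V μ A (b // Λ)) lo₂< (%%-< b Λ>0)))))
          (λ (x , (a≤ , ≤b) , e) → [ (λ p → inj₁ (x , p , e)) , (λ p → inj₂ (x , p , e)) ]′ (cover a≤ ≤b))
        where
        open Split Λ>0 a≤b b<
        module W₁ = SlotWindow ψ V μ A Λ Λ>0 (a // Λ) {a %% Λ} hi₁<
        module W₂ = SlotWindow ψ V μ A Λ Λ>0 (b // Λ) {lo₂} (%%-< b Λ>0)
        lo₂< : lo₂ < Λ
        lo₂< = ≤-<-trans lo₂≤hi₂ (%%-< b Λ>0)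

msbSize : ℕ → ℕ
msbSize ℓ = least (λ m → ℓ <? suc m * (m + m)) (suc ℓ)

module MsbRoom (ℓ : ℕ) where

  private
    P? = λ m → ℓ <? suc m * (m + m)

  m : ℕ
  m = msbSize ℓ

  large : ℓ < suc m * (m + m)
  large = least-holds P? (suc ℓ) (lin (ℓ ∷ []) (con 1 :+ X0 :≤ (con 2 :+ X0) :* (con 1 :+ X0 :+ (con 1 :+ X0))) [] refl)

  m≤ : m ≤ suc ℓ
  m≤ = least-≤ P? (suc ℓ)

  m>0 : 0 < m
  m>0 = n≢0⇒n>0 λ e → n≮0 (subst (λ m → ℓ < suc m * (m + m)) e large)

  square≤ : (m + m) * suc (suc (m + m)) ≤ 10 * ℓ + 8
  square≤ = by m refl m≤
    where
    by : ∀ k → m ≡ k → k ≤ suc ℓ → (k + k) * suc (suc (k + k)) ≤ 10 * ℓ + 8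
    by zero e le = z≤n
    by (suc k) e le = lin (k ∷ ℓ ∷ []) ((con 1 :+ X0 :+ (con 1 :+ X0)) :* (con 2 :+ (con 1 :+ X0 :+ (con 1 :+ X0))) :≤ con 10 :* X1 :+ con 8)
      (hyp (con 2) ((con 1 :+ X0) :* (X0 :+ X0) :≤ X1) (≮⇒≥ λ h → <-irrefl refl (≤-trans (≤-reflexive (sym e)) (least-min P? (suc ℓ) {k} h))) ∷ hyp (con 8) (con 1 :+ X0 :≤ con 1 :+ X1) le ∷ []) refl

  module Constants where
    open Blocks m using (N; b; B; h; X; maskC; addC; topC; repC; powC; topC′)

    N*B : N * B ≤ 10 * ℓ + 8
    N*B = square≤

    private
      under : ∀ {u} k v → k * B ≤ 16 * u → (∀ i → v i < X) → digits X k v < 2 ^ (16 * u)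
      under k v le v< = <-≤-trans (digits-< X k v v<) (≤-trans (≤-reflexive (trans (2^-^ B k) (cong (2 ^_) (*-comm B k)))) (pow-mono le))
      h≤b : h ≤ b
      h≤b = s≤s (m≤m+n m m)
      2^b<X : 2 ^ b < X
      2^b<X = pow-mono-< (n<1+n b)
      m*B≤ : m * B ≤ N * B
      m*B≤ = *-monoˡ-≤ B (m≤m+n m m)

    constants : ∀ {u} → 10 * ℓ + 8 ≤ 16 * u →
      (maskC < 2 ^ (16 * u) × addC < 2 ^ (16 * u) × topC < 2 ^ (16 * u)) × (repC < 2 ^ (16 * u) × powC < 2 ^ (16 * u) × topC′ < 2 ^ (16 * u))
    constants {u} le =
      (under {u} m (λ _ → 2 ^ h ∸ 1) mB≤ (λ _ → ≤-<-trans (m∸n≤m (2 ^ h) 1) (≤-<-trans (pow-mono h≤b) 2^b<X)) ,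
       under {u} m (λ _ → 2 ^ b ∸ 1) mB≤ (λ _ → ≤-<-trans (m∸n≤m (2 ^ b) 1) 2^b<X) , under {u} m (λ _ → 2 ^ b) mB≤ (λ _ → 2^b<X)) ,
      (under {u} N (λ _ → 1) NB≤ (λ _ → ≤-<-trans (pow>0 b) 2^b<X) , under {u} N (λ i → 2 ^ b ∸ 2 ^ i) NB≤ (λ i → ≤-<-trans (m∸n≤m (2 ^ b) (2 ^ i)) 2^b<X) ,
       under {u} N (λ _ → 2 ^ b) NB≤ (λ _ → 2^b<X))
      where
      NB≤ : N * B ≤ 16 * u
      NB≤ = ≤-trans N*B le
      mB≤ : m * B ≤ 16 * u
      mB≤ = ≤-trans m*B≤ NB≤

roomFactor : ℕ → ℕ
roomFactor S = 80 * S + 5000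

module NormalRoom (S : ℕ) (S>0 : 0 < S) (nb ℓ₁ n : ℕ) (n>0 : 0 < n) (nb≤ : nb ≤ n) (n< : n < 2 ^ nb) (2^nb≤ : 2 ^ nb ≤ 1 + 2 * n)
  (regime : bits nb ≤ 2 * ℓ₁ + 6) (u : ℕ) (room : roomFactor S * suc (nb + ℓ₁) ≤ u) where

  open NormalStore S S>0 nb ℓ₁ n n>0 nb≤ n< 2^nb≤ regime
  open MsbRoom ℓ using (m; m≤)

  private
    1*u : ∀ {x} → x ≤ u → x ≤ 1 * u
    1*u h = ≤-trans h (≤-reflexive (sym (*-identityˡ u)))

  2^f≤u : 2 ^ f ≤ 1 * u
  2^f≤u = 1*u (lin (2 ^ f ∷ S ∷ ℓ ∷ nb + ℓ₁ ∷ u ∷ []) (X0 :≤ X4)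
    (hyp (con 1) (X0 :≤ con 1 :+ con 2 :* ((con 4 :* X1 :+ con 128) :* (con 1 :+ X2))) 2^f≤ ∷ hyp (con 8 :* X1 :+ con 256) (X2 :≤ X3) ℓ≤υ
     ∷ hyp (con 1) ((con 80 :* X1 :+ con 5000) :* (con 1 :+ X3) :≤ X4) room ∷ []) refl)

  2^fₜ≤u : 2 ^ fₜ ≤ 1 * u
  2^fₜ≤u = 1*u (lin (2 ^ fₜ ∷ S ∷ ℓ ∷ nb ∷ ℓ₁ ∷ u ∷ []) (X0 :≤ X5)
    (hyp (con 1) (X0 :≤ con 1 :+ con 2 :* ((con 20 :* X1 :+ con 1000) :* (X3 :+ (con 1 :+ X2)))) (2^bits-≤ (Kₜ * (nb + suc ℓ))) ∷ hyp (con 40 :* X1 :+ con 2000) (X2 :≤ X3 :+ X4) ℓ≤υ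
     ∷ hyp (con 1) ((con 80 :* X1 :+ con 5000) :* (con 1 :+ (X3 :+ X4)) :≤ X5) room ∷ []) refl)

  small : ∀ {x} → x ≤ 10 * ℓ + 8 → x ≤ 1 * u
  small {x} h = 1*u (lin (x ∷ S ∷ ℓ ∷ nb + ℓ₁ ∷ u ∷ []) (X0 :≤ X4)
    (hyp (con 1) (X0 :≤ con 10 :* X2 :+ con 8) h ∷ hyp (con 10) (X2 :≤ X3) ℓ≤υ ∷ hyp (con 1) ((con 80 :* X1 :+ con 5000) :* (con 1 :+ X3) :≤ X4) room ∷ []) refl)

  ℓ<u : suc ℓ ≤ 1 * u
  ℓ<u = small (lin (ℓ ∷ []) (con 1 :+ X0 :≤ con 10 :* X0 :+ con 8) [] refl)

  τ≤u : b ≤ 1 * u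
  τ≤u = small (≤-trans b≤ (lin (ℓ ∷ []) (con 1 :+ X0 :≤ con 10 :* X0 :+ con 8) [] refl))

  v₁≤u : b + suc (2 * b) ≤ 1 * u
  v₁≤u = small (lin (b ∷ ℓ ∷ []) (X0 :+ (con 1 :+ con 2 :* X0) :≤ con 10 :* X1 :+ con 8) (hyp (con 3) (X0 :≤ con 1 :+ X1) b≤ ∷ []) refl)

  rS≤u : r * S ≤ 1 * u
  rS≤u = 1*u (lin (r ∷ S ∷ ℓ ∷ nb + ℓ₁ ∷ u ∷ []) (X0 :* X1 :≤ X4)
    (hyp X1 (X0 :≤ con 2 :+ X2) r≤ ∷ hyp X1 (X2 :≤ X3) ℓ≤υ ∷ hyp (con 1) ((con 80 :* X1 :+ con 5000) :* (con 1 :+ X3) :≤ X4) room ∷ []) refl)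

  S≤u : S ≤ 1 * u
  S≤u = 1*u (lin (S ∷ nb + ℓ₁ ∷ u ∷ []) (X0 :≤ X2) (hyp (con 1) ((con 80 :* X0 :+ con 5000) :* (con 1 :+ X1) :≤ X2) room ∷ []) refl)

  r≤u : r ≤ 1 * u
  r≤u = small (≤-trans r≤ (lin (ℓ ∷ []) (con 2 :+ X0 :≤ con 10 :* X0 :+ con 8) [] refl))

  msb≤u : 10 * ℓ + 8 ≤ 16 * u
  msb≤u = ≤-trans (small ≤-refl) (*-monoˡ-≤ u {1} {16} (s≤s z≤n))

  m≤u : suc (m + m) ≤ 1 * u
  m≤u = small (lin (m ∷ ℓ ∷ []) (con 1 :+ (X0 :+ X0) :≤ con 10 :* X1 :+ con 8) (hyp (con 2) (X0 :≤ con 1 :+ X1) m≤ ∷ []) refl)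

  length<2^u : ∀ {x} → x ≤ n * ℓ₁ + n * (700 * Ψ) → x < 2 ^ (1 * u)
  length<2^u {x} h = <-≤-trans (≤-<-trans 2B (*-monoʳ-< 2 (<-bits B))) (pow-mono {suc (bits B)} (≤-trans (≤-trans (s≤s (m≤n*m (bits B) 3)) top-fits) 2^fₜ≤u))
    where
    2B : x ≤ 2 * B
    2B = ≤-trans h (lin (n ∷ ℓ₁ ∷ ℓ ∷ Ψ ∷ []) (X0 :* X1 :+ X0 :* (con 700 :* X3) :≤ con 2 :* (X0 :* (X2 :+ con 400 :* X3))) (hyp X0 (X1 :≤ X2) ℓ₁≤ℓ ∷ []) refl)

module TinyRoom (nb ℓ₁ n : ℕ) (n>0 : 0 < n) (nb≤ : nb ≤ n) (n< : n < 2 ^ nb) (2^nb≤ : 2 ^ nb ≤ 1 + 2 * n)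
  (regime : 2 * ℓ₁ + 6 < bits nb) (S u : ℕ) (room : roomFactor S * suc (nb + ℓ₁) ≤ u) where

  open TinyNumbers nb ℓ₁ n n>0 nb≤ n< 2^nb≤ regime

  private
    1*u : ∀ {x} → x ≤ u → x ≤ 1 * u
    1*u h = ≤-trans h (≤-reflexive (sym (*-identityˡ u)))

  2^fₜ≤u : 2 ^ fₜ ≤ 1 * u
  2^fₜ≤u = 1*u (lin (2 ^ fₜ ∷ S ∷ nb ∷ ℓ₁ ∷ u ∷ []) (X0 :≤ X4)
    (hyp (con 1) (X0 :≤ con 1 :+ con 2 :* (con 1000 :* (con 1 :+ X2))) (2^bits-≤ (1000 * suc nb)) ∷ hyp (con 1) ((con 80 :* X1 :+ con 5000) :* (con 1 :+ (X2 :+ X3)) :≤ X4) room ∷ []) refl)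

  nb≤u : nb ≤ 1 * u
  nb≤u = 1*u (lin (S ∷ nb ∷ ℓ₁ ∷ u ∷ []) (X1 :≤ X3) (hyp (con 1) ((con 80 :* X0 :+ con 5000) :* (con 1 :+ (X1 :+ X2)) :≤ X3) room ∷ []) refl)

  P≤u : 2 ^ y ≤ 1 * u
  P≤u = ≤-trans P≤nb nb≤u

  1≤u : 1 ≤ 1 * u
  1≤u = 1*u (lin (S ∷ nb ∷ ℓ₁ ∷ u ∷ []) (con 1 :≤ X3) (hyp (con 1) ((con 80 :* X0 :+ con 5000) :* (con 1 :+ (X1 :+ X2)) :≤ X3) room ∷ []) refl)

  start<2^u : 2 ^ (2 ^ y) * 2 ^ y < 2 ^ (1 * u)
  start<2^u = <-≤-trans (*-monoʳ-< (2 ^ (2 ^ y)) {{m^n≢0 2 (2 ^ y)}} (n<2^n (2 ^ y)))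
    (≤-trans (≤-reflexive (trans (sym (pow-+ (2 ^ y) (2 ^ y))) (cong (λ x → 2 ^ (2 ^ y + x)) (sym (+-identityʳ (2 ^ y)))))) (pow-mono (≤-trans 2P≤ nb≤u)))

  length<2^u : ∀ {x} → x ≤ n * ℓ₁ + n * 500 → x < 2 ^ (1 * u)
  length<2^u {x} h = <-≤-trans (≤-<-trans (≤-trans h (≤-reflexive (sym (*-distribˡ-+ n ℓ₁ 500)))) (<-bits B)) (pow-mono (≤-trans (≤-trans (m≤n*m (bits B) 3) (<⇒≤ top-fits)) 2^fₜ≤u))

Ex : Set
Ex = Expr 27

aE bE WE ΛE AE QE VE always normal tiny fE fₜE ℓE τE rE v₁E yE PE startE : Ex
aE = par (# 0)
bE = par (# 1)
WE = par (# 2)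
ΛE = par (# 3)
AE = par (# 4)
QE = par (# 5)
VE = par (# 6)
always = par (# 7)
normal = par (# 8)
tiny = par (# 9)
fE = par (# 10)
fₜE = par (# 11)
ℓE = par (# 12)
τE = par (# 13)
rE = par (# 14)
v₁E = par (# 15)
yE = par (# 24)
PE = par (# 25)
startE = par (# 26)

msbRegs : MsbParams 27
msbRegs = record
  { hE = par (# 16) ; bE = par (# 17) ; maskE = par (# 18) ; addE = par (# 19) ; topE = par (# 20)
  ; repE = par (# 21) ; powE = par (# 22) ; topE′ = par (# 23) }

module Program (S : ℕ) where
  open NormalE WE msbRegs fE fₜE ℓE τE rE v₁E S using (normalE)
  open TinyE WE fₜE yE PE startE using (tinyE)

  exactE : Ex → Ex → Ex
  exactE lo hi = orE (mul′ normal (normalE lo hi)) (mul′ tiny (tinyE lo hi))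

  queryE : Ex
  queryE = orE always (pairE ΛE AE QE VE exactE aE bE)

coarser : ∀ {x y λ′ ℓ} → λ′ ≤ ℓ → x // 2 ^ λ′ ≡ y // 2 ^ λ′ → x // 2 ^ ℓ ≡ y // 2 ^ ℓ
coarser {x} {y} {λ′} {ℓ} le h = trans (split x) (trans (cong (_// 2 ^ (ℓ ∸ λ′)) h) (sym (split y)))
  where
  split : ∀ x → x // 2 ^ ℓ ≡ x // 2 ^ λ′ // 2 ^ (ℓ ∸ λ′)
  split x = trans (cong (x //_) (trans (cong (2 ^_) (sym (m+[n∸m]≡n le))) (pow-+ λ′ (ℓ ∸ λ′)))) (//-// x (pow>0 λ′) (pow>0 (ℓ ∸ λ′)))

module Registers (u : ℕ) (u>0 : 0 < u) (R : Fin 27 → Word (F * u)) (β : ℕ → Bool) where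
  open Semantics u u>0 R β
  open Logic u u>0 R β
  open TopLogic u u>0 R β

  Loaded : Vec ℕ 27 → Set
  Loaded v = ∀ i → R i ≡ word w (nth 0 v (toℕ i))

  wordSize-fits : F * u < 2 ^ (7 * u)
  wordSize-fits = <-≤-trans (*-monoʳ-< 64 (n<2^n u)) (≤-trans (*-monoˡ-≤ (2 ^ u) (pow-mono {6} {6 * u} (≤-trans (≤-reflexive (sym (*-identityʳ 6))) (*-monoʳ-≤ 6 u>0))))
    (≤-reflexive (trans (sym (pow-+ (6 * u) u)) (cong (2 ^_) (+-comm (6 * u) u)))))

  one-fits : 1 < 2 ^ (1 * u)
  one-fits = 1<2^u

  zero-fits : 0 < 2 ^ (1 * u)
  zero-fits = pow>0 (1 * u)

  at-most : ∀ {x} → x ≤ 1 * u → x < 2 ^ (1 * u)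
  at-most {x} h = <-≤-trans (n<2^n x) (pow-mono h)

  private variable
    e₁ e₂ e₃ : Expr 27

  keep-left : ∀ {P Q : Set} → e₁ ⇓ 1 ∶ 1 → e₂ ⇓ 0 ∶ 1 → Decides e₃ P Q → Decides (orE (mul′ e₁ e₃) e₂) P Q
  keep-left ⇓1 ⇓0 (decides a v s c) = decides (a ∨ false) (⇓or (⇓and {a = true} ⇓1 v) ⇓0) (s ∘ trans (sym (∨-false a))) (trans (∨-false a) ∘ c)
    where
    ∨-false : ∀ a → a ∨ false ≡ a
    ∨-false true = refl
    ∨-false false = refl

  keep-right : ∀ {P Q : Set} → e₁ ⇓ 1 ∶ 1 → e₂ ⇓ 0 ∶ 1 → Decides e₃ P Q → Decides (orE e₂ (mul′ e₁ e₃)) P Q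
  keep-right ⇓1 ⇓0 (decides a v s c) = decides a (⇓or ⇓0 (⇓and {a = true} ⇓1 v)) s c

module NormalExact (S : ℕ) (S>0 : 0 < S) (nb ℓ₁ n : ℕ) (n>0 : 0 < n) (nb≤ : nb ≤ n) (n< : n < 2 ^ nb) (2^nb≤ : 2 ^ nb ≤ 1 + 2 * n)
  (regime : bits nb ≤ 2 * ℓ₁ + 6) (u : ℕ) (u>0 : 0 < u) (room : roomFactor S * suc (nb + ℓ₁) ≤ u) where

  open NormalStore S S>0 nb ℓ₁ n n>0 nb≤ n< 2^nb≤ regime public
  module NR = NormalRoom S S>0 nb ℓ₁ n n>0 nb≤ n< 2^nb≤ regime u room
  open MsbRoom ℓ using (m; m>0; large; module Constants)
  module Bl = Blocks m

  numbers : (a b W Λ A Q V : ℕ) → Vec ℕ 27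
  numbers a b′ W Λ A Q V = a ∷ b′ ∷ W ∷ Λ ∷ A ∷ Q ∷ V ∷ 0 ∷ 1 ∷ 0 ∷ f ∷ fₜ ∷ ℓ ∷ b ∷ r ∷ (b + suc (2 * b)) ∷
    Bl.h ∷ Bl.b ∷ Bl.maskC ∷ Bl.addC ∷ Bl.topC ∷ Bl.repC ∷ Bl.powC ∷ Bl.topC′ ∷ 0 ∷ 0 ∷ 0 ∷ []

  module Run (R : Fin 27 → Word (F * u)) (β : ℕ → Bool) {a b′ Λ A Q V : ℕ} where
    open Semantics u u>0 R β
    open Logic u u>0 R β
    open TopLogic u u>0 R β
    open Registers u u>0 R β
    open Program S

    module Read (holds : Loaded (numbers a b′ (F * u) Λ A Q V)) where
      ⇓W : WE ⇓ F * u ∶ 7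
      ⇓W = ⇓par (# 2) (holds (# 2)) wordSize-fits
      ⇓normal : normal ⇓ 1 ∶ 1
      ⇓normal = ⇓par (# 8) (holds (# 8)) one-fits
      ⇓tiny : tiny ⇓ 0 ∶ 1
      ⇓tiny = ⇓par (# 9) (holds (# 9)) zero-fits
      ⇓f : fE ⇓ f ∶ 1
      ⇓f = ⇓par (# 10) (holds (# 10)) (at-most (≤-trans (<⇒≤ (n<2^n f)) NR.2^f≤u))
      ⇓fₜ : fₜE ⇓ fₜ ∶ 1
      ⇓fₜ = ⇓par (# 11) (holds (# 11)) (at-most (≤-trans (<⇒≤ (n<2^n fₜ)) NR.2^fₜ≤u))
      ⇓ℓ : ℓE ⇓ ℓ ∶ 1
      ⇓ℓ = ⇓par (# 12) (holds (# 12)) (at-most (≤-trans (n≤1+n ℓ) NR.ℓ<u))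
      ⇓τ : τE ⇓ b ∶ 1
      ⇓τ = ⇓par (# 13) (holds (# 13)) (at-most NR.τ≤u)
      ⇓r : rE ⇓ r ∶ 1
      ⇓r = ⇓par (# 14) (holds (# 14)) (at-most NR.r≤u)
      ⇓v₁ : v₁E ⇓ b + suc (2 * b) ∶ 1
      ⇓v₁ = ⇓par (# 15) (holds (# 15)) (at-most NR.v₁≤u)
      ⇓h : par (# 16) ⇓ Bl.h ∶ 1
      ⇓h = ⇓par (# 16) (holds (# 16)) (at-most (≤-trans (s≤s (m≤m+n m m)) NR.m≤u))
      ⇓b : par (# 17) ⇓ Bl.b ∶ 1
      ⇓b = ⇓par (# 17) (holds (# 17)) (at-most NR.m≤u)
      private
        cs = Constants.constants {u} NR.msb≤u
      ⇓mask : par (# 18) ⇓ Bl.maskC ∶ 16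
      ⇓mask = ⇓par (# 18) (holds (# 18)) (proj₁ (proj₁ cs))
      ⇓addC : par (# 19) ⇓ Bl.addC ∶ 16
      ⇓addC = ⇓par (# 19) (holds (# 19)) (proj₁ (proj₂ (proj₁ cs)))
      ⇓top : par (# 20) ⇓ Bl.topC ∶ 16
      ⇓top = ⇓par (# 20) (holds (# 20)) (proj₂ (proj₂ (proj₁ cs)))
      ⇓rep : par (# 21) ⇓ Bl.repC ∶ 16
      ⇓rep = ⇓par (# 21) (holds (# 21)) (proj₁ (proj₂ cs))
      ⇓powC : par (# 22) ⇓ Bl.powC ∶ 16
      ⇓powC = ⇓par (# 22) (holds (# 22)) (proj₁ (proj₂ (proj₂ cs)))
      ⇓top′ : par (# 23) ⇓ Bl.topC′ ∶ 16
      ⇓top′ = ⇓par (# 23) (holds (# 23)) (proj₂ (proj₂ (proj₂ cs)))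

    module _ (ψ : ℕ → Bool) (few : Σ< (2 ^ (nb + ℓ₁)) (b2n ∘ ψ) ≤ n) (holds : Loaded (numbers a b′ (F * u) Λ A Q V)) where
      private
        module Fits (i : ℕ) = BucketFit S S>0 nb ℓ₁ (NormalBits.χ ψ e ℓ r S b (2 * b) f fₜ ℓ<ρ ℓ<τ i)
      open Read holds

      exact : ∀ {λ′} → λ′ ≤ ℓ₁ → ∀ {Z} → Z < 2 ^ (1 * u) → At β Z 0 (NormalFit.layout S S>0 nb ℓ₁ n n>0 nb≤ n< 2^nb≤ regime ψ few) → Exact exactE ψ (2 ^ (nb + ℓ₁)) (2 ^ λ′)
      exact λ≤ {Z} Z< here {lo} {hi} ⇓lo ⇓hi lo≤hi hi< same = keep-left ⇓normal (⇓mute ⇓tiny)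
        (NormalLookup.normal-decides u u>0 R β Z Z< ⇓W ψ e ℓ r S b (2 * b) f fₜ ℓ<ρ ℓ<τ ⇓f NR.2^f≤u ⇓fₜ NR.2^fₜ≤u ⇓ℓ ⇓τ ⇓r ⇓v₁ NR.ℓ<u NR.τ≤u NR.v₁≤u NR.rS≤u NR.S≤u
          (λ i _ → Fits.v₂< i) (λ i _ → Fits.Fitting.narrow₁ i) (λ i _ → Fits.Fitting.narrow₂ i) (λ i _ → Fits.Fitting.widths₁ i) (λ i _ → Fits.Fitting.widths₂ i) (λ i _ → Fits.Fitting.tables-width i)
          (NormalFit.fitting S S>0 nb ℓ₁ n n>0 nb≤ n< 2^nb≤ regime ψ few) here m m>0 msbRegs ⇓h ⇓b ⇓mask ⇓addC ⇓top ⇓rep ⇓powC ⇓top′ (≤-trans (Constants.N*B) NR.msb≤u) NR.m≤u large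
          ⇓lo ⇓hi lo≤hi (<-≤-trans hi< (≤-reflexive (cong (2 ^_) (sym e+ℓ≡)))) (coarser {lo} {hi} (≤-trans λ≤ ℓ₁≤ℓ) same))

module TinyExact (nb ℓ₁ n : ℕ) (n>0 : 0 < n) (nb≤ : nb ≤ n) (n< : n < 2 ^ nb) (2^nb≤ : 2 ^ nb ≤ 1 + 2 * n)
  (regime : 2 * ℓ₁ + 6 < bits nb) (S u : ℕ) (u>0 : 0 < u) (room : roomFactor S * suc (nb + ℓ₁) ≤ u) where

  open TinyNumbers nb ℓ₁ n n>0 nb≤ n< 2^nb≤ regime public
  module TR = TinyRoom nb ℓ₁ n n>0 nb≤ n< 2^nb≤ regime S u room

  numbers : (a b W Λ A Q V : ℕ) → Vec ℕ 27
  numbers a b′ W Λ A Q V = a ∷ b′ ∷ W ∷ Λ ∷ A ∷ Q ∷ V ∷ 0 ∷ 0 ∷ 1 ∷ 0 ∷ fₜ ∷ 0 ∷ 0 ∷ 0 ∷ 0 ∷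
    0 ∷ 0 ∷ 0 ∷ 0 ∷ 0 ∷ 0 ∷ 0 ∷ 0 ∷ y ∷ 2 ^ y ∷ 2 ^ (2 ^ y) * 2 ^ y ∷ []

  module Run (R : Fin 27 → Word (F * u)) (β : ℕ → Bool) {a b′ Λ A Q V : ℕ} where
    open Semantics u u>0 R β
    open TopLogic u u>0 R β
    open Registers u u>0 R β
    open Program S

    module _ (ψ : ℕ → Bool) (few : Σ< (2 ^ (nb + ℓ₁)) (b2n ∘ ψ) ≤ n) (holds : Loaded (numbers a b′ (F * u) Λ A Q V)) where
      private
        ⇓W : WE ⇓ F * u ∶ 7
        ⇓W = ⇓par (# 2) (holds (# 2)) wordSize-fits
        ⇓normal : normal ⇓ 0 ∶ 1
        ⇓normal = ⇓par (# 8) (holds (# 8)) zero-fits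
        ⇓tiny : tiny ⇓ 1 ∶ 1
        ⇓tiny = ⇓par (# 9) (holds (# 9)) one-fits
        ⇓fₜ : fₜE ⇓ fₜ ∶ 1
        ⇓fₜ = ⇓par (# 11) (holds (# 11)) (at-most (≤-trans (<⇒≤ (n<2^n fₜ)) TR.2^fₜ≤u))
        ⇓y : yE ⇓ y ∶ 1
        ⇓y = ⇓par (# 24) (holds (# 24)) (at-most (≤-trans (<⇒≤ (n<2^n y)) TR.P≤u))
        ⇓P : PE ⇓ 2 ^ y ∶ 1
        ⇓P = ⇓par (# 25) (holds (# 25)) (at-most TR.P≤u)
        ⇓start : startE ⇓ 2 ^ (2 ^ y) * 2 ^ y ∶ 1
        ⇓start = ⇓par (# 26) (holds (# 26)) TR.start<2^u

      exact : ∀ {λ′} → λ′ ≤ ℓ₁ → ∀ {Z} → Z < 2 ^ (1 * u) → At β Z 0 (TinyFit.contents nb ℓ₁ n n>0 nb≤ n< 2^nb≤ regime ψ few) → Exact exactE ψ (2 ^ (nb + ℓ₁)) (2 ^ λ′)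
      exact λ≤ {Z} Z< here {lo} {hi} ⇓lo ⇓hi lo≤hi hi< same = keep-right ⇓tiny (⇓mute ⇓normal)
        (TinyLookup.tiny-decides u u>0 R β Z Z< ⇓W ψ m y ℓ₁ fₜ ℓ₁≤y ⇓fₜ TR.2^fₜ≤u ⇓y ⇓P ⇓start TR.P≤u TR.1≤u (TinyFit.fitting nb ℓ₁ n n>0 nb≤ n< 2^nb≤ regime ψ few) here
          ⇓lo ⇓hi lo≤hi (<-≤-trans hi< (≤-reflexive (cong (2 ^_) (sym m+y≡)))) (coarser {lo} {hi} (≤-trans λ≤ ℓ₁≤y) same))

-- A layout for all sets of at most n points: the registers and the size do not depend on the set.
record Scheme (S : ℕ) (nb ℓ₁ n u : ℕ) (u>0 : 0 < u) : Set where
  field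
    space : ℕ
    root : ℕ
    root≤ : root ^ S ≤ 8 * suc ℓ₁
    space≤ : space ≤ n * ℓ₁ + n * (700 * (overhead-constant S * (root * root)))
    numbers : (W Λ A Q V : ℕ) → Vec ℕ 25
    common : ∀ W Λ A Q V i → i < 5 → nth 0 (numbers W Λ A Q V) i ≡ nth 0 (W ∷ Λ ∷ A ∷ Q ∷ V ∷ []) i
    selected : ∀ W Λ A Q V → nth 0 (numbers W Λ A Q V) 5 ≡ 0
    contents : (ψ : ℕ → Bool) → Σ< (2 ^ (nb + ℓ₁)) (b2n ∘ ψ) ≤ n → Bits
    length≤ : ∀ ψ few → length (contents ψ few) ≤ space
    small : space < 2 ^ (1 * u)
    exact : ∀ (R : Fin 27 → Word (F * u)) (β : ℕ → Bool) {a b Λ A Q V} ψ few → Registers.Loaded u u>0 R β (a ∷ b ∷ numbers (F * u) Λ A Q V) →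
      ∀ {λ′} → λ′ ≤ ℓ₁ → ∀ {Z} → Z < 2 ^ (1 * u) → At β Z 0 (contents ψ few) → TopLogic.Exact u u>0 R β (Program.exactE S) ψ (2 ^ (nb + ℓ₁)) (2 ^ λ′)

module _ (S : ℕ) (S>0 : 0 < S) (nb ℓ₁ n : ℕ) (n>0 : 0 < n) (nb≤ : nb ≤ n) (n< : n < 2 ^ nb) (2^nb≤ : 2 ^ nb ≤ 1 + 2 * n)
  (u : ℕ) (u>0 : 0 < u) (room : roomFactor S * suc (nb + ℓ₁) ≤ u) where

  private
    five : ∀ {x₀ x₁ x₂ x₃ x₄ : ℕ} {xs : Vec ℕ 20} i → i < 5 → nth 0 (x₀ ∷ x₁ ∷ x₂ ∷ x₃ ∷ x₄ ∷ xs) i ≡ nth 0 (x₀ ∷ x₁ ∷ x₂ ∷ x₃ ∷ x₄ ∷ []) i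
    five 0 h = refl
    five 1 h = refl
    five 2 h = refl
    five 3 h = refl
    five 4 h = refl
    five (suc (suc (suc (suc (suc i))))) (s≤s (s≤s (s≤s (s≤s (s≤s ())))))

  normalScheme : bits nb ≤ 2 * ℓ₁ + 6 → Scheme S nb ℓ₁ n u u>0
  normalScheme regime = record
    { space = n * ℓ₁ + n * (700 * Ψ) ; root = q ; root≤ = q^S≤
    ; space≤ = +-monoʳ-≤ (n * ℓ₁) (*-monoʳ-≤ n (*-monoʳ-≤ 700 (Ψ≤ S S>0 nb ℓ₁ n n>0 nb≤ n< 2^nb≤ regime)))
    ; numbers = λ W Λ A Q V → Vec.tail (Vec.tail (numbers 0 0 W Λ A Q V))
    ; common = λ W Λ A Q V i h → five i h
    ; selected = λ W Λ A Q V → refl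
    ; contents = λ ψ few → NormalFit.layout S S>0 nb ℓ₁ n n>0 nb≤ n< 2^nb≤ regime ψ few
    ; length≤ = λ ψ few → NormalFit.length-layout S S>0 nb ℓ₁ n n>0 nb≤ n< 2^nb≤ regime ψ few
    ; small = NR.length<2^u ≤-refl
    ; exact = λ R β ψ few → Run.exact R β ψ few }
    where
    open NormalExact S S>0 nb ℓ₁ n n>0 nb≤ n< 2^nb≤ regime u u>0 room

  tinyScheme : 2 * ℓ₁ + 6 < bits nb → Scheme S nb ℓ₁ n u u>0
  tinyScheme regime = record
    { space = n * ℓ₁ + n * 500 ; root = 1 ; root≤ = ≤-trans (≤-reflexive (^-zeroˡ S)) (s≤s z≤n)
    ; space≤ = +-monoʳ-≤ (n * ℓ₁) (*-monoʳ-≤ n (*-mono-≤ {500} {700} (≤ᵇ⇒≤ 500 700 _) constant≥1))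
    ; numbers = λ W Λ A Q V → Vec.tail (Vec.tail (numbers 0 0 W Λ A Q V))
    ; common = λ W Λ A Q V i h → five i h
    ; selected = λ W Λ A Q V → refl
    ; contents = λ ψ few → TinyFit.contents nb ℓ₁ n n>0 nb≤ n< 2^nb≤ regime ψ few
    ; length≤ = λ ψ few → TinyFit.length-contents nb ℓ₁ n n>0 nb≤ n< 2^nb≤ regime ψ few
    ; small = TR.length<2^u ≤-refl
    ; exact = λ R β ψ few → Run.exact R β ψ few }
    where
    open TinyExact nb ℓ₁ n n>0 nb≤ n< 2^nb≤ regime S u u>0 room
    constant≥1 : 1 ≤ overhead-constant S * (1 * 1)
    constant≥1 = *-mono-≤ (overhead≥1 S) ≤-refl

  scheme : Scheme S nb ℓ₁ n u u>0
  scheme = [ normalScheme , tinyScheme ]′ (≤-<-connex (bits nb) (2 * ℓ₁ + 6))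

nth-map : ∀ {A B : Set} (f : A → B) d {n} (v : Vec A n) i → nth (f d) (Vec.map f v) i ≡ f (nth d v i)
nth-map f d [] i = refl
nth-map f d (x ∷ v) zero = refl
nth-map f d (x ∷ v) (suc i) = nth-map f d v i

pad : (n : ℕ) → Bits → Vec Bool n
pad zero xs = []
pad (suc n) [] = false ∷ pad n []
pad (suc n) (x ∷ xs) = x ∷ pad n xs

At-pad : ∀ n xs → length xs ≤ n → At (nth false (pad n xs)) (length xs) 0 xs
At-pad n xs le = go n xs 0 le ≤-refl (λ i → refl)
  where
  go : ∀ n xs p {β Z} → length xs ≤ n → p + length xs ≤ Z → (∀ i → β (p + i) ≡ nth false (pad n xs) i) → At β Z p xs
  go n [] p le end h = ≤-trans (≤-reflexive (sym (+-identityʳ p))) end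
  go (suc n) (x ∷ xs) p {β} (s≤s le) end h = trans (cong β (sym (+-identityʳ p))) (h 0) ,
    go n xs (suc p) le (≤-trans (≤-reflexive (sym (+-suc p (length xs)))) end) (λ i → trans (cong β (sym (+-suc p i))) (h (suc i)))

verdict : Bool → Maybe Answer
verdict v = just (if v then nonEmpty else empty)

module _ (S : ℕ) where
  open Program S

  steps : ℕ
  steps = length (compile {27} queryE 27) + 2

  start : ∀ {w} → ℕ → ℕ → Vec (Word w) 25 → Reg → Word w
  start {w} a b ps = nth (word w 0) (word w a ∷ word w b ∷ ps)

  loaded : ∀ {w} a b (nums : Vec ℕ 25) (i : Fin 27) → start {w} a b (Vec.map (word w) nums) (toℕ i) ≡ word w (nth 0 (a ∷ b ∷ nums) (toℕ i))
  loaded a b nums Fin.zero = refl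
  loaded a b nums (Fin.suc Fin.zero) = refl
  loaded {w} a b nums (Fin.suc (Fin.suc i)) = nth-map (word w) 0 nums (toℕ i)

  module _ (u : ℕ) (u>0 : 0 < u) (β : ℕ → Bool) (R : Reg → Word (F * u)) where
    open Semantics {27} u u>0 (R ∘ toℕ) β
    open Logic {27} u u>0 (R ∘ toℕ) β
    open TopLogic {27} u u>0 (R ∘ toℕ) β

    run-value : ∀ {v} → queryE ⇓ b2n v ∶ 1 → run (deciding {27} queryE) steps 0 R (mem β w) ≡ verdict v
    run-value {v} h = trans (deciding-run {27} queryE R (mem β w)) (trans (cong (λ x → just (if x ≡ᵇ 0 then empty else nonEmpty)) (program-value {queryE} h)) (same v))
      where
      same : ∀ v → just (if b2n v ≡ᵇ 0 then empty else nonEmpty) ≡ verdict v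
      same true = refl
      same false = refl

  open Scheme

  query-run : ∀ {nb ℓ₁ n u u>0} (𝒮 : Scheme S nb ℓ₁ n u u>0) {w} → w ≡ F * u → ∀ {λ′ κ μ A a b} ψ few →
    λ′ ≤ ℓ₁ → nb + ℓ₁ ≡ μ + λ′ → nb + ℓ₁ < u → κ + μ < u → A < 2 ^ u → a < 2 ^ u → b < 2 ^ u → a ≤ b → b < a + 2 ^ λ′ →
    Σ[ v ∈ Bool ] run (deciding {27} queryE) steps 0 (start a b (Vec.map (word w) (numbers 𝒮 w (2 ^ λ′) A (2 ^ (κ + μ)) (2 ^ κ)))) (memory w (pad (space 𝒮) (contents 𝒮 ψ few))) ≡ verdict v ×
      (v ≡ true → ∃[ x ] ((a ≤ x × x ≤ b) × ψ (address κ μ A (2 ^ λ′) x) ≡ true)) × (∃[ x ] ((a ≤ x × x ≤ b) × ψ (address κ μ A (2 ^ λ′) x) ≡ true) → v ≡ true)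
  query-run {nb} {ℓ₁} {n} {u} {u>0} 𝒮 refl {λ′} {κ} {μ} {A} {a} {b} ψ few λ≤ υ≡ υ<u κμ<u A< a< b< a≤b near = conclude decided
    where
    nums : Vec ℕ 25
    nums = numbers 𝒮 (F * u) (2 ^ λ′) A (2 ^ (κ + μ)) (2 ^ κ)
    R : Reg → Word (F * u)
    R = start a b (Vec.map (word (F * u)) nums)
    β : ℕ → Bool
    β = nth false (pad (space 𝒮) (contents 𝒮 ψ few))
    open Semantics {27} u u>0 (R ∘ toℕ) β
    open Logic {27} u u>0 (R ∘ toℕ) β
    open TopLogic {27} u u>0 (R ∘ toℕ) β
    holds : Registers.Loaded u u>0 (R ∘ toℕ) β (a ∷ b ∷ nums)
    holds i = loaded a b nums i
    1u : ∀ {x} → x < 2 ^ u → x < 2 ^ (1 * u)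
    1u h = <-≤-trans h (≤-reflexive (cong (2 ^_) (sym (*-identityˡ u))))
    field-at : ∀ {i x} (p : Fin 27) → toℕ p ≡ 2 + i → i < 5 → nth 0 (F * u ∷ 2 ^ λ′ ∷ A ∷ 2 ^ (κ + μ) ∷ 2 ^ κ ∷ []) i ≡ x → x < 2 ^ u → par p ⇓ x ∶ 1
    field-at {i} p e i< x≡ x< = ⇓par p (trans (holds p) (cong (word (F * u)) (trans (cong (nth 0 (a ∷ b ∷ nums)) e) (trans (common 𝒮 (F * u) (2 ^ λ′) A (2 ^ (κ + μ)) (2 ^ κ) i i<) x≡)))) (1u x<)
    below : ∀ {x} → x < u → 2 ^ x < 2 ^ u
    below = pow-mono-<
    λ<u : λ′ < u
    λ<u = ≤-<-trans (m≤n+m λ′ μ) (subst (_< u) υ≡ υ<u)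
    ⇓always : always ⇓ b2n false ∶ 1
    ⇓always = ⇓par (# 7) (trans (holds (# 7)) (cong (word (F * u)) (selected 𝒮 (F * u) (2 ^ λ′) A (2 ^ (κ + μ)) (2 ^ κ)))) (1u (pow>0 u))
    inside : At β (length (contents 𝒮 ψ few)) 0 (contents 𝒮 ψ few)
    inside = At-pad (space 𝒮) (contents 𝒮 ψ few) (length≤ 𝒮 ψ few)
    product : 2 ^ (nb + ℓ₁) ≡ 2 ^ μ * 2 ^ λ′
    product = trans (cong (2 ^_) υ≡) (pow-+ μ λ′)
    open Pair {2 ^ λ′} {A} {κ} {μ} (field-at (# 3) refl (s≤s (s≤s z≤n)) refl (below λ<u)) (field-at (# 4) refl (s≤s (s≤s (s≤s z≤n))) refl A<)
      (field-at (# 5) refl (s≤s (s≤s (s≤s (s≤s z≤n)))) refl (below κμ<u)) (field-at (# 6) refl (s≤s (s≤s (s≤s (s≤s (s≤s z≤n))))) refl (below (≤-<-trans (m≤m+n κ μ) κμ<u)))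
      (pow>0 λ′) (1u (subst (_< 2 ^ u) product (below υ<u)))
    P : Set
    P = ∃[ x ] ((a ≤ x × x ≤ b) × ψ (address κ μ A (2 ^ λ′) x) ≡ true)
    exact′ : Exact exactE ψ (2 ^ μ * 2 ^ λ′) (2 ^ λ′)
    exact′ = subst (λ N → Exact exactE ψ N (2 ^ λ′)) product (exact 𝒮 (R ∘ toℕ) β ψ few holds λ≤ (≤-<-trans (length≤ 𝒮 ψ few) (small 𝒮)) inside)
    decided : Decides (pairE ΛE AE QE VE exactE aE bE) P P
    decided = pair-decides exact′ (⇓par (# 0) (holds (# 0)) (1u a<)) (⇓par (# 1) (holds (# 1)) (1u b<)) a≤b near
    conclude : Decides (pairE ΛE AE QE VE exactE aE bE) P P →
      Σ[ v ∈ Bool ] run (deciding {27} queryE) steps 0 R (memory (F * u) (pad (space 𝒮) (contents 𝒮 ψ few))) ≡ verdict v × (v ≡ true → P) × (P → v ≡ true)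
    conclude (decides v h s c) = v , run-value u u>0 β R (⇓or ⇓always h) , s , c

  always-run : ∀ {u} (u>0 : 0 < u) {w} → w ≡ F * u → ∀ {a b m} (bs : Vec Bool m) →
    run (deciding {27} queryE) steps 0 (start a b (Vec.map (word w) (0 ∷ 0 ∷ 0 ∷ 0 ∷ 0 ∷ 1 ∷ Vec.replicate 19 0))) (memory w bs) ≡ just nonEmpty
  always-run {u} u>0 refl {a} {b} bs = run-value u u>0 β R {true} one
    where
    nums : Vec ℕ 25
    nums = 0 ∷ 0 ∷ 0 ∷ 0 ∷ 0 ∷ 1 ∷ Vec.replicate 19 0
    R : Reg → Word (F * u)
    R = start a b (Vec.map (word (F * u)) nums)
    β : ℕ → Bool
    β = nth false bs
    open Semantics {27} u u>0 (R ∘ toℕ) β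
    open Logic {27} u u>0 (R ∘ toℕ) β
    open TopLogic {27} u u>0 (R ∘ toℕ) β
    holds : Registers.Loaded u u>0 (R ∘ toℕ) β (a ∷ b ∷ nums)
    holds i = loaded a b nums i
    zero-at : ∀ (p : Fin 27) → nth 0 (a ∷ b ∷ nums) (toℕ p) ≡ 0 → par p ⇓ 0 ∶ 1
    zero-at p e = ⇓par p (trans (holds p) (cong (word (F * u)) e)) (pow>0 (1 * u))
    silent : ∀ lo hi → exactE lo hi ⇓ b2n false ∶ 1
    silent lo hi = ⇓or (⇓mute (zero-at (# 8) refl)) (⇓mute (zero-at (# 9) refl))
    one : queryE ⇓ b2n true ∶ 1
    one = ⇓or (⇓par (# 7) (holds (# 7)) 1<2^u) (⇓or (silent _ _) (silent _ _))

module Counting where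
  import Data.Fin.Properties as Fin
  open import Data.Fin.Subset using (Subset; ∣_∣) renaming (_∈_ to _∈ˢ_)
  open import Data.Vec using (here; there)

  Σ<-front : ∀ n f → Σ< (suc n) f ≡ f 0 + Σ< n (f ∘ suc)
  Σ<-front zero f = +-comm 0 (f 0)
  Σ<-front (suc n) f = trans (cong (_+ f (suc n)) (Σ<-front n f)) (+-assoc (f 0) _ _)

  Σ<-swap : ∀ m n (f : ℕ → ℕ → ℕ) → Σ< m (λ i → Σ< n (f i)) ≡ Σ< n (λ j → Σ< m (λ i → f i j))
  Σ<-swap m zero f = trans (Σ<-const m 0) (*-zeroʳ m)
  Σ<-swap m (suc n) f = trans (Σ<-+ m (λ i → Σ< n (f i)) (λ i → f i n)) (cong (_+ Σ< m (λ i → f i n)) (Σ<-swap m n f))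

  count-true : ∀ {N} (E : Fin N → Bool) → (∀ i → E i ≡ true) → ∣ tabulate E ∣ ≡ N
  count-true {zero} E h = refl
  count-true {suc N} E h rewrite h Fin.zero = cong suc (count-true (E ∘ Fin.suc) (h ∘ Fin.suc))

  count-exceptions : ∀ {N} (E : Fin N → Bool) (g : ℕ → ℕ) → (∀ i → E i ≡ true ⊎ 1 ≤ g (toℕ i)) → N ≤ ∣ tabulate E ∣ + Σ< N g
  count-exceptions {zero} E g h = z≤n
  count-exceptions {suc N} E g h = ≤-trans (one (E Fin.zero) (h Fin.zero)) (+-monoʳ-≤ ∣ tabulate E ∣ (≤-reflexive (sym (Σ<-front N g))))
    where
    rest : N ≤ ∣ tabulate (E ∘ Fin.suc) ∣ + Σ< N (g ∘ suc)
    rest = count-exceptions (E ∘ Fin.suc) (g ∘ suc) (h ∘ Fin.suc)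
    one : ∀ e → e ≡ true ⊎ 1 ≤ g 0 → suc N ≤ ∣ e ∷ tabulate (E ∘ Fin.suc) ∣ + (g 0 + Σ< N (g ∘ suc))
    one true _ = s≤s (≤-trans rest (+-monoʳ-≤ ∣ tabulate (E ∘ Fin.suc) ∣ (m≤n+m _ (g 0))))
    one false (inj₂ pos) = lin (N ∷ g 0 ∷ ∣ tabulate (E ∘ Fin.suc) ∣ ∷ Σ< N (g ∘ suc) ∷ []) (con 1 :+ X0 :≤ X2 :+ (X1 :+ X3))
      (hyp (con 1) (con 1 :≤ X1) pos ∷ hyp (con 1) (X0 :≤ X2 :+ X3) rest ∷ []) refl

  anyBelow : ℕ → (ℕ → Bool) → Bool
  anyBelow zero f = false
  anyBelow (suc n) f = f n ∨ anyBelow n f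

  anyBelow⁻ : ∀ n f → anyBelow n f ≡ true → ∃[ i ] (i < n × f i ≡ true)
  anyBelow⁻ (suc n) f h = ∨-elim (f n) (λ e → n , n<1+n n , e) (λ e → let i , i< , p = anyBelow⁻ n f e in i , m<n⇒m<1+n i< , p) h

  anyBelow⁺ : ∀ n f {i} → i < n → f i ≡ true → anyBelow n f ≡ true
  anyBelow⁺ (suc n) f {i} i< h with i ≟ n
  ... | yes refl = ∨-introˡ (anyBelow n f) h
  ... | no i≢n = ∨-introʳ (f n) (anyBelow⁺ n f (≤∧≢⇒< (s≤s⁻¹ i<) i≢n) h)

  anyBelow-≤ : ∀ n f → b2n (anyBelow n f) ≤ Σ< n (b2n ∘ f)
  anyBelow-≤ zero f = z≤n
  anyBelow-≤ (suc n) f = ≤-trans (split (f n) (anyBelow n f)) (≤-trans (≤-reflexive (+-comm (b2n (f n)) _)) (+-monoˡ-≤ (b2n (f n)) (anyBelow-≤ n f)))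
    where
    split : ∀ a b → b2n (a ∨ b) ≤ b2n a + b2n b
    split true b = m≤m+n 1 (b2n b)
    split false b = ≤-refl

  ≡ᵇ⇒≡′ : ∀ {m n} → (m ≡ᵇ n) ≡ true → m ≡ n
  ≡ᵇ⇒≡′ {m} {n} e = ≡ᵇ⇒≡ m n (subst T (sym e) _)

  ≡⇒≡ᵇ′ : ∀ {m n} → m ≡ n → (m ≡ᵇ n) ≡ true
  ≡⇒≡ᵇ′ {zero} refl = refl
  ≡⇒≡ᵇ′ {suc m} refl = ≡⇒≡ᵇ′ {m} refl

  indicator-≤ : ∀ N p → Σ< N (λ q → b2n (p ≡ᵇ q)) ≤ 1
  indicator-≤ zero p = z≤n
  indicator-≤ (suc N) p with p ≡ᵇ N in e
  ... | false = ≤-trans (≤-reflexive (+-identityʳ _)) (indicator-≤ N p)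
  ... | true = ≤-reflexive (cong (_+ 1) (trans (Σ<-cong N (λ q q< → cong b2n (differ q q<))) (trans (Σ<-const N 0) (*-zeroʳ N))))
    where
    differ : ∀ q → q < N → (p ≡ᵇ q) ≡ false
    differ q q< with p ≡ᵇ q in e′
    ... | false = refl
    ... | true = ⊥-elim (<-irrefl (trans (sym (≡ᵇ⇒≡′ {p} e′)) (≡ᵇ⇒≡′ {p} e)) q<)

  module _ {U : ℕ} (S : Subset U) where

    member : ℕ → Bool
    member = nth false S

    member-sum : Σ< U (b2n ∘ member) ≡ ∣ S ∣
    member-sum = go S
      where
      go : ∀ {U} (S : Subset U) → Σ< U (b2n ∘ nth false S) ≡ ∣ S ∣
      go [] = refl
      go {suc U} (true ∷ S) = trans (Σ<-front U _) (cong suc (go S))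
      go {suc U} (false ∷ S) = trans (Σ<-front U _) (go S)

    member⁺ : ∀ {x} → x ∈ˢ S → member (toℕ x) ≡ true
    member⁺ = go S
      where
      go : ∀ {U} (S : Subset U) {x} → x ∈ˢ S → nth false S (toℕ x) ≡ true
      go (_ ∷ S) here = refl
      go (_ ∷ S) (there h) = go S h

    member⁻ : ∀ x → member (toℕ x) ≡ true → x ∈ˢ S
    member⁻ = go S
      where
      go : ∀ {U} (S : Subset U) x → nth false S (toℕ x) ≡ true → x ∈ˢ S
      go (true ∷ S) Fin.zero refl = here
      go (_ ∷ S) (Fin.suc x) h = there (go S x h)

    module Image (φ : ℕ → ℕ) where

      image : ℕ → Bool
      image q = anyBelow U (λ s → member s ∧ (φ s ≡ᵇ q))

      image⁺ : ∀ {s} → s < U → member s ≡ true → image (φ s) ≡ true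
      image⁺ {s} s< m = anyBelow⁺ U _ s< (∧-intro m (≡⇒≡ᵇ′ {φ s} refl))

      image⁻ : ∀ {q} → image q ≡ true → ∃[ s ] (s < U × member s ≡ true × φ s ≡ q)
      image⁻ {q} h = let s , s< , e = anyBelow⁻ U _ h in s , s< , ∧-elimˡ (member s) e , ≡ᵇ⇒≡′ {φ s} (∧-elimʳ (member s) e)

      image-few : ∀ N → Σ< N (b2n ∘ image) ≤ ∣ S ∣
      image-few N = begin
        Σ< N (b2n ∘ image) ≤⟨ Σ<-mono N (λ q _ → anyBelow-≤ U _) ⟩
        Σ< N (λ q → Σ< U (λ s → b2n (member s ∧ (φ s ≡ᵇ q)))) ≡⟨ Σ<-swap N U (λ q s → b2n (member s ∧ (φ s ≡ᵇ q))) ⟩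
        Σ< U (λ s → Σ< N (λ q → b2n (member s ∧ (φ s ≡ᵇ q)))) ≤⟨ Σ<-mono U (λ s _ → each s (member s)) ⟩
        Σ< U (b2n ∘ member) ≡⟨ member-sum ⟩
        ∣ S ∣ ∎
        where
        open ≤-Reasoning
        each : ∀ s m → Σ< N (λ q → b2n (m ∧ (φ s ≡ᵇ q))) ≤ b2n m
        each s true = indicator-≤ N (φ s)
        each s false = ≤-reflexive (trans (Σ<-const N 0) (*-zeroʳ N))

  record Multipliers (κ μ n D : ℕ) : Set where
    field
      outcomes : ℕ
      outcomes>0 : 0 < outcomes
      multiplier : ℕ → ℕ
      bounded : ∀ {i} → i < outcomes → multiplier i < 2 ^ suc (κ + μ)
      rare : ∀ {x y} → x ≢ y → x < 2 ^ κ → y < 2 ^ κ →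
        Σ< outcomes (λ i → b2n (slot κ μ (multiplier i) x ≡ᵇ slot κ μ (multiplier i) y)) * (2 * n * D) ≤ outcomes

  random : ∀ κ μ n D → 16 * n * D ≤ 2 ^ μ → Multipliers κ μ n D
  random κ μ n D h = record
    { outcomes = 2 ^ (κ + μ) ; outcomes>0 = pow>0 (κ + μ) ; multiplier = λ i → i
    ; bounded = λ i< → <-trans i< (pow-mono-< (n<1+n (κ + μ)))
    ; rare = λ {x} {y} x≢y x< y< → ≤-trans (*-monoˡ-≤ (2 * n * D) (slot-collisions-≢ κ μ x≢y x< y<))
        (≤-trans (≤-reflexive (ring (2 ^ κ ∷ n ∷ D ∷ []) (con 8 :* X0 :* (con 2 :* X1 :* X2)) (X0 :* (con 16 :* X1 :* X2)) refl refl))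
          (≤-trans (*-monoʳ-≤ (2 ^ κ) h) (≤-reflexive (sym (pow-+ κ μ))))) }

  -- If all blocks fit, multiplying by 2 ^ κ makes the hash function the identity.
  identity : ∀ κ n D → Multipliers κ κ n D
  identity κ n D = record
    { outcomes = 1 ; outcomes>0 = z<s ; multiplier = λ _ → 2 ^ κ
    ; bounded = λ _ → pow-mono-< (s≤s (m≤m+n κ κ))
    ; rare = λ {x} {y} x≢y x< y< → ≤-trans (≤-reflexive (cong (λ c → (0 + b2n c) * (2 * n * D)) (apart x≢y x< y<))) z≤n }
    where
    slot-id : ∀ {x} → x < 2 ^ κ → slot κ κ (2 ^ κ) x ≡ x
    slot-id {x} x< = trans (cong (_// 2 ^ κ) (trans (%%-small (<-≤-trans (*-monoʳ-< (2 ^ κ) {{m^n≢0 2 κ}} x<) (≤-reflexive (sym (pow-+ κ κ))))) (*-comm (2 ^ κ) x))) (//-* 0 x (pow>0 κ))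
    apart : ∀ {x y} → x ≢ y → x < 2 ^ κ → y < 2 ^ κ → (slot κ κ (2 ^ κ) x ≡ᵇ slot κ κ (2 ^ κ) y) ≡ false
    apart {x} {y} x≢y x< y< with slot κ κ (2 ^ κ) x ≡ᵇ slot κ κ (2 ^ κ) y in e
    ... | false = refl
    ... | true = ⊥-elim (x≢y (trans (sym (slot-id x<)) (trans (≡ᵇ⇒≡′ {slot κ κ (2 ^ κ) x} e) (slot-id y<))))

  module Collisions {U : ℕ} (S : Subset U) (κ μ D λ′ : ℕ) (U≤ : U ≤ 2 ^ κ)
    (n : ℕ) (size : ∣ S ∣ ≡ n) (ℳ : Multipliers κ μ n D) (n>0 : 0 < n) where

    open Multipliers ℳ

    Λ : ℕ
    Λ = 2 ^ λ′

    φ : ℕ → ℕ → ℕ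
    φ i = address κ μ (multiplier i) Λ

    collides : ℕ → ℕ → ℕ → Bool
    collides x y i = not (x ≡ᵇ y) ∧ (slot κ μ (multiplier i) x ≡ᵇ slot κ μ (multiplier i) y)

    collides-rare : ∀ {x y} → x < 2 ^ κ → y < 2 ^ κ → Σ< outcomes (b2n ∘ collides x y) * (2 * n * D) ≤ outcomes
    collides-rare {x} {y} x< y< = by (x ≡ᵇ y) refl
      where
      by : ∀ e → (x ≡ᵇ y) ≡ e → Σ< outcomes (λ i → b2n (not e ∧ (slot κ μ (multiplier i) x ≡ᵇ slot κ μ (multiplier i) y))) * (2 * n * D) ≤ outcomes
      by true h = ≤-trans (≤-reflexive (cong (_* (2 * n * D)) (trans (Σ<-const outcomes 0) (*-zeroʳ outcomes)))) z≤n
      by false h = rare (λ e → case (trans (sym h) (≡⇒≡ᵇ′ {x} e))) x< y<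
        where
        case : false ≢ true
        case ()

    failures : ℕ → ℕ → ℕ → ℕ
    failures β β′ i = Σ< U (λ s → b2n (member S s) * (b2n (collides (s // Λ) β i) + b2n (collides (s // Λ) β′ i)))

    failures-rare : ∀ {β β′} → β < 2 ^ κ → β′ < 2 ^ κ → Σ< outcomes (failures β β′) * D ≤ outcomes
    failures-rare {β} {β′} β< β′< = *-cancelʳ-≤ _ outcomes n {{>-nonZero n>0}} (begin
      Σ< outcomes (failures β β′) * D * n ≡⟨ trans (*-assoc (Σ< outcomes (failures β β′)) D n) (cong₂ _*_ swapped (*-comm D n)) ⟩
      Σ< U (λ s → b2n (member S s) * c s) * (n * D) ≡⟨ Σ<-*ʳ U (n * D) (λ s → b2n (member S s) * c s) ⟨
      Σ< U (λ s → b2n (member S s) * c s * (n * D)) ≤⟨ Σ<-mono U (λ s s< → ≤-trans (≤-reflexive (*-assoc (b2n (member S s)) (c s) (n * D))) (*-monoʳ-≤ (b2n (member S s)) (few s s<))) ⟩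
      Σ< U (λ s → b2n (member S s) * outcomes) ≡⟨ trans (Σ<-*ʳ U outcomes (b2n ∘ member S)) (trans (cong (_* outcomes) (trans (member-sum S) size)) (*-comm n outcomes)) ⟩
      outcomes * n ∎)
      where
      open ≤-Reasoning
      c : ℕ → ℕ
      c s = Σ< outcomes (b2n ∘ collides (s // Λ) β) + Σ< outcomes (b2n ∘ collides (s // Λ) β′)
      swapped : Σ< outcomes (failures β β′) ≡ Σ< U (λ s → b2n (member S s) * c s)
      swapped = trans (Σ<-swap outcomes U (λ i s → b2n (member S s) * (b2n (collides (s // Λ) β i) + b2n (collides (s // Λ) β′ i))))
        (Σ<-cong U (λ s _ → trans (Σ<-*ˡ outcomes (b2n (member S s)) _) (cong (b2n (member S s) *_) (Σ<-+ outcomes (b2n ∘ collides (s // Λ) β) (b2n ∘ collides (s // Λ) β′)))))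
      few : ∀ s → s < U → c s * (n * D) ≤ outcomes
      few s s< = *-cancelˡ-≤ 2 (lin (Σ< outcomes (b2n ∘ collides (s // Λ) β) ∷ Σ< outcomes (b2n ∘ collides (s // Λ) β′) ∷ n ∷ D ∷ outcomes ∷ []) (con 2 :* ((X0 :+ X1) :* (X2 :* X3)) :≤ con 2 :* X4)
        (hyp (con 1) (X0 :* (con 2 :* X2 :* X3) :≤ X4) (collides-rare s/< β<) ∷ hyp (con 1) (X1 :* (con 2 :* X2 :* X3) :≤ X4) (collides-rare s/< β′<) ∷ []) refl)
        where
        s/< : s // Λ < 2 ^ κ
        s/< = ≤-<-trans (//-≤ s Λ) (<-≤-trans s< U≤)

    blame : ∀ {i x} → Image.image S (φ i) (φ i x) ≡ true → member S x ≡ true × x < U ⊎ (∀ {β β′} → x // Λ ≡ β ⊎ x // Λ ≡ β′ → 1 ≤ failures β β′ i)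
    blame {i} {x} h = by (x // Λ ≟ s // Λ)
      where
      found = Image.image⁻ S (φ i) h
      s : ℕ
      s = proj₁ found
      s< : s < U
      s< = proj₁ (proj₂ found)
      ms : member S s ≡ true
      ms = proj₁ (proj₂ (proj₂ found))
      φ≡ : φ i s ≡ φ i x
      φ≡ = proj₂ (proj₂ (proj₂ found))
      Λ>0 : 0 < Λ
      Λ>0 = pow>0 λ′
      slots : slot κ μ (multiplier i) (s // Λ) ≡ slot κ μ (multiplier i) (x // Λ)
      slots = trans (sym (quotient s)) (trans (cong (_// Λ) φ≡) (quotient x))
        where
        quotient : ∀ z → φ i z // Λ ≡ slot κ μ (multiplier i) (z // Λ)
        quotient z = trans (cong (_// Λ) (+-comm _ (z %% Λ))) (//-* (z %% Λ) _ (%%-< z Λ>0))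
      offsets : s %% Λ ≡ x %% Λ
      offsets = trans (sym (offset s)) (trans (cong (_%% Λ) φ≡) (offset x))
        where
        offset : ∀ z → φ i z %% Λ ≡ z %% Λ
        offset z = trans (cong (_%% Λ) (+-comm _ (z %% Λ))) (%%-* (z %% Λ) (slot κ μ (multiplier i) (z // Λ)) (%%-< z Λ>0))
      by : Dec (x // Λ ≡ s // Λ) → member S x ≡ true × x < U ⊎ (∀ {β β′} → x // Λ ≡ β ⊎ x // Λ ≡ β′ → 1 ≤ failures β β′ i)
      by (yes e) = inj₁ (subst (λ z → member S z ≡ true × z < U) s≡x (ms , s<))
        where
        s≡x : s ≡ x
        s≡x = trans (div-mod s Λ>0) (trans (cong₂ (λ o β → o + β * Λ) offsets (sym e)) (sym (div-mod x Λ>0)))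
      by (no ne) = inj₂ λ {β} {β′} at → ≤-trans (least-one β β′ at) (Σ<-term (λ s → b2n (member S s) * (b2n (collides (s // Λ) β i) + b2n (collides (s // Λ) β′ i))) s<)
        where
        collision : collides (s // Λ) (x // Λ) i ≡ true
        collision = ∧-intro (cong not (apart (s // Λ ≡ᵇ x // Λ) refl)) (≡⇒≡ᵇ′ slots)
          where
          apart : ∀ e → (s // Λ ≡ᵇ x // Λ) ≡ e → (s // Λ ≡ᵇ x // Λ) ≡ false
          apart false h = h
          apart true h = ⊥-elim (ne (sym (≡ᵇ⇒≡′ {s // Λ} h)))
        least-one : ∀ β β′ → x // Λ ≡ β ⊎ x // Λ ≡ β′ → 1 ≤ b2n (member S s) * (b2n (collides (s // Λ) β i) + b2n (collides (s // Λ) β′ i))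
        least-one β β′ at rewrite ms = ≤-trans ([ (λ e → ≤-trans (≤-reflexive (sym (cong b2n (trans (cong (λ b → collides (s // Λ) b i) (sym e)) collision)))) (m≤m+n _ _))
          , (λ e → ≤-trans (≤-reflexive (sym (cong b2n (trans (cong (λ b → collides (s // Λ) b i) (sym e)) collision)))) (m≤n+m _ _)) ]′ at) (≤-reflexive (sym (+-identityʳ _)))

open Counting

open Rationals
open RealBounds
open SpaceBound
open import Data.Fin.Subset using (Subset; ∣_∣)
open import Data.Fin.Subset.Properties using (∣p∣≤n)
import Data.Integer as ℤ
import Data.Maybe.Relation.Unary.Any as Any
open import Data.Nat.Logarithm using (⌈log₂_⌉; ⌈log₂⌉-mono-≤; ⌈log₂2^n⌉≡n)
open import Data.Rational as ℚ using (ℚ; 0ℚ; 1ℚ; ½)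
import Data.Rational.Properties as ℚ

bits-log : ∀ U → bits U ≤ suc ⌈log₂ U ⌉
bits-log U = by (bits U) refl
  where
  by : ∀ b → bits U ≡ b → b ≤ suc ⌈log₂ U ⌉
  by zero e = z≤n
  by (suc k) e = s≤s (≤-trans (≤-reflexive (sym (⌈log₂2^n⌉≡n k))) (⌈log₂⌉-mono-≤ (≮⇒≥ λ U< → <-irrefl refl (≤-trans (≤-reflexive (sym e)) (bits-≤ {U} U<)))))

module _ (s : ℕ) where

  S unit : ℕ
  S = 2 * suc s
  unit = 3 * roomFactor S

  algorithm : Algorithm
  algorithm = record
    { program = deciding {27} (Program.queryE S) ; wordFactor = F * unit ; wordFactor≢0 = _ ; paramWords = 25 ; time = steps S }

  module _ (n U L : ℕ) (ε : ℝ) where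

    vacuous : U < n → RangeEmptiness algorithm n U L ε
    vacuous U<n = record
      { outcomes = 1 ; bits = 0
      ; params = λ _ → Vec.replicate 25 (word _ 0) ; build = λ _ _ _ → []
      ; constantTime = λ S e → ⊥-elim (impossible S e) ; noFalseNegative = λ S e → ⊥-elim (impossible S e) ; falsePositiveRate = λ S e → ⊥-elim (impossible S e) }
      where
      impossible : ∀ (S : Subset U) → ∣ S ∣ ≡ n → ⊥
      impossible S e = <-irrefl e (≤-<-trans (∣p∣≤n S) U<n)

  wordUnits : ℕ → ℕ
  wordUnits U = unit * suc ⌈log₂ U ⌉

  wordSize≡ : ∀ U → Algorithm.wordSize algorithm U ≡ F * wordUnits U
  wordSize≡ U = *-assoc F unit (suc ⌈log₂ U ⌉)

  unit>0 : 0 < unit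
  unit>0 = *-mono-< {0} {3} z<s (≤-trans (s≤s z≤n) (m≤n+m 5000 (80 * S)))

  units>0 : ∀ U → 0 < wordUnits U
  units>0 U = *-mono-< unit>0 z<s

  is-just : ∀ {a : Maybe Answer} {v} → a ≡ verdict v → Is-just a
  is-just refl = Any.just tt

  module _ (n U L : ℕ) (ε : ℝ) where

    always-nonEmpty : lower ε 1ℚ → RangeEmptiness algorithm n U L ε
    always-nonEmpty 1<ε = record
      { outcomes = 1 ; bits = 0
      ; params = λ _ → Vec.map (word _) (0 ∷ 0 ∷ 0 ∷ 0 ∷ 0 ∷ 1 ∷ Vec.replicate 19 0) ; build = λ _ _ _ → []
      ; constantTime = λ S e I ω → is-just {v = true} (runs I)
      ; noFalseNegative = λ S e I _ → Pr-certain {1} (isNonEmpty ∘ answers I) (count-true {1} (isNonEmpty ∘ answers I) (λ _ → cong isNonEmpty (runs I)))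
      ; falsePositiveRate = λ S e I _ x high → ℚ.≤-trans (1-≤ {x} {0ℚ} (ℚ.≤-trans (ℚ.<⇒≤ (lower-<-upper ε 1<ε high)) (ℚ.≤-reflexive (sym (ℚ.+-identityˡ x))))) (Pr-nonneg {1} (isEmpty ∘ answers I)) }
      where
      answers : Query U L → Fin 1 → Maybe Answer
      answers I _ = execute algorithm (Query.a I) (Query.b I) (Vec.map (word _) (0 ∷ 0 ∷ 0 ∷ 0 ∷ 0 ∷ 1 ∷ Vec.replicate 19 0)) []
      runs : ∀ (I : Query U L) → execute algorithm (Query.a I) (Query.b I) (Vec.map (word _) (0 ∷ 0 ∷ 0 ∷ 0 ∷ 0 ∷ 1 ∷ Vec.replicate 19 0)) [] ≡ just nonEmpty
      runs I = always-run S (units>0 U) (wordSize≡ U) {toℕ (Query.a I)} {toℕ (Query.b I)} []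

  record Choice (κ nb E n : ℕ) : Set where
    field
      μ : ℕ
      nb≤μ : nb ≤ μ
      μ≤κ : μ ≤ κ
      μ≤ : μ ≤ nb + E + 5
      ℳ : Multipliers κ μ n (2 ^ suc E)

  choose : ∀ κ nb E n → nb ≤ κ → n < 2 ^ nb → Choice κ nb E n
  choose κ nb E n nb≤κ n< = [ drawn , exact ]′ (≤-total (nb + E + 5) κ)
    where
    nb≤ : nb ≤ nb + E + 5
    nb≤ = ≤-trans (m≤m+n nb E) (m≤m+n (nb + E) 5)
    drawn : nb + E + 5 ≤ κ → Choice κ nb E n
    drawn le = record { μ = nb + E + 5 ; nb≤μ = nb≤ ; μ≤κ = le ; μ≤ = ≤-refl ; ℳ = random κ (nb + E + 5) n (2 ^ suc E) (begin
      16 * n * 2 ^ suc E ≤⟨ *-monoˡ-≤ (2 ^ suc E) (*-monoʳ-≤ 16 (<⇒≤ n<)) ⟩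
      16 * 2 ^ nb * (2 * 2 ^ E) ≡⟨ ring (2 ^ nb ∷ 2 ^ E ∷ []) (con 16 :* X0 :* (con 2 :* X1)) (X0 :* X1 :* con 32) refl refl ⟩
      2 ^ nb * 2 ^ E * 2 ^ 5 ≡⟨ trans (cong (_* 2 ^ 5) (sym (pow-+ nb E))) (sym (pow-+ (nb + E) 5)) ⟩
      2 ^ (nb + E + 5) ∎) }
      where open ≤-Reasoning
    exact : κ ≤ nb + E + 5 → Choice κ nb E n
    exact le = record { μ = κ ; nb≤μ = nb≤κ ; μ≤κ = ≤-refl ; μ≤ = le ; ℳ = identity κ n (2 ^ suc E) }

  module Instance (n U L : ℕ) (n>0 : 0 < n) (U>0 : 0 < U) (L>0 : 0 < L) (n≤U : n ≤ U) (ε : ℝ) (E : ℕ) (low : lower ε (½ ^ℚ suc E)) where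

    κ nb λ′ u : ℕ
    κ = bits U
    nb = bits n
    λ′ = bits L ⊓ κ
    u = wordUnits U

    open Choice (choose κ nb E n (bits-mono n≤U) (<-bits n)) public
    open Multipliers ℳ public

    ℓ₁ : ℕ
    ℓ₁ = μ + λ′ ∸ nb

    υ≡ : nb + ℓ₁ ≡ μ + λ′
    υ≡ = m+[n∸m]≡n (≤-trans nb≤μ (m≤m+n μ λ′))

    λ≤ℓ₁ : λ′ ≤ ℓ₁
    λ≤ℓ₁ = +-cancelˡ-≤ nb λ′ ℓ₁ (≤-trans (+-monoˡ-≤ λ′ nb≤μ) (≤-reflexive (sym υ≡)))

    ℓ₁≤ : ℓ₁ ≤ λ′ + E + 5
    ℓ₁≤ = +-cancelˡ-≤ nb ℓ₁ (λ′ + E + 5) (≤-trans (≤-reflexive υ≡) (lin (μ ∷ λ′ ∷ nb ∷ E ∷ []) (X0 :+ X1 :≤ X2 :+ (X1 :+ X3 :+ con 5)) (hyp (con 1) (X0 :≤ X2 :+ X3 :+ con 5) μ≤ ∷ []) refl))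

    wide : 2 ^ λ′ ≤ 4 * L
    wide = ≤-trans (pow-mono (m⊓n≤m (bits L) κ)) (≤-trans (2^bits-≤ L) (lin (L ∷ []) (con 1 :+ con 2 :* X0 :≤ con 4 :* X0) (hyp (con 1) (con 1 :≤ X0) L>0 ∷ []) refl))

    private
      c : ℕ
      c = suc ⌈log₂ U ⌉
      rf>0 : 1 ≤ roomFactor S
      rf>0 = ≤-trans (s≤s z≤n) (m≤n+m 5000 (80 * S))

    sizes≤ : ∀ {x y} → x ≤ κ → y ≤ κ → roomFactor S * suc (x + y) ≤ u
    sizes≤ {x} {y} x≤ y≤ = by (roomFactor S)
      where
      by : ∀ ρ → ρ * suc (x + y) ≤ 3 * ρ * c
      by ρ = lin (ρ ∷ x ∷ y ∷ κ ∷ c ∷ []) (X0 :* (con 1 :+ (X1 :+ X2)) :≤ con 3 :* X0 :* X4)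
        (hyp X0 (X1 :≤ X3) x≤ ∷ hyp X0 (X2 :≤ X3) y≤ ∷ hyp (con 2 :* X0) (X3 :≤ X4) (bits-log U) ∷ hyp X0 (con 1 :≤ X4) (s≤s z≤n) ∷ []) refl

    sum<u : ∀ {x y} → x ≤ κ → y ≤ κ → x + y < u
    sum<u {x} {y} x≤ y≤ = ≤-trans (≤-trans (≤-reflexive (sym (*-identityˡ (suc (x + y))))) (*-monoˡ-≤ (suc (x + y)) rf>0)) (sizes≤ x≤ y≤)

    λ≤κ : λ′ ≤ κ
    λ≤κ = m⊓n≤n (bits L) κ

    𝒮 : Scheme S nb ℓ₁ n u (units>0 U)
    𝒮 = scheme S (s≤s z≤n) nb ℓ₁ n n>0 (bits≤ n) (<-bits n) (2^bits-≤ n) u (units>0 U) (subst (λ υ → roomFactor S * suc υ ≤ u) (sym υ≡) (sizes≤ μ≤κ λ≤κ))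

    w : ℕ
    w = Algorithm.wordSize algorithm U

    instance
      outcomes≢0 : NonZero outcomes
      outcomes≢0 = >-nonZero outcomes>0

    φ : ℕ → ℕ → ℕ
    φ i = address κ μ (multiplier i) (2 ^ λ′)

    numbersAt : ℕ → Vec ℕ 25
    numbersAt i = Scheme.numbers 𝒮 w (2 ^ λ′) (multiplier i) (2 ^ (κ + μ)) (2 ^ κ)

    few : (P : Subset U) → ∣ P ∣ ≡ n → ∀ i → Σ< (2 ^ (nb + ℓ₁)) (b2n ∘ Image.image P (φ i)) ≤ n
    few P size i = ≤-trans (Image.image-few P (φ i) (2 ^ (nb + ℓ₁))) (≤-reflexive size)

    memoryOf : (P : Subset U) → ∣ P ∣ ≡ n → ℕ → Vec Bool (Scheme.space 𝒮)
    memoryOf P size i = pad (Scheme.space 𝒮) (Scheme.contents 𝒮 (Image.image P (φ i)) (few P size i))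

    module _ (I : Query U L) where
      open Query I

      U≤ : U ≤ 2 ^ κ
      U≤ = <⇒≤ (<-bits U)

      point< : ∀ (x : Fin U) → toℕ x < 2 ^ κ
      point< x = <-≤-trans (Fin.toℕ<n x) U≤

      near : toℕ b < toℕ a + 2 ^ λ′
      near = ≤-<-trans (m≤n+m∸n (toℕ b) (toℕ a)) (+-monoʳ-< (toℕ a) ([ (λ e → subst (λ k → toℕ b ∸ toℕ a < 2 ^ k) (sym e) (<-trans short (<-bits L))) ,
        (λ e → subst (λ k → toℕ b ∸ toℕ a < 2 ^ k) (sym e) (≤-<-trans (m∸n≤m (toℕ b) (toℕ a)) (point< b))) ]′ (⊓-sel (bits L) κ)))

      κ<u : κ < u
      κ<u = ≤-<-trans (m≤m+n κ κ) (sum<u ≤-refl ≤-refl)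

      ran : (P : Subset U) (size : ∣ P ∣ ≡ n) (ω : Fin outcomes) →
        Σ[ v ∈ Bool ] execute algorithm a b (Vec.map (word w) (numbersAt (toℕ ω))) (memoryOf P size (toℕ ω)) ≡ verdict v ×
          (v ≡ true → ∃[ x ] ((toℕ a ≤ x × x ≤ toℕ b) × Image.image P (φ (toℕ ω)) (φ (toℕ ω) x) ≡ true)) × (∃[ x ] ((toℕ a ≤ x × x ≤ toℕ b) × Image.image P (φ (toℕ ω)) (φ (toℕ ω) x) ≡ true) → v ≡ true)
      ran P size ω = query-run S 𝒮 (wordSize≡ U) {λ′} {κ} {μ} {multiplier (toℕ ω)} {toℕ a} {toℕ b} (Image.image P (φ (toℕ ω))) (few P size (toℕ ω)) λ≤ℓ₁ υ≡
        (subst (_< u) (sym υ≡) (sum<u μ≤κ λ≤κ)) (sum<u ≤-refl μ≤κ) (<-≤-trans (bounded (Fin.toℕ<n ω)) (pow-mono (sum<u ≤-refl μ≤κ)))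
        (<-≤-trans (point< a) (pow-mono (<⇒≤ κ<u))) (<-≤-trans (point< b) (pow-mono (<⇒≤ κ<u))) a≤b near

      module _ (P : Subset U) (size : ∣ P ∣ ≡ n) where
        open Collisions P κ μ (2 ^ suc E) λ′ U≤ n size ℳ n>0 using (failures; failures-rare; blame)

        hit-answered : Hits P a b → ∀ ω → isNonEmpty (execute algorithm a b (Vec.map (word w) (numbersAt (toℕ ω))) (memoryOf P size (toℕ ω))) ≡ true
        hit-answered (x , x∈ , a≤x , x≤b) ω = trans (cong isNonEmpty (proj₁ (proj₂ r))) (cong (isNonEmpty ∘ verdict) (proj₂ (proj₂ (proj₂ r)) (toℕ x , (a≤x , x≤b) , Image.image⁺ P (φ (toℕ ω)) (Fin.toℕ<n x) (member⁺ P x∈))))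
          where r = ran P size ω

        βa βb : ℕ
        βa = toℕ a // 2 ^ λ′
        βb = toℕ b // 2 ^ λ′

        miss-answered : ¬ Hits P a b → ∀ ω → isEmpty (execute algorithm a b (Vec.map (word w) (numbersAt (toℕ ω))) (memoryOf P size (toℕ ω))) ≡ true ⊎ 1 ≤ failures βa βb (toℕ ω)
        miss-answered none ω = by (proj₁ r) (proj₁ (proj₂ r)) (proj₁ (proj₂ (proj₂ r)))
          where
          r = ran P size ω
          by : ∀ v → execute algorithm a b (Vec.map (word w) (numbersAt (toℕ ω))) (memoryOf P size (toℕ ω)) ≡ verdict v →
            (v ≡ true → ∃[ x ] ((toℕ a ≤ x × x ≤ toℕ b) × Image.image P (φ (toℕ ω)) (φ (toℕ ω) x) ≡ true)) →
            isEmpty (execute algorithm a b (Vec.map (word w) (numbersAt (toℕ ω))) (memoryOf P size (toℕ ω))) ≡ true ⊎ 1 ≤ failures βa βb (toℕ ω)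
          by false e _ = inj₁ (cong isEmpty e)
          by true e sound = inj₂ (blamed (sound refl))
            where
            blamed : ∃[ x ] ((toℕ a ≤ x × x ≤ toℕ b) × Image.image P (φ (toℕ ω)) (φ (toℕ ω) x) ≡ true) → 1 ≤ failures βa βb (toℕ ω)
            blamed (x , (a≤x , x≤b) , ψx) = [ (λ (m , x<U) → ⊥-elim (none (fromℕ< x<U , member⁻ P (fromℕ< x<U) (subst (λ y → member P y ≡ true) (sym (Fin.toℕ-fromℕ< x<U)) m) ,
                subst (toℕ a ≤_) (sym (Fin.toℕ-fromℕ< x<U)) a≤x , subst (_≤ toℕ b) (sym (Fin.toℕ-fromℕ< x<U)) x≤b))) ,
              (λ f → f {βa} {βb} ([ inj₁ ∘ proj₁ , inj₂ ∘ proj₁ ]′ (Split.cover (pow>0 λ′) a≤b near a≤x x≤b))) ]′ (blame {toℕ ω} {x} ψx)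

    structure : RangeEmptiness algorithm n U L ε
    structure = record
      { outcomes = outcomes ; bits = Scheme.space 𝒮
      ; params = λ ω → Vec.map (word w) (numbersAt (toℕ ω)) ; build = λ P size ω → memoryOf P size (toℕ ω)
      ; constantTime = λ P size I ω → is-just {v = proj₁ (ran I P size ω)} (proj₁ (proj₂ (ran I P size ω)))
      ; noFalseNegative = λ P size I hits → Pr-certain _ (count-true _ (hit-answered I P size hits))
      ; falsePositiveRate = λ P size I none e high →
          let open Collisions P κ μ (2 ^ suc E) λ′ (U≤ I) n size ℳ n>0 using (failures; failures-rare) in
          Pr-likely _ (suc E) (Σ< outcomes (failures (βa I P size) (βb I P size))) (count-exceptions _ (failures (βa I P size) (βb I P size)) (miss-answered I P size none))
            (failures-rare (≤-<-trans (//-≤ _ (2 ^ λ′)) (point< I (Query.a I))) (≤-<-trans (//-≤ _ (2 ^ λ′)) (point< I (Query.b I)))) (lower-<-upper ε low high) }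

    solution : ∀ (δ : ℝ) → lower δ (ℤ.+ 1 ℚ./ suc s) → upper ε (fromℕℚ 2 ℚ.* ½ ^ℚ E) →
      Σ[ D ∈ RangeEmptiness algorithm n U L ε ] (RangeEmptiness.bits D ≤ᵁ n *ᵁ lg⁺ (L ÷ ε) +ᵁ (spaceFactor (overhead-constant S) * n) *ᵁ lg⁺ (L ÷ ε) ^ᵁ δ)
    solution δ below high = structure ,
      space-bound δ ε {s} {overhead-constant S} {n} {L} {λ′} {E} {ℓ₁} {Scheme.root 𝒮} {Scheme.space 𝒮} below L>0 high wide ℓ₁≤ (Scheme.root≤ 𝒮) (Scheme.space≤ 𝒮)

inverse-below : (δ : ℝ) → Positive δ → ∃[ s ] lower δ (ℤ.+ 1 ℚ./ suc s)
inverse-below δ δ>0 = proj₁ below , lower-≤ δ (proj₂ below) (proj₂ (proj₂ rounded))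
  where
  rounded = lower-rounded δ δ>0
  below = unit-below (proj₁ (proj₂ rounded))

lg⁺-nonneg : ∀ {X} y → lg⁺ X y → 0ℚ ℚ.≤ y
lg⁺-nonneg y h = ℚ.≤-trans (ι-nonNeg 1) (ℚ.<⇒≤ (proj₁ h))

theorem3 : (δ : ℝ) → Positive δ →
    Σ[ A ∈ Algorithm ] Σ[ C ∈ ℕ ]
    ((n U L : ℕ) → NonZero n → NonZero U → NonZero L →
    (ε : ℝ) → Positive ε →
    Σ[ D ∈ RangeEmptiness A n U L ε ]
    (RangeEmptiness.bits D ≤ᵁ n *ᵁ lg⁺ (L ÷ ε) +ᵁ (C * n) *ᵁ lg⁺ (L ÷ ε) ^ᵁ δ))
theorem3 δ δ>0 = algorithm s , C , λ n U L n≢0 U≢0 L≢0 ε ε>0 →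
    [ (λ 1<ε → always-nonEmpty s n U L ε 1<ε , nothing-stored n L ε)
    , (λ ε<2 → [ (λ n≤U → stored n U L n≢0 U≢0 L≢0 ε n≤U (exponent ε ε>0 ε<2))
               , (λ U<n → vacuous s n U L ε U<n , nothing-stored n L ε) ]′ (≤-<-connex n U)) ]′ (located ε {1ℚ} {fromℕℚ 2} 1<2)
  where
  s C : ℕ
  s = proj₁ (inverse-below δ δ>0)
  C = spaceFactor (overhead-constant (S s))
  1<2 : 1ℚ ℚ.< fromℕℚ 2
  1<2 = ℚ.*<* (ℤ.+<+ (s≤s (s≤s z≤n)))
  nothing-stored : ∀ n L ε → 0 ≤ᵁ n *ᵁ lg⁺ (L ÷ ε) +ᵁ (C * n) *ᵁ lg⁺ (L ÷ ε) ^ᵁ δ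
  nothing-stored n L ε = zero-space lg⁺-nonneg (λ z → proj₁) n (C * n)
  stored : ∀ n U L → NonZero n → NonZero U → NonZero L → ∀ ε → n ≤ U → ∃[ E ] (lower ε (½ ^ℚ suc E) × upper ε (fromℕℚ 2 ℚ.* ½ ^ℚ E)) →
    Σ[ D ∈ RangeEmptiness (algorithm s) n U L ε ] (RangeEmptiness.bits D ≤ᵁ n *ᵁ lg⁺ (L ÷ ε) +ᵁ (C * n) *ᵁ lg⁺ (L ÷ ε) ^ᵁ δ)
  stored n U L n≢0 U≢0 L≢0 ε n≤U (E , low , high) =
    Instance.solution s n U L (>-nonZero⁻¹ n {{n≢0}}) (>-nonZero⁻¹ U {{U≢0}}) (>-nonZero⁻¹ L {{L≢0}}) n≤U ε E low δ (proj₂ (inverse-below δ δ>0)) high
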